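{- Let $E/F$ be a totally ramified cubic field extension of non-Archimedean local fields and let $R$ be an order of $E$. Let $s=S(R)$ and let $f=f(R)$ be the conductor exponent of $R$. Then $\#\overline{\mathrm{Cl}}(R)$ depends only on $s$, $f$ and $q$, and is given as follows. If $3\mid f$, $$\#\overline{\mathrm{Cl}}(R)=\begin{cases} \dfrac{q^{\frac s2+2}+9q^{\frac s2+1}+2q^{\frac s2}+2sq^{\frac f6}(1-q)-8q^{\frac f6+1}-3q^{s-\frac f3+1}-q^{s-\frac f3}}{q^{\frac f6}(q-1)^2} & s\text{ even},\ \frac f3\text{ even};\\[1.2em] \dfrac{5q^{\frac s2+1}+7q^{\frac s2}+2sq^{\frac{f-3}6}(1-q)-8q^{\frac{f+3}6}-q^{s-\frac f3+1}-3q^{s-\frac f3}}{q^{\frac{f-3}6}(q-1)^2} & s\text{ even},\ \frac f3\text{ odd};\\[1.2em] \dfrac{5q^{\frac{s+3}2}+7q^{\frac{s+1}2}+2sq^{\frac f6}(1-q)-8q^{\frac f6+1}-3q^{s-\frac f3+1}-q^{s-\frac f3}}{q^{\frac f6}(q-1)^2} & s\text{ odd},\ \frac f3\text{ even};\\[1.2em] \dfrac{q^{\frac{s+3}2}+9q^{\frac{s+1}2}+2q^{\frac{s-1}2}+2sq^{\frac{f-3}6}(1-q)-8q^{\frac{f+3}6}-q^{s-\frac f3+1}-3q^{s-\frac f3}}{q^{\frac{f-3}6}(q-1)^2} & s\text{ odd},\ \frac f3\text{ odd}. \end{cases}$$ If $3\mid(f+1)$, $$\#\overline{\mathrm{Cl}}(R)=\begin{cases}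 \dfrac{2q^{\frac s2+2}+9q^{\frac s2+1}+q^{\frac s2}+2sq^{\frac{f+1}6}(1-q)-8q^{\frac{f+1}6+1}-q^{s-\frac{f+1}3+2}-3q^{s-\frac{f+1}3+1}}{q^{\frac{f+1}6}(q-1)^2} & s\text{ even},\ \frac{f+1}3\text{ even};\\[1.2em] \dfrac{7q^{\frac s2+1}+5q^{\frac s2}+2sq^{\frac{f-2}6}(1-q)-8q^{\frac{f+4}6}-3q^{s-\frac{f+1}3+1}-q^{s-\frac{f+1}3}}{q^{\frac{f-2}6}(q-1)^2} & s\text{ even},\ \frac{f+1}3\text{ odd};\\[1.2em] \dfrac{7q^{\frac{s+3}2}+5q^{\frac{s+1}2}+2sq^{\frac{f+1}6}(1-q)-8q^{\frac{f+1}6+1}-q^{s-\frac{f+1}3+2}-3q^{s-\frac{f+1}3+1}}{q^{\frac{f+1}6}(q-1)^2} & s\text{ odd},\ \frac{f+1}3\text{ even};\\[1.2em] \dfrac{2q^{\frac{s+3}2}+9q^{\frac{s+1}2}+q^{\frac{s-1}2}+2sq^{\frac{f-2}6}(1-q)-8q^{\frac{f+4}6}-3q^{s-\frac{f+1}3+1}-q^{s-\frac{f+1}3}}{q^{\frac{f-2}6}(q-1)^2} & s\text{ odd},\ \frac{f+1}3\text{ odd}. \end{cases}$$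
   Context: $F$ is a non-Archimedean local field of any characteristic, with ring of integers $\mathfrak o$ and residue field of cardinality $q$. $\mathcal O_E$ is the ring of integers of $E$ and $\pi_E$ a uniformizer of $E$. An order of $E$ is a subring $\mathcal O\subset E$ containing $\mathfrak o$, finitely generated as an $\mathfrak o$-module, with $F\mathcal O=E$. $S(R)$ is the length of $\mathcal O_E/R$ as an $\mathfrak o$-module. The conductor exponent $f(R)\ge0$ is defined by $\{a\in\mathcal O_E: a\mathcal O_E\subset R\}=\pi_E^{f(R)}\mathcal O_E$; the case $f(R)\equiv1\pmod 3$ does not occur. A fractional $R$-ideal is a nonzero finitely generated $R$-submodule of $E$; $\overline{\mathrm{Cl}}(R)$ is the set (monoid) of fractional $R$-ideals modulo multiplication by $E^\times$. -}

module Defs where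

open import Level using (Level; _⊔_; suc)
open import Algebra.Bundles using (Ring; CommutativeRing)
open import Algebra.Bundles.Raw using (RawRing)
open import Algebra.Definitions.RawMonoid using (sum)
open import Algebra.Module.Bundles using (LeftModule)
import Algebra.Morphism.RingMonomorphism as RingMonomorphism
open import Algebra.Morphism.Structures using (module RingMorphisms)
import Algebra.Morphism.Construct.Composition as Composition
import Algebra.Properties.AbelianGroup as AbelianGroupProperties
import Algebra.Properties.Ring as RingProperties
open import Data.Fin.Base using (Fin; zero; inject₁; fromℕ)
  renaming (suc to fsuc)
open import Data.Integer.Base as ℤ using (ℤ; +_; 0ℤ; 1ℤ)
import Data.Integer.Properties as ℤₚ
open import Data.Maybe.Base using (map)
open import Data.Nat.Base as ℕ using (ℕ; _∸_)
open import Data.Nat.Divisibility using (_∣_; _∤_)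
open import Data.Nat.DivMod using (_/_)
open import Data.Product.Base using (Σ; ∃-syntax; _×_; _,_; proj₁; proj₂)
open import Data.Vec.Functional using (Vector)
open import Function.Base using (_on_)
open import Function.Bundles using (Bijection; _⇔_; mk⇔; Equivalence)
open import Relation.Binary.Bundles using (Setoid)
open import Relation.Binary.PropositionalEquality as ≡ using (_≡_; _≢_)
open import Relation.Nullary.Construct.Add.Supremum using (_⁺; [_]; ⊤⁺)
open import Relation.Binary.Construct.Add.Supremum.NonStrict ℤ._≤_
  using (_≤⁺_; [_]; _≤⊤⁺)
open import Relation.Nullary.Negation using (¬_; contradiction)
open import Relation.Unary using (Pred; _∈_; _∉_; _⊆_)

private
  variable
    c ℓ p r ℓr m ℓm : Level

HasCardinality : Setoid c ℓ → ℕ → Set (c ⊔ ℓ)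
HasCardinality S n = Bijection (≡.setoid (Fin n)) S

module _ {R : Ring r ℓr} (M : LeftModule R m ℓm) where
  private module R = Ring R
  open LeftModule M

  record IsSubmodule (N : Pred Carrierᴹ p) : Set (r ⊔ m ⊔ ℓm ⊔ p) where
    field
      resp      : ∀ {x y} → x ≈ᴹ y → x ∈ N → y ∈ N
      0-closed   : 0ᴹ ∈ N
      +-closed   : ∀ {x y} → x ∈ N → y ∈ N → (x +ᴹ y) ∈ N
      neg-closed : ∀ {x} → x ∈ N → (-ᴹ x) ∈ N
      *-closed   : ∀ a {x} → x ∈ N → (a *ₗ x) ∈ N

  linearCombination : ∀ {n} → Vector R.Carrier n → Vector Carrierᴹ n → Carrierᴹ
  linearCombination a g = sum +ᴹ-rawMonoid (λ i → a i *ₗ g i)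

  IsFinitelyGenerated : Pred Carrierᴹ p → Set (r ⊔ m ⊔ ℓm ⊔ p)
  IsFinitelyGenerated N =
    ∃[ n ] Σ (Vector Carrierᴹ n) λ g →
      (∀ i → g i ∈ N) ×
      (∀ {x} → x ∈ N → ∃[ a ] x ≈ᴹ linearCombination a g)

  HasBasisOfSize : ℕ → Set (r ⊔ ℓr ⊔ m ⊔ ℓm)
  HasBasisOfSize n =
    Σ (Vector Carrierᴹ n) λ g →
      (∀ x → ∃[ a ] x ≈ᴹ linearCombination a g) ×
      (∀ a b → linearCombination a g ≈ᴹ linearCombination b g →
               ∀ i → a i R.≈ b i)

  _⊊_ : Pred Carrierᴹ p → Pred Carrierᴹ p → Set (m ⊔ p)
  N ⊊ N′ = N ⊆ N′ × ∃[ x ] x ∈ N′ × x ∉ N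

  -- A composition series of length n: a strict chain of submodules
  -- 0 = N₀ ⊊ … ⊊ Nₙ = M into which no further submodule can be inserted.
  record HasLength (n : ℕ) : Set (suc (r ⊔ ℓr ⊔ m ⊔ ℓm)) where
    field
      N           : Fin (ℕ.suc n) → Pred Carrierᴹ (r ⊔ ℓr ⊔ m ⊔ ℓm)
      isSubmodule : ∀ i → IsSubmodule (N i)
      bottom      : ∀ {x} → x ∈ N zero → x ≈ᴹ 0ᴹ
      top         : ∀ x → x ∈ N (fromℕ n)
      strict      : ∀ i → N (inject₁ i) ⊊ N (fsuc i)
      maximal     : ∀ i (L : Pred Carrierᴹ (r ⊔ ℓr ⊔ m ⊔ ℓm)) → IsSubmodule L →
                    N (inject₁ i) ⊊ L → L ⊆ N (fsuc i) → N (fsuc i) ⊆ L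

  -- The module Q / (P ∩ Q); when P ⊆ Q this is Q / P.
  subquotient : ∀ {p q} {Q : Pred Carrierᴹ q} {P : Pred Carrierᴹ p} →
                IsSubmodule Q → IsSubmodule P → LeftModule R (m ⊔ q) p
  subquotient {Q = Q} {P} subQ subP = record
    { Carrierᴹ = Σ Carrierᴹ Q
    ; _≈ᴹ_     = _~_ on proj₁
    ; _+ᴹ_     = λ (x , x∈Q) (y , y∈Q) → x +ᴹ y , Q.+-closed x∈Q y∈Q
    ; _*ₗ_     = λ a (x , x∈Q) → a *ₗ x , Q.*-closed a x∈Q
    ; 0ᴹ       = 0ᴹ , Q.0-closed
    ; -ᴹ_      = λ (x , x∈Q) → -ᴹ x , Q.neg-closed x∈Q
    ; isLeftModule = record
      { isLeftSemimodule = record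
        { +ᴹ-isCommutativeMonoid = record
          { isMonoid = record
            { isSemigroup = record
              { isMagma = record
                { isEquivalence = record
                  { refl = ≈⇒~ ≈ᴹ-refl ; sym = ~-sym ; trans = ~-trans }
                ; ∙-cong = ~-+-cong
                }
              ; assoc = λ _ _ _ → ≈⇒~ (+ᴹ-assoc _ _ _)
              }
            ; identity = (λ _ → ≈⇒~ (+ᴹ-identityˡ _)) , (λ _ → ≈⇒~ (+ᴹ-identityʳ _))
            }
          ; comm = λ _ _ → ≈⇒~ (+ᴹ-comm _ _)
          }
        ; isPreleftSemimodule = record
          { *ₗ-cong      = λ a≈b x~y → ~-*-cong a≈b x~y
          ; *ₗ-zeroˡ     = λ _ → ≈⇒~ (*ₗ-zeroˡ _)
          ; *ₗ-distribʳ  = λ _ _ _ → ≈⇒~ (*ₗ-distribʳ _ _ _)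
          ; *ₗ-identityˡ = λ _ → ≈⇒~ (*ₗ-identityˡ _)
          ; *ₗ-assoc     = λ _ _ _ → ≈⇒~ (*ₗ-assoc _ _ _)
          ; *ₗ-zeroʳ     = λ _ → ≈⇒~ (*ₗ-zeroʳ _)
          ; *ₗ-distribˡ  = λ _ _ _ → ≈⇒~ (*ₗ-distribˡ _ _ _)
          }
        }
      ; -ᴹ‿cong    = ~-neg-cong
      ; -ᴹ‿inverse = (λ _ → ≈⇒~ (-ᴹ‿inverseˡ _)) , (λ _ → ≈⇒~ (-ᴹ‿inverseʳ _))
      }
    }
    where
    module Q = IsSubmodule subQ
    module P = IsSubmodule subP
    open AbelianGroupProperties +ᴹ-abelianGroup
      using (⁻¹-∙-comm; ⁻¹-involutive; inverseˡ-unique; inverseʳ-unique)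
    open import Relation.Binary.Reasoning.Setoid ≈ᴹ-setoid

    _~_ : Carrierᴹ → Carrierᴹ → Set _
    x ~ y = (x +ᴹ (-ᴹ y)) ∈ P

    ≈⇒~ : ∀ {x y} → x ≈ᴹ y → x ~ y
    ≈⇒~ {x} {y} x≈y = P.resp
      (≈ᴹ-trans (≈ᴹ-sym (-ᴹ‿inverseʳ y)) (+ᴹ-cong (≈ᴹ-sym x≈y) ≈ᴹ-refl)) P.0-closed

    ~-sym : ∀ {x y} → x ~ y → y ~ x
    ~-sym {x} {y} x~y = P.resp (begin
      -ᴹ (x +ᴹ -ᴹ y)        ≈⟨ ⁻¹-∙-comm x (-ᴹ y) ⟨
      -ᴹ x +ᴹ -ᴹ (-ᴹ y)     ≈⟨ +ᴹ-cong ≈ᴹ-refl (⁻¹-involutive y) ⟩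
      -ᴹ x +ᴹ y             ≈⟨ +ᴹ-comm _ _ ⟩
      y +ᴹ -ᴹ x             ∎) (P.neg-closed x~y)

    swap : ∀ u v w z → (u +ᴹ v) +ᴹ (w +ᴹ z) ≈ᴹ (u +ᴹ w) +ᴹ (v +ᴹ z)
    swap u v w z = begin
      (u +ᴹ v) +ᴹ (w +ᴹ z)   ≈⟨ +ᴹ-assoc u v _ ⟩
      u +ᴹ (v +ᴹ (w +ᴹ z))   ≈⟨ +ᴹ-cong ≈ᴹ-refl (+ᴹ-assoc v w z) ⟨
      u +ᴹ ((v +ᴹ w) +ᴹ z)   ≈⟨ +ᴹ-cong ≈ᴹ-refl (+ᴹ-cong (+ᴹ-comm v w) ≈ᴹ-refl) ⟩
      u +ᴹ ((w +ᴹ v) +ᴹ z)   ≈⟨ +ᴹ-cong ≈ᴹ-refl (+ᴹ-assoc w v z) ⟩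
      u +ᴹ (w +ᴹ (v +ᴹ z))   ≈⟨ +ᴹ-assoc u w _ ⟨
      (u +ᴹ w) +ᴹ (v +ᴹ z)   ∎

    ~-trans : ∀ {x y z} → x ~ y → y ~ z → x ~ z
    ~-trans {x} {y} {z} x~y y~z = P.resp (begin
      (x +ᴹ -ᴹ y) +ᴹ (y +ᴹ -ᴹ z)   ≈⟨ +ᴹ-assoc _ _ _ ⟩
      x +ᴹ (-ᴹ y +ᴹ (y +ᴹ -ᴹ z))   ≈⟨ +ᴹ-cong ≈ᴹ-refl (+ᴹ-assoc _ _ _) ⟨
      x +ᴹ ((-ᴹ y +ᴹ y) +ᴹ -ᴹ z)   ≈⟨ +ᴹ-cong ≈ᴹ-refl (+ᴹ-cong (-ᴹ‿inverseˡ y) ≈ᴹ-refl) ⟩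
      x +ᴹ (0ᴹ +ᴹ -ᴹ z)            ≈⟨ +ᴹ-cong ≈ᴹ-refl (+ᴹ-identityˡ _) ⟩
      x +ᴹ -ᴹ z                    ∎) (P.+-closed x~y y~z)

    ~-+-cong : ∀ {x y u v} → x ~ y → u ~ v → (x +ᴹ u) ~ (y +ᴹ v)
    ~-+-cong {x} {y} {u} {v} x~y u~v = P.resp (begin
      (x +ᴹ -ᴹ y) +ᴹ (u +ᴹ -ᴹ v)   ≈⟨ swap x (-ᴹ y) u (-ᴹ v) ⟩
      (x +ᴹ u) +ᴹ (-ᴹ y +ᴹ -ᴹ v)   ≈⟨ +ᴹ-cong ≈ᴹ-refl (⁻¹-∙-comm y v) ⟩
      (x +ᴹ u) +ᴹ -ᴹ (y +ᴹ v)      ∎) (P.+-closed x~y u~v)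

    ~-neg-cong : ∀ {x y} → x ~ y → (-ᴹ x) ~ (-ᴹ y)
    ~-neg-cong {x} {y} x~y =
      P.resp (≈ᴹ-sym (⁻¹-∙-comm x (-ᴹ y))) (P.neg-closed x~y)

    *ₗ-neg : ∀ a y → a *ₗ (-ᴹ y) ≈ᴹ -ᴹ (a *ₗ y)
    *ₗ-neg a y = inverseˡ-unique _ _ (begin
      a *ₗ (-ᴹ y) +ᴹ a *ₗ y   ≈⟨ *ₗ-distribˡ a (-ᴹ y) y ⟨
      a *ₗ (-ᴹ y +ᴹ y)        ≈⟨ *ₗ-cong R.refl (-ᴹ‿inverseˡ y) ⟩
      a *ₗ 0ᴹ                 ≈⟨ *ₗ-zeroʳ a ⟩
      0ᴹ                      ∎)

    ~-*-cong : ∀ {a b x y} → a R.≈ b → x ~ y → (a *ₗ x) ~ (b *ₗ y)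
    ~-*-cong {a} {b} {x} {y} a≈b x~y = ~-trans
      (P.resp (≈ᴹ-trans (*ₗ-distribˡ a x (-ᴹ y)) (+ᴹ-cong ≈ᴹ-refl (*ₗ-neg a y)))
              (P.*-closed a x~y))
      (≈⇒~ (*ₗ-cong a≈b ≈ᴹ-refl))

module _ (K : CommutativeRing c ℓ) where
  open CommutativeRing K

  record IsSubring (A : Pred Carrier p) : Set (c ⊔ ℓ ⊔ p) where
    field
      resp       : ∀ {x y} → x ≈ y → x ∈ A → y ∈ A
      0-closed   : 0# ∈ A
      1-closed   : 1# ∈ A
      +-closed   : ∀ {x y} → x ∈ A → y ∈ A → (x + y) ∈ A
      neg-closed : ∀ {x} → x ∈ A → (- x) ∈ A
      *-closed   : ∀ {x y} → x ∈ A → y ∈ A → (x * y) ∈ A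

module _ {K : CommutativeRing c ℓ} {A : Pred (CommutativeRing.Carrier K) p}
         (isSubring : IsSubring K A) where
  open CommutativeRing K
  open IsSubring isSubring

  private
    rawSubring : RawRing (c ⊔ p) ℓ
    rawSubring = record
      { Carrier = Σ Carrier A
      ; _≈_     = _≈_ on proj₁
      ; _+_     = λ (x , x∈A) (y , y∈A) → x + y , +-closed x∈A y∈A
      ; _*_     = λ (x , x∈A) (y , y∈A) → x * y , *-closed x∈A y∈A
      ; -_      = λ (x , x∈A) → - x , neg-closed x∈A
      ; 0#      = 0# , 0-closed
      ; 1#      = 1# , 1-closed
      }

  open RingMorphisms rawSubring rawRing

  inclusion-isRingMonomorphism : IsRingMonomorphism proj₁
  inclusion-isRingMonomorphism = record
    { isRingHomomorphism = record
      { isSemiringHomomorphism = record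
        { isNearSemiringHomomorphism = record
          { +-isMonoidHomomorphism = record
            { isMagmaHomomorphism = record
              { isRelHomomorphism = record { cong = λ x≈y → x≈y }
              ; homo = λ _ _ → refl
              }
            ; ε-homo = refl
            }
          ; *-homo = λ _ _ → refl
          }
        ; 1#-homo = refl
        }
      ; -‿homo = λ _ → refl
      }
    ; injective = λ x≈y → x≈y
    }

  subring : CommutativeRing (c ⊔ p) ℓ
  subring = record
    { isCommutativeRing =
        RingMonomorphism.isCommutativeRing inclusion-isRingMonomorphism isCommutativeRing
    }

  inclusion-isRingHomomorphism : IsRingHomomorphism proj₁
  inclusion-isRingHomomorphism =
    IsRingMonomorphism.isRingHomomorphism inclusion-isRingMonomorphism

module _ (A : CommutativeRing r ℓr) (B : CommutativeRing m ℓm) where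
  private
    module A = CommutativeRing A
    module B = CommutativeRing B

  restrictScalars : ∀ {φ} → RingMorphisms.IsRingHomomorphism A.rawRing B.rawRing φ →
                    LeftModule A.ring m ℓm
  restrictScalars {φ} isHom = record
    { Carrierᴹ = B.Carrier
    ; _≈ᴹ_     = B._≈_
    ; _+ᴹ_     = B._+_
    ; _*ₗ_     = λ a x → φ a B.* x
    ; 0ᴹ       = B.0#
    ; -ᴹ_      = B.-_
    ; isLeftModule = record
      { isLeftSemimodule = record
        { +ᴹ-isCommutativeMonoid = B.+-isCommutativeMonoid
        ; isPreleftSemimodule = record
          { *ₗ-cong      = λ a≈b x≈y → B.*-cong (⟦⟧-cong a≈b) x≈y
          ; *ₗ-zeroˡ     = λ x → B.trans (B.*-congʳ 0#-homo) (B.zeroˡ x)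
          ; *ₗ-distribʳ  = λ x a b → B.trans (B.*-congʳ (+-homo a b)) (B.distribʳ x _ _)
          ; *ₗ-identityˡ = λ x → B.trans (B.*-congʳ 1#-homo) (B.*-identityˡ x)
          ; *ₗ-assoc     = λ a b x → B.trans (B.*-congʳ (*-homo a b)) (B.*-assoc _ _ x)
          ; *ₗ-zeroʳ     = λ a → B.zeroʳ (φ a)
          ; *ₗ-distribˡ  = λ a → B.distribˡ (φ a)
          }
        }
      ; -ᴹ‿cong    = B.-‿cong
      ; -ᴹ‿inverse = B.-‿inverse
      }
    }
    where open RingMorphisms.IsRingHomomorphism isHom

infixl 6 _+⁺_

_+⁺_ : ℤ ⁺ → ℤ ⁺ → ℤ ⁺
[ k ] +⁺ [ l ] = [ k ℤ.+ l ]
[ k ] +⁺ ⊤⁺    = ⊤⁺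
⊤⁺    +⁺ _     = ⊤⁺

record IsField (K : CommutativeRing c ℓ) : Set (c ⊔ ℓ) where
  open CommutativeRing K
  field
    1≉0     : ¬ (1# ≈ 0#)
    inverse : ∀ x → ¬ (x ≈ 0#) → ∃[ y ] x * y ≈ 1#

-- Normalised discrete valuations, with v 0 = ⊤⁺ = ∞.
record DiscreteValuation (K : CommutativeRing c ℓ) : Set (c ⊔ ℓ) where
  open CommutativeRing K
  field
    v          : Carrier → ℤ ⁺
    v-cong     : ∀ {x y} → x ≈ y → v x ≡ v y
    v-0        : v 0# ≡ ⊤⁺
    v≡∞⇒≈0     : ∀ {x} → v x ≡ ⊤⁺ → x ≈ 0#
    v-*        : ∀ x y → v (x * y) ≡ v x +⁺ v y
    v-+        : ∀ {k x y} → k ≤⁺ v x → k ≤⁺ v y → k ≤⁺ v (x + y)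
    normalised : ∃[ π ] v π ≡ [ 1ℤ ]

  IsUniformiser : Pred Carrier Level.zero
  IsUniformiser π = v π ≡ [ 1ℤ ]

  𝒪 𝔪 : Pred Carrier Level.zero
  𝒪 x = [ 0ℤ ] ≤⁺ v x
  𝔪 x = [ 1ℤ ] ≤⁺ v x

  IsCauchy : (ℕ → Carrier) → Set
  IsCauchy x = ∀ (k : ℤ) → ∃[ n₀ ] (∀ i j → n₀ ℕ.≤ i → n₀ ℕ.≤ j → [ k ] ≤⁺ v (x i - x j))

  _ConvergesTo_ : (ℕ → Carrier) → Carrier → Set
  x ConvergesTo l = ∀ (k : ℤ) → ∃[ n₀ ] (∀ i → n₀ ℕ.≤ i → [ k ] ≤⁺ v (x i - l))

  IsComplete : Set c
  IsComplete = ∀ x → IsCauchy x → ∃[ l ] x ConvergesTo l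

module _ {K : CommutativeRing c ℓ} (isField : IsField K) (val : DiscreteValuation K) where
  open CommutativeRing K
  open IsField isField
  open DiscreteValuation val
  open RingProperties ring using (-1*x≈-x; -‿involutive)

  private
    ≤-resp : ∀ {k x y} → x ≈ y → k ≤⁺ v x → k ≤⁺ v y
    ≤-resp {k} x≈y = ≡.subst (k ≤⁺_) (v-cong x≈y)

    k≤v0 : ∀ {k} → k ≤⁺ v 0#
    k≤v0 {k} = ≡.subst (k ≤⁺_) (≡.sym v-0) (k ≤⊤⁺)

    2k≡0⇒k≡0 : ∀ k → k ℤ.+ k ≡ 0ℤ → k ≡ 0ℤ
    2k≡0⇒k≡0 (+ ℕ.zero) _ = ≡.refl

    2k≡k⇒k≡0 : ∀ k → k ℤ.+ k ≡ k → k ≡ 0ℤ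
    2k≡k⇒k≡0 k eq = AbelianGroupProperties.identityʳ-unique ℤₚ.+-0-abelianGroup k k eq

    []-inj : ∀ {i j : ℤ} → _≡_ {A = ℤ ⁺} [ i ] [ j ] → i ≡ j
    []-inj ≡.refl = ≡.refl

    v-1 : v 1# ≡ [ 0ℤ ]
    v-1 with v 1# in eq | v-* 1# 1# | v-cong (*-identityˡ 1#)
    ... | ⊤⁺    | _  | _  = contradiction (v≡∞⇒≈0 eq) 1≉0
    ... | [ k ] | e₁ | e₂ with ≡.trans (≡.sym e₁) e₂
    ...   | e₃ = ≡.cong [_] (2k≡k⇒k≡0 k ([]-inj e₃))

    v-−1 : v (- 1#) ≡ [ 0ℤ ]
    v-−1 with v (- 1#) | ≡.trans (≡.sym (v-* (- 1#) (- 1#)))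
                          (≡.trans (v-cong (trans (-1*x≈-x (- 1#)) (-‿involutive 1#))) v-1)
    ... | [ k ] | e = ≡.cong [_] (2k≡0⇒k≡0 k ([]-inj e))

    0≤+ : ∀ {a b k} → [ 0ℤ ] ≤⁺ a → [ k ] ≤⁺ b → [ k ] ≤⁺ a +⁺ b
    0≤+ {k = k} [ p ] [ q ] =
      [ ≡.subst (ℤ._≤ _) (ℤₚ.+-identityˡ k) (ℤₚ.+-mono-≤ p q) ]
    0≤+ [ p ] (_ ≤⊤⁺) = _ ≤⊤⁺
    0≤+ (_ ≤⊤⁺) q     = _ ≤⊤⁺

    ≤v-* : ∀ {k x y} → x ∈ 𝒪 → [ k ] ≤⁺ v y → [ k ] ≤⁺ v (x * y)
    ≤v-* {k} {x} {y} p q = ≡.subst ([ k ] ≤⁺_) (≡.sym (v-* x y)) (0≤+ p q)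

    -1∈𝒪 : (- 1#) ∈ 𝒪
    -1∈𝒪 = ≡.subst ([ 0ℤ ] ≤⁺_) (≡.sym v-−1) [ ℤₚ.≤-refl ]

    ≤v-neg : ∀ {k x} → [ k ] ≤⁺ v x → [ k ] ≤⁺ v (- x)
    ≤v-neg {k} {x} q = ≤-resp (-1*x≈-x x) (≤v-* -1∈𝒪 q)

  𝒪-isSubring : IsSubring K 𝒪
  𝒪-isSubring = record
    { resp       = ≤-resp
    ; 0-closed   = k≤v0
    ; 1-closed   = ≡.subst ([ 0ℤ ] ≤⁺_) (≡.sym v-1) [ ℤₚ.≤-refl ]
    ; +-closed   = v-+
    ; neg-closed = ≤v-neg
    ; *-closed   = ≤v-*
    }

  integers : CommutativeRing c ℓ
  integers = subring 𝒪-isSubring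

  private
    K-as-𝒪-module : LeftModule (CommutativeRing.ring integers) c ℓ
    K-as-𝒪-module = restrictScalars integers K (inclusion-isRingHomomorphism 𝒪-isSubring)

    ideal : ∀ k → IsSubmodule K-as-𝒪-module (λ x → [ k ] ≤⁺ v x)
    ideal k = record
      { resp       = ≤-resp
      ; 0-closed   = k≤v0
      ; +-closed   = v-+
      ; neg-closed = ≤v-neg
      ; *-closed   = λ (_ , a∈𝒪) x∈I → ≤v-* a∈𝒪 x∈I
      }

  -- The underlying set of the residue field 𝒪 / 𝔪.
  residueField : Setoid c Level.zero
  residueField = LeftModule.≈ᴹ-setoid (subquotient K-as-𝒪-module (ideal 0ℤ) (ideal 1ℤ))

record LocalField c ℓ : Set (suc (c ⊔ ℓ)) where
  field
    commutativeRing   : CommutativeRing c ℓ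
    isField           : IsField commutativeRing
    discreteValuation : DiscreteValuation commutativeRing
    isComplete        : DiscreteValuation.IsComplete discreteValuation
    q                 : ℕ
    residueField-card : HasCardinality (residueField isField discreteValuation) q

  open CommutativeRing commutativeRing public
  open DiscreteValuation discreteValuation public

  𝒪-subring : IsSubring commutativeRing 𝒪
  𝒪-subring = 𝒪-isSubring isField discreteValuation

  𝒪-ring : CommutativeRing c ℓ
  𝒪-ring = integers isField discreteValuation

-- Total ramification: the ramification index e, characterised by
-- v_E ∘ ι = e · v_F for the normalised valuations, equals the degree n.
record TotallyRamifiedExtension (F E : LocalField c ℓ) (n : ℕ) : Set (c ⊔ ℓ) where
  private
    module F = LocalField F
    module E = LocalField E
  field
    ι      : F.Carrier → E.Carrier
    ι-homo : RingMorphisms.IsRingHomomorphism F.rawRing E.rawRing ι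

  E-as-F-module : LeftModule F.ring c ℓ
  E-as-F-module = restrictScalars F.commutativeRing E.commutativeRing ι-homo

  field
    degree       : HasBasisOfSize E-as-F-module n
    ramification : ∀ x → E.v (ι x) ≡ map (+ n ℤ.*_) (F.v x)

  E-as-𝔬-module : LeftModule (CommutativeRing.ring F.𝒪-ring) c ℓ
  E-as-𝔬-module = restrictScalars F.𝒪-ring E.commutativeRing
    (Composition.isRingHomomorphism E.trans
      (inclusion-isRingHomomorphism F.𝒪-subring) ι-homo)

module _ {F E : LocalField c ℓ} {n : ℕ} (E/F : TotallyRamifiedExtension F E n) where
  private
    module F = LocalField F
    module E = LocalField E
  open TotallyRamifiedExtension E/F

  record Order : Set (suc (c ⊔ ℓ)) where
    field
      R         : Pred E.Carrier (c ⊔ ℓ)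
      isSubring : IsSubring E.commutativeRing R
      𝔬⊆R       : ∀ {a} → a ∈ F.𝒪 → ι a ∈ R
      fg        : IsFinitelyGenerated E-as-𝔬-module R
      FR≡E      : ∀ x → ∃[ k ] Σ (Vector F.Carrier k) λ a → Σ (Vector E.Carrier k) λ y →
                    (∀ i → y i ∈ R) × x E.≈ linearCombination E-as-F-module a y

  module _ (𝓡 : Order) where
    open Order 𝓡

    private
      module R = IsSubring isSubring
      module 𝒪E = IsSubring E.𝒪-subring

      R-isSubmodule : IsSubmodule E-as-𝔬-module R
      R-isSubmodule = record
        { resp       = R.resp
        ; 0-closed   = R.0-closed
        ; +-closed   = R.+-closed
        ; neg-closed = R.neg-closed
        ; *-closed   = λ (_ , a∈𝔬) x∈R → R.*-closed (𝔬⊆R a∈𝔬) x∈R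
        }

      0≤n* : ∀ {a} → [ 0ℤ ] ≤⁺ a → [ 0ℤ ] ≤⁺ map (+ n ℤ.*_) a
      0≤n* ([_] {l = l} 0≤k) = [ ≡.subst (ℤ._≤ + n ℤ.* l) (ℤₚ.*-zeroʳ (+ n)) (ℤₚ.*-monoˡ-≤-nonNeg (+ n) 0≤k) ]
      0≤n* (_ ≤⊤⁺)           = _ ≤⊤⁺

      𝒪E-isSubmodule : IsSubmodule E-as-𝔬-module E.𝒪
      𝒪E-isSubmodule = record
        { resp       = 𝒪E.resp
        ; 0-closed   = 𝒪E.0-closed
        ; +-closed   = 𝒪E.+-closed
        ; neg-closed = 𝒪E.neg-closed
        ; *-closed   = λ (a , a∈𝔬) x∈𝒪 → 𝒪E.*-closed
            (≡.subst ([ 0ℤ ] ≤⁺_) (≡.sym (ramification a)) (0≤n* a∈𝔬)) x∈𝒪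
        }

    -- R ⊆ 𝒪_E holds for every order, as its elements are integral over 𝔬.
    𝒪E/R : LeftModule (CommutativeRing.ring F.𝒪-ring) c (c ⊔ ℓ)
    𝒪E/R = subquotient E-as-𝔬-module 𝒪E-isSubmodule R-isSubmodule

    -- { a ∈ 𝒪_E : a 𝒪_E ⊆ R } = π^f 𝒪_E
    IsConductorExponent : ℕ → Set (c ⊔ ℓ)
    IsConductorExponent f = ∀ π → E.IsUniformiser π → ∀ a →
      (a ∈ E.𝒪 × (∀ {b} → b ∈ E.𝒪 → (a E.* b) ∈ R)) ⇔
      (∃[ b ] b ∈ E.𝒪 × a E.≈ π ^ f E.* b)
      where open import Algebra.Properties.Semiring.Exp E.semiring using (_^_)

    E-as-R-module : LeftModule (CommutativeRing.ring (subring isSubring)) c ℓ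
    E-as-R-module = restrictScalars (subring isSubring) E.commutativeRing
      (inclusion-isRingHomomorphism isSubring)

    record FractionalIdeal : Set (suc (c ⊔ ℓ)) where
      field
        I           : Pred E.Carrier (c ⊔ ℓ)
        isSubmodule : IsSubmodule E-as-R-module I
        fg          : IsFinitelyGenerated E-as-R-module I
        nonzero     : ∃[ x ] x ∈ I × ¬ (x E.≈ E.0#)

    _∼_ : FractionalIdeal → FractionalIdeal → Set (c ⊔ ℓ)
    I ∼ J = ∃[ a ] ¬ (a E.≈ E.0#) ×
      (∀ x → x ∈ FractionalIdeal.I J ⇔ (∃[ y ] y ∈ FractionalIdeal.I I × x E.≈ a E.* y))

    private
      unit : ∀ {a b} → a E.* b E.≈ E.1# → ¬ (b E.≈ E.0#)
      unit {a} ab≈1 b≈0 = IsField.1≉0 E.isField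
        (E.trans (E.sym ab≈1) (E.trans (E.*-congˡ b≈0) (E.zeroʳ a)))

      cancel : ∀ {a b} → a E.* b E.≈ E.1# → ∀ x → x E.≈ a E.* (b E.* x)
      cancel {a} {b} ab≈1 x = E.sym (E.trans (E.sym (E.*-assoc a b x))
        (E.trans (E.*-congʳ ab≈1) (E.*-identityˡ x)))

      ∼-refl : ∀ {I} → I ∼ I
      ∼-refl {I} = E.1# , IsField.1≉0 E.isField , λ x → mk⇔
        (λ x∈I → x , x∈I , E.sym (E.*-identityˡ x))
        (λ (y , y∈I , x≈1y) → IsSubmodule.resp (FractionalIdeal.isSubmodule I)
          (E.sym (E.trans x≈1y (E.*-identityˡ y))) y∈I)

      ∼-sym : ∀ {I J} → I ∼ J → J ∼ I
      ∼-sym {I} {J} (a , a≉0 , J≡aI) with IsField.inverse E.isField a a≉0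
      ... | b , ab≈1 = b , unit ab≈1 , λ x → mk⇔
        (λ x∈I → a E.* x , Equivalence.from (J≡aI _) (x , x∈I , E.refl) , cancel ba≈1 x)
        (λ (y , y∈J , x≈by) → let (z , z∈I , y≈az) = Equivalence.to (J≡aI y) y∈J in
          IsSubmodule.resp (FractionalIdeal.isSubmodule I)
            (E.sym (E.trans x≈by (E.trans (E.*-congˡ y≈az) (E.sym (cancel ba≈1 z))))) z∈I)
        where
        ba≈1 : b E.* a E.≈ E.1#
        ba≈1 = E.trans (E.*-comm b a) ab≈1

      ∼-trans : ∀ {I J K} → I ∼ J → J ∼ K → I ∼ K
      ∼-trans {I} (a , a≉0 , J≡aI) (b , b≉0 , K≡bJ) =
        b E.* a , ba≉0 , λ x → mk⇔
        (λ x∈K → let (y , y∈J , x≈by) = Equivalence.to (K≡bJ x) x∈K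
                     (z , z∈I , y≈az) = Equivalence.to (J≡aI y) y∈J in
          z , z∈I , E.trans x≈by (E.trans (E.*-congˡ y≈az) (E.sym (E.*-assoc b a z))))
        (λ (z , z∈I , x≈baz) → Equivalence.from (K≡bJ x)
          (a E.* z , Equivalence.from (J≡aI _) (z , z∈I , E.refl) ,
           E.trans x≈baz (E.*-assoc b a z)))
        where
        ba≉0 : ¬ (b E.* a E.≈ E.0#)
        ba≉0 ba≈0 with IsField.inverse E.isField b b≉0
        ... | b′ , bb′≈1 = a≉0 (E.trans (cancel (E.trans (E.*-comm b′ b) bb′≈1) a)
          (E.trans (E.*-congˡ ba≈0) (E.zeroʳ b′)))

    Cl̄ : Setoid (suc (c ⊔ ℓ)) (c ⊔ ℓ)
    Cl̄ = record
      { Carrier       = FractionalIdeal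
      ; _≈_           = _∼_
      ; isEquivalence = record
        { refl  = λ {I} → ∼-refl {I}
        ; sym   = λ {I} {J} → ∼-sym {I} {J}
        ; trans = λ {I} {J} {K} → ∼-trans {I} {J} {K}
        }
      }

-- n = a / b, as rational numbers.
infix 4 _≐_÷_

_≐_÷_ : ℕ → ℤ → ℤ → Set
n ≐ a ÷ b = b ≢ 0ℤ × + n ℤ.* b ≡ a

-- In each case every division by 2, 3 or 6 is exact.  The subtractions are
-- exact as well: conductor exponents satisfy f ≤ 2 s.
module _ (q s f : ℕ) where
  open import Data.Integer.Base using (_+_; _-_; _*_)

  private
    Q : ℕ → ℤ
    Q k = (+ q) ℤ.^ k

    n : ℕ → ℤ
    n k = + k

    [q-1]² : ℤ
    [q-1]² = (n q - n 1) * (n q - n 1)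

  record ClassNumberFormula (N : ℕ) : Set where
    field
      f₀-s-even-f/3-even : 3 ∣ f → 2 ∣ s → 2 ∣ f / 3 →
        N ≐ Q (s / 2 ℕ.+ 2) + n 9 * Q (s / 2 ℕ.+ 1) + n 2 * Q (s / 2)
            + n 2 * n s * Q (f / 6) * (n 1 - n q) - n 8 * Q (f / 6 ℕ.+ 1)
            - n 3 * Q (s ∸ f / 3 ℕ.+ 1) - Q (s ∸ f / 3)
          ÷ (Q (f / 6) * [q-1]²)

      f₀-s-even-f/3-odd : 3 ∣ f → 2 ∣ s → 2 ∤ f / 3 →
        N ≐ n 5 * Q (s / 2 ℕ.+ 1) + n 7 * Q (s / 2)
            + n 2 * n s * Q ((f ∸ 3) / 6) * (n 1 - n q) - n 8 * Q ((f ℕ.+ 3) / 6)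
            - Q (s ∸ f / 3 ℕ.+ 1) - n 3 * Q (s ∸ f / 3)
          ÷ (Q ((f ∸ 3) / 6) * [q-1]²)

      f₀-s-odd-f/3-even : 3 ∣ f → 2 ∤ s → 2 ∣ f / 3 →
        N ≐ n 5 * Q ((s ℕ.+ 3) / 2) + n 7 * Q ((s ℕ.+ 1) / 2)
            + n 2 * n s * Q (f / 6) * (n 1 - n q) - n 8 * Q (f / 6 ℕ.+ 1)
            - n 3 * Q (s ∸ f / 3 ℕ.+ 1) - Q (s ∸ f / 3)
          ÷ (Q (f / 6) * [q-1]²)

      f₀-s-odd-f/3-odd : 3 ∣ f → 2 ∤ s → 2 ∤ f / 3 →
        N ≐ Q ((s ℕ.+ 3) / 2) + n 9 * Q ((s ℕ.+ 1) / 2) + n 2 * Q ((s ∸ 1) / 2)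
            + n 2 * n s * Q ((f ∸ 3) / 6) * (n 1 - n q) - n 8 * Q ((f ℕ.+ 3) / 6)
            - Q (s ∸ f / 3 ℕ.+ 1) - n 3 * Q (s ∸ f / 3)
          ÷ (Q ((f ∸ 3) / 6) * [q-1]²)

      f₂-s-even-[f+1]/3-even : 3 ∣ f ℕ.+ 1 → 2 ∣ s → 2 ∣ (f ℕ.+ 1) / 3 →
        N ≐ n 2 * Q (s / 2 ℕ.+ 2) + n 9 * Q (s / 2 ℕ.+ 1) + Q (s / 2)
            + n 2 * n s * Q ((f ℕ.+ 1) / 6) * (n 1 - n q) - n 8 * Q ((f ℕ.+ 1) / 6 ℕ.+ 1)
            - Q (s ∸ (f ℕ.+ 1) / 3 ℕ.+ 2) - n 3 * Q (s ∸ (f ℕ.+ 1) / 3 ℕ.+ 1)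
          ÷ (Q ((f ℕ.+ 1) / 6) * [q-1]²)

      f₂-s-even-[f+1]/3-odd : 3 ∣ f ℕ.+ 1 → 2 ∣ s → 2 ∤ (f ℕ.+ 1) / 3 →
        N ≐ n 7 * Q (s / 2 ℕ.+ 1) + n 5 * Q (s / 2)
            + n 2 * n s * Q ((f ∸ 2) / 6) * (n 1 - n q) - n 8 * Q ((f ℕ.+ 4) / 6)
            - n 3 * Q (s ∸ (f ℕ.+ 1) / 3 ℕ.+ 1) - Q (s ∸ (f ℕ.+ 1) / 3)
          ÷ (Q ((f ∸ 2) / 6) * [q-1]²)

      f₂-s-odd-[f+1]/3-even : 3 ∣ f ℕ.+ 1 → 2 ∤ s → 2 ∣ (f ℕ.+ 1) / 3 →
        N ≐ n 7 * Q ((s ℕ.+ 3) / 2) + n 5 * Q ((s ℕ.+ 1) / 2)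
            + n 2 * n s * Q ((f ℕ.+ 1) / 6) * (n 1 - n q) - n 8 * Q ((f ℕ.+ 1) / 6 ℕ.+ 1)
            - Q (s ∸ (f ℕ.+ 1) / 3 ℕ.+ 2) - n 3 * Q (s ∸ (f ℕ.+ 1) / 3 ℕ.+ 1)
          ÷ (Q ((f ℕ.+ 1) / 6) * [q-1]²)

      f₂-s-odd-[f+1]/3-odd : 3 ∣ f ℕ.+ 1 → 2 ∤ s → 2 ∤ (f ℕ.+ 1) / 3 →
        N ≐ n 2 * Q ((s ℕ.+ 3) / 2) + n 9 * Q ((s ℕ.+ 1) / 2) + Q ((s ∸ 1) / 2)
            + n 2 * n s * Q ((f ∸ 2) / 6) * (n 1 - n q) - n 8 * Q ((f ℕ.+ 4) / 6)
            - n 3 * Q (s ∸ (f ℕ.+ 1) / 3 ℕ.+ 1) - Q (s ∸ (f ℕ.+ 1) / 3)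
          ÷ (Q ((f ∸ 2) / 6) * [q-1]²)

-- Since E/F is totally ramified of degree 3, three elements of E with pairwise
-- incongruent valuations modulo 3 form an F-basis, and the valuation of a vector is the
-- least valuation of its terms.  Hence every 𝔬-lattice in E is homothetic to a lattice
-- 𝔬 + 𝔬X + { v ≥ B } with A = v X < B and 0, A, B incongruent modulo 3.  The numbers A
-- and B are invariants of the homothety class, and for given A and B the class is
-- determined by X modulo { v ≥ min(B, 2A) }, up to X ↦ rX + t with r ∈ 𝔬ˣ and t ∈ 𝔬.
--
-- R itself is such a lattice, with X = θ and B ≤ 2A.  Each step of a composition series of
-- 𝒪_E/R lowers A + B by 3, so s = (A + B)/3 - 1, and f = B - 2; thus s and f determine A
-- and B.  The R-stable lattices have X = ϖ⁻ᵏ(θ + cθ²) or X = ϖ⁻ᵏ(θ² + cθ).  For each (A, B)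
-- the parameter c ranges over q^min(i,j) values, where (i, j) runs through the pairs
-- with g ≤ i + j ≤ g + d, with i + j < g + d and with i + j < g + d + e, for numbers given by
-- s = 2g + 3d + e, f = 3g + 6d + 2e and e ∈ {0, 1}.  Summing geometric series gives the formula.

module Submission where

-- Why X matters modulo 2A and not only modulo B: a homothety between two lattices of this shape is
-- multiplication by a unit u with u = r + sX′ modulo { v ≥ B }, and the term sX′ changes uX by
-- sXX′, of valuation at least 2A.
--
-- For the invariants A₀, B₀ of R, the numbers g, d, e are the gaps 2A₀ - B₀ = 3g and B₀ - A₀ = 3d +
-- 1 + e, with A₀ ≡ 1 + e modulo 3. In X = ϖ⁻ᵏ(P + cQ) the parameter c is bounded below by v(cQ) >
-- v(P) or, if that is stronger, by the requirement that the lattice contain θ; this is why the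
-- lattices with A ≡ A₀ form two families. For A ≡ -A₀ the first bound alone restricts c. The pair
-- (i, j) records how far B and 2A lie above the least valuation allowed for ϖ⁻ᵏcQ, in units of v(ϖ)
-- = 3, so that min(i, j) digits of c survive.
--
-- The triangular sums of q^min(i,j) have closed forms that depend on the parity of the side; the
-- eight cases are the parities of g and d and the two values of e.

-- A reflective solver for linear integer arithmetic.

module Lia where

  open import Data.Bool.Base using (Bool; true; false; if_then_else_; _∧_; T)
  open import Data.Integer.Base using (ℤ; +_; -[1+_]; 0ℤ; 1ℤ; _+_; _*_; _-_; -_; _≤_; _<_; +≤+; -≤-)
  open import Data.Integer.Properties as ℤₚ using (_≟_; _≤?_)
  open import Data.Integer.DivMod using (_/ℕ_; _%ℕ_; a≡a%ℕn+[a/ℕn]*n; n%ℕd<d)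
  open import Data.Integer.Tactic.RingSolver using (solve-∀)
  open import Data.List.Base using (List; []; _∷_; _++_)
  open import Data.List.Relation.Unary.All using (All; []; _∷_)
  open import Data.List.Relation.Unary.All.Properties using (++⁺)
  open import Data.Maybe.Base using (Maybe; just; nothing)
  open import Data.Nat.Base as ℕ using (ℕ; zero; suc; NonZero)
  open import Data.Fin.Base using (Fin; zero; suc)
  open import Data.Product.Base using (_×_; _,_; proj₁; proj₂)
  open import Data.Vec.Base using (Vec; []; _∷_; lookup; replicate; map; zipWith; allFin)
  open import Relation.Binary.PropositionalEquality using (_≡_; refl; sym; trans; cong; cong₂; subst)
  open import Relation.Nullary using (¬_; yes; no; contradiction)
  open import Data.Bool.Properties using (T-≡)
  open import Function.Bundles using (Equivalence)
  open import Data.Empty using (⊥-elim)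

  Env : ℕ → Set
  Env = Vec ℤ

  record Affine (n : ℕ) : Set where
    constructor _+ᶜ_
    field
      coeffs : Vec ℤ n
      const  : ℤ

  open Affine

  dot : ∀ {n} → Vec ℤ n → Env n → ℤ
  dot []       []      = 0ℤ
  dot (c ∷ cs) (x ∷ ρ) = c * x + dot cs ρ

  eval : ∀ {n} → Affine n → Env n → ℤ
  eval (cs +ᶜ c) ρ = dot cs ρ + c

  dot-zipWith : ∀ {n} (a b : ℤ) (cs ds : Vec ℤ n) ρ →
    dot (zipWith (λ x y → a * x + b * y) cs ds) ρ ≡ a * dot cs ρ + b * dot ds ρ
  dot-zipWith a b [] [] [] = sym (cong₂ _+_ (ℤₚ.*-zeroʳ a) (ℤₚ.*-zeroʳ b))
  dot-zipWith a b (c ∷ cs) (d ∷ ds) (x ∷ ρ) =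
    trans (cong (λ z → (a * c + b * d) * x + z) (dot-zipWith a b cs ds ρ))
          (lemma a b c d x (dot cs ρ) (dot ds ρ))
    where
    lemma : ∀ a b c d x u v →
      (a * c + b * d) * x + (a * u + b * v) ≡ a * (c * x + u) + b * (d * x + v)
    lemma = solve-∀

  combine : ∀ {n} → ℤ → Affine n → ℤ → Affine n → Affine n
  combine a (cs +ᶜ c) b (ds +ᶜ d) = zipWith (λ x y → a * x + b * y) cs ds +ᶜ (a * c + b * d)

  eval-combine : ∀ {n} a (e : Affine n) b f ρ →
    eval (combine a e b f) ρ ≡ a * eval e ρ + b * eval f ρ
  eval-combine a (cs +ᶜ c) b (ds +ᶜ d) ρ =
    trans (cong (_+ (a * c + b * d)) (dot-zipWith a b cs ds ρ)) (lemma a b c d (dot cs ρ) (dot ds ρ))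
    where
    lemma : ∀ a b c d u v → a * u + b * v + (a * c + b * d) ≡ a * (u + c) + b * (v + d)
    lemma = solve-∀

  constant : ∀ {n} → ℤ → Affine n
  constant c = replicate _ 0ℤ +ᶜ c

  dot-0 : ∀ {n} (ρ : Env n) → dot (replicate n 0ℤ) ρ ≡ 0ℤ
  dot-0 []      = refl
  dot-0 (x ∷ ρ) = cong (λ z → 0ℤ * x + z) (dot-0 ρ)

  eval-constant : ∀ {n} c (ρ : Env n) → eval (constant c) ρ ≡ c
  eval-constant c ρ = trans (cong (_+ c) (dot-0 ρ)) (ℤₚ.+-identityˡ c)

  unit : ∀ {n} → Fin n → Vec ℤ n
  unit zero    = 1ℤ ∷ replicate _ 0ℤ
  unit (suc i) = 0ℤ ∷ unit i

  dot-unit : ∀ {n} (i : Fin n) ρ → dot (unit i) ρ ≡ lookup ρ i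
  dot-unit zero (x ∷ ρ) =
    trans (cong (λ z → 1ℤ * x + z) (dot-0 ρ)) (trans (ℤₚ.+-identityʳ (1ℤ * x)) (ℤₚ.*-identityˡ x))
  dot-unit (suc i) (x ∷ ρ) = trans (ℤₚ.+-identityˡ _) (dot-unit i ρ)

  data Expr (n : ℕ) : Set where
    var         : Fin n → Expr n
    lit         : ℤ → Expr n
    _⊞_ _⊟_     : Expr n → Expr n → Expr n
    neg_          : Expr n → Expr n
    _⊛_         : ℤ → Expr n → Expr n

  infixl 6 _⊞_ _⊟_
  infixr 7 _⊛_
  infix 8 neg_
  infix 4 _≼_ _≛_
  infixr 3 _⇒_

  ⟦_⟧ : ∀ {n} → Expr n → Env n → ℤ
  ⟦ var i ⟧ ρ = lookup ρ i
  ⟦ lit c ⟧ ρ = c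
  ⟦ e ⊞ f ⟧ ρ = ⟦ e ⟧ ρ + ⟦ f ⟧ ρ
  ⟦ e ⊟ f ⟧ ρ = ⟦ e ⟧ ρ - ⟦ f ⟧ ρ
  ⟦ neg e ⟧ ρ   = - ⟦ e ⟧ ρ
  ⟦ c ⊛ e ⟧ ρ = c * ⟦ e ⟧ ρ

  affine : ∀ {n} → Expr n → Affine n
  affine (var i) = unit i +ᶜ 0ℤ
  affine (lit c) = constant c
  affine (e ⊞ f) = combine 1ℤ (affine e) 1ℤ (affine f)
  affine (e ⊟ f) = combine 1ℤ (affine e) (- 1ℤ) (affine f)
  affine (neg e)   = combine (- 1ℤ) (affine e) 0ℤ (constant 0ℤ)
  affine (c ⊛ e) = combine c (affine e) 0ℤ (constant 0ℤ)

  eval-affine : ∀ {n} (e : Expr n) ρ → eval (affine e) ρ ≡ ⟦ e ⟧ ρ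
  eval-affine (var i) ρ = trans (ℤₚ.+-identityʳ _) (dot-unit i ρ)
  eval-affine (lit c) ρ = eval-constant c ρ
  eval-affine (e ⊞ f) ρ = trans (eval-combine 1ℤ (affine e) 1ℤ (affine f) ρ)
    (cong₂ _+_ (trans (ℤₚ.*-identityˡ _) (eval-affine e ρ)) (trans (ℤₚ.*-identityˡ _) (eval-affine f ρ)))
  eval-affine (e ⊟ f) ρ = trans (eval-combine 1ℤ (affine e) (- 1ℤ) (affine f) ρ)
    (cong₂ _+_ (trans (ℤₚ.*-identityˡ _) (eval-affine e ρ))
               (trans (ℤₚ.-1*i≡-i _) (cong -_ (eval-affine f ρ))))
  eval-affine (neg e) ρ = trans (eval-combine (- 1ℤ) (affine e) 0ℤ (constant 0ℤ) ρ)
    (trans (ℤₚ.+-identityʳ _) (trans (ℤₚ.-1*i≡-i _) (cong -_ (eval-affine e ρ))))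
  eval-affine (c ⊛ e) ρ = trans (eval-combine c (affine e) 0ℤ (constant 0ℤ) ρ)
    (trans (ℤₚ.+-identityʳ _) (cong (c *_) (eval-affine e ρ)))

  data Formula (n : ℕ) : Set where
    _≼_ _≛_ : Expr n → Expr n → Formula n

  data Sequent (n : ℕ) : Set where
    ⊩_  : Formula n → Sequent n
    _⇒_ : Formula n → Sequent n → Sequent n

  infix 3 ⊩_

  Holds : ∀ {n} → Env n → Formula n → Set
  Holds ρ (e ≼ f) = ⟦ e ⟧ ρ ≤ ⟦ f ⟧ ρ
  Holds ρ (e ≛ f) = ⟦ e ⟧ ρ ≡ ⟦ f ⟧ ρ

  Valid : ∀ {n} → Env n → Sequent n → Set
  Valid ρ (⊩ φ)   = Holds ρ φ
  Valid ρ (φ ⇒ s) = Holds ρ φ → Valid ρ s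

  NonNeg Zero : ∀ {n} → Env n → Affine n → Set
  NonNeg ρ e = 0ℤ ≤ eval e ρ
  Zero   ρ e = eval e ρ ≡ 0ℤ

  record System (n : ℕ) : Set where
    constructor system
    field
      zeros   : List (Affine n)
      nonnegs : List (Affine n)

  Solves : ∀ {n} → Env n → System n → Set
  Solves ρ (system zs ns) = All (Zero ρ) zs × All (NonNeg ρ) ns

  exact : (g : ℕ) → .{{NonZero g}} → ∀ {n} → Vec ℤ n → Maybe (Vec ℤ n)
  exact g []       = just []
  exact g (c ∷ cs) with + g * (c /ℕ g) ≟ c | exact g cs
  ... | yes _ | just ds = just (c /ℕ g ∷ ds)
  ... | _     | _       = nothing

  exact-sound : ∀ g .{{_ : NonZero g}} {n} (cs : Vec ℤ n) {ds} → exact g cs ≡ just ds →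
    ∀ ρ → dot cs ρ ≡ + g * dot ds ρ
  exact-sound g [] refl [] = sym (ℤₚ.*-zeroʳ (+ g))
  exact-sound g (c ∷ cs) eq (x ∷ ρ) with + g * (c /ℕ g) ≟ c | exact g cs in eq′ | eq
  ... | yes p | just ds | refl =
    trans (cong₂ _+_ (cong (_* x) (sym p)) (exact-sound g cs eq′ ρ)) (lemma (+ g) (c /ℕ g) x (dot ds ρ))
    where
    lemma : ∀ g d x u → g * d * x + g * u ≡ g * (d * x + u)
    lemma = solve-∀

  -- Integrality: g·X + c ≥ 0 implies X + ⌊c/g⌋ ≥ 0.
  tighten : (g : ℕ) → .{{NonZero g}} → ∀ {n} → Affine n → Affine n
  tighten g (cs +ᶜ c) with exact g cs
  ... | just ds = ds +ᶜ (c /ℕ g)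
  ... | nothing = cs +ᶜ c

  -- With remainder `r < g`, the hypothesis reads 0 ≤ r + g(X + ⌊c/g⌋). If the bracket were at most
  -- -1, the right side would be at most r - g < 0.
  floor-bound : ∀ g .{{_ : NonZero g}} X c → 0ℤ ≤ + g * X + c → 0ℤ ≤ X + c /ℕ g
  floor-bound (suc g) X c 0≤ with X + c /ℕ suc g in eq
  ... | + _      = +≤+ ℕ.z≤n
  ... | -[1+ k ] = contradiction 0≤ (ℤₚ.<⇒≱ (subst (_< 0ℤ) (sym total) (negative k (n%ℕd<d c (suc g)))))
    where
    r : ℕ
    r = c %ℕ suc g
    rearrange : ∀ G X r u → G * X + (r + u * G) ≡ r + G * (X + u)
    rearrange = solve-∀
    total : + suc g * X + c ≡ + r + + suc g * -[1+ k ]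
    total = trans (cong (λ z → + suc g * X + z) (a≡a%ℕn+[a/ℕn]*n c (suc g)))
      (trans (rearrange (+ suc g) X (+ r) (c /ℕ suc g)) (cong (λ z → + r + + suc g * z) eq))
    negative : ∀ k → r ℕ.< suc g → + r + + suc g * -[1+ k ] < 0ℤ
    negative k r<g = ℤₚ.≤-<-trans
      (ℤₚ.+-monoʳ-≤ (+ r) (ℤₚ.*-monoˡ-≤-nonNeg (+ suc g) { -[1+ k ]} { -[1+ 0 ]} (-≤- ℕ.z≤n)))
      (subst (_< 0ℤ) (cong (λ z → + r + z) (sym (trans (ℤₚ.*-comm (+ suc g) (- 1ℤ)) (ℤₚ.-1*i≡-i (+ suc g)))))
        (subst (λ z → + r - + suc g < z) (ℤₚ.+-inverseʳ (+ suc g)) (ℤₚ.+-monoˡ-< (- + suc g) (Data.Integer.Base.+<+ r<g))))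

  tighten-sound : ∀ g .{{_ : NonZero g}} {n} ρ (e : Affine n) → NonNeg ρ e → NonNeg ρ (tighten g e)
  tighten-sound g ρ (cs +ᶜ c) p with exact g cs in eq
  ... | just ds = floor-bound g (dot ds ρ) c (subst (λ z → 0ℤ ≤ z + c) (exact-sound g cs eq ρ) p)
  ... | nothing = p

  -- The moduli 3 and 2 are the ones that occur in the applications: valuations on the base field
  -- are multiples of 3, and quantities such as 2A and 2ρ bring in factors 2. A constraint whose
  -- coefficients are not divisible is left unchanged.
  normalise : ∀ {n} → Affine n → Affine n
  normalise e = tighten 2 (tighten 3 e)

  normalise-sound : ∀ {n} ρ (e : Affine n) → NonNeg ρ e → NonNeg ρ (normalise e)
  normalise-sound ρ e p = tighten-sound 2 ρ (tighten 3 e) (tighten-sound 3 ρ e p)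

  drop₁ : ∀ {n} → Affine (suc n) → Affine n
  drop₁ ((_ ∷ cs) +ᶜ c) = cs +ᶜ c

  lead : ∀ {n} → Affine (suc n) → ℤ
  lead ((c ∷ _) +ᶜ _) = c

  eval-split : ∀ {n} (e : Affine (suc n)) x ρ → eval e (x ∷ ρ) ≡ lead e * x + eval (drop₁ e) ρ
  eval-split ((c ∷ cs) +ᶜ d) x ρ = ℤₚ.+-assoc (c * x) (dot cs ρ) d

  record Split (n : ℕ) : Set where
    constructor split
    field
      lower upper : List (ℕ × Affine n)
      rest        : List (Affine n)

  Lower Upper : ∀ {n} → ℤ → Env n → ℕ × Affine n → Set
  Lower x ρ (a , e) = 0ℤ ≤ + a * x + eval e ρ
  Upper x ρ (b , e) = 0ℤ ≤ - (+ b) * x + eval e ρ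

  SolvesSplit : ∀ {n} → ℤ → Env n → Split n → Set
  SolvesSplit x ρ (split ls us rs) = All (Lower x ρ) ls × All (Upper x ρ) us × All (NonNeg ρ) rs

  insert : ∀ {n} → Affine (suc n) → Split n → Split n
  insert e (split ls us rs) with lead e
  ... | + 0      = split ls us (drop₁ e ∷ rs)
  ... | + suc a  = split ((suc a , drop₁ e) ∷ ls) us rs
  ... | -[1+ b ] = split ls ((suc b , drop₁ e) ∷ us) rs

  insert-sound : ∀ {n} x ρ (e : Affine (suc n)) S → NonNeg (x ∷ ρ) e → SolvesSplit x ρ S →
    SolvesSplit x ρ (insert e S)
  insert-sound x ρ e (split ls us rs) p (pl , pu , pr)
    with lead e | subst (0ℤ ≤_) (eval-split e x ρ) p
  ... | + 0      | q = pl , pu , subst (0ℤ ≤_) (ℤₚ.+-identityˡ _) q ∷ pr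
  ... | + suc a  | q = q ∷ pl , pu , pr
  ... | -[1+ b ] | q = pl , q ∷ pu , pr

  splitAll : ∀ {n} → List (Affine (suc n)) → Split n
  splitAll []       = split [] [] []
  splitAll (e ∷ es) = insert e (splitAll es)

  splitAll-sound : ∀ {n} x ρ (es : List (Affine (suc n))) → All (NonNeg (x ∷ ρ)) es →
    SolvesSplit x ρ (splitAll es)
  splitAll-sound x ρ []       []       = [] , [] , []
  splitAll-sound x ρ (e ∷ es) (p ∷ ps) = insert-sound x ρ e (splitAll es) p (splitAll-sound x ρ es ps)

  resolve₁ : ∀ {n} → ℕ × Affine n → List (ℕ × Affine n) → List (Affine n)
  resolve₁ _       []             = []
  resolve₁ (a , e) ((b , f) ∷ us) = normalise (combine (+ b) e (+ a) f) ∷ resolve₁ (a , e) us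

  resolve₁-sound : ∀ {n} x ρ (l : ℕ × Affine n) us → Lower x ρ l → All (Upper x ρ) us →
    All (NonNeg ρ) (resolve₁ l us)
  resolve₁-sound x ρ l       []             p []       = []
  resolve₁-sound x ρ (a , e) ((b , f) ∷ us) p (q ∷ qs) =
    normalise-sound ρ (combine (+ b) e (+ a) f) (subst (0ℤ ≤_) total (ℤₚ.+-mono-≤ (scale b p) (scale a q)))
    ∷ resolve₁-sound x ρ (a , e) us p qs
    where
    scale : ∀ k {z} → 0ℤ ≤ z → 0ℤ ≤ + k * z
    scale k {z} 0≤z = subst (_≤ + k * z) (ℤₚ.*-zeroʳ (+ k)) (ℤₚ.*-monoˡ-≤-nonNeg (+ k) 0≤z)
    lemma : ∀ a b x u v → b * (a * x + u) + a * (- b * x + v) ≡ b * u + a * v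
    lemma = solve-∀
    total : + b * (+ a * x + eval e ρ) + + a * (- (+ b) * x + eval f ρ) ≡ eval (combine (+ b) e (+ a) f) ρ
    total = trans (lemma (+ a) (+ b) x (eval e ρ) (eval f ρ)) (sym (eval-combine (+ b) e (+ a) f ρ))

  resolve : ∀ {n} → List (ℕ × Affine n) → List (ℕ × Affine n) → List (Affine n)
  resolve []       us = []
  resolve (l ∷ ls) us = resolve₁ l us ++ resolve ls us

  resolve-sound : ∀ {n} x ρ (ls us : List (ℕ × Affine n)) → All (Lower x ρ) ls → All (Upper x ρ) us →
    All (NonNeg ρ) (resolve ls us)
  resolve-sound x ρ []       us []       qs = []
  resolve-sound x ρ (l ∷ ls) us (p ∷ ps) qs =
    ++⁺ (resolve₁-sound x ρ l us p qs) (resolve-sound x ρ ls us ps qs)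

  project : ∀ {n} → List (Affine (suc n)) → List (Affine n)
  project es with splitAll es
  ... | split ls us rs = resolve ls us ++ rs

  project-sound : ∀ {n} x ρ (es : List (Affine (suc n))) → All (NonNeg (x ∷ ρ)) es →
    All (NonNeg ρ) (project es)
  project-sound x ρ es ps with splitAll es | splitAll-sound x ρ es ps
  ... | split ls us rs | pl , pu , pr = ++⁺ (resolve-sound x ρ ls us pl pu) pr

  -- An equation with leading coefficient 1 or -1 can be solved for its variable over ℤ without
  -- loss, which keeps congruence information that real elimination would destroy.
  data Pivot {n} : Affine (suc n) → Set where
    none : ∀ {e} → Pivot e
    plus  : ∀ {e} → lead e ≡ 1ℤ → Pivot e
    minus : ∀ {e} → lead e ≡ - 1ℤ → Pivot e

  pivot? : ∀ {n} (e : Affine (suc n)) → Pivot e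
  pivot? e with lead e ≟ 1ℤ | lead e ≟ - 1ℤ
  ... | yes p | _     = plus p
  ... | no _  | yes p = minus p
  ... | no _  | no _  = none

  pivot : ∀ {n} → List (Affine (suc n)) → Maybe (ℤ × Affine (suc n))
  pivot []       = nothing
  pivot (e ∷ es) with pivot? e
  ... | plus _  = just (- 1ℤ , e)
  ... | minus _ = just (1ℤ , e)
  ... | none    = pivot es

  pivot-sound : ∀ {n} ρ (es : List (Affine (suc n))) {s e} → pivot es ≡ just (s , e) →
    All (Zero ρ) es → Zero ρ e
  pivot-sound ρ (e ∷ es) eq (p ∷ ps) with pivot? e | eq
  ... | plus _  | refl = p
  ... | minus _ | refl = p
  ... | none    | eq′  = pivot-sound ρ es eq′ ps

  -- Here `s` is the negative of the leading coefficient of the pivot `e`, which is 1 or -1, so the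
  -- leading coefficients of `f` and of the added multiple of `e` cancel.
  substitute : ∀ {n} → ℤ → Affine (suc n) → Affine (suc n) → Affine (suc n)
  substitute s e f = combine 1ℤ f (s * lead f) e

  eval-substitute : ∀ {n} s (e f : Affine (suc n)) ρ → Zero ρ e → eval (substitute s e f) ρ ≡ eval f ρ
  eval-substitute s e f ρ z = trans (eval-combine 1ℤ f (s * lead f) e ρ)
    (trans (cong (λ t → 1ℤ * eval f ρ + s * lead f * t) z) (lemma (eval f ρ) (s * lead f)))
    where
    lemma : ∀ u v → 1ℤ * u + v * 0ℤ ≡ u
    lemma = solve-∀

  weaken : ∀ {n} → Affine n → List (Affine n)
  weaken e = normalise e ∷ normalise (combine (- 1ℤ) e 0ℤ e) ∷ []

  weaken-sound : ∀ {n} ρ (e : Affine n) → Zero ρ e → All (NonNeg ρ) (weaken e)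
  weaken-sound ρ e z = normalise-sound ρ e (ℤₚ.≤-reflexive (sym z))
    ∷ normalise-sound ρ (combine (- 1ℤ) e 0ℤ e) (ℤₚ.≤-reflexive (sym (trans (eval-combine (- 1ℤ) e 0ℤ e ρ)
        (cong (λ t → - 1ℤ * t + 0ℤ * t) z)))) ∷ []

  mapL : ∀ {n m} → (Affine n → Affine m) → List (Affine n) → List (Affine m)
  mapL f []       = []
  mapL f (e ∷ es) = f e ∷ mapL f es

  mapL-sound : ∀ {n m} {P : Affine n → Set} {Q : Affine m → Set} (f : Affine n → Affine m) →
    (∀ e → P e → Q (f e)) → ∀ es → All P es → All Q (mapL f es)
  mapL-sound f h []       []       = []
  mapL-sound f h (e ∷ es) (p ∷ ps) = h e p ∷ mapL-sound f h es ps

  -- After a substitution the variable has left every equation and all of them survive. Without a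
  -- pivot, an equation still containing the variable is kept only as a pair of inequalities for
  -- Fourier-Motzkin elimination.
  degrade : ∀ {n} → System (suc n) → List (Affine n) × List (Affine (suc n))
  degrade (system [] ns) = [] , ns
  degrade (system (z ∷ zs) ns) with lead z ≟ 0ℤ | degrade (system zs ns)
  ... | yes _ | zs′ , ns′ = drop₁ z ∷ zs′ , ns′
  ... | no _  | zs′ , ns′ = zs′ , weaken z ++ ns′

  degrade-sound : ∀ {n} x ρ (S : System (suc n)) → Solves (x ∷ ρ) S →
    All (Zero ρ) (proj₁ (degrade S)) × All (NonNeg (x ∷ ρ)) (proj₂ (degrade S))
  degrade-sound x ρ (system [] ns) ([] , ps) = [] , ps
  degrade-sound x ρ (system (z ∷ zs) ns) (q ∷ qs , ps)
    with lead z ≟ 0ℤ | degrade (system zs ns) | degrade-sound x ρ (system zs ns) (qs , ps)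
  ... | yes l≡0 | _ | qs′ , ps′ =
    trans (sym (trans (eval-split z x ρ) (trans (cong (λ t → t * x + eval (drop₁ z) ρ) l≡0) (ℤₚ.+-identityˡ _)))) q
    ∷ qs′ , ps′
  ... | no _    | _ | qs′ , ps′ = qs′ , ++⁺ (weaken-sound (x ∷ ρ) z q) ps′

  eliminate : ∀ {n} → System (suc n) → System n
  eliminate S@(system zs ns) with pivot zs
  ... | just (s , e) = let zs′ , ns′ = degrade (system (mapL (substitute s e) zs) (mapL (λ f → normalise (substitute s e f)) ns))
                       in system zs′ (project ns′)
  ... | nothing      = let zs′ , ns′ = degrade S in system zs′ (project ns′)

  eliminate-sound : ∀ {n} x ρ (S : System (suc n)) → Solves (x ∷ ρ) S → Solves ρ (eliminate S)
  eliminate-sound x ρ S@(system zs ns) (qs , ps) with pivot zs in eq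
  ... | nothing =
    let qs′ , ps′ = degrade-sound x ρ S (qs , ps) in qs′ , project-sound x ρ (proj₂ (degrade S)) ps′
  ... | just (s , e) =
    let z  = pivot-sound (x ∷ ρ) zs eq qs
        S′ = system (mapL (substitute s e) zs) (mapL (λ f → normalise (substitute s e f)) ns)
        qs′ , ps′ = degrade-sound x ρ S′
          ( mapL-sound (substitute s e) (λ f p → trans (eval-substitute s e f (x ∷ ρ) z) p) zs qs
          , mapL-sound (λ f → normalise (substitute s e f)) (λ f p → normalise-sound (x ∷ ρ) (substitute s e f)
              (subst (0ℤ ≤_) (sym (eval-substitute s e f (x ∷ ρ) z)) p)) ns ps)
    in qs′ , project-sound x ρ (proj₂ (degrade S′)) ps′

  hasNegative : List (Affine 0) → Bool
  hasNegative []       = false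
  hasNegative (e ∷ es) with 0ℤ ≤? const e
  ... | yes _ = hasNegative es
  ... | no _  = true

  hasNegative-sound : ∀ es → hasNegative es ≡ true → ¬ All (NonNeg []) es
  hasNegative-sound (([] +ᶜ c) ∷ es) eq (p ∷ ps) with 0ℤ ≤? c
  ... | yes _ = hasNegative-sound es eq ps
  ... | no ¬p = ¬p (subst (0ℤ ≤_) (ℤₚ.+-identityˡ c) p)

  hasNonzero : List (Affine 0) → Bool
  hasNonzero []       = false
  hasNonzero (e ∷ es) with const e ≟ 0ℤ
  ... | yes _ = hasNonzero es
  ... | no _  = true

  hasNonzero-sound : ∀ es → hasNonzero es ≡ true → ¬ All (Zero []) es
  hasNonzero-sound (([] +ᶜ c) ∷ es) eq (p ∷ ps) with c ≟ 0ℤ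
  ... | yes _ = hasNonzero-sound es eq ps
  ... | no ¬p = ¬p (trans (sym (ℤₚ.+-identityˡ c)) p)

  infeasible : ∀ {n} → System n → Bool
  infeasible {zero} (system zs ns) = if hasNegative ns then true else hasNonzero zs
  infeasible {suc n} S = infeasible (eliminate S)

  infeasible-sound : ∀ {n} ρ (S : System n) → infeasible S ≡ true → ¬ Solves ρ S
  infeasible-sound [] (system zs ns) eq (qs , ps) with hasNegative ns in eq′
  ... | true  = hasNegative-sound ns eq′ ps
  ... | false = hasNonzero-sound zs eq qs
  infeasible-sound (x ∷ ρ) S eq sol = infeasible-sound ρ (eliminate S) eq (eliminate-sound x ρ S sol)

  difference : ∀ {n} → Expr n → Expr n → Affine n
  difference e f = combine 1ℤ (affine f) (- 1ℤ) (affine e)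

  eval-difference : ∀ {n} (e f : Expr n) ρ → eval (difference e f) ρ ≡ ⟦ f ⟧ ρ - ⟦ e ⟧ ρ
  eval-difference e f ρ = trans (eval-combine 1ℤ (affine f) (- 1ℤ) (affine e) ρ)
    (cong₂ _+_ (trans (ℤₚ.*-identityˡ _) (eval-affine f ρ)) (trans (ℤₚ.-1*i≡-i _) (cong -_ (eval-affine e ρ))))

  assume : ∀ {n} → Formula n → System n → System n
  assume (e ≼ f) (system zs ns) = system zs (normalise (difference e f) ∷ ns)
  assume (e ≛ f) (system zs ns) = system (difference e f ∷ zs) ns

  assume-sound : ∀ {n} ρ (φ : Formula n) S → Holds ρ φ → Solves ρ S → Solves ρ (assume φ S)
  assume-sound ρ (e ≼ f) (system zs ns) p (qs , ps) =
    qs , normalise-sound ρ (difference e f) (subst (0ℤ ≤_) (sym (eval-difference e f ρ)) (ℤₚ.i≤j⇒0≤j-i p)) ∷ ps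
  assume-sound ρ (e ≛ f) (system zs ns) p (qs , ps) =
    trans (eval-difference e f ρ) (ℤₚ.i≡j⇒i-j≡0 (sym p)) ∷ qs , ps

  sucLit : ∀ {n} → Expr n → Expr n
  sucLit e = e ⊞ lit 1ℤ

  entails : ∀ {n} → System n → Formula n → Bool
  entails S (e ≼ f) = infeasible (assume (sucLit f ≼ e) S)
  entails S (e ≛ f) = entails S (e ≼ f) ∧ entails S (f ≼ e)

  ≤-sound : ∀ {n} ρ (S : System n) e f → infeasible (assume (sucLit f ≼ e) S) ≡ true →
    Solves ρ S → ⟦ e ⟧ ρ ≤ ⟦ f ⟧ ρ
  ≤-sound ρ S e f eq sol with ⟦ e ⟧ ρ ≤? ⟦ f ⟧ ρ
  ... | yes p = p
  ... | no ¬p = ⊥-elim (infeasible-sound ρ (assume (sucLit f ≼ e) S) eq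
    (assume-sound ρ (sucLit f ≼ e) S
      (subst (_≤ ⟦ e ⟧ ρ) (ℤₚ.+-comm 1ℤ (⟦ f ⟧ ρ)) (ℤₚ.i<j⇒suc[i]≤j (ℤₚ.≰⇒> ¬p))) sol))

  ∧-split : ∀ a {b} → a ∧ b ≡ true → a ≡ true × b ≡ true
  ∧-split true eq = refl , eq

  entails-sound : ∀ {n} ρ (S : System n) φ → entails S φ ≡ true → Solves ρ S → Holds ρ φ
  entails-sound ρ S (e ≼ f) eq sol = ≤-sound ρ S e f eq sol
  entails-sound ρ S (e ≛ f) eq sol =
    let p , q = ∧-split (entails S (e ≼ f)) eq
    in ℤₚ.≤-antisym (≤-sound ρ S e f p sol) (≤-sound ρ S f e q sol)

  valid : ∀ {n} → System n → Sequent n → Bool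
  valid S (⊩ φ)   = entails S φ
  valid S (φ ⇒ s) = valid (assume φ S) s

  valid-sound : ∀ {n} ρ (S : System n) s → valid S s ≡ true → Solves ρ S → Valid ρ s
  valid-sound ρ S (⊩ φ)   eq sol   = entails-sound ρ S φ eq sol
  valid-sound ρ S (φ ⇒ s) eq sol p = valid-sound ρ (assume φ S) s eq (assume-sound ρ φ S p sol)

  Fun : (n : ℕ) → Set → Set → Set
  Fun zero    A B = B
  Fun (suc n) A B = A → Fun n A B

  apply : ∀ {n A B} → Fun n A B → Vec A n → B
  apply f []       = f
  apply f (x ∷ xs) = apply (f x) xs

  ∀ᵛ : (n : ℕ) → (Env n → Set) → Set
  ∀ᵛ zero    P = P []
  ∀ᵛ (suc n) P = (x : ℤ) → ∀ᵛ n (λ ρ → P (x ∷ ρ))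

  curry : ∀ n {P : Env n → Set} → (∀ ρ → P ρ) → ∀ᵛ n P
  curry zero    f   = f []
  curry (suc n) f x = curry n (λ ρ → f (x ∷ ρ))

  tabulateVars : ∀ n → Vec (Expr n) n
  tabulateVars n = map var (allFin n)

  abstract
    -- Linear integer arithmetic by Fourier–Motzkin elimination with integral tightening.
    lia : ∀ n (s : Fun n (Expr n) (Sequent n)) →
      {_ : T (valid (system [] []) (apply s (tabulateVars n)))} →
      ∀ᵛ n (λ ρ → Valid ρ (apply s (tabulateVars n)))
    lia n s {t} = curry n (λ ρ →
      valid-sound ρ (system [] []) (apply s (tabulateVars n)) (Equivalence.to T-≡ t) ([] , []))

  #_ : ∀ {n} → ℕ → Expr n
  # k = lit (+ k)

-- A reflective solver for consequences of equations in commutative rings.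

module RingSolve where

  open import Algebra.Bundles using (CommutativeRing)
  open import Data.Bool.Base using (Bool; true; false; not; if_then_else_; T)
  open import Data.Fin.Base using (Fin; zero; suc; toℕ)
  open import Data.List.Base using (List; []; _∷_; _++_; map; null)
  open import Data.Nat.Base using (ℕ; zero; suc; _≤ᵇ_; _≡ᵇ_)
  open import Data.Nat.Properties using (≡ᵇ⇒≡)
  open import Data.Fin.Properties using (toℕ-injective)
  open import Data.Product.Base using (_×_; _,_)
  open import Data.Vec.Base as Vec using (Vec; []; _∷_; lookup; allFin)
  open import Data.Unit.Base using (tt)
  open import Relation.Binary.PropositionalEquality as ≡ using (_≡_)
  import Algebra.Properties.Ring as RingProperties
  import Relation.Binary.Reasoning.Setoid as SetoidReasoning

  infixl 6 _⊕_ _⊖_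
  infixl 7 _⊗_
  infix 8 ⊝_
  infix 4 _≗_
  infixr 3 _·_⇒_
  infix 3 ⊢_

  data Poly (n : ℕ) : Set where
    var         : Fin n → Poly n
    𝟘 𝟙         : Poly n
    _⊕_ _⊖_ _⊗_ : Poly n → Poly n → Poly n
    ⊝_          : Poly n → Poly n

  data Equation (n : ℕ) : Set where
    _≗_ : Poly n → Poly n → Equation n

  -- A hypothesis comes with the coefficient by which it enters the goal.
  data Combination (n : ℕ) : Set where
    ⊢_   : Equation n → Combination n
    _·_⇒_ : Poly n → Equation n → Combination n → Combination n

  -- A signed product of variables in increasing order.
  Monomial : ℕ → Set
  Monomial n = Bool × List (Fin n)

  insertᵛ : ∀ {n} → Fin n → List (Fin n) → List (Fin n)
  insertᵛ i []       = i ∷ []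
  insertᵛ i (j ∷ js) = if toℕ i ≤ᵇ toℕ j then i ∷ j ∷ js else j ∷ insertᵛ i js

  mergeᵛ : ∀ {n} → List (Fin n) → List (Fin n) → List (Fin n)
  mergeᵛ []       js = js
  mergeᵛ (i ∷ is) js = insertᵛ i (mergeᵛ is js)

  xnor : Bool → Bool → Bool
  xnor true  b = b
  xnor false b = not b

  scale : ∀ {n} → Monomial n → List (Monomial n) → List (Monomial n)
  scale m []                   = []
  scale (s , is) ((t , js) ∷ p) = (xnor s t , mergeᵛ is js) ∷ scale (s , is) p

  times : ∀ {n} → List (Monomial n) → List (Monomial n) → List (Monomial n)
  times []      q = []
  times (m ∷ p) q = scale m q ++ times p q

  negate : ∀ {n} → List (Monomial n) → List (Monomial n)
  negate []            = []
  negate ((s , is) ∷ p) = (not s , is) ∷ negate p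

  expand : ∀ {n} → Poly n → List (Monomial n)
  expand (var i) = (true , i ∷ []) ∷ []
  expand 𝟘       = []
  expand 𝟙       = (true , []) ∷ []
  expand (p ⊕ q) = expand p ++ expand q
  expand (p ⊖ q) = expand p ++ negate (expand q)
  expand (p ⊗ q) = times (expand p) (expand q)
  expand (⊝ p)   = negate (expand p)

  sameᵛ : ∀ {n} → List (Fin n) → List (Fin n) → Bool
  sameᵛ []       []       = true
  sameᵛ (i ∷ is) (j ∷ js) = if toℕ i ≡ᵇ toℕ j then sameᵛ is js else false
  sameᵛ _        _        = false

  opposite : ∀ {n} → Monomial n → Monomial n → Bool
  opposite (true  , is) (false , js) = sameᵛ is js
  opposite (false , is) (true  , js) = sameᵛ is js
  opposite _            _            = false

  -- Integer coefficients are never stored: a monomial with coefficient k occurs k times, and adding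
  -- one more occurrence first looks for an opposite one to cancel. No opposite pair survives
  -- `collect`, so the empty list is the normal form of exactly the zero polynomial.
  add : ∀ {n} → Monomial n → List (Monomial n) → List (Monomial n)
  add m []       = m ∷ []
  add m (m′ ∷ p) = if opposite m m′ then p else m′ ∷ add m p

  collect : ∀ {n} → List (Monomial n) → List (Monomial n)
  collect []      = []
  collect (m ∷ p) = add m (collect p)

  residual : ∀ {n} → Combination n → Poly n
  residual (⊢ (l ≗ r))         = l ⊖ r
  residual (c · (l ≗ r) ⇒ s)   = residual s ⊖ c ⊗ (l ⊖ r)

  Fun : (n : ℕ) → Set → Set → Set
  Fun zero    A B = B
  Fun (suc n) A B = A → Fun n A B

  apply : ∀ {n A B} → Fun n A B → Vec A n → B
  apply f []       = f
  apply f (x ∷ xs) = apply (f x) xs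

  variables : ∀ n → Vec (Poly n) n
  variables n = Vec.map var (allFin n)

  module Solver {c ℓ} (R : CommutativeRing c ℓ) where
    open CommutativeRing R
    open RingProperties ring using (-0#≈0#; -‿involutive; -‿distribˡ-*; -‿distribʳ-*; -‿+-comm)
    open SetoidReasoning setoid

    private
      variable
        n : ℕ

    ⟦_⟧ : Poly n → Vec Carrier n → Carrier
    ⟦ var i ⟧ ρ = lookup ρ i
    ⟦ 𝟘 ⟧     ρ = 0#
    ⟦ 𝟙 ⟧     ρ = 1#
    ⟦ p ⊕ q ⟧ ρ = ⟦ p ⟧ ρ + ⟦ q ⟧ ρ
    ⟦ p ⊖ q ⟧ ρ = ⟦ p ⟧ ρ - ⟦ q ⟧ ρ
    ⟦ p ⊗ q ⟧ ρ = ⟦ p ⟧ ρ * ⟦ q ⟧ ρ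
    ⟦ ⊝ p ⟧   ρ = - ⟦ p ⟧ ρ

    Holds : Vec Carrier n → Equation n → Set ℓ
    Holds ρ (l ≗ r) = ⟦ l ⟧ ρ ≈ ⟦ r ⟧ ρ

    Valid : Vec Carrier n → Combination n → Set ℓ
    Valid ρ (⊢ e)       = Holds ρ e
    Valid ρ (c · e ⇒ s) = Holds ρ e → Valid ρ s

    private
      product : List (Fin n) → Vec Carrier n → Carrier
      product []       ρ = 1#
      product (i ∷ is) ρ = lookup ρ i * product is ρ

      signed : Bool → Carrier → Carrier
      signed true  x = x
      signed false x = - x

      monomial : Monomial n → Vec Carrier n → Carrier
      monomial (s , is) ρ = signed s (product is ρ)

      total : List (Monomial n) → Vec Carrier n → Carrier
      total []      ρ = 0#
      total (m ∷ p) ρ = monomial m ρ + total p ρ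

      signed-cong : ∀ s {x y} → x ≈ y → signed s x ≈ signed s y
      signed-cong true  eq = eq
      signed-cong false eq = -‿cong eq

      product-insert : ∀ (i : Fin n) js ρ → product (insertᵛ i js) ρ ≈ lookup ρ i * product js ρ
      product-insert i []       ρ = refl
      product-insert i (j ∷ js) ρ with toℕ i ≤ᵇ toℕ j
      ... | true  = refl
      ... | false = begin
        lookup ρ j * product (insertᵛ i js) ρ         ≈⟨ *-congˡ (product-insert i js ρ) ⟩
        lookup ρ j * (lookup ρ i * product js ρ)      ≈⟨ *-assoc _ _ _ ⟨
        lookup ρ j * lookup ρ i * product js ρ        ≈⟨ *-congʳ (*-comm _ _) ⟩
        lookup ρ i * lookup ρ j * product js ρ        ≈⟨ *-assoc _ _ _ ⟩
        lookup ρ i * (lookup ρ j * product js ρ)      ∎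

      product-merge : ∀ (is js : List (Fin n)) ρ →
        product (mergeᵛ is js) ρ ≈ product is ρ * product js ρ
      product-merge []       js ρ = sym (*-identityˡ _)
      product-merge (i ∷ is) js ρ = begin
        product (insertᵛ i (mergeᵛ is js)) ρ        ≈⟨ product-insert i (mergeᵛ is js) ρ ⟩
        lookup ρ i * product (mergeᵛ is js) ρ       ≈⟨ *-congˡ (product-merge is js ρ) ⟩
        lookup ρ i * (product is ρ * product js ρ)  ≈⟨ *-assoc _ _ _ ⟨
        lookup ρ i * product is ρ * product js ρ    ∎

      signed-* : ∀ s t x y → signed (xnor s t) (x * y) ≈ signed s x * signed t y
      signed-* true  true  x y = refl
      signed-* true  false x y = -‿distribʳ-* x y
      signed-* false true  x y = -‿distribˡ-* x y
      signed-* false false x y = begin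
        x * y           ≈⟨ -‿involutive _ ⟨
        - (- (x * y))   ≈⟨ -‿cong (-‿distribʳ-* x y) ⟩
        - (x * - y)     ≈⟨ -‿distribˡ-* x (- y) ⟩
        - x * - y       ∎

      total-++ : ∀ (p q : List (Monomial n)) ρ → total (p ++ q) ρ ≈ total p ρ + total q ρ
      total-++ []      q ρ = sym (+-identityˡ _)
      total-++ (m ∷ p) q ρ = trans (+-congˡ (total-++ p q ρ)) (sym (+-assoc _ _ _))

      total-scale : ∀ (m : Monomial n) p ρ → total (scale m p) ρ ≈ monomial m ρ * total p ρ
      total-scale m [] ρ = sym (zeroʳ _)
      total-scale (s , is) ((t , js) ∷ p) ρ = begin
        signed (xnor s t) (product (mergeᵛ is js) ρ) + total (scale (s , is) p) ρ
          ≈⟨ +-cong (trans (signed-cong (xnor s t) (product-merge is js ρ)) (signed-* s t _ _))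
                    (total-scale (s , is) p ρ) ⟩
        monomial (s , is) ρ * monomial (t , js) ρ + monomial (s , is) ρ * total p ρ
          ≈⟨ distribˡ _ _ _ ⟨
        monomial (s , is) ρ * (monomial (t , js) ρ + total p ρ) ∎

      total-times : ∀ (p q : List (Monomial n)) ρ → total (times p q) ρ ≈ total p ρ * total q ρ
      total-times []      q ρ = sym (zeroˡ _)
      total-times (m ∷ p) q ρ = begin
        total (scale m q ++ times p q) ρ               ≈⟨ total-++ (scale m q) (times p q) ρ ⟩
        total (scale m q) ρ + total (times p q) ρ      ≈⟨ +-cong (total-scale m q ρ) (total-times p q ρ) ⟩
        monomial m ρ * total q ρ + total p ρ * total q ρ ≈⟨ distribʳ _ _ _ ⟨
        (monomial m ρ + total p ρ) * total q ρ         ∎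

      signed-not : ∀ s x → signed (not s) x ≈ - signed s x
      signed-not true  x = refl
      signed-not false x = sym (-‿involutive x)

      total-negate : ∀ (p : List (Monomial n)) ρ → total (negate p) ρ ≈ - total p ρ
      total-negate []             ρ = sym -0#≈0#
      total-negate ((s , is) ∷ p) ρ =
        trans (+-cong (signed-not s _) (total-negate p ρ)) (-‿+-comm _ _)

      total-expand : ∀ (p : Poly n) ρ → total (expand p) ρ ≈ ⟦ p ⟧ ρ
      total-expand (var i) ρ = trans (+-identityʳ _) (*-identityʳ _)
      total-expand 𝟘       ρ = refl
      total-expand 𝟙       ρ = +-identityʳ _
      total-expand (p ⊕ q) ρ =
        trans (total-++ (expand p) (expand q) ρ) (+-cong (total-expand p ρ) (total-expand q ρ))
      total-expand (p ⊖ q) ρ = trans (total-++ (expand p) (negate (expand q)) ρ)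
        (+-cong (total-expand p ρ) (trans (total-negate (expand q) ρ) (-‿cong (total-expand q ρ))))
      total-expand (p ⊗ q) ρ =
        trans (total-times (expand p) (expand q) ρ) (*-cong (total-expand p ρ) (total-expand q ρ))
      total-expand (⊝ p)   ρ = trans (total-negate (expand p) ρ) (-‿cong (total-expand p ρ))

      same-sound : ∀ (is js : List (Fin n)) → T (sameᵛ is js) → is ≡ js
      same-sound []       []       _ = ≡.refl
      same-sound (i ∷ is) (j ∷ js) t with toℕ i ≡ᵇ toℕ j in eq
      ... | true = ≡.cong₂ _∷_ (toℕ-injective (≡ᵇ⇒≡ _ _ (≡.subst T (≡.sym eq) tt))) (same-sound is js t)

      opposite-sound : ∀ (m m′ : Monomial n) ρ → T (opposite m m′) → monomial m ρ + monomial m′ ρ ≈ 0#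
      opposite-sound (true , is) (false , js) ρ t with same-sound is js t
      ... | ≡.refl = -‿inverseʳ _
      opposite-sound (false , is) (true , js) ρ t with same-sound is js t
      ... | ≡.refl = -‿inverseˡ _

      total-add : ∀ (m : Monomial n) p ρ → total (add m p) ρ ≈ monomial m ρ + total p ρ
      total-add m []       ρ = refl
      total-add m (m′ ∷ p) ρ with opposite m m′ in eq
      ... | true  = sym (begin
        monomial m ρ + (monomial m′ ρ + total p ρ)   ≈⟨ +-assoc _ _ _ ⟨
        monomial m ρ + monomial m′ ρ + total p ρ     ≈⟨ +-congʳ (opposite-sound m m′ ρ (≡.subst T (≡.sym eq) tt)) ⟩
        0# + total p ρ                               ≈⟨ +-identityˡ _ ⟩
        total p ρ                                    ∎)
      ... | false = begin
        monomial m′ ρ + total (add m p) ρ            ≈⟨ +-congˡ (total-add m p ρ) ⟩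
        monomial m′ ρ + (monomial m ρ + total p ρ)   ≈⟨ +-assoc _ _ _ ⟨
        monomial m′ ρ + monomial m ρ + total p ρ     ≈⟨ +-congʳ (+-comm _ _) ⟩
        monomial m ρ + monomial m′ ρ + total p ρ     ≈⟨ +-assoc _ _ _ ⟩
        monomial m ρ + (monomial m′ ρ + total p ρ)   ∎

      total-collect : ∀ (p : List (Monomial n)) ρ → total (collect p) ρ ≈ total p ρ
      total-collect []      ρ = refl
      total-collect (m ∷ p) ρ = trans (total-add m (collect p) ρ) (+-congˡ (total-collect p ρ))

      vanishes : ∀ (p : Poly n) ρ → T (null (collect (expand p))) → ⟦ p ⟧ ρ ≈ 0#
      vanishes p ρ t with collect (expand p) in eq
      ... | [] = begin
        ⟦ p ⟧ ρ                      ≈⟨ total-expand p ρ ⟨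
        total (expand p) ρ           ≈⟨ total-collect (expand p) ρ ⟨
        total (collect (expand p)) ρ ≈⟨ reflexive (≡.cong (λ q → total q ρ) eq) ⟩
        0#                           ∎

      x-y≈0⇒x≈y : ∀ {x y} → x - y ≈ 0# → x ≈ y
      x-y≈0⇒x≈y {x} {y} eq = begin
        x             ≈⟨ +-identityʳ x ⟨
        x + 0#        ≈⟨ +-congˡ (-‿inverseˡ y) ⟨
        x + (- y + y) ≈⟨ +-assoc _ _ _ ⟨
        x - y + y     ≈⟨ +-congʳ eq ⟩
        0# + y        ≈⟨ +-identityˡ y ⟩
        y             ∎

      discharge : ∀ {x c l r} → l ≈ r → x - c * (l - r) ≈ 0# → x ≈ 0#
      discharge {x} {c} {l} {r} l≈r eq = trans (sym (begin
        x - c * (l - r)   ≈⟨ +-congˡ (-‿cong (*-congˡ (trans (+-congʳ l≈r) (-‿inverseʳ r)))) ⟩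
        x - c * 0#        ≈⟨ +-congˡ (-‿cong (zeroʳ c)) ⟩
        x - 0#            ≈⟨ +-congˡ -0#≈0# ⟩
        x + 0#            ≈⟨ +-identityʳ x ⟩
        x                 ∎)) eq

      residual-sound : ∀ (s : Combination n) ρ → ⟦ residual s ⟧ ρ ≈ 0# → Valid ρ s
      residual-sound (⊢ (l ≗ r))       ρ eq   = x-y≈0⇒x≈y eq
      residual-sound (c · (l ≗ r) ⇒ s) ρ eq h = residual-sound s ρ (discharge h eq)

    abstract
      -- An identity of commutative rings, or a consequence of given equations by a
      -- linear combination with polynomial coefficients.
      ring! : ∀ n (s : Fun n (Poly n) (Combination n)) →
        {_ : T (null (collect (expand (residual (apply s (variables n))))))} →
        (ρ : Vec Carrier n) → Valid ρ (apply s (variables n))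
      ring! n s {t} ρ = residual-sound (apply s (variables n)) ρ (vanishes (residual (apply s (variables n))) ρ t)

open import Data.Integer.Base as ℤ using (ℤ; +_; 0ℤ; 1ℤ)
import Data.Integer.Properties as ℤₚ
open import Data.Nat.Base as ℕ using (ℕ)
open import Data.Product.Base using (Σ; ∃-syntax; _×_; _,_; proj₁; proj₂)
open import Data.Sum.Base using (_⊎_; inj₁; inj₂; [_,_]′)
open import Data.Vec.Base using ([]; _∷_)
open import Level using (_⊔_)
open import Relation.Binary.Definitions using (tri<; tri≈; tri>)
open import Relation.Binary.PropositionalEquality as ≡ using (_≡_; _≢_)
open import Relation.Nullary using (¬_; Dec; yes; no; contradiction)
open import Defs
open Lia using (Expr; lia; #_; _≼_; _≛_; _⇒_; _⊛_; _⊞_; _⊟_; neg_; ⊩_)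
open RingSolve using (Poly; 𝟘; 𝟙; _⊕_; _⊖_; _⊗_; ⊝_; _≗_; _·_⇒_; ⊢_; module Solver)

-- Calculus in a discretely valued field.

module Valued where

  open import Algebra.Bundles using (CommutativeRing)
  open import Data.Integer.Base as ℤ using (ℤ; +_; -[1+_]; 0ℤ; 1ℤ)
  open import Data.Nat.Base as ℕ using (zero; suc)
  open import Relation.Nullary.Construct.Add.Supremum using (_⁺; [_]; ⊤⁺)
  open import Relation.Binary.Construct.Add.Supremum.NonStrict ℤ._≤_ using (_≤⁺_; [_]; _≤⊤⁺)

  module ValuedField {c ℓ} (K : CommutativeRing c ℓ) (isField : IsField K) (val : DiscreteValuation K) where
    open CommutativeRing K
    open IsField isField
    open DiscreteValuation val
    open Solver K public using (ring!)

    P : ℤ → Carrier → Set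
    P k x = [ k ] ≤⁺ v x

    Val : Carrier → ℤ → Set
    Val x k = v x ≡ [ k ]

    <⇒+1≤ : ∀ {i j} → i ℤ.< j → i ℤ.+ 1ℤ ℤ.≤ j
    <⇒+1≤ {i} {j} i<j = ≡.subst (ℤ._≤ j) (ℤₚ.+-comm 1ℤ i) (ℤₚ.i<j⇒suc[i]≤j i<j)

    +1≰ : ∀ {k} → ¬ k ℤ.+ 1ℤ ℤ.≤ k
    +1≰ {k} h with ℤ.+≤+ () ← lia 1 (λ k → k ⊞ # 1 ≼ k ⇒ ⊩ # 1 ≼ # 0) k h

    private
      []-injective : ∀ {i j : ℤ} → _≡_ {A = ℤ ⁺} [ i ] [ j ] → i ≡ j
      []-injective ≡.refl = ≡.refl

    P-resp : ∀ {k x y} → x ≈ y → P k x → P k y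
    P-resp {k} x≈y = ≡.subst ([ k ] ≤⁺_) (v-cong x≈y)

    P-0 : ∀ {k} → P k 0#
    P-0 {k} = ≡.subst ([ k ] ≤⁺_) (≡.sym v-0) ([ k ] ≤⊤⁺)

    P-≈0 : ∀ {k x} → x ≈ 0# → P k x
    P-≈0 x≈0 = P-resp (sym x≈0) P-0

    P-mono : ∀ {j k x} → j ℤ.≤ k → P k x → P j x
    P-mono {j} {k} {x} j≤k p with v x | p
    ... | [ l ] | [ k≤l ]  = [ ℤₚ.≤-trans j≤k k≤l ]
    ... | ⊤⁺    | _        = _ ≤⊤⁺

    P-+ : ∀ {k x y} → P k x → P k y → P k (x + y)
    P-+ = v-+

    P-* : ∀ {j k x y} → P j x → P k y → P (j ℤ.+ k) (x * y)
    P-* {j} {k} {x} {y} p q = ≡.subst ([ j ℤ.+ k ] ≤⁺_) (≡.sym (v-* x y)) (sum p q)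
      where
      sum : ∀ {a b} → [ j ] ≤⁺ a → [ k ] ≤⁺ b → [ j ℤ.+ k ] ≤⁺ a +⁺ b
      sum [ p ]    [ q ]    = [ ℤₚ.+-mono-≤ p q ]
      sum [ p ]    (_ ≤⊤⁺)  = _ ≤⊤⁺
      sum (_ ≤⊤⁺)  _        = _ ≤⊤⁺

    Val-resp : ∀ {k x y} → x ≈ y → Val x k → Val y k
    Val-resp x≈y e = ≡.trans (≡.sym (v-cong x≈y)) e

    Val⇒P : ∀ {k x} → Val x k → P k x
    Val⇒P {k} e = ≡.subst ([ k ] ≤⁺_) (≡.sym e) [ ℤₚ.≤-refl ]

    Val⇒P≤ : ∀ {j k x} → Val x k → j ℤ.≤ k → P j x
    Val⇒P≤ e j≤k = P-mono j≤k (Val⇒P e)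

    P-Val : ∀ {j k x} → P j x → Val x k → j ℤ.≤ k
    P-Val {j} {k} p e with ≡.subst ([ j ] ≤⁺_) e p
    ... | [ j≤k ] = j≤k

    Val-unique : ∀ {j k x} → Val x j → Val x k → j ≡ k
    Val-unique e f = []-injective (≡.trans (≡.sym e) f)

    Val⇒≉0 : ∀ {k x} → Val x k → ¬ x ≈ 0#
    Val⇒≉0 e x≈0 with () ← ≡.trans (≡.sym e) (≡.trans (v-cong x≈0) v-0)

    zero-or-Val : ∀ x → x ≈ 0# ⊎ ∃[ k ] Val x k
    zero-or-Val x with v x in eq
    ... | [ k ] = inj₂ (k , ≡.refl)
    ... | ⊤⁺    = inj₁ (v≡∞⇒≈0 eq)

    ≉0⇒Val : ∀ {x} → ¬ x ≈ 0# → ∃[ k ] Val x k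
    ≉0⇒Val {x} x≉0 with zero-or-Val x
    ... | inj₁ x≈0 = contradiction x≈0 x≉0
    ... | inj₂ e   = e

    _≈0? : ∀ x → Dec (x ≈ 0#)
    x ≈0? with zero-or-Val x
    ... | inj₁ x≈0     = yes x≈0
    ... | inj₂ (k , e) = no (Val⇒≉0 e)

    P? : ∀ k x → Dec (P k x)
    P? k x with v x
    ... | ⊤⁺ = yes (_ ≤⊤⁺)
    ... | [ l ] with k ℤₚ.≤? l
    ...   | yes p = yes [ p ]
    ...   | no ¬p = no λ { [ p ] → ¬p p }

    Val-or-P : ∀ {k x} → P k x → Val x k ⊎ P (k ℤ.+ 1ℤ) x
    Val-or-P {k} {x} p with v x | p
    ... | ⊤⁺    | _       = inj₂ (_ ≤⊤⁺)
    ... | [ l ] | [ k≤l ] with k ℤₚ.≟ l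
    ...   | yes k≡l = inj₁ (≡.cong [_] (≡.sym k≡l))
    ...   | no  k≢l = inj₂ [ <⇒+1≤ (ℤₚ.≤∧≢⇒< k≤l k≢l) ]

    Val-* : ∀ {j k x y} → Val x j → Val y k → Val (x * y) (j ℤ.+ k)
    Val-* {x = x} {y} e f = ≡.trans (v-* x y) (≡.cong₂ _+⁺_ e f)

    Val-1 : Val 1# 0ℤ
    Val-1 with ≉0⇒Val 1≉0
    ... | k , e with Val-unique (Val-resp (*-identityˡ 1#) (Val-* e e)) e
    ...   | k+k≡k = ≡.subst (Val 1#)
      (lia 1 (λ k → k ⊞ k ≛ k ⇒ ⊩ k ≛ # 0) k k+k≡k) e

    Val-−1 : Val (- 1#) 0ℤ
    Val-−1 with ≉0⇒Val {x = - 1#} (λ e → 1≉0 (ring! 0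
             (𝟘 ⊖ 𝟙 · ⊝ 𝟙 ≗ 𝟘 ⇒ ⊢ 𝟙 ≗ 𝟘) [] e))
    ... | k , e with Val-unique (Val-resp (ring! 0 (⊢ ⊝ 𝟙 ⊗ ⊝ 𝟙 ≗ 𝟙) []) (Val-* e e)) Val-1
    ...   | k+k≡0 = ≡.subst (Val (- 1#))
      (lia 1 (λ k → k ⊞ k ≛ # 0 ⇒ ⊩ k ≛ # 0) k k+k≡0) e

    P-1 : P 0ℤ 1#
    P-1 = Val⇒P Val-1

    P-0* : ∀ {k x y} → P 0ℤ x → P k y → P k (x * y)
    P-0* {k} {x} {y} p q = ≡.subst (λ l → P l (x * y)) (ℤₚ.+-identityˡ k) (P-* p q)

    P-neg : ∀ {k x} → P k x → P k (- x)
    P-neg {k} {x} p = P-resp (ring! 1 (λ x → ⊢ ⊝ 𝟙 ⊗ x ≗ ⊝ x) (x ∷ [])) (P-0* (Val⇒P Val-−1) p)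

    P-- : ∀ {k x y} → P k x → P k y → P k (x - y)
    P-- p q = P-+ p (P-neg q)

    -- Otherwise x = (x + y) - y would have valuation greater than k.
    Val-+ : ∀ {k x y} → Val x k → P (k ℤ.+ 1ℤ) y → Val (x + y) k
    Val-+ {k} {x} {y} e p with Val-or-P (P-+ (Val⇒P e) (P-mono (lia 1 (λ k → ⊩ k ≼ k ⊞ # 1) k) p))
    ... | inj₁ f = f
    ... | inj₂ q = contradiction
      (P-Val (P-resp (ring! 2 (λ x y → ⊢ x ⊕ y ⊖ y ≗ x) (x ∷ y ∷ [])) (P-- q p)) e) +1≰

    Val-inverse : ∀ {k x} → Val x k → ∃[ y ] x * y ≈ 1# × Val y (ℤ.- k)
    Val-inverse {k} {x} e with inverse x (Val⇒≉0 e)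
    ... | y , xy≈1 with zero-or-Val y
    ...   | inj₁ y≈0 = contradiction (trans (sym xy≈1) (trans (*-congˡ y≈0) (zeroʳ x))) 1≉0
    ...   | inj₂ (l , f) = y , xy≈1 , ≡.subst (Val y)
      (lia 2 (λ k l → k ⊞ l ≛ # 0 ⇒ ⊩ l ≛ neg k) k l (Val-unique (Val-resp xy≈1 (Val-* e f)) Val-1)) f

    P-cancel : ∀ {j k x y} → Val x k → P j (x * y) → P (j ℤ.- k) y
    P-cancel {j} {k} {x} {y} e p with Val-inverse e
    ... | z , xz≈1 , f = P-resp
      (ring! 3 (λ x y z → y · x ⊗ z ≗ 𝟙 ⇒ ⊢ x ⊗ y ⊗ z ≗ y) (x ∷ y ∷ z ∷ []) xz≈1) (P-* p (Val⇒P f))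

    private
      π : Carrier
      π = proj₁ normalised

      power : ∀ {x k} → Val x k → ∀ n → ∃[ y ] Val y (+ n ℤ.* k)
      power {x} {k} e zero    = 1# , Val-1
      power {x} {k} e (suc n) with power e n
      ... | y , f = x * y , ≡.subst (Val (x * y)) (≡.sym (ℤₚ.suc-* (+ n) k)) (Val-* e f)

    element : ∀ k → ∃[ x ] Val x k
    element (+ n) with power (proj₂ normalised) n
    ... | y , e = y , ≡.subst (Val y) (ℤₚ.*-identityʳ (+ n)) e
    element -[1+ n ] with power (proj₂ (proj₂ (Val-inverse (proj₂ normalised)))) (suc n)
    ... | y , e = y , ≡.subst (Val y) (≡.trans (ℤₚ.*-comm (+ suc n) -[1+ 0 ]) (ℤₚ.-1*i≡-i (+ suc n))) e

    -- Only finite valuations are compared, so 0 is apart from everything; coordinates of a vector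
    -- may therefore vanish without a case distinction in the statements.
    Apart : Carrier → Carrier → Set
    Apart x y = ∀ {k} → Val x k → ¬ Val y k

    Apart-Val-+ : ∀ {x y k} → Apart x y → Val (x + y) k → Val x k ⊎ Val y k
    Apart-Val-+ {x} {y} {k} x#y e with zero-or-Val x | zero-or-Val y
    ... | inj₁ x≈0 | _ = inj₂ (Val-resp (trans (+-congʳ x≈0) (+-identityˡ y)) e)
    ... | inj₂ _ | inj₁ y≈0 = inj₁ (Val-resp (trans (+-congˡ y≈0) (+-identityʳ x)) e)
    ... | inj₂ (i , f) | inj₂ (j , g) with ℤₚ.<-cmp i j
    ...   | tri< i<j _ _ = inj₁ (≡.subst (Val x) (Val-unique (Val-+ f (Val⇒P≤ g (<⇒+1≤ i<j))) e) f)
    ...   | tri≈ _ ≡.refl _ = contradiction g (x#y f)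
    ...   | tri> _ _ j<i = inj₂ (≡.subst (Val y)
      (Val-unique (Val-+ g (Val⇒P≤ f (<⇒+1≤ j<i))) (Val-resp (+-comm x y) e)) g)

    -- Terms of different valuation cannot cancel: the valuation of the sum is the smaller of the
    -- two, so a lower bound for it bounds both.
    Apart-P-+ : ∀ {x y k} → Apart x y → P k (x + y) → P k x × P k y
    Apart-P-+ {x} {y} {k} x#y p with zero-or-Val x | zero-or-Val y
    ... | inj₁ x≈0 | _ = P-≈0 x≈0 , P-resp (trans (+-congʳ x≈0) (+-identityˡ y)) p
    ... | inj₂ _ | inj₁ y≈0 = P-resp (trans (+-congˡ y≈0) (+-identityʳ x)) p , P-≈0 y≈0
    ... | inj₂ (i , f) | inj₂ (j , g) with ℤₚ.<-cmp i j
    ...   | tri< i<j _ _ =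
      let k≤i = P-Val p (Val-+ f (Val⇒P≤ g (<⇒+1≤ i<j)))
      in Val⇒P≤ f k≤i , Val⇒P≤ g (ℤₚ.≤-trans k≤i (ℤₚ.<⇒≤ i<j))
    ...   | tri≈ _ ≡.refl _ = contradiction g (x#y f)
    ...   | tri> _ _ j<i =
      let k≤j = P-Val p (Val-resp (+-comm y x) (Val-+ g (Val⇒P≤ f (<⇒+1≤ j<i))))
      in Val⇒P≤ f (ℤₚ.≤-trans k≤j (ℤₚ.<⇒≤ j<i)) , Val⇒P≤ g k≤j

-- Totally ramified cubic extensions and bases with distinct residues.

module Extension where

  open import Algebra.Morphism.Structures using (module RingMorphisms)
  open import Data.Fin.Base using (zero; suc)
  open import Data.Maybe.Base using (map)
  open Valued

  1≰0 : ¬ 1ℤ ℤ.≤ 0ℤ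
  1≰0 (ℤ.+≤+ ())

  module Ramified {c ℓ} (F E : LocalField c ℓ) (E/F : TotallyRamifiedExtension F E 3) where
    private
      module F = LocalField F
      module VF = ValuedField F.commutativeRing F.isField F.discreteValuation
    open LocalField E public hiding (zero; q)
    open TotallyRamifiedExtension E/F public
    open ValuedField commutativeRing isField discreteValuation public
    open RingMorphisms.IsRingHomomorphism ι-homo

    -- The base field is handled as a subset of `E`, so that coefficients and vectors live in one
    -- ring and the ring solver applies to both.
    𝕂 : Carrier → Set (c ⊔ ℓ)
    𝕂 x = ∃[ a ] ι a ≈ x

    𝔬 : Carrier → Set (c ⊔ ℓ)
    𝔬 x = 𝕂 x × P 0ℤ x

    𝕂-0 : 𝕂 0#
    𝕂-0 = F.0# , 0#-homo

    𝕂-1 : 𝕂 1#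
    𝕂-1 = F.1# , 1#-homo

    𝕂-+ : ∀ {x y} → 𝕂 x → 𝕂 y → 𝕂 (x + y)
    𝕂-+ (a , e) (b , f) = a F.+ b , trans (+-homo a b) (+-cong e f)

    𝕂-* : ∀ {x y} → 𝕂 x → 𝕂 y → 𝕂 (x * y)
    𝕂-* (a , e) (b , f) = a F.* b , trans (*-homo a b) (*-cong e f)

    𝕂-neg : ∀ {x} → 𝕂 x → 𝕂 (- x)
    𝕂-neg (a , e) = F.- a , trans (-‿homo a) (-‿cong e)

    𝕂-- : ∀ {x y} → 𝕂 x → 𝕂 y → 𝕂 (x - y)
    𝕂-- p q = 𝕂-+ p (𝕂-neg q)

    ι-Val : ∀ {a k} → VF.Val a k → Val (ι a) (+ 3 ℤ.* k)
    ι-Val {a} e = ≡.trans (ramification a) (≡.cong (map (+ 3 ℤ.*_)) e)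

    ι-0 : ∀ {a} → a F.≈ F.0# → ι a ≈ 0#
    ι-0 a≈0 = trans (⟦⟧-cong a≈0) 0#-homo

    𝕂-Val : ∀ {x k} → 𝕂 x → Val x k → ∃[ j ] k ≡ + 3 ℤ.* j
    𝕂-Val {x} {k} (a , e) f with VF.zero-or-Val a
    ... | inj₁ a≈0     = contradiction (trans (sym e) (ι-0 a≈0)) (Val⇒≉0 f)
    ... | inj₂ (j , g) = j , Val-unique f (Val-resp e (ι-Val g))

    𝕂-inverse : ∀ {x k} → 𝕂 x → Val x k → ∃[ y ] 𝕂 y × x * y ≈ 1# × Val y (ℤ.- k)
    𝕂-inverse {x} (a , e) f with VF.zero-or-Val a
    ... | inj₁ a≈0     = contradiction (trans (sym e) (ι-0 a≈0)) (Val⇒≉0 f)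
    ... | inj₂ (j , g) with VF.Val-inverse g | Val-inverse f
    ...   | b , ab≈1 , _ | y , xy≈1 , h = y , (b , unique) , xy≈1 , h
      where
      xb≈1 : x * ι b ≈ 1#
      xb≈1 = trans (*-congʳ (sym e)) (trans (sym (*-homo a b)) (trans (⟦⟧-cong ab≈1) 1#-homo))
      unique : ι b ≈ y
      unique = ring! 3 (λ x b y → (⊝ b) · x ⊗ y ≗ 𝟙 ⇒ y · x ⊗ b ≗ 𝟙 ⇒ ⊢ b ≗ y)
        (x ∷ ι b ∷ y ∷ []) xy≈1 xb≈1

    𝕂-element : ∀ j → ∃[ x ] 𝕂 x × Val x (+ 3 ℤ.* j)
    𝕂-element j with VF.element j
    ... | a , e = ι a , (a , refl) , ι-Val e

    -- Nonzero elements of the base field have valuation in 3ℤ, so a bound of 3j - 2 already forces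
    -- 3j. All integrality statements about coefficients rest on this rounding.
    𝕂-round : ∀ {x k} j → 𝕂 x → P k x → + 3 ℤ.* j ℤ.- + 2 ℤ.≤ k → P (+ 3 ℤ.* j) x
    𝕂-round {x} {k} j 𝕂x p h with zero-or-Val x
    ... | inj₁ x≈0 = P-≈0 x≈0
    ... | inj₂ (l , e) with 𝕂-Val 𝕂x e
    ...   | i , ≡.refl = Val⇒P≤ e
      (lia 3 (λ i j k → k ≼ + 3 ⊛ i ⇒ + 3 ⊛ j ⊟ # 2 ≼ k ⇒ ⊩ + 3 ⊛ j ≼ + 3 ⊛ i) i j k (P-Val p e) h)

    𝔬-0 : 𝔬 0#
    𝔬-0 = 𝕂-0 , P-0

    𝔬-1 : 𝔬 1#
    𝔬-1 = 𝕂-1 , P-1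

    𝔬-+ : ∀ {x y} → 𝔬 x → 𝔬 y → 𝔬 (x + y)
    𝔬-+ (p , p′) (q , q′) = 𝕂-+ p q , P-+ p′ q′

    𝔬-* : ∀ {x y} → 𝔬 x → 𝔬 y → 𝔬 (x * y)
    𝔬-* (p , p′) (q , q′) = 𝕂-* p q , P-0* p′ q′

    𝔬-neg : ∀ {x} → 𝔬 x → 𝔬 (- x)
    𝔬-neg (p , p′) = 𝕂-neg p , P-neg p′

    𝔬-- : ∀ {x y} → 𝔬 x → 𝔬 y → 𝔬 (x - y)
    𝔬-- p q = 𝔬-+ p (𝔬-neg q)

    𝔬-inverse : ∀ {x} → 𝔬 x → Val x 0ℤ → ∃[ y ] 𝔬 y × x * y ≈ 1#
    𝔬-inverse (p , _) e with 𝕂-inverse p e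
    ... | y , q , xy≈1 , f = y , (q , Val⇒P f) , xy≈1

    ι-𝔬 : ∀ {a} → F.𝒪 a → 𝔬 (ι a)
    ι-𝔬 {a} a∈𝒪 = (a , refl) , integral
      where
      integral : P 0ℤ (ι a)
      integral with VF.zero-or-Val a
      ... | inj₁ a≈0     = P-≈0 (ι-0 a≈0)
      ... | inj₂ (j , e) = Val⇒P≤ (ι-Val e)
        (lia 1 (λ j → # 0 ≼ j ⇒ ⊩ # 0 ≼ + 3 ⊛ j) j (VF.P-Val a∈𝒪 e))

    𝔬-ι : ∀ {x} → 𝔬 x → ∃[ a ] F.𝒪 a × ι a ≈ x
    𝔬-ι {x} ((a , e) , p) = a , integral , e
      where
      integral : F.𝒪 a
      integral with VF.zero-or-Val a
      ... | inj₁ a≈0     = VF.P-≈0 a≈0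
      ... | inj₂ (j , f) = VF.Val⇒P≤ f
        (lia 1 (λ j → # 0 ≼ + 3 ⊛ j ⇒ ⊩ # 0 ≼ j) j (P-Val p (Val-resp e (ι-Val f))))

    -- Scalars from the base field move a valuation only by multiples of 3, so incongruent
    -- valuations stay different.
    Apart-𝕂 : ∀ {a b x y i k} → 𝕂 a → 𝕂 b → Val x i → Val y k → (∀ j → i ≢ k ℤ.+ + 3 ℤ.* j) →
      Apart (a * x) (b * y)
    Apart-𝕂 {a} {b} {x} {y} {i} {k} 𝕂a 𝕂b e f i≢k {l} g h with zero-or-Val a | zero-or-Val b
    ... | inj₁ a≈0 | _ = Val⇒≉0 g (trans (*-congʳ a≈0) (zeroˡ x))
    ... | inj₂ _ | inj₁ b≈0 = Val⇒≉0 h (trans (*-congʳ b≈0) (zeroˡ y))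
    ... | inj₂ (m , a-val) | inj₂ (n , b-val) with 𝕂-Val 𝕂a a-val | 𝕂-Val 𝕂b b-val
    ...   | m′ , ≡.refl | n′ , ≡.refl = i≢k (n′ ℤ.- m′)
      (lia 5 (λ i k l m n → l ≛ + 3 ⊛ m ⊞ i ⇒ l ≛ + 3 ⊛ n ⊞ k ⇒ ⊩ i ≛ k ⊞ + 3 ⊛ (n ⊟ m))
        i k l m′ n′ (Val-unique g (Val-* a-val e)) (Val-unique h (Val-* b-val f)))

    Spans : Carrier → Carrier → Carrier → Set (c ⊔ ℓ)
    Spans u v w = ∀ x → ∃[ a ] ∃[ b ] ∃[ c ] 𝕂 a × 𝕂 b × 𝕂 c × x ≈ a * u + b * v + c * w

    private
      swap : ∀ {u v w} → Spans u v w → Spans v u w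
      swap S x with S x
      ... | a , b , c , 𝕂a , 𝕂b , 𝕂c , e = b , a , c , 𝕂b , 𝕂a , 𝕂c , trans e (+-congʳ (+-comm _ _))

      rotate : ∀ {u v w} → Spans u v w → Spans u w v
      rotate {u} {v} {w} S x with S x
      ... | a , b , c , 𝕂a , 𝕂b , 𝕂c , e = a , c , b , 𝕂a , 𝕂c , 𝕂b ,
        trans e (ring! 3 (λ u v w → ⊢ u ⊕ v ⊕ w ≗ u ⊕ w ⊕ v) (a * u ∷ b * v ∷ c * w ∷ []))

      -- Steinitz exchange: the nonzero coefficient of `u` in `z` allows solving for `u`.
      exchange : ∀ {u v w z a b c} → Spans u v w → 𝕂 a → 𝕂 b → 𝕂 c → z ≈ a * u + b * v + c * w →
        ¬ a ≈ 0# → Spans z v w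
      exchange {u} {v} {w} {z} {a} {b} {c} S 𝕂a 𝕂b 𝕂c e a≉0 x with S x | 𝕂-inverse 𝕂a (proj₂ (≉0⇒Val a≉0))
      ... | a₁ , b₁ , c₁ , 𝕂a₁ , 𝕂b₁ , 𝕂c₁ , f | d , 𝕂d , ad≈1 , _ =
        a₁ * d , b₁ - a₁ * d * b , c₁ - a₁ * d * c
        , 𝕂-* 𝕂a₁ 𝕂d , 𝕂-- 𝕂b₁ (𝕂-* (𝕂-* 𝕂a₁ 𝕂d) 𝕂b) , 𝕂-- 𝕂c₁ (𝕂-* (𝕂-* 𝕂a₁ 𝕂d) 𝕂c)
        , trans f (ring! 11 (λ u v w z a b c a₁ b₁ c₁ d →
            (⊝ a₁ ⊗ d) · z ≗ a ⊗ u ⊕ b ⊗ v ⊕ c ⊗ w ⇒ (⊝ a₁ ⊗ u) · a ⊗ d ≗ 𝟙 ⇒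
            ⊢ a₁ ⊗ u ⊕ b₁ ⊗ v ⊕ c₁ ⊗ w ≗ a₁ ⊗ d ⊗ z ⊕ (b₁ ⊖ a₁ ⊗ d ⊗ b) ⊗ v ⊕ (c₁ ⊖ a₁ ⊗ d ⊗ c) ⊗ w)
            (u ∷ v ∷ w ∷ z ∷ a ∷ b ∷ c ∷ a₁ ∷ b₁ ∷ c₁ ∷ d ∷ []) e ad≈1)

      generated : ∃[ u ] ∃[ v ] ∃[ w ] Spans u v w
      generated = let g , span , _ = degree in
        g zero , g (suc zero) , g (suc (suc zero)) , λ x → let a , e = span x in
        ι (a zero) , ι (a (suc zero)) , ι (a (suc (suc zero)))
        , (_ , refl) , (_ , refl) , (_ , refl)
        , trans e (ring! 3 (λ u v w → ⊢ u ⊕ (v ⊕ (w ⊕ 𝟘)) ≗ u ⊕ v ⊕ w) (_ ∷ _ ∷ _ ∷ []))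

    -- Valuations are split into a fixed class and a multiple of 3. The classes are parameters
    -- because lattice reduction replaces the vectors and their multiples of 3 but never the
    -- classes.
    record Triple (z₀ x₀ y₀ : ℤ) : Set c where
      field
        {Z X Y} : Carrier
        {z x y} : ℤ
        Z-val   : Val Z (z₀ ℤ.+ + 3 ℤ.* z)
        X-val   : Val X (x₀ ℤ.+ + 3 ℤ.* x)
        Y-val   : Val Y (y₀ ℤ.+ + 3 ℤ.* y)
        z₀≢x₀   : ∀ j → z₀ ≢ x₀ ℤ.+ + 3 ℤ.* j
        z₀≢y₀   : ∀ j → z₀ ≢ y₀ ℤ.+ + 3 ℤ.* j
        x₀≢y₀   : ∀ j → x₀ ≢ y₀ ℤ.+ + 3 ℤ.* j

    private
      ≢-shift : ∀ {i₀ k₀ i k} → (∀ j → i₀ ≢ k₀ ℤ.+ + 3 ℤ.* j) →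
        ∀ j → i₀ ℤ.+ + 3 ℤ.* i ≢ k₀ ℤ.+ + 3 ℤ.* k ℤ.+ + 3 ℤ.* j
      ≢-shift {i₀} {k₀} {i} {k} h j e = h (k ℤ.+ j ℤ.- i) (lia 5 (λ i₀ k₀ i k j →
        i₀ ⊞ + 3 ⊛ i ≛ k₀ ⊞ + 3 ⊛ k ⊞ + 3 ⊛ j ⇒ ⊩ i₀ ≛ k₀ ⊞ + 3 ⊛ (k ⊞ j ⊟ i))
        i₀ k₀ i k j e)

      ≢-flip : ∀ {i₀ k₀} → (∀ j → i₀ ≢ k₀ ℤ.+ + 3 ℤ.* j) → ∀ j → k₀ ≢ i₀ ℤ.+ + 3 ℤ.* j
      ≢-flip {i₀} {k₀} h j e = h (ℤ.- j) (lia 3 (λ i₀ k₀ j →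
        k₀ ≛ i₀ ⊞ + 3 ⊛ j ⇒ ⊩ i₀ ≛ k₀ ⊞ + 3 ⊛ (neg j)) i₀ k₀ j e)

    rotateᵗ : ∀ {z₀ x₀ y₀} → Triple z₀ x₀ y₀ → Triple x₀ y₀ z₀
    rotateᵗ t = record
      { Z-val = X-val ; X-val = Y-val ; Y-val = Z-val
      ; z₀≢x₀ = x₀≢y₀ ; z₀≢y₀ = ≢-flip z₀≢x₀ ; x₀≢y₀ = ≢-flip z₀≢y₀ }
      where open Triple t

    triple : ∀ {Z X Y z x y ρ} → Val Z (0ℤ ℤ.+ + 3 ℤ.* z) → Val X (ρ ℤ.+ + 3 ℤ.* x) →
      Val Y (ℤ.- ρ ℤ.+ + 3 ℤ.* y) → 1ℤ ℤ.≤ ρ → ρ ℤ.≤ + 2 → Triple 0ℤ ρ (ℤ.- ρ)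
    triple {z = z} {x} {y} {ρ} e f g 1≤ρ ρ≤2 = record
      { z = z ; x = x ; y = y ; Z-val = e ; X-val = f ; Y-val = g
      ; z₀≢x₀ = λ j e → 1≰0 (lia 2 (λ ρ j → # 0 ≛ ρ ⊞ + 3 ⊛ j ⇒ # 1 ≼ ρ ⇒ ρ ≼ # 2 ⇒
          ⊩ # 1 ≼ # 0) ρ j e 1≤ρ ρ≤2)
      ; z₀≢y₀ = λ j e → 1≰0 (lia 2 (λ ρ j → # 0 ≛ neg ρ ⊞ + 3 ⊛ j ⇒ # 1 ≼ ρ ⇒ ρ ≼ # 2 ⇒
          ⊩ # 1 ≼ # 0) ρ j e 1≤ρ ρ≤2)
      -- The hypothesis is 2ρ = 3j, an equation without a unit coefficient. The extra variable i = ρ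
      -- - j supplies pivots: they give j = 2i and ρ = 3i, which is incompatible with 1 ≤ ρ ≤ 2
      -- after tightening by 3. Later calls with a variable `i` of this kind use the same device.
      ; x₀≢y₀ = λ j e → 1≰0 (lia 3 (λ ρ j i → i ≛ ρ ⊟ j ⇒ ρ ≛ neg ρ ⊞ + 3 ⊛ j ⇒
          # 1 ≼ ρ ⇒ ρ ≼ # 2 ⇒ ⊩ # 1 ≼ # 0) ρ j (ρ ℤ.- j) ≡.refl e 1≤ρ ρ≤2)
      }

    -- The field `terms` is the absence of cancellation: the valuation of `u` is the least valuation
    -- of its three terms.
    record Coords (Z X Y u : Carrier) : Set (c ⊔ ℓ) where
      field
        {a b c′}   : Carrier
        𝕂a         : 𝕂 a
        𝕂b         : 𝕂 b
        𝕂c         : 𝕂 c′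
        expansion  : u ≈ a * Z + b * X + c′ * Y
        terms      : ∀ {k} → P k u → P k (a * Z) × P k (b * X) × P k (c′ * Y)

    module Coordinates {z₀ x₀ y₀} (t : Triple z₀ x₀ y₀) where
      open Triple t

      Z#X : ∀ {a b} → 𝕂 a → 𝕂 b → Apart (a * Z) (b * X)
      Z#X 𝕂a 𝕂b = Apart-𝕂 𝕂a 𝕂b Z-val X-val (≢-shift {z₀} {x₀} {z} {x} z₀≢x₀)

      Z#Y : ∀ {a b} → 𝕂 a → 𝕂 b → Apart (a * Z) (b * Y)
      Z#Y 𝕂a 𝕂b = Apart-𝕂 𝕂a 𝕂b Z-val Y-val (≢-shift {z₀} {y₀} {z} {y} z₀≢y₀)

      X#Y : ∀ {a b} → 𝕂 a → 𝕂 b → Apart (a * X) (b * Y)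
      X#Y 𝕂a 𝕂b = Apart-𝕂 𝕂a 𝕂b X-val Y-val (≢-shift {x₀} {y₀} {x} {y} x₀≢y₀)

      ZX#Y : ∀ {a b c} → 𝕂 a → 𝕂 b → 𝕂 c → Apart (a * Z + b * X) (c * Y)
      ZX#Y 𝕂a 𝕂b 𝕂c e with Apart-Val-+ (Z#X 𝕂a 𝕂b) e
      ... | inj₁ f = Z#Y 𝕂a 𝕂c f
      ... | inj₂ f = X#Y 𝕂b 𝕂c f

      P-terms : ∀ {a b c k} → 𝕂 a → 𝕂 b → 𝕂 c → P k (a * Z + b * X + c * Y) →
        P k (a * Z) × P k (b * X) × P k (c * Y)
      P-terms 𝕂a 𝕂b 𝕂c p with Apart-P-+ (ZX#Y 𝕂a 𝕂b 𝕂c) p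
      ... | p₁₂ , p₃ with Apart-P-+ (Z#X 𝕂a 𝕂b) p₁₂
      ...   | p₁ , p₂ = p₁ , p₂ , p₃

      -- Three exchanges carry the given basis into Z, X, Y. If at some stage all coefficients at
      -- the old vectors vanished, the new vector would be a combination of those already exchanged;
      -- no such combination has its valuation.
      spans : Spans Z X Y
      spans with generated
      ... | u , v , w , S with first
        where
        first : ∃[ v ] ∃[ w ] Spans Z v w
        first with S Z
        ... | a , b , c , 𝕂a , 𝕂b , 𝕂c , e with a ≈0? | b ≈0? | c ≈0?
        ...   | no a≉0 | _ | _ = v , w , exchange S 𝕂a 𝕂b 𝕂c e a≉0
        ...   | yes _ | no b≉0 | _ = u , w , exchange (swap S) 𝕂b 𝕂a 𝕂c (trans e (+-congʳ (+-comm _ _))) b≉0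
        ...   | yes _ | yes _ | no c≉0 = v , u , exchange (rotate (swap (rotate S))) 𝕂c 𝕂b 𝕂a
          (trans e (ring! 3 (λ u v w → ⊢ u ⊕ v ⊕ w ≗ w ⊕ v ⊕ u) (_ ∷ _ ∷ _ ∷ []))) c≉0
        ...   | yes a≈0 | yes b≈0 | yes c≈0 = contradiction
          (trans e (ring! 6 (λ u v w a b c → u · a ≗ 𝟘 ⇒ v · b ≗ 𝟘 ⇒ w · c ≗ 𝟘 ⇒
            ⊢ a ⊗ u ⊕ b ⊗ v ⊕ c ⊗ w ≗ 𝟘) (u ∷ v ∷ w ∷ a ∷ b ∷ c ∷ []) a≈0 b≈0 c≈0))
          (Val⇒≉0 Z-val)
      ... | v₁ , w₁ , S₁ with second
        where
        second : ∃[ w ] Spans Z X w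
        second with S₁ X
        ... | a , b , c , 𝕂a , 𝕂b , 𝕂c , e with b ≈0? | c ≈0?
        ...   | no b≉0 | _ = w₁ , swap (exchange (swap S₁) 𝕂b 𝕂a 𝕂c (trans e (+-congʳ (+-comm _ _))) b≉0)
        ...   | yes _ | no c≉0 = v₁ , swap (exchange (swap (rotate S₁)) 𝕂c 𝕂a 𝕂b
          (trans e (ring! 3 (λ u v w → ⊢ u ⊕ v ⊕ w ≗ w ⊕ u ⊕ v) (_ ∷ _ ∷ _ ∷ []))) c≉0)
        ...   | yes b≈0 | yes c≈0 = contradiction (Val-resp (sym (*-identityˡ X)) X-val)
          (Z#X 𝕂a 𝕂-1 (Val-resp
            (trans e (ring! 6 (λ z v w a b c → v · b ≗ 𝟘 ⇒ w · c ≗ 𝟘 ⇒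
              ⊢ a ⊗ z ⊕ b ⊗ v ⊕ c ⊗ w ≗ a ⊗ z) (Z ∷ v₁ ∷ w₁ ∷ a ∷ b ∷ c ∷ []) b≈0 c≈0)) X-val))
      ... | w₂ , S₂ with S₂ Y
      ... | a , b , c , 𝕂a , 𝕂b , 𝕂c , e with c ≈0?
      ...   | no c≉0 = rotate (swap (exchange (swap (rotate S₂)) 𝕂c 𝕂a 𝕂b
          (trans e (ring! 3 (λ u v w → ⊢ u ⊕ v ⊕ w ≗ w ⊕ u ⊕ v) (_ ∷ _ ∷ _ ∷ []))) c≉0))
      ...   | yes c≈0 = contradiction (Val-resp (sym (*-identityˡ Y)) Y-val)
          (ZX#Y 𝕂a 𝕂b 𝕂-1 (Val-resp
            (trans e (trans (+-congˡ (trans (*-congʳ c≈0) (zeroˡ w₂))) (+-identityʳ _))) Y-val))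

      abstract
        coordinates : ∀ u → Coords Z X Y u
        coordinates u with spans u
        ... | a , b , c , 𝕂a , 𝕂b , 𝕂c , e = record
          { 𝕂a = 𝕂a ; 𝕂b = 𝕂b ; 𝕂c = 𝕂c ; expansion = e
          ; terms = λ p → P-terms 𝕂a 𝕂b 𝕂c (P-resp e p) }

    P-coefficient : ∀ {a u k l} j → 𝕂 a → Val u k → P l (a * u) → + 3 ℤ.* j ℤ.- + 2 ℤ.≤ l ℤ.- k → P (+ 3 ℤ.* j) a
    P-coefficient {a} {u} j 𝕂a e p h = 𝕂-round j 𝕂a (P-cancel e (P-resp (*-comm a u) p)) h

-- Normalised lattices and their invariants A and B.

module Lattice where

  open Extension

  -- These are A and B in coordinates: with ρ in {1, 2}, the forms ρ + 3a and -ρ + 3b make 0, A and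
  -- B incongruent modulo 3 by construction, and comparisons inside one class become comparisons of
  -- `a` or of `b`.
  low high : ℤ → ℤ → ℤ
  low  ρ a = ρ ℤ.+ + 3 ℤ.* a
  high ρ b = ℤ.- ρ ℤ.+ + 3 ℤ.* b

  module Lattices {c ℓ} (F E : LocalField c ℓ) (E/F : TotallyRamifiedExtension F E 3) where
    open Ramified F E E/F

    Lat : Carrier → ℤ → Carrier → Set (c ⊔ ℓ)
    Lat X n u = ∃[ r ] ∃[ s ] 𝔬 r × 𝔬 s × P n (u - (r + s * X))

    module _ {X : Carrier} {n : ℤ} where
      Lat-resp : ∀ {u w} → u ≈ w → Lat X n u → Lat X n w
      Lat-resp u≈w (r , s , 𝔬r , 𝔬s , p) = r , s , 𝔬r , 𝔬s , P-resp (+-congʳ u≈w) p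

      Lat-P : ∀ {u} → P n u → Lat X n u
      Lat-P {u} p = 0# , 0# , 𝔬-0 , 𝔬-0 ,
        P-resp (ring! 2 (λ u X → ⊢ u ≗ u ⊖ (𝟘 ⊕ 𝟘 ⊗ X)) (u ∷ X ∷ [])) p

      Lat-𝔬 : ∀ {u} → 𝔬 u → Lat X n u
      Lat-𝔬 {u} 𝔬u = u , 0# , 𝔬u , 𝔬-0 ,
        P-≈0 (ring! 2 (λ u X → ⊢ u ⊖ (u ⊕ 𝟘 ⊗ X) ≗ 𝟘) (u ∷ X ∷ []))

      Lat-X : Lat X n X
      Lat-X = 0# , 1# , 𝔬-0 , 𝔬-1 , P-≈0 (ring! 1 (λ X → ⊢ X ⊖ (𝟘 ⊕ 𝟙 ⊗ X) ≗ 𝟘) (X ∷ []))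

      Lat-+ : ∀ {u w} → Lat X n u → Lat X n w → Lat X n (u + w)
      Lat-+ {u} {w} (r , s , 𝔬r , 𝔬s , p) (r′ , s′ , 𝔬r′ , 𝔬s′ , p′) =
        r + r′ , s + s′ , 𝔬-+ 𝔬r 𝔬r′ , 𝔬-+ 𝔬s 𝔬s′ ,
        P-resp (ring! 7 (λ u w r s r′ s′ X →
          ⊢ (u ⊖ (r ⊕ s ⊗ X)) ⊕ (w ⊖ (r′ ⊕ s′ ⊗ X)) ≗ u ⊕ w ⊖ (r ⊕ r′ ⊕ (s ⊕ s′) ⊗ X))
          (u ∷ w ∷ r ∷ s ∷ r′ ∷ s′ ∷ X ∷ [])) (P-+ p p′)

      Lat-𝔬* : ∀ {t u} → 𝔬 t → Lat X n u → Lat X n (t * u)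
      Lat-𝔬* {t} {u} 𝔬t (r , s , 𝔬r , 𝔬s , p) =
        t * r , t * s , 𝔬-* 𝔬t 𝔬r , 𝔬-* 𝔬t 𝔬s ,
        P-resp (ring! 5 (λ t u r s X → ⊢ t ⊗ (u ⊖ (r ⊕ s ⊗ X)) ≗ t ⊗ u ⊖ (t ⊗ r ⊕ t ⊗ s ⊗ X))
          (t ∷ u ∷ r ∷ s ∷ X ∷ [])) (P-0* (proj₂ 𝔬t) p)

      Lat-neg : ∀ {u} → Lat X n u → Lat X n (- u)
      Lat-neg {u} p = Lat-resp (ring! 1 (λ u → ⊢ ⊝ 𝟙 ⊗ u ≗ ⊝ u) (u ∷ [])) (Lat-𝔬* (𝔬-neg 𝔬-1) p)

      Lat-- : ∀ {u w} → Lat X n u → Lat X n w → Lat X n (u - w)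
      Lat-- p q = Lat-+ p (Lat-neg q)

    -- Multiplication by `u` is 𝔬-linear, so 1 and X are the generators to test; the tail { v ≥ n }
    -- is carried into { v ≥ n′ } because `u` is integral.
    Lat-elim : ∀ {X n X′ n′ u} → P 0ℤ u → n′ ℤ.≤ n → Lat X′ n′ u → Lat X′ n′ (u * X) →
      ∀ {w} → Lat X n w → Lat X′ n′ (u * w)
    Lat-elim {X} {u = u} P0u n′≤n u∈ uX∈ {w} (r , s , 𝔬r , 𝔬s , p) = Lat-resp
      (ring! 5 (λ u w r s X → ⊢ r ⊗ u ⊕ s ⊗ (u ⊗ X) ⊕ u ⊗ (w ⊖ (r ⊕ s ⊗ X)) ≗ u ⊗ w)
        (u ∷ w ∷ r ∷ s ∷ X ∷ []))
      (Lat-+ (Lat-+ (Lat-𝔬* 𝔬r u∈) (Lat-𝔬* 𝔬s uX∈)) (Lat-P (P-mono n′≤n (P-0* P0u p))))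

    -- The lattices 𝔬 + 𝔬X + {v ≥ B} with v X = A < B, where 0, A and B are
    -- incongruent modulo 3.
    record Frame (X : Carrier) (ρ a b : ℤ) : Set where
      field
        X-val : Val X (low ρ a)
        1≤ρ   : 1ℤ ℤ.≤ ρ
        ρ≤2   : ρ ℤ.≤ + 2
        1≤A   : 1ℤ ℤ.≤ low ρ a
        A<B   : low ρ a ℤ.+ 1ℤ ℤ.≤ high ρ b

    module FrameProperties {X ρ a b} (f : Frame X ρ a b) where
      open Frame f
      private
        A B : ℤ
        A = low ρ a
        B = high ρ b

        Y : Carrier
        Y = proj₁ (element B)

        Y-val : Val Y B
        Y-val = proj₂ (element B)

      basis : Triple 0ℤ ρ (ℤ.- ρ)
      basis = triple {z = 0ℤ} {a} {b} Val-1 X-val Y-val 1≤ρ ρ≤2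

      P0-X : P 0ℤ X
      P0-X = Val⇒P≤ X-val (lia 1 (λ A → # 1 ≼ A ⇒ ⊩ # 0 ≼ A) A 1≤A)

      Lat⇒P0 : ∀ {u} → Lat X B u → P 0ℤ u
      Lat⇒P0 {u} (r , s , 𝔬r , 𝔬s , p) = P-resp
        (ring! 4 (λ u r s X → ⊢ (r ⊕ s ⊗ X) ⊕ (u ⊖ (r ⊕ s ⊗ X)) ≗ u) (u ∷ r ∷ s ∷ X ∷ []))
        (P-+ (P-+ (proj₂ 𝔬r) (P-0* (proj₂ 𝔬s) P0-X))
             (P-mono (lia 2 (λ A B → # 1 ≼ A ⇒ A ⊞ # 1 ≼ B ⇒ ⊩ # 0 ≼ B) A B 1≤A A<B) p))

      -- Expand in 1, X and a vector of valuation B. Relative to vectors of valuation at most B, an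
      -- element of valuation at least B - 2 has coefficients of valuation at least -2, which round
      -- up to 0. This is where the conductor exponent B - 2 comes from.
      P-2⇒Lat : ∀ {u} → P (B ℤ.- + 2) u → Lat X B u
      P-2⇒Lat {u} p = a′ , b′ ,
        (𝕂a , 𝕂-round 0ℤ 𝕂a (P-resp (*-identityʳ a′) (proj₁ (terms p)))
          (lia 2 (λ A B → # 1 ≼ A ⇒ A ⊞ # 1 ≼ B ⇒ ⊩ + 3 ⊛ # 0 ⊟ # 2 ≼ B ⊟ # 2) A B 1≤A A<B)) ,
        (𝕂b , P-coefficient 0ℤ 𝕂b X-val (proj₁ (proj₂ (terms p)))
          (lia 2 (λ A B → A ⊞ # 1 ≼ B ⇒ ⊩ + 3 ⊛ # 0 ⊟ # 2 ≼ B ⊟ # 2 ⊟ A) A B A<B)) ,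
        P-resp (ring! 6 (λ u a b c X Y → ⊝ 𝟙 · u ≗ a ⊗ 𝟙 ⊕ b ⊗ X ⊕ c ⊗ Y ⇒
            ⊢ c ⊗ Y ≗ u ⊖ (a ⊕ b ⊗ X)) (u ∷ a′ ∷ b′ ∷ c′ ∷ X ∷ Y ∷ []) expansion)
          (≡.subst (λ n → P n (c′ * Y)) (ℤₚ.+-identityˡ B) (P-* c-integral (Val⇒P Y-val)))
        where
        open Coords (Coordinates.coordinates basis u) renaming (a to a′; b to b′)
        c-integral : P 0ℤ c′
        c-integral = P-coefficient 0ℤ 𝕂c Y-val (proj₂ (proj₂ (terms p)))
          (lia 1 (λ B → ⊩ + 3 ⊛ # 0 ⊟ # 2 ≼ B ⊟ # 2 ⊟ B) B)

      private
        head-val : ∀ {u k} → (l : Lat X B u) → Val u k → k ℤ.+ 1ℤ ℤ.≤ B →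
          Val (proj₁ l * 1#) k ⊎ Val (proj₁ (proj₂ l) * X) k
        head-val {u} (r , s , 𝔬r , 𝔬s , p) e k<B =
          Apart-Val-+ (Coordinates.Z#X basis (proj₁ 𝔬r) (proj₁ 𝔬s)) (Val-resp
            (ring! 4 (λ u r s X → ⊢ u ⊕ ⊝ (u ⊖ (r ⊕ s ⊗ X)) ≗ r ⊗ 𝟙 ⊕ s ⊗ X) (u ∷ r ∷ s ∷ X ∷ []))
            (Val-+ e (P-neg (P-mono k<B p))))

      -- Below B the leading term of `u` is that of r or of sX. The former has valuation divisible
      -- by 3, so in the class of A only sX is left, and s is integral.
      low-bound : ∀ {u m} → Lat X B u → Val u (low ρ m) → a ℤ.≤ m
      low-bound {u} {m} l@(r , s , 𝔬r , 𝔬s , p) e with low ρ m ℤ.+ 1ℤ ℤₚ.≤? B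
      ... | no m≮B = lia 4 (λ ρ a b m → ρ ⊞ + 3 ⊛ a ⊞ # 1 ≼ b ⇒ b ⊞ # 1 ≼ ρ ⊞ + 3 ⊛ m ⊞ # 1 ⇒ ⊩ a ≼ m)
        ρ a B m A<B (<⇒+1≤ (ℤₚ.≰⇒> m≮B))
      ... | yes m<B with head-val l e m<B
      ...   | inj₂ f = lia 3 (λ ρ a m → # 0 ⊞ (ρ ⊞ + 3 ⊛ a) ≼ ρ ⊞ + 3 ⊛ m ⇒ ⊩ a ≼ m)
        ρ a m (P-Val (P-* (proj₂ 𝔬s) (Val⇒P X-val)) f)
      ...   | inj₁ f with 𝕂-Val (proj₁ 𝔬r) (Val-resp (*-identityʳ r) f)
      ...     | j , eq = contradiction (lia 3 (λ ρ m j → ρ ⊞ + 3 ⊛ m ≛ + 3 ⊛ j ⇒ # 1 ≼ ρ ⇒ ρ ≼ # 2 ⇒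
        ⊩ # 1 ≼ # 0) ρ m j eq 1≤ρ ρ≤2) 1≰0

      -- Neither r nor sX can have a valuation in the class of B, so the leading term must come from
      -- { v ≥ B }.
      high-bound : ∀ {u m} → Lat X B u → Val u (high ρ m) → b ℤ.≤ m
      high-bound {u} {m} l@(r , s , 𝔬r , 𝔬s , p) e with high ρ m ℤ.+ 1ℤ ℤₚ.≤? B
      ... | no m≮B = lia 3 (λ ρ b m → neg ρ ⊞ + 3 ⊛ b ⊞ # 1 ≼ neg ρ ⊞ + 3 ⊛ m ⊞ # 1 ⇒ ⊩ b ≼ m)
        ρ b m (<⇒+1≤ (ℤₚ.≰⇒> m≮B))
      ... | yes m<B with head-val l e m<B
      ...   | inj₂ f = contradiction f (λ f → Coordinates.X#Y basis (proj₁ 𝔬s) 𝕂u f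
                (Val-resp (ring! 2 (λ a b → ⊢ a ⊗ b ≗ b ⊗ a) (Y ∷ u′ ∷ []))
                  (≡.subst (Val (Y * u′)) (lia 3 (λ ρ b m → ⊩ neg ρ ⊞ + 3 ⊛ b ⊞ + 3 ⊛ (m ⊟ b) ≛ neg ρ ⊞ + 3 ⊛ m) ρ b m)
                    (Val-* Y-val u′-val))))
        where
        u′ : Carrier
        u′ = proj₁ (𝕂-element (m ℤ.- b))
        𝕂u : 𝕂 u′
        𝕂u = proj₁ (proj₂ (𝕂-element (m ℤ.- b)))
        u′-val : Val u′ (+ 3 ℤ.* (m ℤ.- b))
        u′-val = proj₂ (proj₂ (𝕂-element (m ℤ.- b)))
      ...   | inj₁ f with 𝕂-Val (proj₁ 𝔬r) (Val-resp (*-identityʳ r) f)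
      ...     | j , eq = contradiction (lia 3 (λ ρ m j → neg ρ ⊞ + 3 ⊛ m ≛ + 3 ⊛ j ⇒ # 1 ≼ ρ ⇒ ρ ≼ # 2 ⇒
        ⊩ # 1 ≼ # 0) ρ m j eq 1≤ρ ρ≤2) 1≰0

    -- u · Lat X n = Lat X′ n′.
    record Homothety (u : Carrier) (X : Carrier) (n : ℤ) (X′ : Carrier) (n′ : ℤ) : Set (c ⊔ ℓ) where
      field
        nonzero : ¬ u ≈ 0#
        to      : ∀ {w} → Lat X n w → Lat X′ n′ (u * w)
        from    : ∀ {w} → Lat X′ n′ (u * w) → Lat X n w

    Homothety-sym : ∀ {u X n X′ n′} → Homothety u X n X′ n′ → ∃[ u′ ] Homothety u′ X′ n′ X n
    Homothety-sym {u} h with Val-inverse (proj₂ (≉0⇒Val nonzero))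
      where open Homothety h
    ... | u′ , uu′≈1 , e = u′ , record
      { nonzero = Val⇒≉0 e
      ; to      = λ {w} l → from (Lat-resp (sym (cancel w)) l)
      ; from    = λ {w} l → Lat-resp (cancel w) (to l)
      }
      where
      open Homothety h
      cancel : ∀ w → u * (u′ * w) ≈ w
      cancel w = ring! 3 (λ u v w → w · u ⊗ v ≗ 𝟙 ⇒ ⊢ u ⊗ (v ⊗ w) ≗ w) (u ∷ u′ ∷ w ∷ []) uu′≈1

-- Homothety of normalised lattices.

module Similarity where

  open Extension
  open Lattice

  module Homotheties {c ℓ} (F E : LocalField c ℓ) (E/F : TotallyRamifiedExtension F E 3) where
    open Ramified F E E/F
    open Lattices F E E/F

    congruent⇒homothety : ∀ {X X′ n} → P n (X′ - X) → Homothety 1# X n X′ n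
    congruent⇒homothety {X} {X′} {n} p = record
      { nonzero = Val⇒≉0 Val-1
      ; to      = Lat-elim P-1 ℤₚ.≤-refl (Lat-𝔬 𝔬-1) (Lat-resp
          (ring! 2 (λ X X′ → ⊢ X′ ⊖ (X′ ⊖ X) ≗ 𝟙 ⊗ X) (X ∷ X′ ∷ [])) (Lat-- Lat-X (Lat-P p)))
      ; from    = λ {w} l → Lat-resp
          (ring! 1 (λ w → ⊢ 𝟙 ⊗ (𝟙 ⊗ w) ≗ w) (w ∷ []))
          (Lat-elim P-1 ℤₚ.≤-refl (Lat-𝔬 𝔬-1) (Lat-resp
            (ring! 2 (λ X X′ → ⊢ X ⊕ (X′ ⊖ X) ≗ 𝟙 ⊗ X′) (X ∷ X′ ∷ [])) (Lat-+ Lat-X (Lat-P p))) l)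
      }

    -- If v(X′ - X) ≥ 2A, write X′ - X = r + tX′ + sXX′ with integral coefficients.
    -- Then u = 1 + sX′ satisfies uX = X′ - r - tX′, and the matrix which expresses
    -- u and uX by 1 and X′ has unit determinant 1 - t + sr.
    close⇒homothety : ∀ {X X′ ρ a b} → Frame X ρ a b → Frame X′ ρ a b →
      P (low ρ a ℤ.+ low ρ a) (X′ - X) →
      ∃[ u ] Homothety u X (high ρ b) X′ (high ρ b)
    close⇒homothety {X} {X′} {ρ} {a} {b} f f′ p = u , record
      { nonzero = Val⇒≉0 u-val
      ; to      = Lat-elim P0-u ℤₚ.≤-refl u∈ uX∈
      ; from    = λ {w} l → Lat-resp (cancel w) (Lat-elim P0-u⁻¹ ℤₚ.≤-refl u⁻¹∈ u⁻¹X′∈ l)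
      }
      where
      module f = Frame f
      module f′ = Frame f′
      A : ℤ
      A = low ρ a

      -- The vectors 1, X′ and XX′ have valuations 0, A and 2A ≡ -A, hence distinct classes. Since
      -- v(X′ - X) ≥ 2A, all three coefficients r, t, s of the difference are integral.
      basis : Triple 0ℤ ρ (ℤ.- ρ)
      basis = triple {z = 0ℤ} {a} {+ 2 ℤ.* a ℤ.+ ρ} Val-1 f′.X-val
        (≡.subst (Val (X * X′))
          (lia 2 (λ ρ a → ⊩ ρ ⊞ + 3 ⊛ a ⊞ (ρ ⊞ + 3 ⊛ a) ≛ neg ρ ⊞ + 3 ⊛ (+ 2 ⊛ a ⊞ ρ)) ρ a)
          (Val-* f.X-val f′.X-val)) f.1≤ρ f.ρ≤2

      open Coords (Coordinates.coordinates basis (X′ - X))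
        renaming (a to r; b to t; c′ to s; 𝕂a to 𝕂r; 𝕂b to 𝕂t; 𝕂c to 𝕂s)

      P1-r : P 1ℤ r
      P1-r = P-mono (lia 1 (λ A → # 1 ≼ A ⇒ ⊩ # 1 ≼ A ⊞ A) A f.1≤A)
        (P-resp (*-identityʳ r) (proj₁ (terms p)))

      P1-t : P 1ℤ t
      P1-t = P-mono (lia 1 (λ A → # 1 ≼ A ⇒ ⊩ # 1 ≼ A ⊞ A ⊟ A) A f.1≤A)
        (P-cancel f′.X-val (P-resp (*-comm t X′) (proj₁ (proj₂ (terms p)))))

      P0-s : P 0ℤ s
      P0-s = P-mono (lia 1 (λ A → ⊩ # 0 ≼ A ⊞ A ⊟ (A ⊞ A)) A)
        (P-cancel (Val-* f.X-val f′.X-val) (P-resp (*-comm s (X * X′)) (proj₂ (proj₂ (terms p)))))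

      0≤1 : 0ℤ ℤ.≤ 1ℤ
      0≤1 = lia 0 (⊩ # 0 ≼ # 1)

      𝔬r : 𝔬 r
      𝔬r = 𝕂r , P-mono 0≤1 P1-r

      𝔬t : 𝔬 t
      𝔬t = 𝕂t , P-mono 0≤1 P1-t

      𝔬s : 𝔬 s
      𝔬s = 𝕂s , P0-s

      u d : Carrier
      u = 1# + s * X′
      d = 1# + (s * r - t)

      u-val : Val u 0ℤ
      u-val = Val-+ Val-1 (P-0* P0-s (Val⇒P≤ f′.X-val f.1≤A))

      d-val : Val d 0ℤ
      d-val = Val-+ Val-1 (P-- (P-0* P0-s P1-r) P1-t)

      P0-u : P 0ℤ u
      P0-u = Val⇒P u-val

      u∈ : Lat X′ (high ρ b) u
      u∈ = Lat-+ (Lat-𝔬 𝔬-1) (Lat-𝔬* 𝔬s Lat-X)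

      uX∈ : Lat X′ (high ρ b) (u * X)
      uX∈ = Lat-resp
        (ring! 5 (λ X X′ r s t → 𝟙 · X′ ⊖ X ≗ r ⊗ 𝟙 ⊕ t ⊗ X′ ⊕ s ⊗ (X ⊗ X′) ⇒
          ⊢ X′ ⊖ (r ⊕ t ⊗ X′) ≗ (𝟙 ⊕ s ⊗ X′) ⊗ X) (X ∷ X′ ∷ r ∷ s ∷ t ∷ []) expansion)
        (Lat-- Lat-X (Lat-+ (Lat-𝔬 𝔬r) (Lat-𝔬* 𝔬t Lat-X)))

      u⁻¹ : ∃[ u′ ] u * u′ ≈ 1# × Val u′ 0ℤ
      u⁻¹ = Val-inverse u-val

      P0-u⁻¹ : P 0ℤ (proj₁ u⁻¹)
      P0-u⁻¹ = Val⇒P (proj₂ (proj₂ u⁻¹))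

      cancel : ∀ w → proj₁ u⁻¹ * (u * w) ≈ w
      cancel w = ring! 3 (λ u v w → w · u ⊗ v ≗ 𝟙 ⇒ ⊢ v ⊗ (u ⊗ w) ≗ w) (u ∷ proj₁ u⁻¹ ∷ w ∷ []) (proj₁ (proj₂ u⁻¹))

      d⁻¹ : ∃[ e ] 𝔬 e × d * e ≈ 1#
      d⁻¹ = 𝔬-inverse (𝔬-+ 𝔬-1 (𝔬-- (𝔬-* 𝔬s 𝔬r) 𝔬t)) d-val

      -- The relation for X′ - X gives (1 - t - sX)u = d and (r + X)u = dX′, with d a unit of 𝔬.
      -- Dividing by d and by u expresses u⁻¹ and u⁻¹X′ by 1 and X.
      u⁻¹∈ : Lat X (high ρ b) (proj₁ u⁻¹)
      u⁻¹∈ = Lat-resp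
        (ring! 7 (λ X X′ r s t v e →
          (e ⊗ v ⊗ s) · X′ ⊖ X ≗ r ⊗ 𝟙 ⊕ t ⊗ X′ ⊕ s ⊗ (X ⊗ X′) ⇒
          (⊝ (e ⊗ (𝟙 ⊖ t ⊖ s ⊗ X))) · (𝟙 ⊕ s ⊗ X′) ⊗ v ≗ 𝟙 ⇒
          v · (𝟙 ⊕ (s ⊗ r ⊖ t)) ⊗ e ≗ 𝟙 ⇒
          ⊢ e ⊗ (𝟙 ⊖ t ⊖ s ⊗ X) ≗ v)
          (X ∷ X′ ∷ r ∷ s ∷ t ∷ proj₁ u⁻¹ ∷ proj₁ d⁻¹ ∷ []) expansion (proj₁ (proj₂ u⁻¹)) (proj₂ (proj₂ d⁻¹)))
        (Lat-𝔬* (proj₁ (proj₂ d⁻¹)) (Lat-- (Lat-- (Lat-𝔬 𝔬-1) (Lat-𝔬 𝔬t)) (Lat-𝔬* 𝔬s Lat-X)))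

      u⁻¹X′∈ : Lat X (high ρ b) (proj₁ u⁻¹ * X′)
      u⁻¹X′∈ = Lat-resp
        (ring! 7 (λ X X′ r s t v e →
          (⊝ (e ⊗ v)) · X′ ⊖ X ≗ r ⊗ 𝟙 ⊕ t ⊗ X′ ⊕ s ⊗ (X ⊗ X′) ⇒
          (⊝ (e ⊗ (r ⊕ X))) · (𝟙 ⊕ s ⊗ X′) ⊗ v ≗ 𝟙 ⇒
          (v ⊗ X′) · (𝟙 ⊕ (s ⊗ r ⊖ t)) ⊗ e ≗ 𝟙 ⇒
          ⊢ e ⊗ (r ⊕ X) ≗ v ⊗ X′)
          (X ∷ X′ ∷ r ∷ s ∷ t ∷ proj₁ u⁻¹ ∷ proj₁ d⁻¹ ∷ []) expansion (proj₁ (proj₂ u⁻¹)) (proj₂ (proj₂ d⁻¹)))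
        (Lat-𝔬* (proj₁ (proj₂ d⁻¹)) (Lat-+ (Lat-𝔬 𝔬r) Lat-X))

    -- Both lattices contain 1 and consist of integral elements, so u and u⁻¹ are integral.
    Homothety-val : ∀ {u X ρ a b X′ ρ′ a′ b′} → Frame X ρ a b → Frame X′ ρ′ a′ b′ →
      Homothety u X (high ρ b) X′ (high ρ′ b′) → Val u 0ℤ
    Homothety-val {u} {X} {ρ} {a} {b} {X′} {ρ′} {a′} {b′} f f′ h =
      ≡.subst (Val u) (ℤₚ.≤-antisym k≤0 (P-Val P0-u e)) e
      where
      open Homothety h
      k : ℤ
      k = proj₁ (≉0⇒Val nonzero)
      e : Val u k
      e = proj₂ (≉0⇒Val nonzero)
      P0-u : P 0ℤ u
      P0-u = FrameProperties.Lat⇒P0 f′ (Lat-resp (*-identityʳ u) (to (Lat-𝔬 𝔬-1)))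
      inv : ∃[ u′ ] u * u′ ≈ 1# × Val u′ (ℤ.- k)
      inv = Val-inverse e
      k≤0 : k ℤ.≤ 0ℤ
      k≤0 = lia 1 (λ k → # 0 ≼ neg k ⇒ ⊩ k ≼ # 0) k
        (P-Val (FrameProperties.Lat⇒P0 f (from (Lat-resp (sym (proj₁ (proj₂ inv))) (Lat-𝔬 𝔬-1)))) (proj₂ (proj₂ inv)))

    -- In the class of A this is `low-bound`; in the remaining nonzero class every valuation is at
    -- least B > A. Thus A is the least valuation not divisible by 3, a description that does not
    -- presuppose ρ and therefore recovers ρ and a together.
    low-least : ∀ {X ρ a b u ρ′ m} → Frame X ρ a b → Lat X (high ρ b) u →
      Val u (low ρ′ m) → 1ℤ ℤ.≤ ρ′ → ρ′ ℤ.≤ + 2 → low ρ a ℤ.≤ low ρ′ m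
    low-least {X} {ρ} {a} {b} {u} {ρ′} {m} f l e 1≤ρ′ ρ′≤2 with ρ ℤₚ.≟ ρ′
    ... | yes ≡.refl = lia 3 (λ ρ a m → a ≼ m ⇒ ⊩ ρ ⊞ + 3 ⊛ a ≼ ρ ⊞ + 3 ⊛ m) ρ a m
      (FrameProperties.low-bound f l e)
    ... | no ρ≢ρ′ = lia 5 (λ ρ ρ′ a b m → ρ ⊞ + 3 ⊛ a ⊞ # 1 ≼ neg ρ ⊞ + 3 ⊛ b ⇒ b ≼ m ⊞ # 1 ⇒ ρ′ ≛ # 3 ⊟ ρ ⇒
        ⊩ ρ ⊞ + 3 ⊛ a ≼ ρ′ ⊞ + 3 ⊛ m) ρ ρ′ a b m A<B
      (FrameProperties.high-bound f {m = m ℤ.+ 1ℤ} l (≡.subst (Val u)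
        (lia 3 (λ ρ ρ′ m → ρ′ ≛ # 3 ⊟ ρ ⇒ ⊩ ρ′ ⊞ + 3 ⊛ m ≛ neg ρ ⊞ + 3 ⊛ (m ⊞ # 1)) ρ ρ′ m other) e)) other
      where
      open Frame f
      other : ρ′ ≡ + 3 ℤ.- ρ
      other with ℤₚ.<-cmp ρ ρ′
      ... | tri< ρ<ρ′ _ _ = lia 2 (λ ρ ρ′ → ρ ⊞ # 1 ≼ ρ′ ⇒ # 1 ≼ ρ ⇒ ρ′ ≼ # 2 ⇒ ⊩ ρ′ ≛ # 3 ⊟ ρ) ρ ρ′ (<⇒+1≤ ρ<ρ′) 1≤ρ ρ′≤2
      ... | tri≈ _ ρ≡ρ′ _ = contradiction ρ≡ρ′ ρ≢ρ′
      ... | tri> _ _ ρ′<ρ = lia 2 (λ ρ ρ′ → ρ′ ⊞ # 1 ≼ ρ ⇒ # 1 ≼ ρ′ ⇒ ρ ≼ # 2 ⇒ ⊩ ρ′ ≛ # 3 ⊟ ρ) ρ ρ′ (<⇒+1≤ ρ′<ρ) 1≤ρ′ ρ≤2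

    private
      Val-unit* : ∀ {u x k} → Val u 0ℤ → Val x k → Val (u * x) k
      Val-unit* {k = k} e f = ≡.subst (Val _) (ℤₚ.+-identityˡ k) (Val-* e f)

      low≤ : ∀ {u X ρ a b X′ ρ′ a′ b′} → Frame X ρ a b → Frame X′ ρ′ a′ b′ →
        Homothety u X (high ρ b) X′ (high ρ′ b′) → low ρ′ a′ ℤ.≤ low ρ a
      low≤ {ρ = ρ} {a} f f′ h = low-least {ρ′ = ρ} {a} f′ (to Lat-X)
        (Val-unit* (Homothety-val f f′ h) X-val) 1≤ρ ρ≤2
        where
        open Homothety h
        open Frame f

    Homothety-low : ∀ {u X ρ a b X′ ρ′ a′ b′} → Frame X ρ a b → Frame X′ ρ′ a′ b′ →
      Homothety u X (high ρ b) X′ (high ρ′ b′) → ρ ≡ ρ′ × a ≡ a′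
    Homothety-low {u} {X} {ρ} {a} {b} {X′} {ρ′} {a′} {b′} f f′ h =
      lia 5 (λ ρ ρ′ a a′ i → i ≛ a ⊟ a′ ⇒ ρ ⊞ + 3 ⊛ a ≛ ρ′ ⊞ + 3 ⊛ a′ ⇒
        # 1 ≼ ρ ⇒ # 1 ≼ ρ′ ⇒ ρ ≼ # 2 ⇒ ρ′ ≼ # 2 ⇒ ⊩ ρ ≛ ρ′) ρ ρ′ a a′ (a ℤ.- a′) ≡.refl eq f.1≤ρ f′.1≤ρ f.ρ≤2 f′.ρ≤2
      , lia 5 (λ ρ ρ′ a a′ i → i ≛ a ⊟ a′ ⇒ ρ ⊞ + 3 ⊛ a ≛ ρ′ ⊞ + 3 ⊛ a′ ⇒
        # 1 ≼ ρ ⇒ # 1 ≼ ρ′ ⇒ ρ ≼ # 2 ⇒ ρ′ ≼ # 2 ⇒ ⊩ a ≛ a′) ρ ρ′ a a′ (a ℤ.- a′) ≡.refl eq f.1≤ρ f′.1≤ρ f.ρ≤2 f′.ρ≤2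
      where
      module f = Frame f
      module f′ = Frame f′
      eq : low ρ a ≡ low ρ′ a′
      eq = ℤₚ.≤-antisym (low≤ f′ f (proj₂ (Homothety-sym h))) (low≤ f f′ h)

    private
      high≤ : ∀ {u X ρ a b X′ a′ b′} → Frame X ρ a b → Frame X′ ρ a′ b′ →
        Homothety u X (high ρ b) X′ (high ρ b′) → b′ ℤ.≤ b
      high≤ {ρ = ρ} {b = b} f f′ h with element (high ρ b)
      ... | Y , Y-val = FrameProperties.high-bound f′ {m = b} (to (Lat-P (Val⇒P Y-val)))
        (Val-unit* (Homothety-val f f′ h) Y-val)
        where open Homothety h

    Homothety-high : ∀ {u X ρ a b X′ a′ b′} → Frame X ρ a b → Frame X′ ρ a′ b′ →
      Homothety u X (high ρ b) X′ (high ρ b′) → b ≡ b′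
    Homothety-high f f′ h = ℤₚ.≤-antisym (high≤ f′ f (proj₂ (Homothety-sym h))) (high≤ f f′ h)

    -- Modulo { v ≥ B }, write u = r + sX′ and uX = t + s′X′. Multiplying the first by X and
    -- comparing leaves the error sXX′, of valuation at least 2A, so rX and s′X′ + t agree modulo
    -- min(B, 2A). The coefficient r is a unit because u is one and v(X′) ≥ 1.
    Homothety-close : ∀ {u X ρ a b X′} → Frame X ρ a b → Frame X′ ρ a b →
      Homothety u X (high ρ b) X′ (high ρ b) →
      ∃[ r ] ∃[ s ] ∃[ t ] 𝔬 r × 𝔬 s × 𝔬 t × Val r 0ℤ ×
      (∀ {k} → k ℤ.≤ high ρ b → k ℤ.≤ low ρ a ℤ.+ low ρ a → P k (r * X - s * X′ - t))
    Homothety-close {u} {X} {ρ} {a} {b} {X′} f f′ h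
      with Lat-resp (*-identityʳ u) (Homothety.to h (Lat-𝔬 𝔬-1)) | Homothety.to h Lat-X
    ... | r , s , 𝔬r , 𝔬s , p | t , s′ , 𝔬t , 𝔬s′ , p′ = r , s′ , t , 𝔬r , 𝔬s′ , 𝔬t
      , Val-resp (ring! 4 (λ u r s X′ → ⊢ u ⊕ ⊝ (s ⊗ X′ ⊕ (u ⊖ (r ⊕ s ⊗ X′))) ≗ r) (u ∷ r ∷ s ∷ X′ ∷ []))
          (Val-+ (Homothety-val f f′ h) (P-neg (P-+ (P-0* (proj₂ 𝔬s) (Val⇒P≤ f′.X-val f.1≤A))
            (P-mono (lia 2 (λ A B → # 1 ≼ A ⇒ A ⊞ # 1 ≼ B ⇒ ⊩ # 1 ≼ B) (low ρ a) (high ρ b) f.1≤A f.A<B) p))))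
      , λ k≤B k≤2A → P-resp
          (ring! 7 (λ u r s t s′ X X′ →
            ⊢ (u ⊗ X ⊖ (t ⊕ s′ ⊗ X′)) ⊖ X ⊗ (u ⊖ (r ⊕ s ⊗ X′)) ⊖ s ⊗ (X ⊗ X′) ≗ r ⊗ X ⊖ s′ ⊗ X′ ⊖ t)
            (u ∷ r ∷ s ∷ t ∷ s′ ∷ X ∷ X′ ∷ []))
          (P-- (P-- (P-mono k≤B p′) (P-0* (FrameProperties.P0-X f) (P-mono k≤B p)))
               (P-0* (proj₂ 𝔬s) (P-mono k≤2A (P-* (Val⇒P f.X-val) (Val⇒P f′.X-val)))))
      where
      module f = Frame f
      module f′ = Frame f′

-- Reduction of generating systems to bases with distinct residues.

module Reduction where

  open import Algebra.Definitions.RawMonoid using (sum)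
  open import Data.Fin.Base using (Fin; zero; suc)
  open import Data.Nat.Base as ℕ using (ℕ; zero; suc)
  open Extension
  open Lattice

  module Reductions {c ℓ} (F E : LocalField c ℓ) (E/F : TotallyRamifiedExtension F E 3) where
    open Ramified F E E/F
    open Lattices F E E/F

    sum-closed : ∀ {p} (S : Carrier → Set p) → S 0# → (∀ {x y} → S x → S y → S (x + y)) →
      ∀ {n} (f : Fin n → Carrier) → (∀ i → S (f i)) → S (sum +-rawMonoid f)
    sum-closed S S0 S+ {zero}  f h = S0
    sum-closed S S0 S+ {suc n} f h = S+ (h zero) (sum-closed S S0 S+ (λ i → f (suc i)) (λ i → h (suc i)))

    least : ∀ {n} (g : Fin n → Carrier) →
      (∀ i → g i ≈ 0#) ⊎ ∃[ j ] ∃[ k ] Val (g j) k × (∀ i → P k (g i))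
    least {zero}  g = inj₁ λ ()
    least {suc n} g with zero-or-Val (g zero) | least (λ i → g (suc i))
    ... | inj₁ 0≈0 | inj₁ all = inj₁ λ { zero → 0≈0 ; (suc i) → all i }
    ... | inj₁ 0≈0 | inj₂ (j , k , e , p) = inj₂ (suc j , k , e , λ { zero → P-≈0 0≈0 ; (suc i) → p i })
    ... | inj₂ (k , e) | inj₁ all = inj₂ (zero , k , e , λ { zero → Val⇒P e ; (suc i) → P-≈0 (all i) })
    ... | inj₂ (k , e) | inj₂ (j , l , f , p) with ℤₚ.≤-total k l
    ...   | inj₁ k≤l = inj₂ (zero , k , e , λ { zero → Val⇒P e ; (suc i) → P-mono k≤l (p i) })
    ...   | inj₂ l≤k = inj₂ (suc j , l , f , λ { zero → Val⇒P≤ e l≤k ; (suc i) → p i })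

    record IsModule {p} (M : Carrier → Set p) : Set (c ⊔ ℓ ⊔ p) where
      field
        M-resp : ∀ {u w} → u ≈ w → M u → M w
        M-+    : ∀ {u w} → M u → M w → M (u + w)
        M-𝔬*   : ∀ {t u} → 𝔬 t → M u → M (t * u)

      M-- : ∀ {u w} → M u → M w → M (u - w)
      M-- {u} {w} p q = M-resp (ring! 2 (λ u w → ⊢ u ⊕ ⊝ 𝟙 ⊗ w ≗ u ⊖ w) (u ∷ w ∷ [])) (M-+ p (M-𝔬* (𝔬-neg 𝔬-1) q))

    record InSpan (Z X Y u : Carrier) : Set (c ⊔ ℓ) where
      constructor inSpan
      field
        {r s t} : Carrier
        𝔬r      : 𝔬 r
        𝔬s      : 𝔬 s
        𝔬t      : 𝔬 t
        equal   : u ≈ r * Z + s * X + t * Y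

    span-isModule : ∀ Z X Y → IsModule (InSpan Z X Y)
    span-isModule Z X Y = record
      { M-resp = λ u≈w (inSpan p q r e) → inSpan p q r (trans (sym u≈w) e)
      ; M-+    = λ { {u} {w} (inSpan {r} {s} {t} 𝔬r 𝔬s 𝔬t e) (inSpan {r′} {s′} {t′} 𝔬r′ 𝔬s′ 𝔬t′ e′) →
          inSpan (𝔬-+ 𝔬r 𝔬r′) (𝔬-+ 𝔬s 𝔬s′) (𝔬-+ 𝔬t 𝔬t′) (trans (+-cong e e′)
            (ring! 9 (λ Z X Y r s t r′ s′ t′ → ⊢ (r ⊗ Z ⊕ s ⊗ X ⊕ t ⊗ Y) ⊕ (r′ ⊗ Z ⊕ s′ ⊗ X ⊕ t′ ⊗ Y) ≗
              (r ⊕ r′) ⊗ Z ⊕ (s ⊕ s′) ⊗ X ⊕ (t ⊕ t′) ⊗ Y) (Z ∷ X ∷ Y ∷ r ∷ s ∷ t ∷ r′ ∷ s′ ∷ t′ ∷ []))) }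
      ; M-𝔬*   = λ { {q} 𝔬q (inSpan {r} {s} {t} 𝔬r 𝔬s 𝔬t e) →
          inSpan (𝔬-* 𝔬q 𝔬r) (𝔬-* 𝔬q 𝔬s) (𝔬-* 𝔬q 𝔬t) (trans (*-congˡ e)
            (ring! 7 (λ Z X Y r s t q → ⊢ q ⊗ (r ⊗ Z ⊕ s ⊗ X ⊕ t ⊗ Y) ≗
              q ⊗ r ⊗ Z ⊕ q ⊗ s ⊗ X ⊕ q ⊗ t ⊗ Y) (Z ∷ X ∷ Y ∷ r ∷ s ∷ t ∷ q ∷ []))) }
      }

    span₁ : ∀ {Z X Y} → InSpan Z X Y Z
    span₁ {Z} {X} {Y} = inSpan 𝔬-1 𝔬-0 𝔬-0 (ring! 3 (λ Z X Y → ⊢ Z ≗ 𝟙 ⊗ Z ⊕ 𝟘 ⊗ X ⊕ 𝟘 ⊗ Y) (Z ∷ X ∷ Y ∷ []))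

    span₂ : ∀ {Z X Y} → InSpan Z X Y X
    span₂ {Z} {X} {Y} = inSpan 𝔬-0 𝔬-1 𝔬-0 (ring! 3 (λ Z X Y → ⊢ X ≗ 𝟘 ⊗ Z ⊕ 𝟙 ⊗ X ⊕ 𝟘 ⊗ Y) (Z ∷ X ∷ Y ∷ []))

    span₃ : ∀ {Z X Y} → InSpan Z X Y Y
    span₃ {Z} {X} {Y} = inSpan 𝔬-0 𝔬-0 𝔬-1 (ring! 3 (λ Z X Y → ⊢ Y ≗ 𝟘 ⊗ Z ⊕ 𝟘 ⊗ X ⊕ 𝟙 ⊗ Y) (Z ∷ X ∷ Y ∷ []))

    span-elim : ∀ {p} {M : Carrier → Set p} → IsModule M → ∀ {Z X Y u} → M Z → M X → M Y → InSpan Z X Y u → M u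
    span-elim isM MZ MX MY (inSpan 𝔬r 𝔬s 𝔬t e) =
      M-resp (sym e) (M-+ (M-+ (M-𝔬* 𝔬r MZ) (M-𝔬* 𝔬s MX)) (M-𝔬* 𝔬t MY))
      where open IsModule isM

    span-rotate : ∀ {Z X Y u} → InSpan X Y Z u → InSpan Z X Y u
    span-rotate {Z} {X} {Y} = span-elim (span-isModule Z X Y) span₂ span₃ span₁

    module Reduce {p} {M : Carrier → Set p} (isModule : IsModule M) (N : ℤ) where
      open IsModule isModule

      -- Triples in M whose 𝔬-span contains { v ≥ N }.
      record Good {z₀ x₀ y₀} (t : Triple z₀ x₀ y₀) : Set p where
        open Triple t
        field
          MZ : M Z
          MX : M X
          MY : M Y
          z≤ : z₀ ℤ.+ + 3 ℤ.* z ℤ.≤ N ℤ.+ + 2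
          x≤ : x₀ ℤ.+ + 3 ℤ.* x ℤ.≤ N ℤ.+ + 2
          y≤ : y₀ ℤ.+ + 3 ℤ.* y ℤ.≤ N ℤ.+ + 2

      Spanned : ∀ {z₀ x₀ y₀} → Triple z₀ x₀ y₀ → Carrier → Set (c ⊔ ℓ)
      Spanned t = InSpan Z X Y
        where open Triple t

      record Insertion {z₀ x₀ y₀} (t : Triple z₀ x₀ y₀) (u : Carrier) : Set (c ⊔ ℓ ⊔ p) where
        field
          t′   : Triple z₀ x₀ y₀
          good : Good t′
          u∈   : Spanned t′ u
          Z∈   : Spanned t′ (Triple.Z t)
          X∈   : Spanned t′ (Triple.X t)
          Y∈   : Spanned t′ (Triple.Y t)

      Good-rotate : ∀ {z₀ x₀ y₀} {t : Triple z₀ x₀ y₀} → Good t → Good (rotateᵗ t)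
      Good-rotate g = record { MZ = MX ; MX = MY ; MY = MZ ; z≤ = x≤ ; x≤ = y≤ ; y≤ = z≤ }
        where open Good g

      Insertion-rotate : ∀ {z₀ x₀ y₀} {t : Triple z₀ x₀ y₀} {u} → Insertion (rotateᵗ t) u → Insertion t u
      Insertion-rotate {t = t} i = record
        { t′ = rotateᵗ (rotateᵗ t′) ; good = Good-rotate (Good-rotate good)
        ; u∈ = span-rotate u∈
        ; Z∈ = span-rotate Y∈
        ; X∈ = span-rotate Z∈
        ; Y∈ = span-rotate X∈
        }
        where open Insertion i

      -- The number `n` is fuel: every step raises the known lower bound k for the valuation by 1,
      -- and once k reaches N the vector lies in the span already.
      Inserts : ℕ → Set (c ⊔ ℓ ⊔ p)
      Inserts n = ∀ {z₀ x₀ y₀} (t : Triple z₀ x₀ y₀) → Good t → ∀ u k → M u → P k u → N ℤ.≤ k ℤ.+ + n →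
        Insertion t u

      private
        integral : ∀ {a Z k} → 𝕂 a → Val Z k → P N (a * Z) → k ℤ.≤ N ℤ.+ + 2 → 𝔬 a
        integral {a} {Z} {k} 𝕂a e p h = 𝕂a , P-coefficient 0ℤ 𝕂a e p
          (lia 2 (λ N k → k ≼ N ⊞ # 2 ⇒ ⊩ + 3 ⊛ # 0 ⊟ # 2 ≼ N ⊟ k) N k h)

        -- Each term has valuation at least N and each basis vector at most N + 2, so the
        -- coefficients have valuation at least -2 and round up to integral ones. This explains the
        -- bound N + 2 in `Good`.
        exhausted : ∀ {z₀ x₀ y₀} (t : Triple z₀ x₀ y₀) → Good t → ∀ u → P N u → Insertion t u
        exhausted t g u p = record
          { t′ = t ; good = g
          ; u∈ = inSpan (integral 𝕂a Z-val (proj₁ (terms p)) z≤)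
                        (integral 𝕂b X-val (proj₁ (proj₂ (terms p))) x≤)
                        (integral 𝕂c Y-val (proj₂ (proj₂ (terms p))) y≤) expansion
          ; Z∈ = span₁ ; X∈ = span₂ ; Y∈ = span₃ }
          where
          open Triple t
          open Good g
          open Coords (Coordinates.coordinates t u)

        skip : ∀ {k x} → P k x → ¬ Val x k → P (k ℤ.+ 1ℤ) x
        skip p ¬e with Val-or-P p
        ... | inj₁ e = contradiction e ¬e
        ... | inj₂ q = q

        -- The leading term of u lies in the direction of Z: either it can be
        -- subtracted from u, or u has smaller valuation than Z and replaces it.
        step : ∀ {n} → Inserts n → ∀ {z₀ x₀ y₀} (t : Triple z₀ x₀ y₀) → Good t →
          let open Triple t in ∀ {u k a b c} → M u → 𝕂 a → 𝕂 b → 𝕂 c → u ≈ a * Z + b * X + c * Y →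
          Val (a * Z) k → P k (b * X) → P k (c * Y) → N ℤ.≤ k ℤ.+ + suc n → Insertion t u
        step {n} insert {z₀} {x₀} {y₀} t g {u} {k} {a} {b} {c} Mu 𝕂a 𝕂b 𝕂c e aZ-val bX-P cY-P N≤
          with zero-or-Val a
        ... | inj₁ a≈0 = contradiction (trans (*-congʳ a≈0) (zeroˡ _)) (Val⇒≉0 aZ-val)
        ... | inj₂ (l , a-val) with 𝕂-Val 𝕂a a-val
        ...   | i , ≡.refl with 0ℤ ℤₚ.≤? i
        ...     | yes 0≤i = record { Insertion result ; u∈ = M-resp′ (sym split) (M-+′ (M-𝔬*′ 𝔬a Z∈) u∈) }
          where
          open Triple t
          open Good g
          𝔬a : 𝔬 a
          𝔬a = 𝕂a , Val⇒P≤ a-val (lia 1 (λ i → # 0 ≼ i ⇒ ⊩ # 0 ≼ + 3 ⊛ i) i 0≤i)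
          tail : Carrier
          tail = b * X + c * Y
          split : u ≈ a * Z + tail
          split = trans e (+-assoc _ _ _)
          result : Insertion t tail
          result = insert t g tail (k ℤ.+ 1ℤ)
            (M-resp (ring! 3 (λ u z w → 𝟙 · u ≗ z ⊕ w ⇒ ⊢ u ⊖ z ≗ w) (u ∷ a * Z ∷ tail ∷ []) split)
              (M-- Mu (M-𝔬* 𝔬a MZ)))
            (P-+ (skip bX-P (Coordinates.Z#X t 𝕂a 𝕂b aZ-val)) (skip cY-P (Coordinates.Z#Y t 𝕂a 𝕂c aZ-val)))
            (lia 3 (λ N k n → N ≼ k ⊞ (# 1 ⊞ n) ⇒ ⊩ N ≼ k ⊞ # 1 ⊞ n) N k (+ n) N≤)
          open Insertion result
          open IsModule (span-isModule (Triple.Z t′) (Triple.X t′) (Triple.Y t′))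
            renaming (M-resp to M-resp′; M-+ to M-+′; M-𝔬* to M-𝔬*′)
        ...     | no 0≰i = record
          { t′ = t′ ; good = good ; u∈ = Z∈ ; X∈ = X∈ ; Y∈ = Y∈
          ; Z∈ = M-resp′ (ring! 3 (λ Z d u → ⊢ (Z ⊖ d ⊗ u) ⊕ d ⊗ u ≗ Z) (Z ∷ d ∷ u ∷ [])) (M-+′ u∈ (M-𝔬*′ 𝔬d Z∈)) }
          where
          open Triple t
          open Good g
          inv : ∃[ d ] 𝕂 d × a * d ≈ 1# × Val d (ℤ.- (+ 3 ℤ.* i))
          inv = 𝕂-inverse 𝕂a a-val
          d : Carrier
          d = proj₁ inv
          𝔬d : 𝔬 d
          𝔬d = proj₁ (proj₂ inv) , Val⇒P≤ (proj₂ (proj₂ (proj₂ inv)))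
            (lia 1 (λ i → i ⊞ # 1 ≼ # 0 ⇒ ⊩ # 0 ≼ neg (+ 3 ⊛ i)) i (<⇒+1≤ (ℤₚ.≰⇒> 0≰i)))
          k≡ : k ≡ + 3 ℤ.* i ℤ.+ (z₀ ℤ.+ + 3 ℤ.* z)
          k≡ = Val-unique aZ-val (Val-* a-val Z-val)
          tail-P : P (k ℤ.+ 1ℤ) (b * X + c * Y)
          tail-P = P-+ (skip bX-P (Coordinates.Z#X t 𝕂a 𝕂b aZ-val)) (skip cY-P (Coordinates.Z#Y t 𝕂a 𝕂c aZ-val))
          u-val : Val u (z₀ ℤ.+ + 3 ℤ.* (z ℤ.+ i))
          u-val = ≡.subst (Val u)
            (lia 4 (λ k i z₀ z → k ≛ + 3 ⊛ i ⊞ (z₀ ⊞ + 3 ⊛ z) ⇒ ⊩ k ≛ z₀ ⊞ + 3 ⊛ (z ⊞ i)) k i z₀ z k≡)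
            (Val-resp (sym (trans e (+-assoc _ _ _))) (Val-+ aZ-val tail-P))
          t₁ : Triple z₀ x₀ y₀
          t₁ = record { z = z ℤ.+ i ; x = x ; y = y ; Z-val = u-val ; X-val = X-val ; Y-val = Y-val
                      ; z₀≢x₀ = z₀≢x₀ ; z₀≢y₀ = z₀≢y₀ ; x₀≢y₀ = x₀≢y₀ }
          g₁ : Good t₁
          g₁ = record { MZ = Mu ; MX = MX ; MY = MY ; x≤ = x≤ ; y≤ = y≤
                      ; z≤ = lia 4 (λ z₀ z i N → z₀ ⊞ + 3 ⊛ z ≼ N ⊞ # 2 ⇒ i ⊞ # 1 ≼ # 0 ⇒
                          ⊩ z₀ ⊞ + 3 ⊛ (z ⊞ i) ≼ N ⊞ # 2) z₀ z i N z≤ (<⇒+1≤ (ℤₚ.≰⇒> 0≰i)) }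
          -- With d = a⁻¹ one has Z - du = -d(bX + cY), whose valuation exceeds k. Inserting this
          -- remainder keeps the displaced Z in the span.
          result : Insertion t₁ (Z - d * u)
          result = insert t₁ g₁ (Z - d * u) (k ℤ.+ 1ℤ) (M-- MZ (M-𝔬* 𝔬d Mu))
            (P-resp (ring! 7 (λ Z X Y a d u w → d · u ≗ a ⊗ Z ⊕ w ⇒ Z · a ⊗ d ≗ 𝟙 ⇒ ⊢ ⊝ (d ⊗ w) ≗ Z ⊖ d ⊗ u)
              (Z ∷ X ∷ Y ∷ a ∷ d ∷ u ∷ b * X + c * Y ∷ []) (trans e (+-assoc _ _ _)) (proj₁ (proj₂ (proj₂ inv))))
              (P-neg (P-0* (proj₂ 𝔬d) tail-P)))
            (lia 3 (λ N k n → N ≼ k ⊞ (# 1 ⊞ n) ⇒ ⊩ N ≼ k ⊞ # 1 ⊞ n) N k (+ n) N≤)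
          open Insertion result
          open IsModule (span-isModule (Triple.Z t′) (Triple.X t′) (Triple.Y t′))
            renaming (M-resp to M-resp′; M-+ to M-+′; M-𝔬* to M-𝔬*′)

      insert : ∀ n → Inserts n
      insert zero t g u k Mu p N≤ = exhausted t g u (P-mono (≡.subst (N ℤ.≤_) (ℤₚ.+-identityʳ k) N≤) p)
      insert (suc n) t g u k Mu p N≤ with Val-or-P p
      ... | inj₂ q = insert n t g u (k ℤ.+ 1ℤ) Mu q
        (lia 3 (λ N k n → N ≼ k ⊞ (# 1 ⊞ n) ⇒ ⊩ N ≼ k ⊞ # 1 ⊞ n) N k (+ n) N≤)
      ... | inj₁ u-val = by-leading-term (Apart-Val-+ (Coordinates.ZX#Y t 𝕂a 𝕂b 𝕂c) (Val-resp expansion u-val))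
        where
        open Triple t
        open Coords (Coordinates.coordinates t u)
        pa : P k (a * Z)
        pa = proj₁ (terms p)
        pb : P k (b * X)
        pb = proj₁ (proj₂ (terms p))
        pc : P k (c′ * Y)
        pc = proj₂ (proj₂ (terms p))
        by-leading-term : Val (a * Z + b * X) k ⊎ Val (c′ * Y) k → Insertion t u
        by-leading-term (inj₂ f) = Insertion-rotate (Insertion-rotate (step (insert n) (rotateᵗ (rotateᵗ t))
          (Good-rotate (Good-rotate g)) Mu 𝕂c 𝕂a 𝕂b
          (trans expansion (ring! 3 (λ u v w → ⊢ u ⊕ v ⊕ w ≗ w ⊕ u ⊕ v) (_ ∷ _ ∷ _ ∷ []))) f pa pb N≤))
        by-leading-term (inj₁ f) with Apart-Val-+ (Coordinates.Z#X t 𝕂a 𝕂b) f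
        ... | inj₁ f = step (insert n) t g Mu 𝕂a 𝕂b 𝕂c expansion f pb pc N≤
        ... | inj₂ f = Insertion-rotate (step (insert n) (rotateᵗ t) (Good-rotate g) Mu 𝕂b 𝕂c 𝕂a
          (trans expansion (ring! 3 (λ u v w → ⊢ u ⊕ v ⊕ w ≗ v ⊕ w ⊕ u) (_ ∷ _ ∷ _ ∷ []))) f pc pa N≤)

      insertAny : ∀ {z₀ x₀ y₀} (t : Triple z₀ x₀ y₀) → Good t → ∀ u → M u → Insertion t u
      insertAny t g u Mu with zero-or-Val u
      ... | inj₁ u≈0     = exhausted t g u (P-≈0 u≈0)
      -- The absolute value serves as fuel for either sign of N - k; if k exceeds N the fuel is
      -- merely too large.
      ... | inj₂ (k , e) = insert ℤ.∣ N ℤ.- k ∣ t g u k Mu (Val⇒P e) (bound (ℤₚ.+∣i∣≡i⊎+∣i∣≡-i (N ℤ.- k)))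
        where
        bound : + ℤ.∣ N ℤ.- k ∣ ≡ N ℤ.- k ⊎ + ℤ.∣ N ℤ.- k ∣ ≡ ℤ.- (N ℤ.- k) → N ℤ.≤ k ℤ.+ + ℤ.∣ N ℤ.- k ∣
        bound (inj₁ eq) = lia 3 (λ N k m → m ≛ N ⊟ k ⇒ ⊩ N ≼ k ⊞ m) N k (+ ℤ.∣ N ℤ.- k ∣) eq
        bound (inj₂ eq) = lia 3 (λ N k m → m ≛ neg (N ⊟ k) ⇒ # 0 ≼ m ⇒ ⊩ N ≼ k ⊞ m) N k (+ ℤ.∣ N ℤ.- k ∣) eq (ℤ.+≤+ ℕ.z≤n)

      abstract
        -- Generators are inserted one at a time. An insertion never shrinks the span, so the
        -- generators treated before remain covered.
        reduce : ∀ {z₀ x₀ y₀} (t : Triple z₀ x₀ y₀) → Good t → ∀ {n} (g : Fin n → Carrier) → (∀ i → M (g i)) →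
          ∃[ t′ ] Good {z₀} {x₀} {y₀} t′ × (∀ i → Spanned t′ (g i))
        reduce t gd {zero}  g Mg = t , gd , λ ()
        reduce t gd {suc n} g Mg with reduce t gd (λ i → g (suc i)) (λ i → Mg (suc i))
        ... | t′ , gd′ , h with insertAny t′ gd′ (g zero) (Mg zero)
        ...   | i = Insertion.t′ i , Insertion.good i , λ
          { zero    → Insertion.u∈ i
          ; (suc j) → span-elim (span-isModule _ _ _) (Insertion.Z∈ i) (Insertion.X∈ i) (Insertion.Y∈ i) (h j) }

-- Normal forms of lattices that contain 1 and lie in 𝒪.

module Normal where

  open Extension
  open Lattice
  open Reduction

  module NormalForms {c ℓ} (F E : LocalField c ℓ) (E/F : TotallyRamifiedExtension F E 3) where
    open Ramified F E E/F
    open Lattices F E E/F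
    open Reductions F E E/F

    Lat-isModule : ∀ X n → IsModule (Lat X n)
    Lat-isModule X n = record { M-resp = Lat-resp ; M-+ = Lat-+ ; M-𝔬* = Lat-𝔬* }

    record NormalForm {p} (M : Carrier → Set p) : Set (c ⊔ ℓ ⊔ p) where
      field
        {X}     : Carrier
        {ρ a b} : ℤ
        frame   : Frame X ρ a b
        to      : ∀ {u} → M u → Lat X (high ρ b) u
        from    : ∀ {u} → Lat X (high ρ b) u → M u

    Lat⇒span : ∀ {X Y ρ a b} → Frame X ρ a b → Val Y (high ρ b) →
      ∀ {u} → Lat X (high ρ b) u → InSpan 1# X Y u
    Lat⇒span {X} {Y} {ρ} {a} {b} frame Y-val {u} (r , s , 𝔬r , 𝔬s , p) = M-resp
      (ring! 4 (λ u r s X → ⊢ r ⊗ 𝟙 ⊕ s ⊗ X ⊕ (u ⊖ (r ⊕ s ⊗ X)) ≗ u) (u ∷ r ∷ s ∷ X ∷ []))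
      (M-+ (M-+ (M-𝔬* 𝔬r span₁) (M-𝔬* 𝔬s span₂)) tail)
      where
      open Frame frame
      open IsModule (span-isModule 1# X Y)
      B : ℤ
      B = high ρ b
      integral : ∀ {k t Z} → 𝕂 t → Val Z k → k ℤ.≤ B → P B (t * Z) → 𝔬 t
      integral {k} 𝕂t e k≤B q = 𝕂t , P-coefficient 0ℤ 𝕂t e q
        (lia 2 (λ B k → k ≼ B ⇒ ⊩ + 3 ⊛ # 0 ⊟ # 2 ≼ B ⊟ k) B k k≤B)
      tail : InSpan 1# X Y (u - (r + s * X))
      tail = inSpan
        (integral 𝕂a Val-1 (lia 2 (λ A B → # 1 ≼ A ⇒ A ⊞ # 1 ≼ B ⇒ ⊩ # 0 ≼ B) (low ρ a) B 1≤A A<B) (proj₁ (terms p)))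
        (integral 𝕂b X-val (lia 2 (λ A B → A ⊞ # 1 ≼ B ⇒ ⊩ A ≼ B) (low ρ a) B A<B) (proj₁ (proj₂ (terms p))))
        (integral 𝕂c Y-val ℤₚ.≤-refl (proj₂ (proj₂ (terms p)))) expansion
        where
        open Coords (Coordinates.coordinates (triple {z = 0ℤ} {a} {b} Val-1 X-val Y-val 1≤ρ ρ≤2) (u - (r + s * X)))
          renaming (a to a₁; b to b₁)

    module _ {p} {M : Carrier → Set p} (isModule : IsModule M) where
      open IsModule isModule

      sorted : ∀ {X Y ρ a b} → Frame X ρ a b → Val Y (high ρ b) → M 1# → M X → M Y →
        (∀ {u} → M u → InSpan 1# X Y u) → NormalForm M
      sorted {X} {Y} {ρ} {a} {b} frame Y-val M1 MX MY span = record
        { frame = frame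
        ; to    = λ Mu → span-elim (Lat-isModule X (high ρ b)) (Lat-𝔬 𝔬-1) Lat-X (Lat-P (Val⇒P Y-val)) (span Mu)
        ; from  = λ l → span-elim isModule M1 MX MY (Lat⇒span frame Y-val l)
        }

      -- In 1 = rZ + sX + tY the terms sX and tY are integral of valuation prime to 3, hence at
      -- least 1, so rZ has valuation 0. Both factors being integral, r is a unit, and Z can be
      -- replaced by 1. The other two vectors are then ordered by valuation.
      normalise : (t : Triple 0ℤ 1ℤ (ℤ.- 1ℤ)) → let open Triple t in
        M 1# → (∀ {u} → M u → P 0ℤ u) → M Z → M X → M Y → (∀ {u} → M u → InSpan Z X Y u) → NormalForm M
      normalise t M1 M⊂P0 MZ MX MY span = sort (x ℤ.+ 1ℤ ℤₚ.≤? y)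
        where
        open Triple t
        open InSpan (span M1)

        skip : ∀ {u k} → Val u k → (∀ j → 0ℤ ≢ k ℤ.+ + 3 ℤ.* j) → ∀ {s} → 𝔬 s → M u → P 1ℤ (s * u)
        skip {u} {k} e 0≢k {s} 𝔬s Mu with Val-or-P (P-0* (proj₂ 𝔬s) (M⊂P0 Mu))
        ... | inj₂ q = q
        ... | inj₁ f = contradiction f
          (Apart-𝕂 𝕂-1 (proj₁ 𝔬s) Val-1 e 0≢k (Val-resp (sym (*-identityˡ 1#)) Val-1))

        rZ-val : Val (r * Z) 0ℤ
        rZ-val with Val-or-P (P-0* (proj₂ 𝔬r) (M⊂P0 MZ))
        ... | inj₁ f = f
        ... | inj₂ q = contradiction (P-Val (P-resp (sym equal) (P-+ (P-+ q
          (skip X-val (λ j e → 1≰0 (lia 2 (λ x j → # 0 ≛ # 1 ⊞ + 3 ⊛ x ⊞ + 3 ⊛ j ⇒ ⊩ # 1 ≼ # 0) x j e)) 𝔬s MX))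
          (skip Y-val (λ j e → 1≰0 (lia 2 (λ y j → # 0 ≛ neg # 1 ⊞ + 3 ⊛ y ⊞ + 3 ⊛ j ⇒ ⊩ # 1 ≼ # 0) y j e)) 𝔬t MY))) Val-1) 1≰0

        r-val : Val r 0ℤ
        r-val with zero-or-Val r
        ... | inj₁ r≈0 = contradiction (trans (*-congʳ r≈0) (zeroˡ Z)) (Val⇒≉0 rZ-val)
        ... | inj₂ (k , e) = ≡.subst (Val r) (lia 2 (λ k z → # 0 ≼ k ⇒ # 0 ≼ # 0 ⊞ + 3 ⊛ z ⇒ # 0 ≛ k ⊞ (# 0 ⊞ + 3 ⊛ z) ⇒
          ⊩ k ≛ # 0) k z (P-Val (proj₂ 𝔬r) e) (P-Val (M⊂P0 MZ) Z-val) (Val-unique rZ-val (Val-* e Z-val))) e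

        r⁻¹ : ∃[ d ] 𝔬 d × r * d ≈ 1#
        r⁻¹ = 𝔬-inverse 𝔬r r-val

        Z∈ : InSpan 1# X Y Z
        Z∈ = inSpan (proj₁ (proj₂ r⁻¹)) (𝔬-neg (𝔬-* (proj₁ (proj₂ r⁻¹)) 𝔬s)) (𝔬-neg (𝔬-* (proj₁ (proj₂ r⁻¹)) 𝔬t))
          (ring! 7 (λ Z X Y r s t d → (⊝ d) · 𝟙 ≗ r ⊗ Z ⊕ s ⊗ X ⊕ t ⊗ Y ⇒ (⊝ Z) · r ⊗ d ≗ 𝟙 ⇒
            ⊢ Z ≗ d ⊗ 𝟙 ⊕ (⊝ (d ⊗ s)) ⊗ X ⊕ (⊝ (d ⊗ t)) ⊗ Y) (Z ∷ X ∷ Y ∷ r ∷ s ∷ _ ∷ proj₁ r⁻¹ ∷ []) equal (proj₂ (proj₂ r⁻¹)))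

        span′ : ∀ {u} → M u → InSpan 1# X Y u
        span′ Mu = span-elim (span-isModule 1# X Y) Z∈ span₂ span₃ (span Mu)

        swapped : ∀ {u} → M u → InSpan 1# Y X u
        swapped Mu = span-elim (span-isModule 1# Y X) span₁ span₃ span₂ (span′ Mu)

        sort : Dec (x ℤ.+ 1ℤ ℤ.≤ y) → NormalForm M
        sort (yes x<y) = sorted {ρ = 1ℤ} {x} {y}
          (record { X-val = X-val
                  ; 1≤ρ = lia 0 (⊩ # 1 ≼ # 1) ; ρ≤2 = lia 0 (⊩ # 1 ≼ # 2)
                  ; 1≤A = lia 1 (λ x → # 0 ≼ # 1 ⊞ + 3 ⊛ x ⇒ ⊩ # 1 ≼ # 1 ⊞ + 3 ⊛ x) x (P-Val (M⊂P0 MX) X-val)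
                  ; A<B = lia 2 (λ x y → x ⊞ # 1 ≼ y ⇒ ⊩ # 1 ⊞ + 3 ⊛ x ⊞ # 1 ≼ neg # 1 ⊞ + 3 ⊛ y) x y x<y })
          Y-val M1 MX MY span′
        -- The roles of X and Y are exchanged and ρ becomes 2: the indices shift because -1 + 3y = 2
        -- + 3(y - 1) and 1 + 3x = -2 + 3(x + 1).
        sort (no x≮y) = sorted {ρ = + 2} {y ℤ.- 1ℤ} {x ℤ.+ 1ℤ}
          (record { X-val = ≡.subst (Val Y) (lia 1 (λ y → ⊩ neg # 1 ⊞ + 3 ⊛ y ≛ # 2 ⊞ + 3 ⊛ (y ⊟ # 1)) y) Y-val
                  ; 1≤ρ = lia 0 (⊩ # 1 ≼ # 2) ; ρ≤2 = lia 0 (⊩ # 2 ≼ # 2)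
                  ; 1≤A = lia 1 (λ y → # 0 ≼ neg # 1 ⊞ + 3 ⊛ y ⇒ ⊩ # 1 ≼ # 2 ⊞ + 3 ⊛ (y ⊟ # 1)) y (P-Val (M⊂P0 MY) Y-val)
                  ; A<B = lia 2 (λ x y → y ⊞ # 1 ≼ x ⊞ # 1 ⇒ ⊩ # 2 ⊞ + 3 ⊛ (y ⊟ # 1) ⊞ # 1 ≼ neg # 2 ⊞ + 3 ⊛ (x ⊞ # 1)) x y (<⇒+1≤ (ℤₚ.≰⇒> x≮y)) })
          (≡.subst (Val X) (lia 1 (λ x → ⊩ # 1 ⊞ + 3 ⊛ x ≛ neg # 2 ⊞ + 3 ⊛ (x ⊞ # 1)) x) X-val)
          M1 MY MX swapped

-- Normal forms of the order and of its fractional ideals.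

module Orders where

  open import Algebra.Definitions.RawMonoid using (sum)
  open import Data.Fin.Base using (Fin; zero; suc; remQuot; combine)
  open import Data.Fin.Properties using (remQuot-combine)
  open Extension
  open Lattice
  open Reduction
  open Normal

  module OrderStructure {c ℓ} (F E : LocalField c ℓ) (E/F : TotallyRamifiedExtension F E 3) (𝓡 : Order E/F) where
    open Ramified F E E/F
    open Lattices F E E/F
    open Reductions F E E/F
    open NormalForms F E E/F
    open Order 𝓡 using (R; 𝔬⊆R; FR≡E)
    module R = IsSubring (Order.isSubring 𝓡)

    R-𝔬 : ∀ {t} → 𝔬 t → R t
    R-𝔬 𝔬t with 𝔬-ι 𝔬t
    ... | a , a∈𝒪 , ιa≈t = R.resp ιa≈t (𝔬⊆R a∈𝒪)

    R-isModule : IsModule R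
    R-isModule = record
      { M-resp = R.resp ; M-+ = R.+-closed ; M-𝔬* = λ 𝔬t Ru → R.*-closed (R-𝔬 𝔬t) Ru }

    private
      n : ℕ
      n = proj₁ (Order.fg 𝓡)

      generator : Fin n → Carrier
      generator = proj₁ (proj₂ (Order.fg 𝓡))

      generator∈R : ∀ i → R (generator i)
      generator∈R = proj₁ (proj₂ (proj₂ (Order.fg 𝓡)))

      generate : ∀ {p} {S : Carrier → Set p} → IsModule S → S 0# → (∀ i → S (generator i)) → ∀ {u} → R u → S u
      generate {S = S} isModule S0 h {u} Ru = M-resp (sym (proj₂ (proj₂ (proj₂ (proj₂ (Order.fg 𝓡))) Ru)))
        (sum-closed S S0 M-+ _ (λ i → M-𝔬* (ι-𝔬 (proj₂ (proj₁ (proj₂ (proj₂ (proj₂ (Order.fg 𝓡))) Ru) i))) (h i)))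
        where open IsModule isModule

      generate-combinations : ∀ {p} {S : Carrier → Set p} → IsModule S → S 0# →
        ∀ {m} (g : Fin m → Carrier) → (∀ i l → S (generator l * g i)) →
        ∀ (a : Fin m → Carrier) → (∀ i → R (a i)) → S (sum +-rawMonoid (λ i → a i * g i))
      generate-combinations {S = S} isModule S0 g h a Ra = sum-closed S S0 S.M-+ (λ i → a i * g i) (λ i →
        generate {S = λ r → S (r * g i)} (record
          { M-resp = λ u≈w → S.M-resp (*-congʳ u≈w)
          ; M-+    = λ p q → S.M-resp (sym (distribʳ _ _ _)) (S.M-+ p q)
          ; M-𝔬*   = λ 𝔬t p → S.M-resp (sym (*-assoc _ _ _)) (S.M-𝔬* 𝔬t p)
          })
          (S.M-resp (sym (zeroˡ (g i))) S0) (h i) (Ra i))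
        where module S = IsModule isModule

      P-isModule : ∀ k → IsModule (P k)
      P-isModule k = record { M-resp = P-resp ; M-+ = P-+ ; M-𝔬* = λ 𝔬t p → P-0* (proj₂ 𝔬t) p }

      zero-isModule : IsModule (_≈ 0#)
      zero-isModule = record
        { M-resp = λ u≈w u≈0 → trans (sym u≈w) u≈0
        ; M-+    = λ u≈0 w≈0 → trans (+-cong u≈0 w≈0) (+-identityˡ 0#)
        ; M-𝔬*   = λ _ u≈0 → trans (*-congˡ u≈0) (zeroʳ _)
        }

    -- A generator of least valuation k has its square in R, so that k ≤ 2k.
    R⊂P0 : ∀ {u} → R u → P 0ℤ u
    R⊂P0 {u} Ru with least generator
    ... | inj₁ all = contradiction (generate zero-isModule refl all R.1-closed) (IsField.1≉0 isField)
    ... | inj₂ (j , k , e , p) = P-mono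
      (lia 1 (λ k → k ≼ k ⊞ k ⇒ ⊩ # 0 ≼ k) k
        (P-Val (generate (P-isModule k) P-0 p (R.*-closed (generator∈R j) (generator∈R j))) (Val-* e e)))
      (generate (P-isModule k) P-0 p Ru)

    private
      -- A denominator bound: scalars of large valuation carry `b` into R. It is stated for all N
      -- beyond N₀ so that the bounds of the terms of a finite sum combine by taking a maximum.
      Absorbed : Carrier → Set (c ⊔ ℓ)
      Absorbed b = ∃[ N₀ ] (∀ N d → N₀ ℤ.≤ N → 𝕂 d → P (+ 3 ℤ.* N) d → R (d * b))

      Absorbed-+ : ∀ {x y} → Absorbed x → Absorbed y → Absorbed (x + y)
      Absorbed-+ (N , h) (N′ , h′) = N ℤ.⊔ N′ , λ m d ≤m 𝕂d p → R.resp (sym (distribˡ d _ _)) (R.+-closed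
        (h m d (ℤₚ.≤-trans (ℤₚ.i≤i⊔j N N′) ≤m) 𝕂d p) (h′ m d (ℤₚ.≤-trans (ℤₚ.i≤j⊔i N N′) ≤m) 𝕂d p))

      absorb-multiple : ∀ a y → R y → Absorbed (ι a * y)
      absorb-multiple a y Ry with zero-or-Val (ι a)
      ... | inj₁ ιa≈0 = 0ℤ , λ _ d _ _ _ → R.resp
        (ring! 3 (λ d a y → (⊝ (d ⊗ y)) · a ≗ 𝟘 ⇒ ⊢ 𝟘 ≗ d ⊗ (a ⊗ y)) (d ∷ ι a ∷ y ∷ []) ιa≈0) R.0-closed
      ... | inj₂ (k , e) with 𝕂-Val (a , refl) e
      ...   | j , ≡.refl = ℤ.- j , λ N d ≤N 𝕂d p → R.resp (*-assoc d (ι a) y) (R.*-closed (R-𝔬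
        ( 𝕂-* 𝕂d (a , refl)
        , P-mono (lia 2 (λ j N → neg j ≼ N ⇒ ⊩ # 0 ≼ + 3 ⊛ N ⊞ + 3 ⊛ j) j N ≤N) (P-* p (Val⇒P e)))) Ry)

      absorbed : ∀ x → Absorbed x
      absorbed x with FR≡E x
      ... | k , a , y , Ry , e with sum-closed Absorbed
          (0ℤ , λ _ d _ _ _ → R.resp (sym (zeroʳ d)) R.0-closed) Absorbed-+
          (λ i → ι (a i) * y i) (λ i → absorb-multiple (a i) (y i) (Ry i))
      ...   | N₀ , h = N₀ , λ N d ≤N 𝕂d p → R.resp (*-congˡ (sym e)) (h N d ≤N 𝕂d p)

      N₁ N₂ N₃ N : ℤ
      N₁ = proj₁ (absorbed 1#)
      N₂ = proj₁ (absorbed (proj₁ (element 1ℤ)))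
      N₃ = proj₁ (absorbed (proj₁ (element (ℤ.- 1ℤ))))
      N  = N₁ ℤ.⊔ (N₂ ℤ.⊔ N₃)

      N₁≤N : N₁ ℤ.≤ N
      N₁≤N = ℤₚ.i≤i⊔j N₁ _

      N₂≤N : N₂ ℤ.≤ N
      N₂≤N = ℤₚ.≤-trans (ℤₚ.i≤i⊔j N₂ N₃) (ℤₚ.i≤j⊔i N₁ _)

      N₃≤N : N₃ ℤ.≤ N
      N₃≤N = ℤₚ.≤-trans (ℤₚ.i≤j⊔i N₂ N₃) (ℤₚ.i≤j⊔i N₁ _)

      d : Carrier
      d = proj₁ (𝕂-element N)

      𝕂d : 𝕂 d
      𝕂d = proj₁ (proj₂ (𝕂-element N))

      d-val : Val d (+ 3 ℤ.* N)
      d-val = proj₂ (proj₂ (𝕂-element N))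

      -- A first triple inside R: elements of valuation 0, 1 and -1, scaled by an element d of the
      -- base field of valuation 3N, large enough for all three to be absorbed.
      t₀ : Triple 0ℤ 1ℤ (ℤ.- 1ℤ)
      t₀ = triple {z = N} {N} {N} (shift 0ℤ Val-1) (shift 1ℤ (proj₂ (element 1ℤ)))
        (shift (ℤ.- 1ℤ) (proj₂ (element (ℤ.- 1ℤ)))) (lia 0 (⊩ # 1 ≼ # 1)) (lia 0 (⊩ # 1 ≼ # 2))
        where
        shift : ∀ k {x} → Val x k → Val (d * x) (k ℤ.+ + 3 ℤ.* N)
        shift k e = ≡.subst (Val _) (ℤₚ.+-comm (+ 3 ℤ.* N) k) (Val-* d-val e)

      t₀-good : ∀ {p} {M : Carrier → Set p} (isModule : IsModule M) → (∀ {u} → R u → M u) →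
        Reduce.Good isModule (+ 3 ℤ.* N) t₀
      t₀-good _ R⊂M = record
        { MZ = R⊂M (proj₂ (absorbed 1#) N d N₁≤N 𝕂d (Val⇒P d-val))
        ; MX = R⊂M (proj₂ (absorbed (proj₁ (element 1ℤ))) N d N₂≤N 𝕂d (Val⇒P d-val))
        ; MY = R⊂M (proj₂ (absorbed (proj₁ (element (ℤ.- 1ℤ)))) N d N₃≤N 𝕂d (Val⇒P d-val))
        ; z≤ = lia 1 (λ N → ⊩ # 0 ⊞ + 3 ⊛ N ≼ + 3 ⊛ N ⊞ # 2) N
        ; x≤ = lia 1 (λ N → ⊩ # 1 ⊞ + 3 ⊛ N ≼ + 3 ⊛ N ⊞ # 2) N
        ; y≤ = lia 1 (λ N → ⊩ neg # 1 ⊞ + 3 ⊛ N ≼ + 3 ⊛ N ⊞ # 2) N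
        }

    -- The products of the 𝔬-generators of R with the R-generators of M generate M over 𝔬. They are
    -- inserted into `t₀`, which lies in M because R ⊂ M.
    normalForm : ∀ {p} {M : Carrier → Set p} (isModule : IsModule M) →
      (∀ {r u} → R r → M u → M (r * u)) → M 1# → (∀ {u} → M u → P 0ℤ u) →
      ∀ {m} (g : Fin m → Carrier) → (∀ i → M (g i)) →
      (∀ {u} → M u → ∃[ a ] (∀ i → R (a i)) × u ≈ sum +-rawMonoid (λ i → a i * g i)) →
      NormalForm M
    normalForm {M = M} isModule R* M1 M⊂P0 {m} g Mg span = from-reduced
      (Reduce.reduce isModule (+ 3 ℤ.* N) t₀ (t₀-good isModule R⊂M) h (λ ij → R* (generator∈R _) (Mg _)))
      where
      open IsModule isModule
      R⊂M : ∀ {u} → R u → M u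
      R⊂M {u} Ru = M-resp (*-identityʳ u) (R* Ru M1)
      h : Fin (m ℕ.* n) → Carrier
      h ij = generator (proj₂ (remQuot {m} n ij)) * g (proj₁ (remQuot {m} n ij))
      from-reduced : ∃[ t ] Reduce.Good isModule (+ 3 ℤ.* N) {0ℤ} {1ℤ} {ℤ.- 1ℤ} t ×
        (∀ i → Reduce.Spanned isModule (+ 3 ℤ.* N) t (h i)) → NormalForm M
      from-reduced (t , good , cover) = normalise isModule t M1 M⊂P0 MZ MX MY spanned
        where
        open Triple t
        open Reduce.Good good
        covered : ∀ i l → InSpan Z X Y (generator l * g i)
        covered i l = ≡.subst (λ il → InSpan Z X Y (generator (proj₂ il) * g (proj₁ il))) (remQuot-combine i l)
          (cover (combine i l))
        spanned : ∀ {u} → M u → InSpan Z X Y u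
        spanned Mu with span Mu
        ... | a , Ra , e = IsModule.M-resp (span-isModule Z X Y) (sym e)
          (generate-combinations (span-isModule Z X Y) (IsModule.M-resp (span-isModule Z X Y) (zeroˡ Z)
            (IsModule.M-𝔬* (span-isModule Z X Y) 𝔬-0 span₁)) g covered a Ra)

    abstract
      R-normalForm : NormalForm R
      R-normalForm = normalForm R-isModule R.*-closed R.1-closed R⊂P0 {1} (λ _ → 1#) (λ _ → R.1-closed)
        λ {u} Ru → (λ _ → u) , (λ _ → Ru) , ring! 1 (λ u → ⊢ u ≗ u ⊗ 𝟙 ⊕ 𝟘) (u ∷ [])

    open NormalForm R-normalForm public using ()
      renaming (X to θ; ρ to ρ₀; a to a₀; b to b₀; frame to θ-frame; to to R⇒Lat; from to Lat⇒R)
    module θ = Frame θ-frame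

    θ∈R : R θ
    θ∈R = Lat⇒R Lat-X

    θ²-val : Val (θ * θ) (high ρ₀ (+ 2 ℤ.* a₀ ℤ.+ ρ₀))
    θ²-val = ≡.subst (Val (θ * θ))
      (lia 2 (λ ρ a → ⊩ ρ ⊞ + 3 ⊛ a ⊞ (ρ ⊞ + 3 ⊛ a) ≛ neg ρ ⊞ + 3 ⊛ (+ 2 ⊛ a ⊞ ρ)) ρ₀ a₀)
      (Val-* θ.X-val θ.X-val)

    -- This is B₀ ≤ 2A₀. As R is a ring it contains θ², whose valuation 2A₀ lies in the class of B₀.
    b₀≤2a₀+ρ₀ : b₀ ℤ.≤ + 2 ℤ.* a₀ ℤ.+ ρ₀
    b₀≤2a₀+ρ₀ = FrameProperties.high-bound θ-frame {m = + 2 ℤ.* a₀ ℤ.+ ρ₀}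
      (R⇒Lat (R.*-closed θ∈R θ∈R)) θ²-val

    module _ (𝓘 : FractionalIdeal E/F 𝓡) where
      open FractionalIdeal 𝓘 using (I)
      private
        module I = IsSubmodule (FractionalIdeal.isSubmodule 𝓘)

        size : ℕ
        size = proj₁ (FractionalIdeal.fg 𝓘)

        g : Fin size → Carrier
        g = proj₁ (proj₂ (FractionalIdeal.fg 𝓘))

        resolve : ∀ {u} → I u → ∃[ a ] (∀ i → R (a i)) × u ≈ sum +-rawMonoid (λ i → a i * g i)
        resolve Iu = let a , e = proj₂ (proj₂ (proj₂ (FractionalIdeal.fg 𝓘))) Iu in
          (λ i → proj₁ (a i)) , (λ i → proj₂ (a i)) , e

        I⊂ : ∀ {p} {S : Carrier → Set p} → S 0# → (∀ {x y} → S x → S y → S (x + y)) → (∀ {x y} → x ≈ y → S x → S y) →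
          (∀ i {r} → R r → S (r * g i)) → ∀ {u} → I u → S u
        I⊂ {S = S} S0 S+ S-resp h Iu with resolve Iu
        ... | a , Ra , e = S-resp (sym e) (sum-closed S S0 S+ (λ i → a i * g i) (λ i → h i (Ra i)))

      abstract
        -- Dividing by a generator of least valuation puts 1 into the ideal. Since R is integral, no
        -- combination of the generators has smaller valuation, so the quotient lies in 𝒪.
        ideal-normalForm : ∃[ u ] ¬ u ≈ 0# × NormalForm (λ w → I (u * w))
        ideal-normalForm with least g
        ... | inj₁ all = contradiction
          (I⊂ refl (λ p q → trans (+-cong p q) (+-identityˡ 0#)) (λ e p → trans (sym e) p)
            (λ i {r} _ → trans (*-congˡ (all i)) (zeroʳ r)) (proj₁ (proj₂ (FractionalIdeal.nonzero 𝓘))))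
          (proj₂ (proj₂ (FractionalIdeal.nonzero 𝓘)))
        ... | inj₂ (j , k , e , p) = m , Val⇒≉0 e , normalForm
          (record
            { M-resp = λ u≈w → I.resp (*-congˡ u≈w)
            ; M-+    = λ p q → I.resp (sym (distribˡ m _ _)) (I.+-closed p q)
            ; M-𝔬*   = λ 𝔬t → R* (R-𝔬 𝔬t)
            })
          R* (I.resp (sym (*-identityʳ m)) (proj₁ (proj₂ (proj₂ (FractionalIdeal.fg 𝓘))) j))
          (λ Iu → P-mono (lia 1 (λ k → ⊩ # 0 ≼ k ⊟ k) k)
            (P-cancel e (I⊂ P-0 P-+ P-resp (λ i Rr → P-0* (R⊂P0 Rr) (p i)) Iu)))
          (λ i → proj₁ m⁻¹ * g i)
          (λ i → I.resp (sym (cancel (g i))) (proj₁ (proj₂ (proj₂ (FractionalIdeal.fg 𝓘))) i))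
          rescale
          where
          m : Carrier
          m = g j
          R* : ∀ {r u} → R r → I (m * u) → I (m * (r * u))
          R* {r} {u} Rr Iu = I.resp (ring! 3 (λ r m u → ⊢ r ⊗ (m ⊗ u) ≗ m ⊗ (r ⊗ u)) (r ∷ m ∷ u ∷ [])) (I.*-closed (r , Rr) Iu)
          m⁻¹ : ∃[ v ] m * v ≈ 1# × Val v (ℤ.- k)
          m⁻¹ = Val-inverse e
          cancel : ∀ w → m * (proj₁ m⁻¹ * w) ≈ w
          cancel w = ring! 3 (λ m v w → w · m ⊗ v ≗ 𝟙 ⇒ ⊢ m ⊗ (v ⊗ w) ≗ w) (m ∷ proj₁ m⁻¹ ∷ w ∷ []) (proj₁ (proj₂ m⁻¹))
          cancel′ : ∀ w → proj₁ m⁻¹ * (m * w) ≈ w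
          cancel′ w = ring! 3 (λ m v w → w · m ⊗ v ≗ 𝟙 ⇒ ⊢ v ⊗ (m ⊗ w) ≗ w) (m ∷ proj₁ m⁻¹ ∷ w ∷ []) (proj₁ (proj₂ m⁻¹))
          distribute : ∀ {n} (f h : Fin n → Carrier) → (∀ i → proj₁ m⁻¹ * f i ≈ h i) →
            proj₁ m⁻¹ * sum +-rawMonoid f ≈ sum +-rawMonoid h
          distribute {ℕ.zero} f h eq = zeroʳ _
          distribute {ℕ.suc n} f h eq = trans (distribˡ _ _ _)
            (+-cong (eq zero) (distribute (λ i → f (suc i)) (λ i → h (suc i)) (λ i → eq (suc i))))
          rescale : ∀ {u} → I (m * u) → Σ (Fin size → Carrier) λ a → (∀ i → R (a i)) × u ≈ sum +-rawMonoid (λ i → a i * (proj₁ m⁻¹ * g i))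
          rescale {u} Iu with resolve Iu
          ... | a , Ra , e = a , Ra , trans (sym (cancel′ u)) (trans (*-congˡ e)
            (distribute (λ i → a i * g i) (λ i → a i * (proj₁ m⁻¹ * g i)) (λ i →
              ring! 3 (λ a v g → ⊢ v ⊗ (a ⊗ g) ≗ a ⊗ (v ⊗ g)) (a i ∷ proj₁ m⁻¹ ∷ g i ∷ []))))

-- The length of 𝒪_E/R in terms of A and B.

module Length where

  open import Data.Fin.Base using (Fin; zero; suc; inject₁; fromℕ; toℕ)
  open import Data.Fin.Properties using (toℕ-inject₁; toℕ-fromℕ)
  open import Data.Fin.Induction using (<-weakInduction)
  open Extension
  open Lattice
  open Reduction
  open Normal
  open Orders

  module OrderLength {c ℓ} (F E : LocalField c ℓ) (E/F : TotallyRamifiedExtension F E 3) (𝓡 : Order E/F) where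
    open Ramified F E E/F
    open Lattices F E E/F
    open Reductions F E E/F
    open NormalForms F E E/F
    open OrderStructure F E E/F 𝓡
    open Order 𝓡 using (R)

    record Residues (p₀ q₀ : ℤ) : Set where
      constructor residues
      field
        z≢p : ∀ j → 0ℤ ≢ p₀ ℤ.+ + 3 ℤ.* j
        z≢q : ∀ j → 0ℤ ≢ q₀ ℤ.+ + 3 ℤ.* j
        p≢q : ∀ j → p₀ ≢ q₀ ℤ.+ + 3 ℤ.* j

    -- In contrast to `Frame` this is symmetric in X and Y: along the composition series either
    -- valuation may drop, and their order may change.
    record Span {p} (M : Carrier → Set p) (p₀ q₀ x y : ℤ) : Set (c ⊔ ℓ ⊔ p) where
      field
        {X Y} : Carrier
        X-val : Val X (p₀ ℤ.+ + 3 ℤ.* x)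
        Y-val : Val Y (q₀ ℤ.+ + 3 ℤ.* y)
        MX    : M X
        MY    : M Y
        spans : ∀ {u} → M u → InSpan 1# X Y u

    module _ {p₀ q₀} (res : Residues p₀ q₀) where

      private
        basis : ∀ {X Y x y} → Val X (p₀ ℤ.+ + 3 ℤ.* x) → Val Y (q₀ ℤ.+ + 3 ℤ.* y) → Triple 0ℤ p₀ q₀
        basis {x = x} {y} e f = record { z = 0ℤ ; x = x ; y = y ; Z-val = Val-1 ; X-val = e ; Y-val = f
          ; z₀≢x₀ = Residues.z≢p res ; z₀≢y₀ = Residues.z≢q res ; x₀≢y₀ = Residues.p≢q res }

      -- The classes of 1 and Y are excluded, so the leading term is sX with s integral.
      span-least : ∀ {X Y x y u m} → Val X (p₀ ℤ.+ + 3 ℤ.* x) → Val Y (q₀ ℤ.+ + 3 ℤ.* y) →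
        InSpan 1# X Y u → Val u (p₀ ℤ.+ + 3 ℤ.* m) → x ℤ.≤ m
      span-least {X} {Y} {x} {y} {u} {m} e f (inSpan {r} {s} {t} 𝔬r 𝔬s 𝔬t eq) g
        with Apart-Val-+ (Coordinates.ZX#Y (basis e f) (proj₁ 𝔬r) (proj₁ 𝔬s) (proj₁ 𝔬t)) (Val-resp eq g)
      ... | inj₂ h = contradiction (Val-resp (sym (*-identityˡ u)) g)
        (λ g′ → Apart-𝕂 𝕂-1 (proj₁ 𝔬t) g f shift g′ h)
        where
        shift : ∀ j → p₀ ℤ.+ + 3 ℤ.* m ≢ q₀ ℤ.+ + 3 ℤ.* y ℤ.+ + 3 ℤ.* j
        shift j eq = Residues.p≢q res (y ℤ.+ j ℤ.- m) (lia 5 (λ p q m y j → p ⊞ + 3 ⊛ m ≛ q ⊞ + 3 ⊛ y ⊞ + 3 ⊛ j ⇒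
          ⊩ p ≛ q ⊞ + 3 ⊛ (y ⊞ j ⊟ m)) p₀ q₀ m y j eq)
      ... | inj₁ h with Apart-Val-+ (Coordinates.Z#X (basis e f) (proj₁ 𝔬r) (proj₁ 𝔬s)) h
      ...   | inj₂ h = lia 3 (λ p x m → # 0 ⊞ (p ⊞ + 3 ⊛ x) ≼ p ⊞ + 3 ⊛ m ⇒ ⊩ x ≼ m) p₀ x m
        (P-Val (P-* (proj₂ 𝔬s) (Val⇒P e)) h)
      ...   | inj₁ h with 𝕂-Val (proj₁ 𝔬r) (Val-resp (*-identityʳ r) h)
      ...     | j , eq′ = contradiction (lia 3 (λ p m j → p ⊞ + 3 ⊛ m ≛ + 3 ⊛ j ⇒ ⊩ # 0 ≛ p ⊞ + 3 ⊛ (m ⊟ j)) p₀ m j eq′)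
        (Residues.z≢p res (m ℤ.- j))

      -- If u ∉ 𝔬 + 𝔬X + 𝔬Y then some multiple T = bX + cY of its (X,Y)-component has
      -- coefficients in ϖ⁻¹𝔬 which are not both integral.
      record Defect (X Y u : Carrier) : Set (c ⊔ ℓ) where
        field
          {d r b c′} : Carrier
          𝔬d         : 𝔬 d
          𝔬r         : 𝔬 r
          𝕂b         : 𝕂 b
          𝕂c         : 𝕂 c′
          T≈         : d * (u - r) ≈ b * X + c′ * Y
          P-b        : P (ℤ.- + 3) b
          P-c        : P (ℤ.- + 3) c′
          leading    : Val b (ℤ.- + 3) ⊎ Val c′ (ℤ.- + 3)

      nonintegral : ∀ {b} → 𝕂 b → ¬ P 0ℤ b → ∃[ j ] Val b (+ 3 ℤ.* j) × j ℤ.+ 1ℤ ℤ.≤ 0ℤ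
      nonintegral {b} 𝕂b ¬p with zero-or-Val b
      ... | inj₁ b≈0 = contradiction (P-≈0 b≈0) ¬p
      ... | inj₂ (k , e) with 𝕂-Val 𝕂b e
      ...   | j , ≡.refl with 0ℤ ℤₚ.≤? j
      ...     | yes 0≤j = contradiction (Val⇒P≤ e (lia 1 (λ j → # 0 ≼ j ⇒ ⊩ # 0 ≼ + 3 ⊛ j) j 0≤j)) ¬p
      ...     | no 0≰j = j , e , <⇒+1≤ (ℤₚ.≰⇒> 0≰j)

      defect : ∀ {X Y x y u} → Val X (p₀ ℤ.+ + 3 ℤ.* x) → Val Y (q₀ ℤ.+ + 3 ℤ.* y) →
        P 0ℤ u → ¬ InSpan 1# X Y u → Defect X Y u
      defect {X} {Y} {x} {y} {u} e f p u∉ = from-coords (P? 0ℤ b) (P? 0ℤ c′)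
        where
        open Coords (Coordinates.coordinates (basis e f) u)
        𝔬a : 𝔬 a
        𝔬a = 𝕂a , P-resp (*-identityʳ a) (proj₁ (terms p))
        rescaled : ∀ j → j ℤ.+ 1ℤ ℤ.≤ 0ℤ → P (+ 3 ℤ.* j) b → P (+ 3 ℤ.* j) c′ →
          Val b (+ 3 ℤ.* j) ⊎ Val c′ (+ 3 ℤ.* j) → Defect X Y u
        -- The smallest coefficient has valuation 3j < 0; a factor of valuation 3(-j - 1) raises it
        -- to -3, the least denominator that is still nontrivial.
        rescaled j j<0 pb pc lead with 𝕂-element (ℤ.- j ℤ.- 1ℤ)
        ... | d , 𝕂d , d-val = record
          { 𝔬d = 𝕂d , Val⇒P≤ d-val (lia 1 (λ j → j ⊞ # 1 ≼ # 0 ⇒ ⊩ # 0 ≼ + 3 ⊛ (neg j ⊟ # 1)) j j<0)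
          ; 𝔬r = 𝔬a ; 𝕂b = 𝕂-* 𝕂d 𝕂b ; 𝕂c = 𝕂-* 𝕂d 𝕂c
          ; T≈ = ring! 7 (λ u a b c X Y d → d · u ≗ a ⊗ 𝟙 ⊕ b ⊗ X ⊕ c ⊗ Y ⇒ ⊢ d ⊗ (u ⊖ a) ≗ d ⊗ b ⊗ X ⊕ d ⊗ c ⊗ Y)
              (u ∷ a ∷ b ∷ c′ ∷ X ∷ Y ∷ d ∷ []) expansion
          ; P-b = ≡.subst (λ k → P k (d * b)) total (P-* (Val⇒P d-val) pb)
          ; P-c = ≡.subst (λ k → P k (d * c′)) total (P-* (Val⇒P d-val) pc)
          ; leading = [ (λ g → inj₁ (≡.subst (Val (d * b)) total (Val-* d-val g)))
                      , (λ g → inj₂ (≡.subst (Val (d * c′)) total (Val-* d-val g))) ]′ lead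
          }
          where
          total : + 3 ℤ.* (ℤ.- j ℤ.- 1ℤ) ℤ.+ + 3 ℤ.* j ≡ ℤ.- + 3
          total = lia 1 (λ j → ⊩ + 3 ⊛ (neg j ⊟ # 1) ⊞ + 3 ⊛ j ≛ neg # 3) j
        3* : ∀ {i j} → i ℤ.≤ j → + 3 ℤ.* i ℤ.≤ + 3 ℤ.* j
        3* {i} {j} = lia 2 (λ i j → i ≼ j ⇒ ⊩ + 3 ⊛ i ≼ + 3 ⊛ j) i j
        3*≤0 : ∀ {i} → i ℤ.+ 1ℤ ℤ.≤ 0ℤ → + 3 ℤ.* i ℤ.≤ 0ℤ
        3*≤0 {i} = lia 1 (λ i → i ⊞ # 1 ≼ # 0 ⇒ ⊩ + 3 ⊛ i ≼ # 0) i
        from-coords : Dec (P 0ℤ b) → Dec (P 0ℤ c′) → Defect X Y u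
        from-coords (yes pb) (yes pc) = contradiction (inSpan 𝔬a (𝕂b , pb) (𝕂c , pc) expansion) u∉
        from-coords (no ¬pb) (yes pc) with nonintegral 𝕂b ¬pb
        ... | j , g , j<0 = rescaled j j<0 (Val⇒P g) (P-mono (3*≤0 j<0) pc) (inj₁ g)
        from-coords (yes pb) (no ¬pc) with nonintegral 𝕂c ¬pc
        ... | j , g , j<0 = rescaled j j<0 (P-mono (3*≤0 j<0) pb) (Val⇒P g) (inj₂ g)
        from-coords (no ¬pb) (no ¬pc) with nonintegral 𝕂b ¬pb | nonintegral 𝕂c ¬pc
        ... | i , g , i<0 | j , h , j<0 with ℤₚ.≤-total i j
        ...   | inj₁ i≤j = rescaled i i<0 (Val⇒P g) (Val⇒P≤ h (3* i≤j)) (inj₁ g)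
        ...   | inj₂ j≤i = rescaled j j<0 (Val⇒P≤ g (3* j≤i)) (Val⇒P h) (inj₂ h)

      -- Coordinates are unique, and the leading coefficient of this vector has valuation -3.
      defect∉ : ∀ {X Y x y u} → Val X (p₀ ℤ.+ + 3 ℤ.* x) → Val Y (q₀ ℤ.+ + 3 ℤ.* y) →
        (D : Defect X Y u) → let open Defect D in ¬ InSpan 1# X Y (b * X + c′ * Y)
      defect∉ {X} {Y} {x} {y} e f D (inSpan {r₁} {s₁} {t₁} 𝔬r₁ 𝔬s₁ 𝔬t₁ eq) = [ absurd 𝔬s₁ (λ k → proj₁ (proj₂ (difference k))) e
                                                      , absurd 𝔬t₁ (λ k → proj₂ (proj₂ (difference k))) f ]′ leading
        where
        open Defect D
        difference : ∀ k → P k ((0# - r₁) * 1#) × P k ((b - s₁) * X) × P k ((c′ - t₁) * Y)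
        difference k = Coordinates.P-terms (basis e f) (𝕂-- 𝕂-0 (proj₁ 𝔬r₁)) (𝕂-- 𝕂b (proj₁ 𝔬s₁)) (𝕂-- 𝕂c (proj₁ 𝔬t₁))
          (P-≈0 (ring! 7 (λ X Y b c r s t → 𝟙 · b ⊗ X ⊕ c ⊗ Y ≗ r ⊗ 𝟙 ⊕ s ⊗ X ⊕ t ⊗ Y ⇒
            ⊢ (𝟘 ⊖ r) ⊗ 𝟙 ⊕ (b ⊖ s) ⊗ X ⊕ (c ⊖ t) ⊗ Y ≗ 𝟘) (X ∷ Y ∷ b ∷ c′ ∷ r₁ ∷ s₁ ∷ t₁ ∷ []) eq))
        absurd : ∀ {s b X k} → 𝔬 s → (∀ k → P k ((b - s) * X)) → Val X k → ¬ Val b (ℤ.- + 3)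
        absurd {s} {b} {X} {k} 𝔬s all e g = contradiction (P-Val (P-resp
            (ring! 2 (λ b s → ⊢ (b ⊖ s) ⊕ s ≗ b) (b ∷ s ∷ [])) (P-+ (P-mono (lia 1 (λ k → ⊩ # 0 ≼ k ⊟ k) k)
              (P-cancel e (P-resp (*-comm (b - s) X) (all k)))) (proj₂ 𝔬s))) g)
          λ ()

      gain : ∀ {p} {M : Carrier → Set p}  {X Y X′ x y T} → M Y →
        Val Y (q₀ ℤ.+ + 3 ℤ.* y) → Val X′ (p₀ ℤ.+ + 3 ℤ.* (x ℤ.- 1ℤ)) →
        (∀ {u} → M u → ∃[ n ] ∃[ s ] InSpan 1# X Y n × 𝔬 s × u ≈ n + s * T) →
        M X′ → InSpan 1# X′ Y X → InSpan 1# X′ Y T → Span M p₀ q₀ (x ℤ.- 1ℤ) y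
      gain {X = X} {Y} {X′} {x} {y} {T} MY Y-val X′-val split MX′ X∈ T∈ = record
        { X-val = X′-val ; Y-val = Y-val ; MX = MX′ ; MY = MY
        ; spans = λ Mu → spans′ (split Mu) }
        where
        module S = IsModule (span-isModule 1# X′ Y)
        spans′ : ∀ {u} → (∃[ n ] ∃[ s ] InSpan 1# X Y n × 𝔬 s × u ≈ n + s * T) → InSpan 1# X′ Y u
        spans′ (n , s , n∈ , 𝔬s , e) = S.M-resp (sym e)
          (S.M-+ (span-elim (span-isModule 1# X′ Y) span₁ X∈ span₃ n∈) (S.M-𝔬* 𝔬s T∈))

      -- Here M′ = M + 𝔬T with T = bX + cY and v(b) = -3. If c is integral, then bX lies in M′ and
      -- replaces X. If v(X) < v(Y), then T itself replaces X, its leading term being bX because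
      -- v(c) ≥ -3. Multiplying by b⁻¹ recovers X in both cases.
      split-step : ∀ {p} {M M′ : Carrier → Set p} → IsModule M′ → ∀ {x y u} →
        (sp : Span M p₀ q₀ x y) → let open Span sp in (∀ {w} → M w → M′ w) →
        (D : Defect X Y u) → let open Defect D in M′ (b * X + c′ * Y) →
        (∀ {w} → M′ w → ∃[ n ] ∃[ s ] M n × 𝔬 s × w ≈ n + s * (b * X + c′ * Y)) →
        Val b (ℤ.- + 3) → P 0ℤ c′ ⊎ p₀ ℤ.+ + 3 ℤ.* x ℤ.+ 1ℤ ℤ.≤ q₀ ℤ.+ + 3 ℤ.* y →
        Span M′ p₀ q₀ (x ℤ.- 1ℤ) y
      split-step {M′ = M′} isM′ {x} {y} sp M⊂M′ D MT split b-val alternative = by alternative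
        where
        open Span sp
        open Defect D
        open IsModule isM′
        T : Carrier
        T = b * X + c′ * Y
        inv : ∃[ e ] 𝕂 e × b * e ≈ 1# × Val e (ℤ.- (ℤ.- + 3))
        inv = 𝕂-inverse 𝕂b b-val
        e : Carrier
        e = proj₁ inv
        be≈1 : b * e ≈ 1#
        be≈1 = proj₁ (proj₂ (proj₂ inv))
        𝔬e : 𝔬 e
        𝔬e = proj₁ (proj₂ inv) , Val⇒P≤ (proj₂ (proj₂ (proj₂ inv))) (ℤ.+≤+ ℕ.z≤n)
        𝔬ec : 𝔬 (e * c′)
        𝔬ec = 𝕂-* (proj₁ 𝔬e) 𝕂c , P-* (Val⇒P (proj₂ (proj₂ (proj₂ inv)))) P-c
        bX-val : Val (b * X) (p₀ ℤ.+ + 3 ℤ.* (x ℤ.- 1ℤ))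
        bX-val = ≡.subst (Val (b * X)) (lia 2 (λ p x → ⊩ neg # 3 ⊞ (p ⊞ + 3 ⊛ x) ≛ p ⊞ + 3 ⊛ (x ⊟ # 1)) p₀ x)
          (Val-* b-val X-val)
        split′ : ∀ {w} → M′ w → ∃[ n ] ∃[ s ] InSpan 1# X Y n × 𝔬 s × w ≈ n + s * T
        split′ M′w = let n , s , Mn , 𝔬s , eq = split M′w in n , s , spans Mn , 𝔬s , eq
        by : P 0ℤ c′ ⊎ p₀ ℤ.+ + 3 ℤ.* x ℤ.+ 1ℤ ℤ.≤ q₀ ℤ.+ + 3 ℤ.* y → Span M′ p₀ q₀ (x ℤ.- 1ℤ) y
        by (inj₁ pc) = gain {M = M′} {X} {Y} {b * X} {x} {y} {T} (M⊂M′ MY) Y-val bX-val split′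
          (M-resp (ring! 2 (λ u w → ⊢ u ⊕ w ⊖ w ≗ u) (b * X ∷ c′ * Y ∷ [])) (M-- MT (M-𝔬* (𝕂c , pc) (M⊂M′ MY))))
          (inSpan 𝔬-0 𝔬e 𝔬-0 (ring! 4 (λ X Y b e → (⊝ X) · b ⊗ e ≗ 𝟙 ⇒ ⊢ X ≗ 𝟘 ⊗ 𝟙 ⊕ e ⊗ (b ⊗ X) ⊕ 𝟘 ⊗ Y) (X ∷ Y ∷ b ∷ e ∷ []) be≈1))
          (inSpan 𝔬-0 𝔬-1 (𝕂c , pc) (ring! 4 (λ X Y b c → ⊢ b ⊗ X ⊕ c ⊗ Y ≗ 𝟘 ⊗ 𝟙 ⊕ 𝟙 ⊗ (b ⊗ X) ⊕ c ⊗ Y) (X ∷ Y ∷ b ∷ c′ ∷ [])))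
        by (inj₂ p<q) = gain {M = M′} {X} {Y} {T} {x} {y} {T} (M⊂M′ MY) Y-val
          (Val-+ bX-val (P-mono (lia 4 (λ p q x y → p ⊞ + 3 ⊛ x ⊞ # 1 ≼ q ⊞ + 3 ⊛ y ⇒
              ⊩ p ⊞ + 3 ⊛ (x ⊟ # 1) ⊞ # 1 ≼ neg # 3 ⊞ (q ⊞ + 3 ⊛ y)) p₀ q₀ x y p<q)
            (P-* P-c (Val⇒P Y-val))))
          split′ MT
          (inSpan 𝔬-0 𝔬e (𝔬-neg 𝔬ec) (ring! 5 (λ X Y b c e → (⊝ X) · b ⊗ e ≗ 𝟙 ⇒
            ⊢ X ≗ 𝟘 ⊗ 𝟙 ⊕ e ⊗ (b ⊗ X ⊕ c ⊗ Y) ⊕ (⊝ (e ⊗ c)) ⊗ Y) (X ∷ Y ∷ b ∷ c′ ∷ e ∷ []) be≈1))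
          (inSpan 𝔬-0 𝔬-1 𝔬-0 (ring! 2 (λ T Y → ⊢ T ≗ 𝟘 ⊗ 𝟙 ⊕ 𝟙 ⊗ T ⊕ 𝟘 ⊗ Y) (T ∷ Y ∷ [])))

    Span-swap : ∀ {p} {M : Carrier → Set p} {p₀ q₀ x y} → Span M p₀ q₀ x y → Span M q₀ p₀ y x
    Span-swap sp = record { X-val = Y-val ; Y-val = X-val ; MX = MY ; MY = MX
      ; spans = λ Mu → span-elim (span-isModule _ _ _) span₁ span₃ span₂ (spans Mu) }
      where open Span sp

    Residues-swap : ∀ {p₀ q₀} → Residues p₀ q₀ → Residues q₀ p₀
    Residues-swap {p₀} {q₀} (residues z≢p z≢q p≢q) = residues z≢q z≢p λ j e → p≢q (ℤ.- j)
      (lia 3 (λ p q j → q ≛ p ⊞ + 3 ⊛ j ⇒ ⊩ p ≛ q ⊞ + 3 ⊛ (neg j)) p₀ q₀ j e)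

    Defect-swap : ∀ {p₀ q₀} (res : Residues p₀ q₀) {X Y u} → Defect res X Y u → Defect (Residues-swap res) Y X u
    Defect-swap res D = record { 𝔬d = 𝔬d ; 𝔬r = 𝔬r ; 𝕂b = 𝕂c ; 𝕂c = 𝕂b ; T≈ = trans T≈ (+-comm _ _)
      ; P-b = P-c ; P-c = P-b ; leading = [ inj₂ , inj₁ ]′ leading }
      where open Defect D

    module _ {p₀ q₀} (res : Residues p₀ q₀) where

      -- By simplicity any T in M′ outside M satisfies M′ = M + 𝔬T; the defect of an element outside
      -- M provides one with controlled coefficients. Adding it lowers exactly one of the two
      -- valuations by exactly 3.
      simple-step : ∀ {p} {M M′ : Carrier → Set p} → IsModule M → IsModule M′ → M 1# → (∀ {w} → M w → M′ w) →
        (∀ {w} → M′ w → P 0ℤ w) → ∀ {x y u} → Span M p₀ q₀ x y → M′ u → ¬ M u →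
        (∀ {T} → M′ T → ¬ M T → ∀ {w} → M′ w → ∃[ n ] ∃[ s ] M n × 𝔬 s × w ≈ n + s * T) →
        ∃[ x′ ] ∃[ y′ ] Span M′ p₀ q₀ x′ y′ × x′ ℤ.+ y′ ℤ.+ 1ℤ ≡ x ℤ.+ y
      simple-step {M = M} {M′} isM isM′ M1 M⊂M′ M′⊂P0 {x} {y} {u} sp M′u ¬Mu simple =
        conclude leading (P? 0ℤ b) (P? 0ℤ c′) (ℤₚ.<-cmp (p₀ ℤ.+ + 3 ℤ.* x) (q₀ ℤ.+ + 3 ℤ.* y))
        where
        open Span sp
        D : Defect res X Y u
        D = defect res X-val Y-val (M′⊂P0 M′u) (λ u∈ → ¬Mu (span-elim isM M1 MX MY u∈))
        open Defect D
        T : Carrier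
        T = b * X + c′ * Y
        M′T : M′ T
        M′T = IsModule.M-resp isM′ T≈ (IsModule.M-𝔬* isM′ 𝔬d (IsModule.M-- isM′ M′u
          (IsModule.M-resp isM′ (*-identityʳ r) (IsModule.M-𝔬* isM′ 𝔬r (M⊂M′ M1)))))
        split : ∀ {w} → M′ w → ∃[ n ] ∃[ s ] M n × 𝔬 s × w ≈ n + s * T
        split = simple M′T (λ MT → defect∉ res X-val Y-val D (spans MT))
        flipped : ∀ {w} → M′ w → ∃[ n ] ∃[ s ] M n × 𝔬 s × w ≈ n + s * (c′ * Y + b * X)
        flipped M′w = let n , s , Mn , 𝔬s , e = split M′w in
          n , s , Mn , 𝔬s , trans e (+-congˡ (*-congˡ (+-comm _ _)))
        Result : Set _
        Result = ∃[ x′ ] ∃[ y′ ] Span M′ p₀ q₀ x′ y′ × x′ ℤ.+ y′ ℤ.+ 1ℤ ≡ x ℤ.+ y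
        gain-X : Val b (ℤ.- + 3) → P 0ℤ c′ ⊎ p₀ ℤ.+ + 3 ℤ.* x ℤ.+ 1ℤ ℤ.≤ q₀ ℤ.+ + 3 ℤ.* y → Result
        gain-X e h = x ℤ.- 1ℤ , y , split-step res isM′ sp M⊂M′ D M′T split e h
          , lia 2 (λ x y → ⊩ x ⊟ # 1 ⊞ y ⊞ # 1 ≛ x ⊞ y) x y
        gain-Y : Val c′ (ℤ.- + 3) → P 0ℤ b ⊎ q₀ ℤ.+ + 3 ℤ.* y ℤ.+ 1ℤ ℤ.≤ p₀ ℤ.+ + 3 ℤ.* x → Result
        gain-Y e h = x , y ℤ.- 1ℤ , Span-swap (split-step (Residues-swap res) isM′ (Span-swap sp) M⊂M′
            (Defect-swap res D) (IsModule.M-resp isM′ (+-comm _ _) M′T) flipped e h)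
          , lia 2 (λ x y → ⊩ x ⊞ (y ⊟ # 1) ⊞ # 1 ≛ x ⊞ y) x y
        sharp : ∀ {b} → 𝕂 b → P (ℤ.- + 3) b → ¬ P 0ℤ b → Val b (ℤ.- + 3)
        sharp 𝕂b p ¬p with nonintegral res 𝕂b ¬p
        ... | j , e , j<0 = ≡.subst (Val _) (lia 1 (λ j → neg # 3 ≼ + 3 ⊛ j ⇒ j ⊞ # 1 ≼ # 0 ⇒
          ⊩ + 3 ⊛ j ≛ neg # 3) j (P-Val p e) j<0) e
        conclude : Val b (ℤ.- + 3) ⊎ Val c′ (ℤ.- + 3) → Dec (P 0ℤ b) → Dec (P 0ℤ c′) →
          Relation.Binary.Definitions.Tri (p₀ ℤ.+ + 3 ℤ.* x ℤ.< q₀ ℤ.+ + 3 ℤ.* y)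
            (p₀ ℤ.+ + 3 ℤ.* x ≡ q₀ ℤ.+ + 3 ℤ.* y) (q₀ ℤ.+ + 3 ℤ.* y ℤ.< p₀ ℤ.+ + 3 ℤ.* x) → Result
        conclude (inj₁ e) _ (yes pc) _ = gain-X e (inj₁ pc)
        conclude (inj₂ e) (yes pb) _ _ = gain-Y e (inj₁ pb)
        -- Both coefficients now have valuation -3, so the basis vector of smaller valuation carries
        -- the leading term and is the one to be replaced.
        conclude _ (no ¬pb) (no ¬pc) (tri< p<q _ _) = gain-X (sharp 𝕂b P-b ¬pb) (inj₂ (<⇒+1≤ p<q))
        conclude _ (no ¬pb) (no ¬pc) (tri> _ _ q<p) = gain-Y (sharp 𝕂c P-c ¬pc) (inj₂ (<⇒+1≤ q<p))
        conclude _ (no ¬pb) (no ¬pc) (tri≈ _ p≡q _) = contradiction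
          (lia 4 (λ p q x y → p ⊞ + 3 ⊛ x ≛ q ⊞ + 3 ⊛ y ⇒ ⊩ p ≛ q ⊞ + 3 ⊛ (y ⊟ x)) p₀ q₀ x y p≡q)
          (Residues.p≢q res (y ℤ.- x))
        conclude (inj₁ e) (yes pb) (no _) _ = contradiction (P-Val pb e) λ ()
        conclude (inj₂ e) (no _) (yes pc) _ = contradiction (P-Val pc e) λ ()

    residues₀ : Residues ρ₀ (ℤ.- ρ₀)
    residues₀ = residues z₀≢x₀ z₀≢y₀ x₀≢y₀
      where open Triple (FrameProperties.basis θ-frame)

    R-span : Span R ρ₀ (ℤ.- ρ₀) a₀ b₀
    R-span with element (high ρ₀ b₀)
    ... | Y , Y-val = record
      { X-val = θ.X-val ; Y-val = Y-val ; MX = θ∈R ; MY = Lat⇒R (Lat-P (Val⇒P Y-val))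
      ; spans = λ Ru → Lat⇒span θ-frame Y-val (R⇒Lat Ru) }

    -- The smallest nonnegative valuations in the classes of ρ₀ and -ρ₀ are ρ₀ and 3 - ρ₀, that is,
    -- `low ρ₀ 0` and `high ρ₀ 1`.
    𝒪-span : ∀ {p} {M : Carrier → Set p} {x y} → (∀ {u} → M u → P 0ℤ u) → (∀ {u} → P 0ℤ u → M u) →
      Span M ρ₀ (ℤ.- ρ₀) x y → x ≡ 0ℤ × y ≡ 1ℤ
    𝒪-span {M = M} {x} {y} M⊂P0 P0⊂M sp = ℤₚ.≤-antisym x≤0 0≤x , ℤₚ.≤-antisym y≤1 1≤y
      where
      open Span sp
      0≤x : 0ℤ ℤ.≤ x
      0≤x = lia 2 (λ ρ x → # 0 ≼ ρ ⊞ + 3 ⊛ x ⇒ ρ ≼ # 2 ⇒ ⊩ # 0 ≼ x) ρ₀ x (P-Val (M⊂P0 MX) X-val) θ.ρ≤2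
      1≤y : 1ℤ ℤ.≤ y
      1≤y = lia 2 (λ ρ y → # 0 ≼ neg ρ ⊞ + 3 ⊛ y ⇒ # 1 ≼ ρ ⇒ ⊩ # 1 ≼ y) ρ₀ y (P-Val (M⊂P0 MY) Y-val) θ.1≤ρ
      x≤0 : x ℤ.≤ 0ℤ
      x≤0 with element (low ρ₀ 0ℤ)
      ... | u , e = span-least residues₀ X-val Y-val (spans (P0⊂M (Val⇒P≤ e
        (lia 1 (λ ρ → # 1 ≼ ρ ⇒ ⊩ # 0 ≼ ρ ⊞ + 3 ⊛ # 0) ρ₀ θ.1≤ρ)))) e
      y≤1 : y ℤ.≤ 1ℤ
      y≤1 with element (high ρ₀ 1ℤ)
      ... | u , e = span-least (Residues-swap residues₀) Y-val X-val (Span.spans (Span-swap sp) (P0⊂M (Val⇒P≤ e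
        (lia 1 (λ ρ → ρ ≼ # 2 ⇒ ⊩ # 0 ≼ neg ρ ⊞ + 3 ⊛ # 1) ρ₀ θ.ρ≤2)))) e

    module _ {s : ℕ} (length : HasLength (𝒪E/R E/F 𝓡) s) where
      open HasLength length

      private
        -- The preimage in 𝒪_E of the i-th module of the composition series. It contains R, hence 1.
        Member : Fin (ℕ.suc s) → Carrier → Set (c ⊔ ℓ)
        Member i u = Σ (P 0ℤ u) λ p → N i (u , p)

        0∼ : ∀ {u w} → u ≈ w → R (u - w)
        0∼ {u} {w} u≈w = R.resp (trans (sym (-‿inverseʳ w)) (+-congʳ (sym u≈w))) R.0-closed

        Member-R : ∀ i {u} → R u → Member i u
        Member-R i {u} Ru = R⊂P0 Ru , IsSubmodule.resp (isSubmodule i)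
          (R.resp (ring! 1 (λ u → ⊢ ⊝ u ≗ 𝟘 ⊖ u) (u ∷ [])) (R.neg-closed Ru)) (IsSubmodule.0-closed (isSubmodule i))

        Member-isModule : ∀ i → IsModule (Member i)
        Member-isModule i = record
          { M-resp = λ u≈w (p , Nu) → P-resp u≈w p , I.resp (0∼ u≈w) Nu
          ; M-+    = λ (p , Nu) (q , Nw) → P-+ p q , I.resp (0∼ refl) (I.+-closed Nu Nw)
          ; M-𝔬*   = λ 𝔬t (p , Nu) → let a , a∈𝒪 , ιa≈t = 𝔬-ι 𝔬t in
              P-0* (proj₂ 𝔬t) p , I.resp (0∼ (*-congʳ ιa≈t)) (I.*-closed (a , a∈𝒪) Nu)
          }
          where module I = IsSubmodule (isSubmodule i)

        -- The submodule Nᵢ + 𝔬T, to which maximality is applied: it contains Nᵢ properly if T lies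
        -- outside, and is then the whole next module.
        Extended : Fin (ℕ.suc s) → Carrier → Σ Carrier (P 0ℤ) → Set (c ⊔ ℓ)
        Extended i T (u , _) = ∃[ n ] ∃[ t ] Member i n × 𝔬 t × u ≈ n + t * T

        Extended-isSubmodule : ∀ i T → IsSubmodule (𝒪E/R E/F 𝓡) (Extended i T)
        Extended-isSubmodule i T = record
          { resp       = λ { {u , _} {w , _} u-w (n , t , Mn , 𝔬t , e) → n - (u - w) , t
              , M-- Mn (Member-R i u-w) , 𝔬t
              , ring! 5 (λ u w n t T → 𝟙 · u ≗ n ⊕ t ⊗ T ⇒ ⊢ w ≗ n ⊖ (u ⊖ w) ⊕ t ⊗ T) (u ∷ w ∷ n ∷ t ∷ T ∷ []) e }
          ; 0-closed   = 0# , 0# , Member-R i R.0-closed , 𝔬-0 , ring! 1 (λ T → ⊢ 𝟘 ≗ 𝟘 ⊕ 𝟘 ⊗ T) (T ∷ [])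
          ; +-closed   = λ { (n , t , Mn , 𝔬t , e) (n′ , t′ , Mn′ , 𝔬t′ , e′) → n + n′ , t + t′ , M-+ Mn Mn′ , 𝔬-+ 𝔬t 𝔬t′
              , trans (+-cong e e′) (ring! 5 (λ n n′ t t′ T → ⊢ (n ⊕ t ⊗ T) ⊕ (n′ ⊕ t′ ⊗ T) ≗ n ⊕ n′ ⊕ (t ⊕ t′) ⊗ T)
                  (n ∷ n′ ∷ t ∷ t′ ∷ T ∷ [])) }
          ; neg-closed = λ { (n , t , Mn , 𝔬t , e) → - n , - t
              , M-resp (ring! 1 (λ n → ⊢ ⊝ 𝟙 ⊗ n ≗ ⊝ n) (n ∷ [])) (M-𝔬* (𝔬-neg 𝔬-1) Mn) , 𝔬-neg 𝔬t
              , trans (-‿cong e) (ring! 3 (λ n t T → ⊢ ⊝ (n ⊕ t ⊗ T) ≗ ⊝ n ⊕ ⊝ t ⊗ T) (n ∷ t ∷ T ∷ [])) }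
          ; *-closed   = λ { (a , a∈𝒪) (n , t , Mn , 𝔬t , e) → ι a * n , ι a * t , M-𝔬* (ι-𝔬 a∈𝒪) Mn , 𝔬-* (ι-𝔬 a∈𝒪) 𝔬t
              , trans (*-congˡ e) (ring! 4 (λ a n t T → ⊢ a ⊗ (n ⊕ t ⊗ T) ≗ a ⊗ n ⊕ a ⊗ t ⊗ T) (ι a ∷ n ∷ t ∷ T ∷ [])) }
          }
          where open IsModule (Member-isModule i)

        Dropped : Fin (ℕ.suc s) → Set (c ⊔ ℓ)
        Dropped i = ∃[ x ] ∃[ y ] Span (Member i) ρ₀ (ℤ.- ρ₀) x y × x ℤ.+ y ℤ.+ + toℕ i ≡ a₀ ℤ.+ b₀

        base : Dropped zero
        base = a₀ , b₀ , record
          { X-val = X-val ; Y-val = Y-val ; MX = Member-R zero MX ; MY = Member-R zero MY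
          ; spans = λ (p , Nu) → spans (R.resp (ring! 1 (λ u → ⊢ u ⊖ 𝟘 ≗ u) (_ ∷ [])) (bottom Nu)) }
          , ℤₚ.+-identityʳ _
          where open Span R-span

        drop : ∀ i → Dropped (inject₁ i) → Dropped (suc i)
        drop i (x , y , sp , eq) with simple-step residues₀ (Member-isModule (inject₁ i)) (Member-isModule (suc i))
            (Member-R (inject₁ i) R.1-closed) M⊂M′ proj₁ sp
            (proj₂ u , proj₁ (proj₂ (proj₂ (strict i))))
            (λ (p , Nu) → proj₂ (proj₂ (proj₂ (strict i))) (IsSubmodule.resp (isSubmodule (inject₁ i)) (0∼ refl) Nu)) simple
          where
          u : Σ Carrier (P 0ℤ)
          u = proj₁ (proj₂ (strict i))
          M⊂M′ : ∀ {w} → Member (inject₁ i) w → Member (suc i) w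
          M⊂M′ (p , Nw) = p , proj₁ (strict i) Nw
          simple : ∀ {T} → Member (suc i) T → ¬ Member (inject₁ i) T → ∀ {w} → Member (suc i) w →
            ∃[ n ] ∃[ t ] Member (inject₁ i) n × 𝔬 t × w ≈ n + t * T
          simple {T} MT ¬MT (p , Nw) = maximal i (Extended (inject₁ i) T) (Extended-isSubmodule (inject₁ i) T)
            ( (λ {w} Nw → proj₁ w , 0# , (proj₂ w , Nw) , 𝔬-0 , ring! 2 (λ w T → ⊢ w ≗ w ⊕ 𝟘 ⊗ T) (proj₁ w ∷ T ∷ []))
            , (T , proj₁ MT) , (0# , 1# , Member-R (inject₁ i) R.0-closed , 𝔬-1 , ring! 1 (λ T → ⊢ T ≗ 𝟘 ⊕ 𝟙 ⊗ T) (T ∷ []))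
            , λ NT → ¬MT (proj₁ MT , NT) )
            (λ { {w} (n , t , Mn , 𝔬t , e) → IsSubmodule.resp (isSubmodule (suc i)) (0∼ (sym e))
              (proj₂ (IsModule.M-+ (Member-isModule (suc i)) (M⊂M′ Mn) (IsModule.M-𝔬* (Member-isModule (suc i)) 𝔬t MT))) })
            Nw
        ... | x′ , y′ , sp′ , eq′ = x′ , y′ , sp′
          , lia 7 (λ x y x′ y′ i S j → x′ ⊞ y′ ⊞ # 1 ≛ x ⊞ y ⇒ x ⊞ y ⊞ j ≛ S ⇒ j ≛ i ⇒
              ⊩ x′ ⊞ y′ ⊞ (# 1 ⊞ i) ≛ S) x y x′ y′ (+ toℕ i) (a₀ ℤ.+ b₀) (+ toℕ (inject₁ i)) eq′ eq
              (≡.cong +_ (toℕ-inject₁ i))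

      abstract
        -- Each of the s steps lowers the sum of the two indices by 1, from a₀ + b₀ for R down to 0
        -- + 1 for 𝒪_E.
        a₀+b₀≡1+s : a₀ ℤ.+ b₀ ≡ 1ℤ ℤ.+ + s
        a₀+b₀≡1+s with <-weakInduction Dropped base drop (fromℕ s)
        ... | x , y , sp , eq with 𝒪-span proj₁ (λ p → p , top (_ , p)) sp
        ...   | ≡.refl , ≡.refl = ≡.trans (≡.sym eq) (≡.cong (λ n → 1ℤ ℤ.+ + n) (toℕ-fromℕ s))

-- The conductor exponent in terms of B.

module Conductor where

  open import Data.Nat.Base as ℕ using (ℕ; zero; suc)
  open import Function.Bundles using (Equivalence)
  open Extension
  open Lattice
  open Reduction
  open Normal
  open Orders

  module OrderConductor {c ℓ} (F E : LocalField c ℓ) (E/F : TotallyRamifiedExtension F E 3) (𝓡 : Order E/F) where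
    open Ramified F E E/F
    open Lattices F E E/F
    open OrderStructure F E E/F 𝓡
    open import Algebra.Properties.Semiring.Exp semiring using (_^_)

    Val-^ : ∀ {π} → Val π 1ℤ → ∀ n → Val (π ^ n) (+ n)
    Val-^ e zero    = Val-1
    Val-^ e (suc n) = Val-* e (Val-^ e n)

    module _ {f : ℕ} (conductor : IsConductorExponent E/F 𝓡 f) where
      private
        B : ℤ
        B = high ρ₀ b₀
        π : Carrier
        π = proj₁ normalised
        conductor-π : ∀ a → _
        conductor-π = conductor π (proj₂ normalised)

        -- R contains { v ≥ B - 2 }, so an element of valuation B - 2 multiplies 𝒪_E into R and must
        -- be divisible by the f-th power of the uniformiser.
        f≤ : + f ℤ.≤ B ℤ.- + 2
        f≤ with element (B ℤ.- + 2)
        ... | a , a-val with Equivalence.to (conductor-π a)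
              ( Val⇒P≤ a-val 0≤ , λ {b} b∈𝒪 → Lat⇒R (FrameProperties.P-2⇒Lat θ-frame
                  (P-resp (*-comm b a) (P-0* b∈𝒪 (Val⇒P a-val)))))
          where
          0≤ : 0ℤ ℤ.≤ B ℤ.- + 2
          0≤ = lia 2 (λ A B → # 1 ≼ A ⇒ A ⊞ # 1 ≼ B ⇒ ⊩ # 0 ≼ B ⊟ # 2) (low ρ₀ a₀) B θ.1≤A θ.A<B
        ...   | b , b∈𝒪 , a≈ = lia 2 (λ f B → f ⊞ # 0 ≼ B ⊟ # 2 ⇒ ⊩ f ≼ B ⊟ # 2) (+ f) B
          (P-Val (P-resp (sym a≈) (P-* (Val⇒P (Val-^ (proj₂ normalised) f)) b∈𝒪)) a-val)

        ≤f : B ℤ.- + 2 ℤ.≤ + f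
        ≤f with B ℤ.- + 2 ℤₚ.≤? + f
        ... | yes p = p
        -- If f < B - 2, the integral factor chosen here makes an element of R of valuation B - 3.
        -- That valuation lies in the class of B but below B, against `high-bound`.
        ... | no ¬p with element (B ℤ.- + 3 ℤ.- + f)
        ...   | b , b-val = contradiction
          (FrameProperties.high-bound θ-frame {m = b₀ ℤ.- 1ℤ} (R⇒Lat (proj₂ π^f∈ b∈𝒪))
            (≡.subst (Val (π ^ f * b)) (lia 3 (λ ρ b f → ⊩ f ⊞ (neg ρ ⊞ + 3 ⊛ b ⊟ # 3 ⊟ f) ≛ neg ρ ⊞ + 3 ⊛ (b ⊟ # 1)) ρ₀ b₀ (+ f))
              (Val-* (Val-^ (proj₂ normalised) f) b-val)))
          (λ h → 1≰0 (lia 1 (λ b → b ≼ b ⊟ # 1 ⇒ ⊩ # 1 ≼ # 0) b₀ h))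
          where
          b∈𝒪 : P 0ℤ b
          b∈𝒪 = Val⇒P≤ b-val (lia 2 (λ B f → f ⊞ # 1 ≼ B ⊟ # 2 ⇒ ⊩ # 0 ≼ B ⊟ # 3 ⊟ f) B (+ f) (<⇒+1≤ (ℤₚ.≰⇒> ¬p)))
          π^f∈ : P 0ℤ (π ^ f) × (∀ {b} → P 0ℤ b → Order.R 𝓡 (π ^ f * b))
          π^f∈ = Equivalence.from (conductor-π (π ^ f)) (1# , P-1 , sym (*-identityʳ _))

      abstract
        f≡B-2 : + f ≡ high ρ₀ b₀ ℤ.- + 2
        f≡B-2 = ℤₚ.≤-antisym f≤ ≤f

-- Representatives of 𝔬 modulo powers of ϖ.

module Digits where

  open import Data.Fin.Base using (Fin; zero; suc; remQuot; combine)
  open import Data.Fin.Properties using (remQuot-combine; combine-remQuot)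
  open import Data.Nat.Base as ℕ using (ℕ; zero; suc)
  open import Algebra.Morphism.Structures using (module RingMorphisms)
  open import Function.Bundles using (Bijection)
  open Valued
  open Extension

  module DigitExpansions {c ℓ} (F E : LocalField c ℓ) (E/F : TotallyRamifiedExtension F E 3) where
    open Ramified F E E/F
    private
      module F = LocalField F
      module VF = ValuedField F.commutativeRing F.isField F.discreteValuation
      module ι = RingMorphisms.IsRingHomomorphism ι-homo
      module B = Bijection F.residueField-card

      q : ℕ
      q = F.q

      ϖ : Carrier
      ϖ = proj₁ (𝕂-element 1ℤ)

      𝔬ϖ : 𝔬 ϖ
      𝔬ϖ = proj₁ (proj₂ (𝕂-element 1ℤ)) , Val⇒P≤ (proj₂ (proj₂ (𝕂-element 1ℤ))) (ℤ.+≤+ ℕ.z≤n)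

      ϖ-val : Val ϖ (+ 3)
      ϖ-val = proj₂ (proj₂ (𝕂-element 1ℤ))

      ι-minus : ∀ a b → ι (a F.- b) ≈ ι a - ι b
      ι-minus a b = trans (ι.+-homo a _) (+-congˡ (ι.-‿homo b))

      ι-P : ∀ {k a} → VF.P k a → P (+ 3 ℤ.* k) (ι a)
      ι-P {k} {a} p with VF.zero-or-Val a
      ... | inj₁ a≈0     = P-≈0 (ι-0 a≈0)
      ... | inj₂ (j , e) = Val⇒P≤ (ι-Val e)
        (lia 2 (λ k j → k ≼ j ⇒ ⊩ + 3 ⊛ k ≼ + 3 ⊛ j) k j (VF.P-Val p e))

      ι-P⁻¹ : ∀ {k a} → P (+ 3 ℤ.* k ℤ.- + 2) (ι a) → VF.P k a
      ι-P⁻¹ {k} {a} p with VF.zero-or-Val a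
      ... | inj₁ a≈0     = VF.P-≈0 a≈0
      ... | inj₂ (j , e) = VF.Val⇒P≤ e
        (lia 2 (λ k j → + 3 ⊛ k ⊟ # 2 ≼ + 3 ⊛ j ⇒ ⊩ k ≼ j) k j (P-Val p (ι-Val e)))

    digit : Fin q → Carrier
    digit i = ι (proj₁ (B.to i))

    𝔬-digit : ∀ i → 𝔬 (digit i)
    𝔬-digit i = ι-𝔬 (proj₂ (B.to i))

    digit-injective : ∀ {i j} → P (+ 3) (digit i - digit j) → i ≡ j
    digit-injective {i} {j} p = B.injective (ι-P⁻¹ {1ℤ} (P-mono (ℤ.+≤+ (ℕ.s≤s ℕ.z≤n)) (P-resp (sym (ι-minus _ _)) p)))

    digit-surjective : ∀ {x} → 𝔬 x → ∃[ i ] P (+ 3) (x - digit i)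
    digit-surjective {x} 𝔬x with 𝔬-ι 𝔬x
    ... | a , a∈𝒪 , ιa≈x with B.surjective (a , a∈𝒪)
    ...   | i , h = i , P-resp (ring! 2 (λ x y → ⊢ ⊝ (y ⊖ x) ≗ x ⊖ y) (x ∷ digit i ∷ []))
      (P-neg (P-resp (trans (ι-minus _ _) (+-congˡ (-‿cong ιa≈x))) (ι-P {1ℤ} (h ≡.refl))))

    -- Truncated ϖ-adic expansions in Horner form, lowest digit first: a complete system of
    -- representatives for 𝔬/ϖᵉ𝔬. Congruence modulo ϖᵉ is valuation 3e in `E`.
    representative : ∀ e → Fin (q ℕ.^ e) → Carrier
    representative zero    _ = 0#
    representative (suc e) x =
      digit (proj₁ (remQuot {q} (q ℕ.^ e) x)) + ϖ * representative e (proj₂ (remQuot {q} (q ℕ.^ e) x))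

    𝔬-representative : ∀ e x → 𝔬 (representative e x)
    𝔬-representative zero    x = 𝔬-0
    𝔬-representative (suc e) x = 𝔬-+ (𝔬-digit _) (𝔬-* 𝔬ϖ (𝔬-representative e _))

    private
      suc-3* : ∀ e → + 3 ℤ.* + suc e ≡ + 3 ℤ.+ + 3 ℤ.* + e
      suc-3* e = lia 1 (λ e → ⊩ + 3 ⊛ (# 1 ⊞ e) ≛ # 3 ⊞ + 3 ⊛ e) (+ e)

      leading : ∀ e {i j} (x y : Fin (q ℕ.^ e)) →
        P (+ 3 ℤ.* + suc e) ((digit i + ϖ * representative e x) - (digit j + ϖ * representative e y)) → i ≡ j
      leading e {i} {j} x y p = digit-injective (P-resp
        (ring! 5 (λ a b w x y → ⊢ ((a ⊕ w ⊗ x) ⊖ (b ⊕ w ⊗ y)) ⊖ w ⊗ (x ⊖ y) ≗ a ⊖ b)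
          (digit i ∷ digit j ∷ ϖ ∷ representative e x ∷ representative e y ∷ []))
        (P-- (P-mono (lia 1 (λ e → # 0 ≼ e ⇒ ⊩ # 3 ≼ + 3 ⊛ (# 1 ⊞ e)) (+ e) (ℤ.+≤+ ℕ.z≤n)) p)
             (P-* (Val⇒P ϖ-val) (proj₂ (𝔬-- (𝔬-representative e x) (𝔬-representative e y))))))

    representative-injective : ∀ e {x y} → P (+ 3 ℤ.* + e) (representative e x - representative e y) → x ≡ y
    representative-injective zero {zero} {zero} _ = ≡.refl
    representative-injective (suc e) {x} {y} p =
      ≡.trans (≡.sym (combine-remQuot {q} (q ℕ.^ e) x))
        (≡.trans (≡.cong₂ combine i≡j x′≡y′) (combine-remQuot {q} (q ℕ.^ e) y))
      where
      i j : Fin q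
      i = proj₁ (remQuot {q} (q ℕ.^ e) x)
      j = proj₁ (remQuot {q} (q ℕ.^ e) y)
      x′ y′ : Fin (q ℕ.^ e)
      x′ = proj₂ (remQuot {q} (q ℕ.^ e) x)
      y′ = proj₂ (remQuot {q} (q ℕ.^ e) y)
      i≡j : i ≡ j
      i≡j = leading e x′ y′ p
      x′≡y′ : x′ ≡ y′
      x′≡y′ = representative-injective e (P-mono
        (lia 1 (λ e → ⊩ + 3 ⊛ e ≼ + 3 ⊛ (# 1 ⊞ e) ⊟ # 3) (+ e))
        (P-cancel ϖ-val (P-resp
          (ring! 5 (λ a b w x y → 𝟙 · a ≗ b ⇒ ⊢ (a ⊕ w ⊗ x) ⊖ (b ⊕ w ⊗ y) ≗ w ⊗ (x ⊖ y))
            (digit i ∷ digit j ∷ ϖ ∷ representative e x′ ∷ representative e y′ ∷ []) (reflexive (≡.cong digit i≡j))) p)))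

    representative-surjective : ∀ e {c} → 𝔬 c → ∃[ x ] P (+ 3 ℤ.* + e) (c - representative e x)
    representative-surjective zero    {c} 𝔬c = zero , P-resp (ring! 1 (λ c → ⊢ c ≗ c ⊖ 𝟘) (c ∷ [])) (proj₂ 𝔬c)
    representative-surjective (suc e) {c} 𝔬c with digit-surjective 𝔬c | 𝕂-inverse (proj₁ 𝔬ϖ) ϖ-val
    ... | i , p | w , 𝕂w , ϖw≈1 , w-val with representative-surjective e {w * (c - digit i)}
          (𝕂-* 𝕂w (𝕂-- (proj₁ 𝔬c) (proj₁ (𝔬-digit i))) , P-* (Val⇒P w-val) p)
    ...   | x , p′ = combine i x , ≡.subst (λ ix → P (+ 3 ℤ.* + suc e) (c - (digit (proj₁ ix) + ϖ * representative e (proj₂ ix))))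
      (≡.sym (remQuot-combine i x))
      (P-resp (ring! 5 (λ c i ϖ w x → (c ⊖ i) · ϖ ⊗ w ≗ 𝟙 ⇒ ⊢ ϖ ⊗ (w ⊗ (c ⊖ i) ⊖ x) ≗ c ⊖ (i ⊕ ϖ ⊗ x))
          (c ∷ digit i ∷ ϖ ∷ w ∷ representative e x ∷ []) ϖw≈1)
        (≡.subst (λ k → P k (ϖ * (w * (c - digit i) - representative e x))) (≡.sym (suc-3* e)) (P-* (Val⇒P ϖ-val) p′)))

-- Parametrisation of lattices by one coefficient.

module Charts where

  open import Data.Empty using (⊥)
  open Extension
  open Lattice
  open Similarity

  module LatticeCharts {c ℓ} (F E : LocalField c ℓ) (E/F : TotallyRamifiedExtension F E 3) where
    open Ramified F E E/F
    open Lattices F E E/F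
    open Homotheties F E E/F

    abstract
      -- This plays the part of ϖᵏ. Only membership in the base field and the valuation are exposed.
      τ : ℤ → Carrier
      τ k = proj₁ (𝕂-element k)

      𝕂τ : ∀ k → 𝕂 (τ k)
      𝕂τ k = proj₁ (proj₂ (𝕂-element k))

      τ-val : ∀ k → Val (τ k) (+ 3 ℤ.* k)
      τ-val k = proj₂ (proj₂ (𝕂-element k))

    -- A chart (P, Q) parametrises the lattices 𝔬 + 𝔬X + {v ≥ B} by X = ϖ⁻ᵏ(P + cQ).
    record Chart (ρ p r : ℤ) : Set c where
      field
        {P₁ Q} : Carrier
        P-val  : Val P₁ (low ρ p)
        Q-val  : Val Q (high ρ r)
        1≤ρ    : 1ℤ ℤ.≤ ρ
        ρ≤2    : ρ ℤ.≤ + 2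

    module ChartProperties {ρ p r} (chart : Chart ρ p r) where
      open Chart chart

      basis : Triple 0ℤ ρ (ℤ.- ρ)
      basis = triple {z = 0ℤ} {p} {r} Val-1 P-val Q-val 1≤ρ ρ≤2

      shape : ℤ → Carrier → Carrier
      shape k c = τ (ℤ.- k) * (P₁ + c * Q)

      -- The strict bound v(tQ) > v(P₁) makes P₁ the leading term of every shape, so the valuation
      -- of a shape depends on k alone.
      Admissible : Carrier → Set (c ⊔ ℓ)
      Admissible t = 𝕂 t × P (low ρ p ℤ.+ 1ℤ) (t * Q)

      private
        multiple : ∀ {x y n} → P (low ρ p ℤ.+ 1ℤ) y → P n (x * P₁) → P n (x * y)
        multiple {x} {y} {n} py px = P-mono (lia 2 (λ n p → ⊩ n ≼ n ⊟ p ⊞ (p ⊞ # 1)) n (low ρ p))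
          (P-* (P-cancel P-val (P-resp (*-comm x P₁) px)) py)

      shape-frame : ∀ {k b t} → Admissible t → 1ℤ ℤ.≤ low ρ (p ℤ.- k) → low ρ (p ℤ.- k) ℤ.+ 1ℤ ℤ.≤ high ρ b →
        Frame (shape k t) ρ (p ℤ.- k) b
      shape-frame {k} {b} {t} (_ , tQ-P) 1≤A A<B = record
        { X-val = ≡.subst (Val (shape k t))
            (lia 3 (λ ρ p k → ⊩ + 3 ⊛ (neg k) ⊞ (ρ ⊞ + 3 ⊛ p) ≛ ρ ⊞ + 3 ⊛ (p ⊟ k)) ρ p k)
            (Val-* (τ-val (ℤ.- k)) (Val-+ P-val tQ-P))
        ; 1≤ρ = 1≤ρ ; ρ≤2 = ρ≤2 ; 1≤A = 1≤A ; A<B = A<B }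

      shape-difference : ∀ k t t′ → shape k t - shape k t′ ≈ τ (ℤ.- k) * ((t - t′) * Q)
      shape-difference k t t′ = ring! 5 (λ w P Q t t′ → ⊢ w ⊗ (P ⊕ t ⊗ Q) ⊖ w ⊗ (P ⊕ t′ ⊗ Q) ≗ w ⊗ ((t ⊖ t′) ⊗ Q))
        (τ (ℤ.- k) ∷ P₁ ∷ Q ∷ t ∷ t′ ∷ [])

      shape-close : ∀ {k b t t′} → Frame (shape k t) ρ (p ℤ.- k) b → Frame (shape k t′) ρ (p ℤ.- k) b →
        P (high ρ b) (τ (ℤ.- k) * ((t′ - t) * Q)) ⊎
          P (low ρ (p ℤ.- k) ℤ.+ low ρ (p ℤ.- k)) (τ (ℤ.- k) * ((t′ - t) * Q)) →
        ∃[ u ] Homothety u (shape k t) (high ρ b) (shape k t′) (high ρ b)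
      shape-close {k} {b} {t} {t′} f f′ (inj₁ h) = 1# , congruent⇒homothety (P-resp (sym (shape-difference k t′ t)) h)
      shape-close {k} {b} {t} {t′} f f′ (inj₂ h) =
        close⇒homothety {a = p ℤ.- k} f f′ (P-resp (sym (shape-difference k t′ t)) h)

      -- Write P₁ = x + sw(P₁ + tQ) modulo { v ≥ n } and compare coordinates: (1 - sw)P₁ and swtQ
      -- have valuation at least n. As tQ is smaller than P₁, so has (1 - sw)tQ, and adding swtQ
      -- gives tQ.
      Q-term-bound : ∀ {k n t} → Admissible t → Lat (shape k t) n P₁ → P n (t * Q)
      Q-term-bound {k} {n} {t} (𝕂t , tQ-P) (x , s , 𝔬x , 𝔬s , p) = P-resp
        (ring! 4 (λ s w t Q → ⊢ (𝟙 ⊖ s ⊗ w) ⊗ (t ⊗ Q) ⊖ (⊝ (s ⊗ w ⊗ t)) ⊗ Q ≗ t ⊗ Q) (s ∷ w ∷ t ∷ Q ∷ []))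
        (P-- (first (proj₁ (proj₂ terms))) (proj₂ (proj₂ terms)))
        where
        w : Carrier
        w = τ (ℤ.- k)
        terms : P n ((- x) * 1#) × P n ((1# - s * w) * P₁) × P n ((- (s * w * t)) * Q)
        terms = Coordinates.P-terms basis (𝕂-neg (proj₁ 𝔬x))
          (𝕂-- 𝕂-1 (𝕂-* (proj₁ 𝔬s) (𝕂τ (ℤ.- k)))) (𝕂-neg (𝕂-* (𝕂-* (proj₁ 𝔬s) (𝕂τ (ℤ.- k))) 𝕂t))
          (P-resp (ring! 6 (λ x s w t P Q → ⊢ P ⊖ (x ⊕ s ⊗ (w ⊗ (P ⊕ t ⊗ Q))) ≗
            (⊝ x) ⊗ 𝟙 ⊕ (𝟙 ⊖ s ⊗ w) ⊗ P ⊕ (⊝ (s ⊗ w ⊗ t)) ⊗ Q) (x ∷ s ∷ w ∷ t ∷ P₁ ∷ Q ∷ [])) p)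
        first : P n ((1# - s * w) * P₁) → P n ((1# - s * w) * (t * Q))
        first = multiple tQ-P

      -- From rX - sX′ - z ≡ 0, the P₁-coordinate bounds (r - s)wP₁ and therefore (r - s)wt′Q.
      -- Subtracting this from the Q-coordinate (rt - st′)wQ leaves r times the difference of the
      -- shapes, with r a unit.
      shape-separated : ∀ {k b t t′ u} → Admissible t → Admissible t′ →
        Frame (shape k t) ρ (p ℤ.- k) b → Frame (shape k t′) ρ (p ℤ.- k) b →
        Homothety u (shape k t) (high ρ b) (shape k t′) (high ρ b) →
        ∀ {m} → m ℤ.≤ high ρ b → m ℤ.≤ low ρ (p ℤ.- k) ℤ.+ low ρ (p ℤ.- k) →
        P m (τ (ℤ.- k) * ((t - t′) * Q))
      shape-separated {k} {b} {t} {t′} (𝕂t , _) (𝕂t′ , t′Q-P) f f′ h {m} m≤B m≤2A =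
        let r₁ , s , z , 𝔬r , 𝔬s , 𝔬z , r-val , close = Homothety-close {a = p ℤ.- k} f f′ h
        in separate 𝔬r 𝔬s 𝔬z r-val (close m≤B m≤2A)
        where
        w : Carrier
        w = τ (ℤ.- k)
        separate : ∀ {r₁ s z} → 𝔬 r₁ → 𝔬 s → 𝔬 z → Val r₁ 0ℤ → P m (r₁ * shape k t - s * shape k t′ - z) →
          P m (w * ((t - t′) * Q))
        separate {r₁} {s} {z} 𝔬r 𝔬s 𝔬z r-val close = P-mono (lia 1 (λ m → ⊩ m ≼ m ⊟ # 0) m) (P-cancel r-val scaled)
          where
          expanded : P m ((- z) * 1# + (r₁ - s) * w * P₁ + (r₁ * t - s * t′) * w * Q)
          expanded = P-resp (ring! 8 (λ r s z w P Q t t′ →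
              ⊢ r ⊗ (w ⊗ (P ⊕ t ⊗ Q)) ⊖ s ⊗ (w ⊗ (P ⊕ t′ ⊗ Q)) ⊖ z ≗
                (⊝ z) ⊗ 𝟙 ⊕ (r ⊖ s) ⊗ w ⊗ P ⊕ (r ⊗ t ⊖ s ⊗ t′) ⊗ w ⊗ Q) (r₁ ∷ s ∷ z ∷ w ∷ P₁ ∷ Q ∷ t ∷ t′ ∷ []))
              close
          terms : P m ((- z) * 1#) × P m ((r₁ - s) * w * P₁) × P m ((r₁ * t - s * t′) * w * Q)
          terms = Coordinates.P-terms basis (𝕂-neg (proj₁ 𝔬z)) (𝕂-* (𝕂-- (proj₁ 𝔬r) (proj₁ 𝔬s)) (𝕂τ (ℤ.- k)))
            (𝕂-* (𝕂-- (𝕂-* (proj₁ 𝔬r) 𝕂t) (𝕂-* (proj₁ 𝔬s) 𝕂t′)) (𝕂τ (ℤ.- k))) expanded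
          second : P m ((r₁ - s) * w * (t′ * Q))
          second = multiple t′Q-P (proj₁ (proj₂ terms))
          scaled : P m (r₁ * (w * ((t - t′) * Q)))
          scaled = P-resp (ring! 6 (λ r s w t t′ Q →
              ⊢ (r ⊗ t ⊖ s ⊗ t′) ⊗ w ⊗ Q ⊖ (r ⊖ s) ⊗ w ⊗ (t′ ⊗ Q) ≗ r ⊗ (w ⊗ ((t ⊖ t′) ⊗ Q)))
              (r₁ ∷ s ∷ w ∷ t ∷ t′ ∷ Q ∷ [])) (P-- (proj₂ (proj₂ terms)) second)

      shape-exists : ∀ {X a b} → Frame X ρ a b →
        ∃[ t ] Admissible t × Homothety 1# X (high ρ b) (shape (p ℤ.- a) t) (high ρ b)
      shape-exists {X} {a} {b} f = t , (𝕂-* 𝕂γ (proj₁ (proj₂ β⁻¹)) , tQ-P) , record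
        { nonzero = Val⇒≉0 Val-1
        ; to      = Lat-elim P-1 ℤₚ.≤-refl (Lat-𝔬 𝔬-1) X∈
        ; from    = λ {z} l → Lat-resp (ring! 1 (λ w → ⊢ 𝟙 ⊗ (𝟙 ⊗ w) ≗ w) (z ∷ []))
            (Lat-elim P-1 ℤₚ.≤-refl (Lat-𝔬 𝔬-1) shape∈ l)
        }
        where
        module f = Frame f
        A : ℤ
        A = low ρ a
        open Coords (Coordinates.coordinates basis X)
          renaming (a to α; b to β; c′ to γ; 𝕂a to 𝕂α; 𝕂b to 𝕂β; 𝕂c to 𝕂γ)
        pα : P A (α * 1#)
        pα = proj₁ (terms (Val⇒P f.X-val))
        pγ : P A (γ * Q)
        pγ = proj₂ (proj₂ (terms (Val⇒P f.X-val)))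
        𝔬α : 𝔬 α
        𝔬α = 𝕂α , P-mono (lia 1 (λ A → # 1 ≼ A ⇒ ⊩ # 0 ≼ A) A f.1≤A) (P-resp (*-identityʳ α) pα)
        same-class : ∀ {X Y : Carrier} {i k} → Val X i → Val Y k → (∀ j → i ≢ k ℤ.+ + 3 ℤ.* j) → ∀ {γ} → 𝕂 γ → Val X A → Val (γ * Y) A → ⊥
        same-class {X} e g i≢k 𝕂γ h h′ = Apart-𝕂 𝕂-1 𝕂γ e g i≢k (Val-resp (sym (*-identityˡ X)) h) h′
        βP-val : Val (β * P₁) A
        βP-val with Apart-Val-+ (Coordinates.ZX#Y basis 𝕂α 𝕂β 𝕂γ) (Val-resp expansion f.X-val)
        ... | inj₂ h = contradiction h (same-class f.X-val Q-val
          (λ j e → 1≰0 (lia 5 (λ ρ a r j i → i ≛ ρ ⊞ a ⊟ r ⊟ j ⇒ ρ ⊞ + 3 ⊛ a ≛ neg ρ ⊞ + 3 ⊛ r ⊞ + 3 ⊛ j ⇒ # 1 ≼ ρ ⇒ ρ ≼ # 2 ⇒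
            ⊩ # 1 ≼ # 0) ρ a r j (ρ ℤ.+ a ℤ.- r ℤ.- j) ≡.refl e 1≤ρ ρ≤2)) 𝕂γ f.X-val)
        ... | inj₁ h with Apart-Val-+ (Coordinates.Z#X basis 𝕂α 𝕂β) h
        ...   | inj₂ h = h
        ...   | inj₁ h = contradiction h (same-class f.X-val Val-1
          (λ j e → 1≰0 (lia 3 (λ ρ a j → ρ ⊞ + 3 ⊛ a ≛ # 0 ⊞ + 3 ⊛ j ⇒ # 1 ≼ ρ ⇒ ρ ≼ # 2 ⇒
            ⊩ # 1 ≼ # 0) ρ a j e 1≤ρ ρ≤2)) 𝕂α f.X-val)
        β-val : Val β (+ 3 ℤ.* (a ℤ.- p))
        β-val with zero-or-Val β
        ... | inj₁ β≈0 = contradiction (trans (*-congʳ β≈0) (zeroˡ P₁)) (Val⇒≉0 βP-val)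
        ... | inj₂ (l , e) = ≡.subst (Val β) (lia 4 (λ ρ a p l → l ⊞ (ρ ⊞ + 3 ⊛ p) ≛ ρ ⊞ + 3 ⊛ a ⇒
          ⊩ l ≛ + 3 ⊛ (a ⊟ p)) ρ a p l (Val-unique (Val-* e P-val) βP-val)) e
        β⁻¹ : ∃[ β′ ] 𝕂 β′ × β * β′ ≈ 1# × Val β′ (ℤ.- (+ 3 ℤ.* (a ℤ.- p)))
        β⁻¹ = 𝕂-inverse 𝕂β β-val
        β′ w : Carrier
        β′ = proj₁ β⁻¹
        w = τ (ℤ.- (p ℤ.- a))
        w⁻¹ : ∃[ w′ ] 𝕂 w′ × w * w′ ≈ 1# × Val w′ (ℤ.- (+ 3 ℤ.* (ℤ.- (p ℤ.- a))))
        w⁻¹ = 𝕂-inverse (𝕂τ (ℤ.- (p ℤ.- a))) (τ-val (ℤ.- (p ℤ.- a)))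
        w′ : Carrier
        w′ = proj₁ w⁻¹
        t : Carrier
        t = γ * β′
        γQ-P : P (A ℤ.+ 1ℤ) (γ * Q)
        γQ-P with Val-or-P pγ
        ... | inj₂ h = h
        ... | inj₁ h = contradiction h (Coordinates.X#Y basis 𝕂β 𝕂γ βP-val)
        tQ-P : P (low ρ p ℤ.+ 1ℤ) (t * Q)
        tQ-P = P-resp (ring! 3 (λ γ β′ Q → ⊢ β′ ⊗ (γ ⊗ Q) ≗ γ ⊗ β′ ⊗ Q) (γ ∷ β′ ∷ Q ∷ []))
          (P-mono (lia 3 (λ ρ a p → ⊩ ρ ⊞ + 3 ⊛ p ⊞ # 1 ≼ neg (+ 3 ⊛ (a ⊟ p)) ⊞ (ρ ⊞ + 3 ⊛ a ⊞ # 1)) ρ a p)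
            (P-* (Val⇒P (proj₂ (proj₂ (proj₂ β⁻¹)))) γQ-P))
        𝔬η : 𝔬 (β * w′)
        𝔬η = 𝕂-* 𝕂β (proj₁ (proj₂ w⁻¹)) , P-mono (lia 2 (λ a p → ⊩ # 0 ≼ + 3 ⊛ (a ⊟ p) ⊞ neg (+ 3 ⊛ (neg (p ⊟ a)))) a p)
          (P-* (Val⇒P β-val) (Val⇒P (proj₂ (proj₂ (proj₂ w⁻¹)))))
        𝔬η⁻¹ : 𝔬 (β′ * w)
        𝔬η⁻¹ = 𝕂-* (proj₁ (proj₂ β⁻¹)) (𝕂τ (ℤ.- (p ℤ.- a))) , P-mono (lia 2 (λ a p → ⊩ # 0 ≼ neg (+ 3 ⊛ (a ⊟ p)) ⊞ + 3 ⊛ (neg (p ⊟ a))) a p)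
          (P-* (Val⇒P (proj₂ (proj₂ (proj₂ β⁻¹)))) (Val⇒P (τ-val (ℤ.- (p ℤ.- a)))))
        X∈ : Lat (shape (p ℤ.- a) t) (high ρ b) (1# * X)
        X∈ = Lat-resp
          (ring! 9 (λ X α β γ β′ w w′ P Q →
            (⊝ 𝟙) · X ≗ α ⊗ 𝟙 ⊕ β ⊗ P ⊕ γ ⊗ Q ⇒
            (γ ⊗ Q) · β ⊗ β′ ≗ 𝟙 ⇒
            (β ⊗ P ⊕ β ⊗ γ ⊗ β′ ⊗ Q) · w ⊗ w′ ≗ 𝟙 ⇒
            ⊢ α ⊕ (β ⊗ w′) ⊗ (w ⊗ (P ⊕ γ ⊗ β′ ⊗ Q)) ≗ 𝟙 ⊗ X)
            (X ∷ α ∷ β ∷ γ ∷ β′ ∷ w ∷ w′ ∷ P₁ ∷ Q ∷ []) expansion (proj₁ (proj₂ (proj₂ β⁻¹))) (proj₁ (proj₂ (proj₂ w⁻¹))))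
          (Lat-+ (Lat-𝔬 𝔬α) (Lat-𝔬* 𝔬η Lat-X))
        shape∈ : Lat X (high ρ b) (1# * shape (p ℤ.- a) t)
        shape∈ = Lat-resp
          (ring! 8 (λ X α β γ β′ w P Q →
            (β′ ⊗ w) · X ≗ α ⊗ 𝟙 ⊕ β ⊗ P ⊕ γ ⊗ Q ⇒
            (w ⊗ P) · β ⊗ β′ ≗ 𝟙 ⇒
            ⊢ (β′ ⊗ w) ⊗ (X ⊖ α) ≗ 𝟙 ⊗ (w ⊗ (P ⊕ γ ⊗ β′ ⊗ Q)))
            (X ∷ α ∷ β ∷ γ ∷ β′ ∷ w ∷ P₁ ∷ Q ∷ []) expansion (proj₁ (proj₂ (proj₂ β⁻¹))))
          (Lat-𝔬* 𝔬η⁻¹ (Lat-- Lat-X (Lat-𝔬 𝔬α)))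

-- The dictionary between stable lattices and fractional ideals.

module Ideals where

  open import Data.Fin.Base using (Fin; zero; suc)
  open import Function.Bundles using (mk⇔; Equivalence)
  open import Relation.Binary.Bundles using (Setoid)
  open import Relation.Binary.PropositionalEquality as ≡ using ()
  open Extension
  open Lattice
  open Similarity
  open Reduction
  open Normal
  open Orders

  module LatticeIdeals {c ℓ} (F E : LocalField c ℓ) (E/F : TotallyRamifiedExtension F E 3) (𝓡 : Order E/F) where
    open Ramified F E E/F
    open Lattices F E E/F
    open Homotheties F E E/F
    open Reductions F E E/F
    open NormalForms F E E/F
    open OrderStructure F E E/F 𝓡
    open Order 𝓡 using (R)

    Stable : Carrier → ℤ → Set (c ⊔ ℓ)
    Stable X n = ∀ {r u} → R r → Lat X n u → Lat X n (r * u)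

    -- R = 𝔬 + 𝔬θ + { v ≥ B₀ }, and the last summand carries the integral lattice into { v ≥ B₀ }, a
    -- part of { v ≥ B }. What is left is multiplication by θ, tested on 1 and X.
    generators⇒stable : ∀ {X ρ a b} → Frame X ρ a b → high ρ b ℤ.≤ high ρ₀ b₀ →
      Lat X (high ρ b) θ → Lat X (high ρ b) (θ * X) → Stable X (high ρ b)
    generators⇒stable {X} {ρ} {a} {b} f B≤B₀ θ∈ θX∈ {r} {u} Rr u∈ with R⇒Lat Rr
    ... | x , s , 𝔬x , 𝔬s , p = Lat-resp
      (ring! 5 (λ r u x s θ → ⊢ x ⊗ u ⊕ s ⊗ (θ ⊗ u) ⊕ u ⊗ (r ⊖ (x ⊕ s ⊗ θ)) ≗ r ⊗ u) (r ∷ u ∷ x ∷ s ∷ θ ∷ []))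
      (Lat-+ (Lat-+ (Lat-𝔬* 𝔬x u∈) (Lat-𝔬* 𝔬s (Lat-elim (FrameProperties.P0-X θ-frame) ℤₚ.≤-refl θ∈ θX∈ u∈)))
        (Lat-P (P-mono B≤B₀ (P-0* (FrameProperties.Lat⇒P0 f u∈) p))))

    abstract
      toIdeal : ∀ {X ρ a b} → Frame X ρ a b → Stable X (high ρ b) → FractionalIdeal E/F 𝓡
      toIdeal {X} {ρ} {a} {b} f stable = record
        { I           = Lat X (high ρ b)
        ; isSubmodule = record
          { resp       = Lat-resp
          ; 0-closed   = Lat-𝔬 𝔬-0
          ; +-closed   = Lat-+
          ; neg-closed = Lat-neg
          ; *-closed   = λ (_ , Rr) → stable Rr
          }
        ; fg          = 3 , generator , generator∈ , λ u∈ → coefficients (Lat⇒span f Y-val u∈)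
        ; nonzero     = 1# , Lat-𝔬 𝔬-1 , IsField.1≉0 isField
        }
        where
        Y : Carrier
        Y = proj₁ (element (high ρ b))
        Y-val : Val Y (high ρ b)
        Y-val = proj₂ (element (high ρ b))
        generator : Fin 3 → Carrier
        generator zero             = 1#
        generator (suc zero)       = X
        generator (suc (suc zero)) = Y
        generator∈ : ∀ i → Lat X (high ρ b) (generator i)
        generator∈ zero             = Lat-𝔬 𝔬-1
        generator∈ (suc zero)       = Lat-X
        generator∈ (suc (suc zero)) = Lat-P (Val⇒P Y-val)
        coefficients : ∀ {u} → InSpan 1# X Y u → ∃[ k ] u ≈ linearCombination (E-as-R-module E/F 𝓡) k generator
        coefficients {u} (inSpan {r} {s} {t} 𝔬r 𝔬s 𝔬t e) = k
          , trans e (ring! 3 (λ u v w → ⊢ u ⊕ v ⊕ w ≗ u ⊕ (v ⊕ (w ⊕ 𝟘))) (r * 1# ∷ s * X ∷ t * Y ∷ []))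
          where
          k : Fin 3 → Σ Carrier R
          k zero             = r , R-𝔬 𝔬r
          k (suc zero)       = s , R-𝔬 𝔬s
          k (suc (suc zero)) = t , R-𝔬 𝔬t

    _≋_ : FractionalIdeal E/F 𝓡 → FractionalIdeal E/F 𝓡 → Set (c ⊔ ℓ)
    _≋_ = _∼_ E/F 𝓡

    private
      inverse-of : ∀ {u} → ¬ u ≈ 0# → ∃[ v ] u * v ≈ 1#
      inverse-of u≉0 = IsField.inverse isField _ u≉0

      cancel : ∀ {u v} → u * v ≈ 1# → ∀ w → u * (v * w) ≈ w
      cancel {u} {v} uv≈1 w = ring! 3 (λ u v w → w · u ⊗ v ≗ 𝟙 ⇒ ⊢ u ⊗ (v ⊗ w) ≗ w) (u ∷ v ∷ w ∷ []) uv≈1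

      cancel′ : ∀ {u v} → u * v ≈ 1# → ∀ w → v * (u * w) ≈ w
      cancel′ {u} {v} uv≈1 w = ring! 3 (λ u v w → w · u ⊗ v ≗ 𝟙 ⇒ ⊢ v ⊗ (u ⊗ w) ≗ w) (u ∷ v ∷ w ∷ []) uv≈1

    module _ {X ρ a b X′ ρ′ a′ b′} (f : Frame X ρ a b) (f′ : Frame X′ ρ′ a′ b′)
             (stable : Stable X (high ρ b)) (stable′ : Stable X′ (high ρ′ b′)) where

      abstract
        homothety⇒∼ : ∀ {u} → Homothety u X (high ρ b) X′ (high ρ′ b′) → toIdeal f stable ≋ toIdeal f′ stable′
        homothety⇒∼ {u} h with inverse-of (Homothety.nonzero h)
        ... | v , uv≈1 = u , nonzero , λ x → mk⇔
          (λ x∈ → v * x , from (Lat-resp (sym (cancel uv≈1 x)) x∈) , sym (cancel uv≈1 x))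
          (λ (y , y∈ , x≈uy) → Lat-resp (sym x≈uy) (to y∈))
          where open Homothety h

        ∼⇒homothety : toIdeal f stable ≋ toIdeal f′ stable′ → ∃[ u ] Homothety u X (high ρ b) X′ (high ρ′ b′)
        ∼⇒homothety (u , u≉0 , eq) with inverse-of u≉0
        ... | v , uv≈1 = u , record
          { nonzero = u≉0
          ; to      = λ {w} w∈ → Equivalence.from (eq (u * w)) (w , w∈ , refl)
          ; from    = λ {w} uw∈ → let y , y∈ , uw≈uy = Equivalence.to (eq (u * w)) uw∈ in
              Lat-resp (trans (sym (cancel′ uv≈1 y)) (trans (*-congˡ (sym uw≈uy)) (cancel′ uv≈1 w))) y∈
          }

    record LatticeModel (𝓘 : FractionalIdeal E/F 𝓡) : Set (c ⊔ ℓ) where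
      field
        {X}     : Carrier
        {ρ a b} : ℤ
        frame   : Frame X ρ a b
        stable  : Stable X (high ρ b)
        similar : toIdeal frame stable ≋ 𝓘

    abstract
      latticeModel : ∀ 𝓘 → LatticeModel 𝓘
      latticeModel 𝓘 = from-normalForm (ideal-normalForm 𝓘)
        where
        open FractionalIdeal 𝓘 using (I)
        module I = IsSubmodule (FractionalIdeal.isSubmodule 𝓘)
        from-normalForm : (∃[ u ] ¬ u ≈ 0# × NormalForm (λ w → I (u * w))) → LatticeModel 𝓘
        from-normalForm (u , u≉0 , nf) with inverse-of u≉0
        ... | v , uv≈1 = record
          { frame   = frame
          ; stable  = λ {r} {w} Rr w∈ → to (I.resp (ring! 3 (λ r u w → ⊢ r ⊗ (u ⊗ w) ≗ u ⊗ (r ⊗ w)) (r ∷ u ∷ w ∷ []))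
              (I.*-closed (r , Rr) (from w∈)))
          ; similar = u , u≉0 , λ x → mk⇔
              (λ x∈ → v * x , to (I.resp (sym (cancel uv≈1 x)) x∈) , sym (cancel uv≈1 x))
              (λ (y , y∈ , x≈uy) → I.resp (sym x≈uy) (from y∈))
          }
          where open NormalForm nf

    abstract
      ∼-trans : ∀ {𝓘 𝓙 𝓚} → 𝓘 ≋ 𝓙 → 𝓙 ≋ 𝓚 → 𝓘 ≋ 𝓚
      ∼-trans {𝓘} {𝓙} {𝓚} = Setoid.trans (Cl̄ E/F 𝓡) {𝓘} {𝓙} {𝓚}

-- Classification of the stable lattices by codes.

module Cells where

  open import Data.Fin.Base using (Fin)
  open import Data.Nat.Base as ℕ using (ℕ; _∸_; _⊓_)
  import Data.Nat.Properties as ℕₚ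
  open Extension
  open Lattice
  open Similarity
  open Reduction
  open Normal
  open Orders
  open Digits
  open Charts
  open Ideals

  data Part : Set where
    lower upper crossed : Part

  -- The pair (i, j) is stored as i and n = i + j, because the range of each part is a condition on
  -- the sum alone.
  record Code (q : ℕ) : Set where
    constructor code
    field
      part   : Part
      n i    : ℕ
      digits : Fin (q ℕ.^ (i ⊓ (n ∸ i)))

  -- For `lower`, θ being in the lattice is the stronger bound on c, and g ≤ n says B ≤ B₀. For
  -- `upper`, v(cθ²) > v(θ) is stronger. The two bounds agree at b = a₀ + ρ₀, which is n = g + d in
  -- `lower`. For `crossed`, the condition says B ≤ A₀, since θ lies in the class of B.
  Bounded : ℕ → ℕ → ℕ → Part → ℕ → Set
  Bounded g d e lower   n = g ℕ.≤ n × n ℕ.≤ g ℕ.+ d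
  Bounded g d e upper   n = n ℕ.< g ℕ.+ d
  Bounded g d e crossed n = n ℕ.< g ℕ.+ d ℕ.+ e

  Valid : ∀ {q} → ℕ → ℕ → ℕ → Code q → Set
  Valid g d e (code part n i _) = i ℕ.≤ n × Bounded g d e part n

  Bounded-irrelevant : ∀ g d e part {n} (p p′ : Bounded g d e part n) → p ≡ p′
  Bounded-irrelevant g d e lower   (p , q) (p′ , q′) = ≡.cong₂ _,_ (ℕₚ.≤-irrelevant p p′) (ℕₚ.≤-irrelevant q q′)
  Bounded-irrelevant g d e upper   p p′ = ℕₚ.≤-irrelevant p p′
  Bounded-irrelevant g d e crossed p p′ = ℕₚ.≤-irrelevant p p′

  -- The ideal of a code takes its validity proof as an argument; this identifies the ideals built
  -- from two different proofs.
  Valid-irrelevant : ∀ {q} g d e (x : Code q) (v v′ : Valid g d e x) → v ≡ v′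
  Valid-irrelevant g d e (code part n i _) (p , b) (p′ , b′) =
    ≡.cong₂ _,_ (ℕₚ.≤-irrelevant p p′) (Bounded-irrelevant g d e part b b′)

  +-∸ : ∀ {m n} → n ℕ.≤ m → + (m ∸ n) ≡ + m ℤ.- + n
  +-∸ {m} {n} n≤m = ≡.trans (≡.sym (ℤₚ.⊖-≥ n≤m)) (≡.sym (ℤₚ.m-n≡m⊖n m n))

  toℕ : ∀ {z} → 0ℤ ℤ.≤ z → ∃[ n ] z ≡ + n
  toℕ {+ n} _ = n , ≡.refl

  module Classification {c ℓ} (F E : LocalField c ℓ) (E/F : TotallyRamifiedExtension F E 3) (𝓡 : Order E/F) where
    open Ramified F E E/F
    open Lattices F E E/F
    open Homotheties F E E/F
    open Reductions F E E/F
    open NormalForms F E E/F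
    open DigitExpansions F E E/F
    open LatticeCharts F E E/F
    open OrderStructure F E E/F 𝓡
    open LatticeIdeals F E E/F 𝓡
    open Order 𝓡 using (R)

    private
      q : ℕ
      q = LocalField.q F

    -- Lattices 𝔬 + 𝔬X + … with v X ≡ v θ modulo 3 are described by X = ϖ⁻ᵏ(θ + cθ²),
    -- the others by X = ϖ⁻ᵏ(θ² + cθ).
    straight : Chart ρ₀ a₀ (+ 2 ℤ.* a₀ ℤ.+ ρ₀)
    straight = record { P-val = θ.X-val ; Q-val = θ²-val ; 1≤ρ = θ.1≤ρ ; ρ≤2 = θ.ρ≤2 }

    twisted : Chart (+ 3 ℤ.- ρ₀) (+ 2 ℤ.* a₀ ℤ.+ ρ₀ ℤ.- 1ℤ) (a₀ ℤ.+ 1ℤ)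
    twisted = record
      { P-val = ≡.subst (Val (θ * θ)) (lia 2 (λ ρ a → ⊩ neg ρ ⊞ + 3 ⊛ (+ 2 ⊛ a ⊞ ρ) ≛
          # 3 ⊟ ρ ⊞ + 3 ⊛ (+ 2 ⊛ a ⊞ ρ ⊟ # 1)) ρ₀ a₀) θ²-val
      ; Q-val = ≡.subst (Val θ) (lia 2 (λ ρ a → ⊩ ρ ⊞ + 3 ⊛ a ≛ neg (# 3 ⊟ ρ) ⊞ + 3 ⊛ (a ⊞ # 1)) ρ₀ a₀) θ.X-val
      ; 1≤ρ   = lia 1 (λ ρ → ρ ≼ # 2 ⇒ ⊩ # 1 ≼ # 3 ⊟ ρ) ρ₀ θ.ρ≤2
      ; ρ≤2   = lia 1 (λ ρ → # 1 ≼ ρ ⇒ ⊩ # 3 ⊟ ρ ≼ # 2) ρ₀ θ.1≤ρ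
      }

    ρᵖ pᵖ rᵖ : Part → ℤ
    ρᵖ crossed = + 3 ℤ.- ρ₀
    ρᵖ _       = ρ₀
    pᵖ crossed = + 2 ℤ.* a₀ ℤ.+ ρ₀ ℤ.- 1ℤ
    pᵖ _       = a₀
    rᵖ crossed = a₀ ℤ.+ 1ℤ
    rᵖ _       = + 2 ℤ.* a₀ ℤ.+ ρ₀

    chart : ∀ part → Chart (ρᵖ part) (pᵖ part) (rᵖ part)
    chart lower   = straight
    chart upper   = straight
    chart crossed = twisted

    -- In the cell (n, i) of a part, c runs through ϖˡᵒ𝔬.  A class depends on c only
    -- modulo { v ≥ min(B, 2A) } of the lattice, that is, modulo ϖ^(lo + min(i, n - i)):
    -- see B≡ and 2A≡ below.
    kᵖ loᵖ bᵖ : Part → ℕ → ℕ → ℤ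
    kᵖ lower   n i = + i
    kᵖ upper   n i = a₀ ℤ.- + n ℤ.+ + i
    kᵖ crossed n i = + 2 ℤ.* a₀ ℤ.+ ρ₀ ℤ.- 1ℤ ℤ.- + n ℤ.+ + i
    loᵖ lower   n i = ℤ.- + n
    loᵖ upper   n i = ℤ.- a₀
    loᵖ crossed n i = a₀ ℤ.+ 1ℤ
    bᵖ part n i = rᵖ part ℤ.+ loᵖ part n i ℤ.+ + i ℤ.- kᵖ part n i

    aᵖ Bᵖ : Part → ℕ → ℕ → ℤ
    aᵖ part n i = pᵖ part ℤ.- kᵖ part n i
    Bᵖ part n i = high (ρᵖ part) (bᵖ part n i)

    -- The last two fields carry the count: 3(-k) + 3lo + `high ρ r` is the least valuation of ϖ⁻ᵏcQ
    -- for c in ϖˡᵒ𝔬, and B and 2A lie above it by exactly 3i and 3j. The field `adm` makes every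
    -- such c admissible.
    record Numerics (ρ p r k lo b i j : ℤ) : Set where
      field
        1≤A  : 1ℤ ℤ.≤ low ρ (p ℤ.- k)
        A<B  : low ρ (p ℤ.- k) ℤ.+ 1ℤ ℤ.≤ high ρ b
        adm  : low ρ p ℤ.+ 1ℤ ℤ.≤ + 3 ℤ.* lo ℤ.+ high ρ r
        B≤B₀ : high ρ b ℤ.≤ high ρ₀ b₀
        B≡   : high ρ b ≡ + 3 ℤ.* (ℤ.- k) ℤ.+ (+ 3 ℤ.* lo ℤ.+ + 3 ℤ.* i ℤ.+ high ρ r)
        2A≡  : low ρ (p ℤ.- k) ℤ.+ low ρ (p ℤ.- k) ≡
               + 3 ℤ.* (ℤ.- k) ℤ.+ (+ 3 ℤ.* lo ℤ.+ + 3 ℤ.* j ℤ.+ high ρ r)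

    Facts : Part → ℕ → ℕ → Set
    Facts part n i =
      Numerics (ρᵖ part) (pᵖ part) (rᵖ part) (kᵖ part n i) (loᵖ part n i) (bᵖ part n i) (+ i) (+ (n ∸ i))

    module _ (g d e : ℕ) (ρ₀≡ : ρ₀ ≡ 1ℤ ℤ.+ + e) (a₀≡ : a₀ ≡ + g ℤ.+ + d)
             (b₀≡ : b₀ ≡ 1ℤ ℤ.+ + e ℤ.+ + g ℤ.+ + 2 ℤ.* + d) where

      private
        e≤1 : + e ℤ.≤ 1ℤ
        e≤1 = lia 2 (λ ρ e → ρ ≛ # 1 ⊞ e ⇒ ρ ≼ # 2 ⇒ ⊩ e ≼ # 1) ρ₀ (+ e) ρ₀≡ θ.ρ≤2

        0≤ : ∀ {n} → 0ℤ ℤ.≤ + n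
        0≤ = ℤ.+≤+ ℕ.z≤n

      facts : ∀ part n i → i ℕ.≤ n → Bounded g d e part n → Facts part n i
      facts lower n i i≤n (g≤n , n≤g+d) = record
        { 1≤A  = lia 6 (λ ρ a g d n i → a ≛ g ⊞ d ⇒ # 1 ≼ ρ ⇒ i ≼ n ⇒ n ≼ g ⊞ d ⇒
            ⊩ # 1 ≼ ρ ⊞ + 3 ⊛ (a ⊟ i)) ρ₀ a₀ (+ g) (+ d) (+ n) (+ i) a₀≡ θ.1≤ρ (ℤ.+≤+ i≤n) (ℤ.+≤+ n≤g+d)
        ; A<B  = lia 6 (λ ρ a g d n i → a ≛ g ⊞ d ⇒ # 1 ≼ ρ ⇒ # 0 ≼ i ⇒ n ≼ g ⊞ d ⇒
            ⊩ ρ ⊞ + 3 ⊛ (a ⊟ i) ⊞ # 1 ≼ neg ρ ⊞ + 3 ⊛ (+ 2 ⊛ a ⊞ ρ ⊞ neg n ⊞ i ⊟ i))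
            ρ₀ a₀ (+ g) (+ d) (+ n) (+ i) a₀≡ θ.1≤ρ 0≤ (ℤ.+≤+ n≤g+d)
        ; adm  = lia 5 (λ ρ a g d n → a ≛ g ⊞ d ⇒ # 1 ≼ ρ ⇒ n ≼ g ⊞ d ⇒
            ⊩ ρ ⊞ + 3 ⊛ a ⊞ # 1 ≼ + 3 ⊛ (neg n) ⊞ (neg ρ ⊞ + 3 ⊛ (+ 2 ⊛ a ⊞ ρ)))
            ρ₀ a₀ (+ g) (+ d) (+ n) a₀≡ θ.1≤ρ (ℤ.+≤+ n≤g+d)
        ; B≤B₀ = lia 8 (λ ρ a b g d e n i → ρ ≛ # 1 ⊞ e ⇒ a ≛ g ⊞ d ⇒ b ≛ # 1 ⊞ e ⊞ g ⊞ + 2 ⊛ d ⇒ g ≼ n ⇒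
            ⊩ neg ρ ⊞ + 3 ⊛ (+ 2 ⊛ a ⊞ ρ ⊞ neg n ⊞ i ⊟ i) ≼ neg ρ ⊞ + 3 ⊛ b)
            ρ₀ a₀ b₀ (+ g) (+ d) (+ e) (+ n) (+ i) ρ₀≡ a₀≡ b₀≡ (ℤ.+≤+ g≤n)
        ; B≡   = lia 4 (λ ρ a n i → ⊩ neg ρ ⊞ + 3 ⊛ (+ 2 ⊛ a ⊞ ρ ⊞ neg n ⊞ i ⊟ i) ≛
            + 3 ⊛ (neg i) ⊞ (+ 3 ⊛ (neg n) ⊞ + 3 ⊛ i ⊞ (neg ρ ⊞ + 3 ⊛ (+ 2 ⊛ a ⊞ ρ)))) ρ₀ a₀ (+ n) (+ i)
        ; 2A≡  = lia 5 (λ ρ a n i j → j ≛ n ⊟ i ⇒ ⊩ ρ ⊞ + 3 ⊛ (a ⊟ i) ⊞ (ρ ⊞ + 3 ⊛ (a ⊟ i)) ≛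
            + 3 ⊛ (neg i) ⊞ (+ 3 ⊛ (neg n) ⊞ + 3 ⊛ j ⊞ (neg ρ ⊞ + 3 ⊛ (+ 2 ⊛ a ⊞ ρ)))) ρ₀ a₀ (+ n) (+ i) (+ (n ∸ i)) (+-∸ i≤n)
        }
      facts upper n i i≤n n<g+d = record
        { 1≤A  = lia 4 (λ ρ a n i → # 1 ≼ ρ ⇒ i ≼ n ⇒
            ⊩ # 1 ≼ ρ ⊞ + 3 ⊛ (a ⊟ (a ⊟ n ⊞ i))) ρ₀ a₀ (+ n) (+ i) θ.1≤ρ (ℤ.+≤+ i≤n)
        ; A<B  = lia 4 (λ ρ a n i → # 1 ≼ ρ ⇒ # 0 ≼ i ⇒
            ⊩ ρ ⊞ + 3 ⊛ (a ⊟ (a ⊟ n ⊞ i)) ⊞ # 1 ≼ neg ρ ⊞ + 3 ⊛ (+ 2 ⊛ a ⊞ ρ ⊞ neg a ⊞ i ⊟ (a ⊟ n ⊞ i)))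
            ρ₀ a₀ (+ n) (+ i) θ.1≤ρ 0≤
        ; adm  = lia 2 (λ ρ a → # 1 ≼ ρ ⇒
            ⊩ ρ ⊞ + 3 ⊛ a ⊞ # 1 ≼ + 3 ⊛ (neg a) ⊞ (neg ρ ⊞ + 3 ⊛ (+ 2 ⊛ a ⊞ ρ)))
            ρ₀ a₀ θ.1≤ρ
        ; B≤B₀ = lia 8 (λ ρ a b g d e n i → ρ ≛ # 1 ⊞ e ⇒ a ≛ g ⊞ d ⇒ b ≛ # 1 ⊞ e ⊞ g ⊞ + 2 ⊛ d ⇒ # 1 ⊞ n ≼ g ⊞ d ⇒ # 0 ≼ d ⇒
            ⊩ neg ρ ⊞ + 3 ⊛ (+ 2 ⊛ a ⊞ ρ ⊞ neg a ⊞ i ⊟ (a ⊟ n ⊞ i)) ≼ neg ρ ⊞ + 3 ⊛ b)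
            ρ₀ a₀ b₀ (+ g) (+ d) (+ e) (+ n) (+ i) ρ₀≡ a₀≡ b₀≡ (ℤ.+≤+ n<g+d) 0≤
        ; B≡   = lia 4 (λ ρ a n i → ⊩ neg ρ ⊞ + 3 ⊛ (+ 2 ⊛ a ⊞ ρ ⊞ neg a ⊞ i ⊟ (a ⊟ n ⊞ i)) ≛
            + 3 ⊛ (neg (a ⊟ n ⊞ i)) ⊞ (+ 3 ⊛ (neg a) ⊞ + 3 ⊛ i ⊞ (neg ρ ⊞ + 3 ⊛ (+ 2 ⊛ a ⊞ ρ)))) ρ₀ a₀ (+ n) (+ i)
        ; 2A≡  = lia 5 (λ ρ a n i j → j ≛ n ⊟ i ⇒ ⊩ ρ ⊞ + 3 ⊛ (a ⊟ (a ⊟ n ⊞ i)) ⊞ (ρ ⊞ + 3 ⊛ (a ⊟ (a ⊟ n ⊞ i))) ≛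
            + 3 ⊛ (neg (a ⊟ n ⊞ i)) ⊞ (+ 3 ⊛ (neg a) ⊞ + 3 ⊛ j ⊞ (neg ρ ⊞ + 3 ⊛ (+ 2 ⊛ a ⊞ ρ)))) ρ₀ a₀ (+ n) (+ i) (+ (n ∸ i)) (+-∸ i≤n)
        }
      facts crossed n i i≤n n<g+d+e = record
        { 1≤A  = lia 4 (λ ρ a n i → ρ ≼ # 2 ⇒ i ≼ n ⇒
            ⊩ # 1 ≼ # 3 ⊟ ρ ⊞ + 3 ⊛ (+ 2 ⊛ a ⊞ ρ ⊟ # 1 ⊟ (+ 2 ⊛ a ⊞ ρ ⊟ # 1 ⊟ n ⊞ i))) ρ₀ a₀ (+ n) (+ i) θ.ρ≤2 (ℤ.+≤+ i≤n)
        ; A<B  = lia 4 (λ ρ a n i → # 1 ≼ ρ ⇒ ρ ≼ # 2 ⇒ # 0 ≼ i ⇒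
            ⊩ # 3 ⊟ ρ ⊞ + 3 ⊛ (+ 2 ⊛ a ⊞ ρ ⊟ # 1 ⊟ (+ 2 ⊛ a ⊞ ρ ⊟ # 1 ⊟ n ⊞ i)) ⊞ # 1 ≼
              neg (# 3 ⊟ ρ) ⊞ + 3 ⊛ (a ⊞ # 1 ⊞ (a ⊞ # 1) ⊞ i ⊟ (+ 2 ⊛ a ⊞ ρ ⊟ # 1 ⊟ n ⊞ i)))
            ρ₀ a₀ (+ n) (+ i) θ.1≤ρ θ.ρ≤2 0≤
        ; adm  = lia 2 (λ ρ a → ρ ≼ # 2 ⇒
            ⊩ # 3 ⊟ ρ ⊞ + 3 ⊛ (+ 2 ⊛ a ⊞ ρ ⊟ # 1) ⊞ # 1 ≼ + 3 ⊛ (a ⊞ # 1) ⊞ (neg (# 3 ⊟ ρ) ⊞ + 3 ⊛ (a ⊞ # 1)))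
            ρ₀ a₀ θ.ρ≤2
        ; B≤B₀ = lia 8 (λ ρ a b g d e n i → ρ ≛ # 1 ⊞ e ⇒ a ≛ g ⊞ d ⇒ b ≛ # 1 ⊞ e ⊞ g ⊞ + 2 ⊛ d ⇒ # 1 ⊞ n ≼ g ⊞ d ⊞ e ⇒
            # 0 ≼ d ⇒ # 0 ≼ e ⇒
            ⊩ neg (# 3 ⊟ ρ) ⊞ + 3 ⊛ (a ⊞ # 1 ⊞ (a ⊞ # 1) ⊞ i ⊟ (+ 2 ⊛ a ⊞ ρ ⊟ # 1 ⊟ n ⊞ i)) ≼ neg ρ ⊞ + 3 ⊛ b)
            ρ₀ a₀ b₀ (+ g) (+ d) (+ e) (+ n) (+ i) ρ₀≡ a₀≡ b₀≡ (ℤ.+≤+ n<g+d+e) 0≤ 0≤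
        ; B≡   = lia 4 (λ ρ a n i → ⊩ neg (# 3 ⊟ ρ) ⊞ + 3 ⊛ (a ⊞ # 1 ⊞ (a ⊞ # 1) ⊞ i ⊟ (+ 2 ⊛ a ⊞ ρ ⊟ # 1 ⊟ n ⊞ i)) ≛
            + 3 ⊛ (neg (+ 2 ⊛ a ⊞ ρ ⊟ # 1 ⊟ n ⊞ i)) ⊞ (+ 3 ⊛ (a ⊞ # 1) ⊞ + 3 ⊛ i ⊞ (neg (# 3 ⊟ ρ) ⊞ + 3 ⊛ (a ⊞ # 1))))
            ρ₀ a₀ (+ n) (+ i)
        ; 2A≡  = lia 5 (λ ρ a n i j → j ≛ n ⊟ i ⇒
            ⊩ # 3 ⊟ ρ ⊞ + 3 ⊛ (+ 2 ⊛ a ⊞ ρ ⊟ # 1 ⊟ (+ 2 ⊛ a ⊞ ρ ⊟ # 1 ⊟ n ⊞ i))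
                ⊞ (# 3 ⊟ ρ ⊞ + 3 ⊛ (+ 2 ⊛ a ⊞ ρ ⊟ # 1 ⊟ (+ 2 ⊛ a ⊞ ρ ⊟ # 1 ⊟ n ⊞ i))) ≛
            + 3 ⊛ (neg (+ 2 ⊛ a ⊞ ρ ⊟ # 1 ⊟ n ⊞ i)) ⊞ (+ 3 ⊛ (a ⊞ # 1) ⊞ + 3 ⊛ j ⊞ (neg (# 3 ⊟ ρ) ⊞ + 3 ⊛ (a ⊞ # 1))))
            ρ₀ a₀ (+ n) (+ i) (+ (n ∸ i)) (+-∸ i≤n)
        }

      private
        module ch (part : Part) = ChartProperties (chart part)

      coefficient : ∀ part n i → Fin (q ℕ.^ (i ⊓ (n ∸ i))) → Carrier
      coefficient part n i x = τ (loᵖ part n i) * representative (i ⊓ (n ∸ i)) x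

      private
        coefficient-P : ∀ part n i x → P (+ 3 ℤ.* loᵖ part n i) (coefficient part n i x)
        coefficient-P part n i x = P-resp (*-comm _ _)
          (P-0* (proj₂ (𝔬-representative (i ⊓ (n ∸ i)) x)) (Val⇒P (τ-val (loᵖ part n i))))

        admissible : ∀ {part n i t} → Facts part n i → 𝕂 t → P (+ 3 ℤ.* loᵖ part n i) t → ch.Admissible part t
        admissible {part} ft 𝕂t p = 𝕂t , P-mono adm (P-* p (Val⇒P (Chart.Q-val (chart part))))
          where open Numerics ft

      shapeᵖ : ∀ part → ℕ → ℕ → Carrier → Carrier
      shapeᵖ part n i t = ch.shape part (kᵖ part n i) t

      shapeᵖ-frame : ∀ {part n i t} → Facts part n i → 𝕂 t → P (+ 3 ℤ.* loᵖ part n i) t →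
        Frame (shapeᵖ part n i t) (ρᵖ part) (aᵖ part n i) (bᵖ part n i)
      shapeᵖ-frame {part} {n} {i} ft 𝕂t p =
        ch.shape-frame part {kᵖ part n i} {bᵖ part n i} (admissible {part} {n} {i} ft 𝕂t p) 1≤A A<B
        where open Numerics ft

      private
        -- θ = ϖᵏX - cθ², and both cθ² and θX lie in { v ≥ B }.
        straight-stable : ∀ {k b lo t} → 𝕂 t → P (+ 3 ℤ.* lo) t → P (low ρ₀ a₀ ℤ.+ 1ℤ) (t * (θ * θ)) →
          Frame (ChartProperties.shape straight k t) ρ₀ (a₀ ℤ.- k) b → 0ℤ ℤ.≤ k → b ℤ.≤ lo ℤ.+ (+ 2 ℤ.* a₀ ℤ.+ ρ₀) →
          b ℤ.≤ + 2 ℤ.* a₀ ℤ.+ ρ₀ ℤ.- k → high ρ₀ b ℤ.≤ high ρ₀ b₀ →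
          Stable (ChartProperties.shape straight k t) (high ρ₀ b)
        straight-stable {k} {b} {lo} {t} 𝕂t p adm f 0≤k h₁ h₂ B≤B₀ = generators⇒stable f B≤B₀ θ∈ (Lat-P θX-P)
          where
          w : Carrier
          w = τ (ℤ.- k)
          inv : ∃[ w′ ] 𝕂 w′ × w * w′ ≈ 1# × Val w′ (ℤ.- (+ 3 ℤ.* (ℤ.- k)))
          inv = 𝕂-inverse (𝕂τ (ℤ.- k)) (τ-val (ℤ.- k))
          w′ : Carrier
          w′ = proj₁ inv
          𝔬w′ : 𝔬 w′
          𝔬w′ = proj₁ (proj₂ inv) , Val⇒P≤ (proj₂ (proj₂ (proj₂ inv))) (lia 1 (λ k → # 0 ≼ k ⇒ ⊩ # 0 ≼ neg (+ 3 ⊛ (neg k))) k 0≤k)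
          θ∈ : Lat (w * (θ + t * (θ * θ))) (high ρ₀ b) θ
          θ∈ = Lat-resp (ring! 4 (λ w w′ θ t → (θ ⊕ t ⊗ (θ ⊗ θ)) · w ⊗ w′ ≗ 𝟙 ⇒
              ⊢ w′ ⊗ (w ⊗ (θ ⊕ t ⊗ (θ ⊗ θ))) ⊖ t ⊗ (θ ⊗ θ) ≗ θ) (w ∷ w′ ∷ θ ∷ t ∷ []) (proj₁ (proj₂ (proj₂ inv))))
            (Lat-- (Lat-𝔬* 𝔬w′ Lat-X) (Lat-P (P-mono
              (lia 4 (λ ρ a b l → b ≼ l ⊞ (+ 2 ⊛ a ⊞ ρ) ⇒ ⊩ neg ρ ⊞ + 3 ⊛ b ≼ + 3 ⊛ l ⊞ (neg ρ ⊞ + 3 ⊛ (+ 2 ⊛ a ⊞ ρ))) ρ₀ a₀ b lo h₁)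
              (P-* p (Val⇒P θ²-val)))))
          θX-P : P (high ρ₀ b) (θ * (w * (θ + t * (θ * θ))))
          θX-P = P-resp (ring! 3 (λ w θ t → ⊢ w ⊗ (θ ⊗ θ) ⊕ w ⊗ (θ ⊗ (t ⊗ (θ ⊗ θ))) ≗ θ ⊗ (w ⊗ (θ ⊕ t ⊗ (θ ⊗ θ)))) (w ∷ θ ∷ t ∷ []))
            (P-+ (P-mono (lia 4 (λ ρ a b k → b ≼ + 2 ⊛ a ⊞ ρ ⊟ k ⇒ ⊩ neg ρ ⊞ + 3 ⊛ b ≼ + 3 ⊛ (neg k) ⊞ (neg ρ ⊞ + 3 ⊛ (+ 2 ⊛ a ⊞ ρ))) ρ₀ a₀ b k h₂)
                   (P-* (Val⇒P (τ-val (ℤ.- k))) (Val⇒P θ²-val)))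
                 (P-mono (lia 4 (λ ρ a b k → b ≼ + 2 ⊛ a ⊞ ρ ⊟ k ⇒ ⊩ neg ρ ⊞ + 3 ⊛ b ≼ + 3 ⊛ (neg k) ⊞ (ρ ⊞ + 3 ⊛ a ⊞ (ρ ⊞ + 3 ⊛ a ⊞ # 1))) ρ₀ a₀ b k h₂)
                   (P-* (Val⇒P (τ-val (ℤ.- k))) (P-* (Val⇒P θ.X-val) adm))))

        -- If B ≤ A₀, then θ and θX both lie in { v ≥ B }, whatever X is.
        twisted-stable : ∀ {X ρ a b} → Frame X ρ a b → high ρ b ℤ.≤ low ρ₀ a₀ → high ρ b ℤ.≤ high ρ₀ b₀ → Stable X (high ρ b)
        twisted-stable {X} {ρ} {a} {b} f B≤A₀ B≤B₀ = generators⇒stable f B≤B₀ (Lat-P (Val⇒P≤ θ.X-val B≤A₀))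
          (Lat-P (P-resp (*-comm X θ) (P-0* (FrameProperties.P0-X f) (Val⇒P≤ θ.X-val B≤A₀))))

      shapeᵖ-stable : ∀ {part n i t} → i ℕ.≤ n → Bounded g d e part n → (ft : Facts part n i) →
        (𝕂t : 𝕂 t) (p : P (+ 3 ℤ.* loᵖ part n i) t) → Stable (shapeᵖ part n i t) (Bᵖ part n i)
      shapeᵖ-stable {lower} {n} {i} i≤n bd ft 𝕂t p = straight-stable {+ i} {bᵖ lower n i} {ℤ.- + n} 𝕂t p
        (proj₂ (admissible {lower} {n} {i} ft 𝕂t p)) (shapeᵖ-frame {lower} {n} {i} ft 𝕂t p) 0≤
        (lia 4 (λ ρ a n i → ⊩ + 2 ⊛ a ⊞ ρ ⊞ neg n ⊞ i ⊟ i ≼ neg n ⊞ (+ 2 ⊛ a ⊞ ρ)) ρ₀ a₀ (+ n) (+ i))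
        (lia 4 (λ ρ a n i → i ≼ n ⇒ ⊩ + 2 ⊛ a ⊞ ρ ⊞ neg n ⊞ i ⊟ i ≼ + 2 ⊛ a ⊞ ρ ⊟ i) ρ₀ a₀ (+ n) (+ i) (ℤ.+≤+ i≤n))
        (Numerics.B≤B₀ ft)
      shapeᵖ-stable {upper} {n} {i} i≤n n<g+d ft 𝕂t p = straight-stable {kᵖ upper n i} {bᵖ upper n i} {ℤ.- a₀} 𝕂t p
        (proj₂ (admissible {upper} {n} {i} ft 𝕂t p)) (shapeᵖ-frame {upper} {n} {i} ft 𝕂t p)
        (lia 5 (λ a g d n i → a ≛ g ⊞ d ⇒ # 1 ⊞ n ≼ g ⊞ d ⇒ # 0 ≼ i ⇒ ⊩ # 0 ≼ a ⊟ n ⊞ i) a₀ (+ g) (+ d) (+ n) (+ i) a₀≡ (ℤ.+≤+ n<g+d) 0≤)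
        (lia 6 (λ ρ a g d n i → a ≛ g ⊞ d ⇒ # 1 ⊞ n ≼ g ⊞ d ⇒ ⊩ + 2 ⊛ a ⊞ ρ ⊞ neg a ⊞ i ⊟ (a ⊟ n ⊞ i) ≼ neg a ⊞ (+ 2 ⊛ a ⊞ ρ))
          ρ₀ a₀ (+ g) (+ d) (+ n) (+ i) a₀≡ (ℤ.+≤+ n<g+d))
        (lia 6 (λ ρ a g d n i → a ≛ g ⊞ d ⇒ # 1 ⊞ n ≼ g ⊞ d ⇒ i ≼ n ⇒ ⊩ + 2 ⊛ a ⊞ ρ ⊞ neg a ⊞ i ⊟ (a ⊟ n ⊞ i) ≼ + 2 ⊛ a ⊞ ρ ⊟ (a ⊟ n ⊞ i))
          ρ₀ a₀ (+ g) (+ d) (+ n) (+ i) a₀≡ (ℤ.+≤+ n<g+d) (ℤ.+≤+ i≤n))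
        (Numerics.B≤B₀ ft)
      shapeᵖ-stable {crossed} {n} {i} i≤n n<g+d+e ft 𝕂t p = twisted-stable (shapeᵖ-frame {crossed} {n} {i} ft 𝕂t p)
        (lia 7 (λ ρ a g d e n i → ρ ≛ # 1 ⊞ e ⇒ a ≛ g ⊞ d ⇒ # 1 ⊞ n ≼ g ⊞ d ⊞ e ⇒
            ⊩ neg (# 3 ⊟ ρ) ⊞ + 3 ⊛ (a ⊞ # 1 ⊞ (a ⊞ # 1) ⊞ i ⊟ (+ 2 ⊛ a ⊞ ρ ⊟ # 1 ⊟ n ⊞ i)) ≼ ρ ⊞ + 3 ⊛ a)
            ρ₀ a₀ (+ g) (+ d) (+ e) (+ n) (+ i) ρ₀≡ a₀≡ (ℤ.+≤+ n<g+d+e))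
        (Numerics.B≤B₀ ft)

      module _ {part n i} (i≤n : i ℕ.≤ n) (bounded : Bounded g d e part n) where
        private
          ft : Facts part n i
          ft = facts part n i i≤n bounded

        cell-frame : ∀ x → Frame (shapeᵖ part n i (coefficient part n i x)) (ρᵖ part) (aᵖ part n i) (bᵖ part n i)
        cell-frame x = shapeᵖ-frame {part} {n} {i} ft
          (𝕂-* (𝕂τ (loᵖ part n i)) (proj₁ (𝔬-representative (i ⊓ (n ∸ i)) x))) (coefficient-P part n i x)

        cell-stable : ∀ x → Stable (shapeᵖ part n i (coefficient part n i x)) (Bᵖ part n i)
        cell-stable x = shapeᵖ-stable {part} {n} {i} i≤n bounded ft
          (𝕂-* (𝕂τ (loᵖ part n i)) (proj₁ (𝔬-representative (i ⊓ (n ∸ i)) x))) (coefficient-P part n i x)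

        cell-ideal : Fin (q ℕ.^ (i ⊓ (n ∸ i))) → FractionalIdeal E/F 𝓡
        cell-ideal x = toIdeal (cell-frame x) (cell-stable x)

        private
          k lo : ℤ
          k  = kᵖ part n i
          lo = loᵖ part n i
          m : ℕ
          m = i ⊓ (n ∸ i)
          Q-val : Val (Chart.Q (chart part)) (high (ρᵖ part) (rᵖ part))
          Q-val = Chart.Q-val (chart part)

          bound : ℤ → ℤ
          bound j = + 3 ℤ.* (ℤ.- k) ℤ.+ (+ 3 ℤ.* lo ℤ.+ + 3 ℤ.* j ℤ.+ high (ρᵖ part) (rᵖ part))

          bound-mono : ∀ {i j} → i ℕ.≤ j → bound (+ i) ℤ.≤ bound (+ j)
          bound-mono {i} {j} i≤j = lia 5 (λ k l r i j → i ≼ j ⇒ ⊩ + 3 ⊛ (neg k) ⊞ (+ 3 ⊛ l ⊞ + 3 ⊛ i ⊞ r) ≼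
            + 3 ⊛ (neg k) ⊞ (+ 3 ⊛ l ⊞ + 3 ⊛ j ⊞ r)) k lo (high (ρᵖ part) (rᵖ part)) (+ i) (+ j) (ℤ.+≤+ i≤j)

        -- By `shape-separated` the shapes agree modulo min(B, 2A), which is `bound m`. Cancelling
        -- the valuation of ϖ⁻ᵏϖˡᵒQ leaves exactly 3m, so all m digits agree.
        cell-injective : ∀ {x y} → cell-ideal x ≋ cell-ideal y → x ≡ y
        cell-injective {x} {y} sim with ∼⇒homothety (cell-frame x) (cell-frame y) (cell-stable x) (cell-stable y) sim
        ... | u , h = representative-injective m (P-mono
          (lia 4 (λ k l r m → ⊩ + 3 ⊛ m ≼ + 3 ⊛ (neg k) ⊞ (+ 3 ⊛ l ⊞ + 3 ⊛ m ⊞ r) ⊟ + 3 ⊛ (neg k) ⊟ (+ 3 ⊛ l ⊞ r))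
            k lo (high (ρᵖ part) (rᵖ part)) (+ m))
          (P-cancel (Val-* (τ-val lo) Q-val) (P-cancel (τ-val (ℤ.- k)) (P-resp
            (ring! 5 (λ w l x y Q → ⊢ w ⊗ ((l ⊗ x ⊖ l ⊗ y) ⊗ Q) ≗ w ⊗ (l ⊗ Q ⊗ (x ⊖ y)))
              (τ (ℤ.- k) ∷ τ lo ∷ representative m x ∷ representative m y ∷ Chart.Q (chart part) ∷ []))
            (ch.shape-separated part {k} {bᵖ part n i}
              (admissible {part} {n} {i} ft (𝕂-* (𝕂τ lo) (proj₁ (𝔬-representative m x))) (coefficient-P part n i x))
              (admissible {part} {n} {i} ft (𝕂-* (𝕂τ lo) (proj₁ (𝔬-representative m y))) (coefficient-P part n i y))
              (cell-frame x) (cell-frame y) h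
              (ℤₚ.≤-trans (bound-mono (ℕₚ.m⊓n≤m i (n ∸ i))) (ℤₚ.≤-reflexive (≡.sym (Numerics.B≡ ft))))
              (ℤₚ.≤-trans (bound-mono (ℕₚ.m⊓n≤n i (n ∸ i))) (ℤₚ.≤-reflexive (≡.sym (Numerics.2A≡ ft)))))))))

        -- Approximating t/ϖˡᵒ by m digits moves the shape within { v ≥ min(B, 2A) }. Whichever of i
        -- and n - i is the minimum decides which criterion for homothety applies.
        cell-surjective : ∀ {t} → 𝕂 t → P (+ 3 ℤ.* lo) t →
          (f : Frame (shapeᵖ part n i t) (ρᵖ part) (aᵖ part n i) (bᵖ part n i)) →
          (stable : Stable (shapeᵖ part n i t) (Bᵖ part n i)) → ∃[ x ] cell-ideal x ≋ toIdeal f stable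
        cell-surjective {t} 𝕂t p f stable with 𝕂-inverse (𝕂τ lo) (τ-val lo)
        ... | l′ , 𝕂l′ , ll′≈1 , l′-val with representative-surjective m {t * l′}
              (𝕂-* 𝕂t 𝕂l′ , P-mono (lia 1 (λ l → ⊩ # 0 ≼ + 3 ⊛ l ⊟ + 3 ⊛ l) lo) (P-* p (Val⇒P l′-val)))
        ...   | x , close = x , homothety⇒∼ (cell-frame x) f (cell-stable x) stable
          (proj₂ (ch.shape-close part {k} {bᵖ part n i} (cell-frame x) f (which (ℕₚ.⊓-sel i (n ∸ i)))))
          where
          difference : P (bound (+ m)) (τ (ℤ.- k) * ((t - coefficient part n i x) * Chart.Q (chart part)))
          difference = P-resp
            (ring! 6 (λ w l l′ t x Q → (w ⊗ t ⊗ Q) · l ⊗ l′ ≗ 𝟙 ⇒ ⊢ w ⊗ (l ⊗ (t ⊗ l′ ⊖ x) ⊗ Q) ≗ w ⊗ ((t ⊖ l ⊗ x) ⊗ Q))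
              (τ (ℤ.- k) ∷ τ lo ∷ l′ ∷ t ∷ representative m x ∷ Chart.Q (chart part) ∷ []) ll′≈1)
            (P-* (Val⇒P (τ-val (ℤ.- k))) (P-* (P-* (Val⇒P (τ-val lo)) close) (Val⇒P Q-val)))
          which : m ≡ i ⊎ m ≡ n ∸ i →
            P (Bᵖ part n i) (τ (ℤ.- k) * ((t - coefficient part n i x) * Chart.Q (chart part))) ⊎
            P (low (ρᵖ part) (aᵖ part n i) ℤ.+ low (ρᵖ part) (aᵖ part n i)) (τ (ℤ.- k) * ((t - coefficient part n i x) * Chart.Q (chart part)))
          which (inj₁ m≡i) = inj₁ (P-mono (ℤₚ.≤-reflexive (≡.trans (Numerics.B≡ ft) (≡.cong (λ m → bound (+ m)) (≡.sym m≡i)))) difference)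
          which (inj₂ m≡j) = inj₂ (P-mono (ℤₚ.≤-reflexive (≡.trans (Numerics.2A≡ ft) (≡.cong (λ m → bound (+ m)) (≡.sym m≡j)))) difference)

      code-ideal : ∀ x → Valid g d e x → FractionalIdeal E/F 𝓡
      code-ideal (code part n i x) (i≤n , bounded) = cell-ideal {part} {n} {i} i≤n bounded x

      private
        same-cell : ∀ part n i n′ i′ {x y} (v : Valid g d e (code part n i x)) (v′ : Valid g d e (code part n′ i′ y)) →
          + n ≡ + n′ → + i ≡ + i′ → code-ideal (code part n i x) v ≋ code-ideal (code part n′ i′ y) v′ →
          code part n i x ≡ code part n′ i′ y
        same-cell part n i n′ i′ (i≤n , bd) (i′≤n′ , bd′) ≡.refl ≡.refl sim
          with ℕₚ.≤-irrelevant i≤n i′≤n′ | Bounded-irrelevant g d e part bd bd′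
        ... | ≡.refl | ≡.refl = ≡.cong (code part _ _) (cell-injective {part} i≤n bd sim)

        3-ρ₀≢ρ₀ : + 3 ℤ.- ρ₀ ≢ ρ₀
        3-ρ₀≢ρ₀ eq = 1≰0 (lia 1 (λ ρ → # 3 ⊟ ρ ≛ ρ ⇒ ⊩ # 1 ≼ # 0) ρ₀ eq)

        ρ-of a-of b-of : Code q → ℤ
        ρ-of (code part n i x) = ρᵖ part
        a-of (code part n i x) = aᵖ part n i
        b-of (code part n i x) = bᵖ part n i

        X-of : Code q → Carrier
        X-of (code part n i x) = shapeᵖ part n i (coefficient part n i x)

        frame-of : ∀ x → Valid g d e x → Frame (X-of x) (ρ-of x) (a-of x) (b-of x)
        frame-of (code part n i x) (i≤n , bd) = cell-frame {part} {n} {i} i≤n bd x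

        homothety : ∀ x y (v : Valid g d e x) (v′ : Valid g d e y) → code-ideal x v ≋ code-ideal y v′ →
          ∃[ u ] Homothety u (X-of x) (high (ρ-of x) (b-of x)) (X-of y) (high (ρ-of y) (b-of y))
        homothety (code part n i x) (code part′ n′ i′ x′) (i≤n , bd) (i′≤n′ , bd′) sim = ∼⇒homothety
          (cell-frame {part} {n} {i} i≤n bd x) (cell-frame {part′} {n′} {i′} i′≤n′ bd′ x′)
          (cell-stable {part} {n} {i} i≤n bd x) (cell-stable {part′} {n′} {i′} i′≤n′ bd′ x′) sim

        ρ,a≡ : ∀ x y (v : Valid g d e x) (v′ : Valid g d e y) → code-ideal x v ≋ code-ideal y v′ →
          ρ-of x ≡ ρ-of y × a-of x ≡ a-of y
        ρ,a≡ x y v v′ sim = Homothety-low {a = a-of x} {b-of x} {a′ = a-of y} {b-of y}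
          (frame-of x v) (frame-of y v′) (proj₂ (homothety x y v v′ sim))

        high≡ : ∀ {u X X′ ρ ρ′ a a′ b b′} → ρ ≡ ρ′ → Frame X ρ a b → Frame X′ ρ′ a′ b′ →
          Homothety u X (high ρ b) X′ (high ρ′ b′) → b ≡ b′
        high≡ {ρ = ρ} {a = a} {a′} {b} {b′} ≡.refl = Homothety-high {ρ = ρ} {a} {b} {a′ = a′} {b′}

        b≡ : ∀ x y (v : Valid g d e x) (v′ : Valid g d e y) → code-ideal x v ≋ code-ideal y v′ → b-of x ≡ b-of y
        b≡ x y v v′ sim = high≡ {ρ = ρ-of x} {ρ-of y} {a-of x} {a-of y} {b-of x} {b-of y}
          (proj₁ (ρ,a≡ x y v v′ sim)) (frame-of x v) (frame-of y v′) (proj₂ (homothety x y v v′ sim))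

      -- The invariants ρ, a, b of the class recover the cell: ρ singles out `crossed`, the other
      -- two parts are separated by b ≥ a₀ + ρ₀ against b < a₀ + ρ₀, and then b gives n and a gives
      -- i.
      code-ideal-injective : ∀ x y (v : Valid g d e x) (v′ : Valid g d e y) → code-ideal x v ≋ code-ideal y v′ → x ≡ y
      code-ideal-injective x@(code lower n i _) y@(code lower n′ i′ _) v v′ sim = same-cell lower n i n′ i′ v v′
        (lia 6 (λ ρ a n i n′ i′ → + 2 ⊛ a ⊞ ρ ⊞ neg n ⊞ i ⊟ i ≛ + 2 ⊛ a ⊞ ρ ⊞ neg n′ ⊞ i′ ⊟ i′ ⇒ ⊩ n ≛ n′)
          ρ₀ a₀ (+ n) (+ i) (+ n′) (+ i′) (b≡ x y v v′ sim))
        (lia 3 (λ a i i′ → a ⊟ i ≛ a ⊟ i′ ⇒ ⊩ i ≛ i′) a₀ (+ i) (+ i′) (proj₂ (ρ,a≡ x y v v′ sim))) sim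
      code-ideal-injective x@(code upper n i _) y@(code upper n′ i′ _) v v′ sim = same-cell upper n i n′ i′ v v′ n≡
        (lia 5 (λ a n i n′ i′ → n ≛ n′ ⇒ a ⊟ (a ⊟ n ⊞ i) ≛ a ⊟ (a ⊟ n′ ⊞ i′) ⇒ ⊩ i ≛ i′)
          a₀ (+ n) (+ i) (+ n′) (+ i′) n≡ (proj₂ (ρ,a≡ x y v v′ sim))) sim
        where
        n≡ : + n ≡ + n′
        n≡ = lia 6 (λ ρ a n i n′ i′ → + 2 ⊛ a ⊞ ρ ⊞ neg a ⊞ i ⊟ (a ⊟ n ⊞ i) ≛ + 2 ⊛ a ⊞ ρ ⊞ neg a ⊞ i′ ⊟ (a ⊟ n′ ⊞ i′) ⇒ ⊩ n ≛ n′)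
          ρ₀ a₀ (+ n) (+ i) (+ n′) (+ i′) (b≡ x y v v′ sim)
      code-ideal-injective x@(code crossed n i _) y@(code crossed n′ i′ _) v v′ sim = same-cell crossed n i n′ i′ v v′ n≡
        (lia 6 (λ a ρ n i n′ i′ → n ≛ n′ ⇒ + 2 ⊛ a ⊞ ρ ⊟ # 1 ⊟ (+ 2 ⊛ a ⊞ ρ ⊟ # 1 ⊟ n ⊞ i) ≛ + 2 ⊛ a ⊞ ρ ⊟ # 1 ⊟ (+ 2 ⊛ a ⊞ ρ ⊟ # 1 ⊟ n′ ⊞ i′) ⇒ ⊩ i ≛ i′)
          a₀ ρ₀ (+ n) (+ i) (+ n′) (+ i′) n≡ (proj₂ (ρ,a≡ x y v v′ sim))) sim
        where
        n≡ : + n ≡ + n′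
        n≡ = lia 6 (λ ρ a n i n′ i′ → a ⊞ # 1 ⊞ (a ⊞ # 1) ⊞ i ⊟ (+ 2 ⊛ a ⊞ ρ ⊟ # 1 ⊟ n ⊞ i) ≛ a ⊞ # 1 ⊞ (a ⊞ # 1) ⊞ i′ ⊟ (+ 2 ⊛ a ⊞ ρ ⊟ # 1 ⊟ n′ ⊞ i′) ⇒ ⊩ n ≛ n′)
          ρ₀ a₀ (+ n) (+ i) (+ n′) (+ i′) (b≡ x y v v′ sim)
      code-ideal-injective x@(code lower n i _) y@(code upper n′ i′ _) v@(_ , _ , n≤) v′@(_ , n′<) sim = contradiction
        (lia 8 (λ ρ a n i n′ i′ g d → + 2 ⊛ a ⊞ ρ ⊞ neg n ⊞ i ⊟ i ≛ + 2 ⊛ a ⊞ ρ ⊞ neg a ⊞ i′ ⊟ (a ⊟ n′ ⊞ i′) ⇒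
          a ≛ g ⊞ d ⇒ n ≼ g ⊞ d ⇒ # 1 ⊞ n′ ≼ g ⊞ d ⇒ ⊩ # 1 ≼ # 0)
          ρ₀ a₀ (+ n) (+ i) (+ n′) (+ i′) (+ g) (+ d) (b≡ x y v v′ sim) a₀≡ (ℤ.+≤+ n≤) (ℤ.+≤+ n′<)) 1≰0
      code-ideal-injective x@(code upper n i _) y@(code lower n′ i′ _) v@(_ , n<) v′@(_ , _ , n′≤) sim = contradiction
        (lia 8 (λ ρ a n i n′ i′ g d → + 2 ⊛ a ⊞ ρ ⊞ neg a ⊞ i ⊟ (a ⊟ n ⊞ i) ≛ + 2 ⊛ a ⊞ ρ ⊞ neg n′ ⊞ i′ ⊟ i′ ⇒
          a ≛ g ⊞ d ⇒ n′ ≼ g ⊞ d ⇒ # 1 ⊞ n ≼ g ⊞ d ⇒ ⊩ # 1 ≼ # 0)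
          ρ₀ a₀ (+ n) (+ i) (+ n′) (+ i′) (+ g) (+ d) (b≡ x y v v′ sim) a₀≡ (ℤ.+≤+ n′≤) (ℤ.+≤+ n<)) 1≰0
      code-ideal-injective x@(code lower _ _ _) y@(code crossed _ _ _) v v′ sim =
        contradiction (≡.sym (proj₁ (ρ,a≡ x y v v′ sim))) 3-ρ₀≢ρ₀
      code-ideal-injective x@(code upper _ _ _) y@(code crossed _ _ _) v v′ sim =
        contradiction (≡.sym (proj₁ (ρ,a≡ x y v v′ sim))) 3-ρ₀≢ρ₀
      code-ideal-injective x@(code crossed _ _ _) y@(code lower _ _ _) v v′ sim =
        contradiction (proj₁ (ρ,a≡ x y v v′ sim)) 3-ρ₀≢ρ₀
      code-ideal-injective x@(code crossed _ _ _) y@(code upper _ _ _) v v′ sim =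
        contradiction (proj₁ (ρ,a≡ x y v v′ sim)) 3-ρ₀≢ρ₀

      private
        Coded : FractionalIdeal E/F 𝓡 → Set (c ⊔ ℓ)
        Coded 𝓘 = Σ (Code q) λ x → Σ (Valid g d e x) λ v → code-ideal x v ≋ 𝓘

        finish : ∀ part n i {k b t 𝓘} → i ℕ.≤ n → Bounded g d e part n → kᵖ part n i ≡ k → bᵖ part n i ≡ b →
          𝕂 t → P (+ 3 ℤ.* loᵖ part n i) t → (f : Frame (ch.shape part k t) (ρᵖ part) (pᵖ part ℤ.- k) b)
          (stable : Stable (ch.shape part k t) (high (ρᵖ part) b)) → toIdeal f stable ≋ 𝓘 → Coded 𝓘
        finish part n i {𝓘 = 𝓘} i≤n bd ≡.refl ≡.refl 𝕂t p f stable sim =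
          let x , sim′ = cell-surjective {part} {n} {i} i≤n bd 𝕂t p f stable in
          code part n i x , (i≤n , bd) , ∼-trans {cell-ideal {part} {n} {i} i≤n bd x} {toIdeal f stable} {𝓘} sim′ sim

        transport-stable : ∀ {X n X′ n′} → Homothety 1# X n X′ n′ → Stable X n → Stable X′ n′
        transport-stable h stable Rr u∈ = Lat-resp (*-identityˡ _) (to (stable Rr (from (Lat-resp (sym (*-identityˡ _)) u∈))))
          where open Homothety h

        stable-1 : ∀ {X n r} → Stable X n → R r → Lat X n r
        stable-1 stable Rr = Lat-resp (*-identityʳ _) (stable Rr (Lat-𝔬 𝔬-1))

        +-injective-≤ : ∀ {m n} → + m ℤ.≤ + n → m ℕ.≤ n
        +-injective-≤ (ℤ.+≤+ h) = h

      module _ {X ρ a b} (f : Frame X ρ a b) (stable : Stable X (high ρ b)) where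
        private
          module f = Frame f

          0≤a : 0ℤ ℤ.≤ a
          0≤a = lia 2 (λ ρ a → # 1 ≼ ρ ⊞ + 3 ⊛ a ⇒ ρ ≼ # 2 ⇒ ⊩ # 0 ≼ a) ρ a f.1≤A f.ρ≤2

          -- A < B says 3(b - a) > 2ρ, and for ρ in {1, 2} this rounds up to b - a ≥ ρ.
          a+ρ≤b : a ℤ.+ ρ ℤ.≤ b
          a+ρ≤b = lia 3 (λ ρ a b → ρ ⊞ + 3 ⊛ a ⊞ # 1 ≼ neg ρ ⊞ + 3 ⊛ b ⇒ ρ ≼ # 2 ⇒ ⊩ a ⊞ ρ ≼ b) ρ a b f.A<B f.ρ≤2

          module Shape {p r} (chart : Chart ρ p r) where
            open ChartProperties chart

            t : Carrier
            t = proj₁ (shape-exists f)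
            admissible′ : Admissible t
            admissible′ = proj₁ (proj₂ (shape-exists f))
            h : Homothety 1# X (high ρ b) (shape (p ℤ.- a) t) (high ρ b)
            h = proj₂ (proj₂ (shape-exists f))
            frame′ : Frame (shape (p ℤ.- a) t) ρ (p ℤ.- (p ℤ.- a)) b
            frame′ = shape-frame {p ℤ.- a} {b} admissible′
              (lia 3 (λ ρ a p → # 1 ≼ ρ ⊞ + 3 ⊛ a ⇒ ⊩ # 1 ≼ ρ ⊞ + 3 ⊛ (p ⊟ (p ⊟ a))) ρ a p f.1≤A)
              (lia 4 (λ ρ a p b → ρ ⊞ + 3 ⊛ a ⊞ # 1 ≼ b ⇒ ⊩ ρ ⊞ + 3 ⊛ (p ⊟ (p ⊟ a)) ⊞ # 1 ≼ b) ρ a p (high ρ b) f.A<B)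
            stable′ : Stable (shape (p ℤ.- a) t) (high ρ b)
            stable′ = transport-stable h stable
            similar′ : toIdeal frame′ stable′ ≋ toIdeal f stable
            similar′ = homothety⇒∼ frame′ f stable′ stable (proj₂ (Homothety-sym h))

        -- Stability supplies three elements whose classes are known: θ gives a ≤ a₀, θX gives b ≤
        -- a₀ + a + ρ₀, and an element of R of valuation B₀ gives b ≤ b₀. These become the bounds on
        -- n and i.
        straight-coded : ρ ≡ ρ₀ → Coded (toIdeal f stable)
        straight-coded ≡.refl = by (+ 2 ℤ.* a₀ ℤ.+ ρ₀ ℤ.- b ℤₚ.≤? a₀)
          where
          open Shape straight
          a≤a₀ : a ℤ.≤ a₀
          a≤a₀ = FrameProperties.low-bound f (stable-1 stable θ∈R) θ.X-val
          b≤ : b ℤ.≤ a₀ ℤ.+ a ℤ.+ ρ₀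
          b≤ = FrameProperties.high-bound f {m = a₀ ℤ.+ a ℤ.+ ρ₀} (stable θ∈R Lat-X) (≡.subst (Val (θ * X))
            (lia 3 (λ ρ a₀ a → ⊩ ρ ⊞ + 3 ⊛ a₀ ⊞ (ρ ⊞ + 3 ⊛ a) ≛ neg ρ ⊞ + 3 ⊛ (a₀ ⊞ a ⊞ ρ)) ρ₀ a₀ a)
            (Val-* θ.X-val f.X-val))
          b≤b₀ : b ℤ.≤ b₀
          b≤b₀ with element (high ρ₀ b₀)
          ... | u , e = FrameProperties.high-bound f {m = b₀} (stable-1 stable (Lat⇒R (Lat-P (Val⇒P e)))) e
          tθ²-P : P (high ρ₀ b) (t * (θ * θ))
          tθ²-P = ChartProperties.Q-term-bound straight {a₀ ℤ.- a} {high ρ₀ b} admissible′ (stable-1 stable′ θ∈R)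
          by : Dec (+ 2 ℤ.* a₀ ℤ.+ ρ₀ ℤ.- b ℤ.≤ a₀) → Coded (toIdeal f stable)
          -- Here 3n = v(θ²) - B and i = a₀ - a. Since θ lies in the lattice, tθ² has valuation at
          -- least B, which is v(t) ≥ -3n.
          by (yes J≤a₀) with toℕ {+ 2 ℤ.* a₀ ℤ.+ ρ₀ ℤ.- b} (lia 8 (λ ρ a b b₀ g d e _ → ρ ≛ # 1 ⊞ e ⇒ a ≛ g ⊞ d ⇒
                  b₀ ≛ # 1 ⊞ e ⊞ g ⊞ + 2 ⊛ d ⇒ b ≼ b₀ ⇒ # 0 ≼ g ⇒ ⊩ # 0 ≼ + 2 ⊛ a ⊞ ρ ⊟ b)
                  ρ₀ a₀ b b₀ (+ g) (+ d) (+ e) 0ℤ ρ₀≡ a₀≡ b₀≡ b≤b₀ 0≤)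
                | toℕ {a₀ ℤ.- a} (lia 2 (λ a₀ a → a ≼ a₀ ⇒ ⊩ # 0 ≼ a₀ ⊟ a) a₀ a a≤a₀)
          ... | n , J≡ | i , k≡ = finish lower n i {𝓘 = toIdeal f stable}
            (+-injective-≤ (lia 6 (λ ρ a₀ a b n i → + 2 ⊛ a₀ ⊞ ρ ⊟ b ≛ n ⇒ a₀ ⊟ a ≛ i ⇒ b ≼ a₀ ⊞ a ⊞ ρ ⇒ ⊩ i ≼ n)
              ρ₀ a₀ a b (+ n) (+ i) J≡ k≡ b≤))
            ( +-injective-≤ (lia 8 (λ ρ a b b₀ g d e n → ρ ≛ # 1 ⊞ e ⇒ a ≛ g ⊞ d ⇒ b₀ ≛ # 1 ⊞ e ⊞ g ⊞ + 2 ⊛ d ⇒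
                + 2 ⊛ a ⊞ ρ ⊟ b ≛ n ⇒ b ≼ b₀ ⇒ ⊩ g ≼ n) ρ₀ a₀ b b₀ (+ g) (+ d) (+ e) (+ n) ρ₀≡ a₀≡ b₀≡ J≡ b≤b₀)
            , +-injective-≤ (ℤₚ.≤-trans (≡.subst (ℤ._≤ a₀) J≡ J≤a₀) (ℤₚ.≤-reflexive a₀≡)))
            (≡.sym k≡)
            (lia 5 (λ ρ a b n i → + 2 ⊛ a ⊞ ρ ⊟ b ≛ n ⇒ ⊩ + 2 ⊛ a ⊞ ρ ⊞ neg n ⊞ i ⊟ i ≛ b) ρ₀ a₀ b (+ n) (+ i) J≡)
            (proj₁ admissible′)
            (P-mono (lia 4 (λ ρ a b n → + 2 ⊛ a ⊞ ρ ⊟ b ≛ n ⇒ ⊩ + 3 ⊛ (neg n) ≼ neg ρ ⊞ + 3 ⊛ b ⊟ (neg ρ ⊞ + 3 ⊛ (+ 2 ⊛ a ⊞ ρ)))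
                ρ₀ a₀ b (+ n) J≡) (P-cancel θ²-val (P-resp (*-comm t (θ * θ)) tθ²-P)))
            frame′ stable′ similar′
          -- Here n = b - ρ₀ and i = n - a. The range of t comes from admissibility: v(t) > v(θ) -
          -- v(θ²) = -A₀, and the next multiple of 3 is -3a₀.
          by (no J≰a₀) with toℕ {b ℤ.- ρ₀} (lia 3 (λ ρ a b → # 0 ≼ a ⇒ a ⊞ ρ ≼ b ⇒ ⊩ # 0 ≼ b ⊟ ρ) ρ₀ a b 0≤a a+ρ≤b)
                | toℕ {b ℤ.- ρ₀ ℤ.- a} (lia 3 (λ ρ a b → a ⊞ ρ ≼ b ⇒ ⊩ # 0 ≼ b ⊟ ρ ⊟ a) ρ₀ a b a+ρ≤b)
          ... | n , n≡ | i , i≡ = finish upper n i {𝓘 = toIdeal f stable}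
            (+-injective-≤ (lia 5 (λ ρ a b n i → b ⊟ ρ ≛ n ⇒ b ⊟ ρ ⊟ a ≛ i ⇒ # 0 ≼ a ⇒ ⊩ i ≼ n) ρ₀ a b (+ n) (+ i) n≡ i≡ 0≤a))
            (+-injective-≤ (lia 6 (λ ρ a₀ b n g d → a₀ ≛ g ⊞ d ⇒ b ⊟ ρ ≛ n ⇒ a₀ ⊞ # 1 ≼ + 2 ⊛ a₀ ⊞ ρ ⊟ b ⇒ ⊩ # 1 ⊞ n ≼ g ⊞ d)
              ρ₀ a₀ b (+ n) (+ g) (+ d) a₀≡ n≡ (<⇒+1≤ (ℤₚ.≰⇒> J≰a₀))))
            (lia 6 (λ ρ a₀ a b n i → b ⊟ ρ ≛ n ⇒ b ⊟ ρ ⊟ a ≛ i ⇒ ⊩ a₀ ⊟ n ⊞ i ≛ a₀ ⊟ a) ρ₀ a₀ a b (+ n) (+ i) n≡ i≡)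
            (lia 5 (λ ρ a₀ b n i → b ⊟ ρ ≛ n ⇒ ⊩ + 2 ⊛ a₀ ⊞ ρ ⊞ neg a₀ ⊞ i ⊟ (a₀ ⊟ n ⊞ i) ≛ b) ρ₀ a₀ b (+ n) (+ i) n≡)
            (proj₁ admissible′)
            (P-coefficient (ℤ.- a₀) (proj₁ admissible′) θ²-val (proj₂ admissible′)
              (lia 2 (λ ρ a → ρ ≼ # 2 ⇒ ⊩ + 3 ⊛ (neg a) ⊟ # 2 ≼ ρ ⊞ + 3 ⊛ a ⊞ # 1 ⊟ (neg ρ ⊞ + 3 ⊛ (+ 2 ⊛ a ⊞ ρ))) ρ₀ a₀ θ.ρ≤2))
            frame′ stable′ similar′

        twisted-coded : ρ ≡ + 3 ℤ.- ρ₀ → Coded (toIdeal f stable)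
        twisted-coded ≡.refl with toℕ {b ℤ.- (+ 3 ℤ.- ρ₀)} (lia 3 (λ ρ a b → # 0 ≼ a ⇒ a ⊞ ρ ≼ b ⇒ ⊩ # 0 ≼ b ⊟ ρ) (+ 3 ℤ.- ρ₀) a b 0≤a a+ρ≤b)
          | toℕ {b ℤ.- (+ 3 ℤ.- ρ₀) ℤ.- a} (lia 3 (λ ρ a b → a ⊞ ρ ≼ b ⇒ ⊩ # 0 ≼ b ⊟ ρ ⊟ a) (+ 3 ℤ.- ρ₀) a b a+ρ≤b)
        ... | n , n≡ | i , i≡ = finish crossed n i {𝓘 = toIdeal f stable}
          (+-injective-≤ (lia 5 (λ ρ a b n i → b ⊟ ρ ≛ n ⇒ b ⊟ ρ ⊟ a ≛ i ⇒ # 0 ≼ a ⇒ ⊩ i ≼ n) (+ 3 ℤ.- ρ₀) a b (+ n) (+ i) n≡ i≡ 0≤a))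
          (+-injective-≤ (lia 7 (λ ρ a₀ b n g d e → ρ ≛ # 1 ⊞ e ⇒ a₀ ≛ g ⊞ d ⇒ b ⊟ (# 3 ⊟ ρ) ≛ n ⇒ b ≼ a₀ ⊞ # 1 ⇒ ⊩ # 1 ⊞ n ≼ g ⊞ d ⊞ e)
            ρ₀ a₀ b (+ n) (+ g) (+ d) (+ e) ρ₀≡ a₀≡ n≡ b≤))
          (lia 6 (λ ρ a₀ a b n i → b ⊟ (# 3 ⊟ ρ) ≛ n ⇒ b ⊟ (# 3 ⊟ ρ) ⊟ a ≛ i ⇒
            ⊩ + 2 ⊛ a₀ ⊞ ρ ⊟ # 1 ⊟ n ⊞ i ≛ + 2 ⊛ a₀ ⊞ ρ ⊟ # 1 ⊟ a) ρ₀ a₀ a b (+ n) (+ i) n≡ i≡)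
          (lia 5 (λ ρ a₀ b n i → b ⊟ (# 3 ⊟ ρ) ≛ n ⇒
            ⊩ a₀ ⊞ # 1 ⊞ (a₀ ⊞ # 1) ⊞ i ⊟ (+ 2 ⊛ a₀ ⊞ ρ ⊟ # 1 ⊟ n ⊞ i) ≛ b) ρ₀ a₀ b (+ n) (+ i) n≡)
          (proj₁ admissible′)
          -- Admissibility reads v(t) > v(θ²) - v(θ) = A₀, which rounds up to 3(a₀ + 1).
          (P-coefficient (a₀ ℤ.+ 1ℤ) (proj₁ admissible′) (Chart.Q-val twisted) (proj₂ admissible′)
            (lia 2 (λ ρ a → # 1 ≼ ρ ⇒ ⊩ + 3 ⊛ (a ⊞ # 1) ⊟ # 2 ≼
              # 3 ⊟ ρ ⊞ + 3 ⊛ (+ 2 ⊛ a ⊞ ρ ⊟ # 1) ⊞ # 1 ⊟ (neg (# 3 ⊟ ρ) ⊞ + 3 ⊛ (a ⊞ # 1))) ρ₀ a₀ θ.1≤ρ))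
          frame′ stable′ similar′
          where
          open Shape twisted
          b≤ : b ℤ.≤ a₀ ℤ.+ 1ℤ
          b≤ = FrameProperties.high-bound f {m = a₀ ℤ.+ 1ℤ} (stable-1 stable θ∈R) (Chart.Q-val twisted)

      code-ideal-surjective : ∀ 𝓘 → Σ (Code q) λ x → Σ (Valid g d e x) λ v → code-ideal x v ≋ 𝓘
      code-ideal-surjective 𝓘 = extend (by (ρ ℤₚ.≟ ρ₀))
        where
        open LatticeModel (latticeModel 𝓘)
        module f = Frame frame
        other : ρ ≢ ρ₀ → ρ ≡ + 3 ℤ.- ρ₀
        other ρ≢ρ₀ with ℤₚ.<-cmp ρ ρ₀
        ... | tri< ρ<ρ₀ _ _ = lia 2 (λ ρ ρ₀ → ρ ⊞ # 1 ≼ ρ₀ ⇒ # 1 ≼ ρ ⇒ ρ₀ ≼ # 2 ⇒ ⊩ ρ ≛ # 3 ⊟ ρ₀) ρ ρ₀ (<⇒+1≤ ρ<ρ₀) f.1≤ρ θ.ρ≤2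
        ... | tri≈ _ ρ≡ρ₀ _ = contradiction ρ≡ρ₀ ρ≢ρ₀
        ... | tri> _ _ ρ₀<ρ = lia 2 (λ ρ ρ₀ → ρ₀ ⊞ # 1 ≼ ρ ⇒ # 1 ≼ ρ₀ ⇒ ρ ≼ # 2 ⇒ ⊩ ρ ≛ # 3 ⊟ ρ₀) ρ ρ₀ (<⇒+1≤ ρ₀<ρ) θ.1≤ρ f.ρ≤2
        by : Dec (ρ ≡ ρ₀) → Coded (toIdeal frame stable)
        by (yes ρ≡ρ₀) = straight-coded frame stable ρ≡ρ₀
        by (no ρ≢ρ₀)  = twisted-coded frame stable (other ρ≢ρ₀)
        extend : Coded (toIdeal frame stable) → Coded 𝓘
        extend (x , v , sim) = x , v , ∼-trans {code-ideal x v} {toIdeal frame stable} {𝓘} sim similar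

-- Enumeration of the valid codes.

module Counting where

  open import Data.Fin.Base using (Fin; splitAt; join; _↑ˡ_; _↑ʳ_)
  open import Data.Fin.Properties using (splitAt-↑ˡ; splitAt-↑ʳ; join-splitAt)
  open import Data.Nat.Base as ℕ using (ℕ; zero; suc; _+_; _*_; _∸_; _⊓_; _^_; _≤_; _<_; s≤s)
  import Data.Nat.Properties as ℕₚ
  open import Relation.Binary.PropositionalEquality as ≡ using (_≡_; refl; sym; trans; cong; cong₂; module ≡-Reasoning)
  open Cells

  sum< : ℕ → (ℕ → ℕ) → ℕ
  sum< zero    h = 0
  sum< (suc n) h = sum< n h + h n

  pick : ∀ n (h : ℕ → ℕ) → Fin (sum< n h) → Σ ℕ λ i → Fin (h i)
  pick (suc n) h x = [ pick n h , n ,_ ]′ (splitAt (sum< n h) x)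

  pick-< : ∀ n h x → proj₁ (pick n h x) < n
  pick-< (suc n) h x with splitAt (sum< n h) x
  ... | inj₁ y = ℕₚ.m<n⇒m<1+n (pick-< n h y)
  ... | inj₂ _ = ℕₚ.n<1+n n

  splitAt-injective : ∀ m {n} {x y : Fin (m + n)} → splitAt m x ≡ splitAt m y → x ≡ y
  splitAt-injective m {n} {x} {y} eq =
    trans (sym (join-splitAt m n x)) (trans (cong (join m n) eq) (join-splitAt m n y))

  ,-injectiveʳ : ∀ {h : ℕ → ℕ} {i} {x y : Fin (h i)} → _≡_ {A = Σ ℕ λ i → Fin (h i)} (i , x) (i , y) → x ≡ y
  ,-injectiveʳ refl = refl

  pick-injective : ∀ n h {x y} → pick n h x ≡ pick n h y → x ≡ y
  pick-injective (suc n) h {x} {y} eq = splitAt-injective (sum< n h) (same (splitAt (sum< n h) x) (splitAt (sum< n h) y) eq)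
    where
    same : ∀ (a b : Fin (sum< n h) ⊎ Fin (h n)) → [ pick n h , n ,_ ]′ a ≡ [ pick n h , n ,_ ]′ b → a ≡ b
    same (inj₁ a) (inj₁ b) eq = cong inj₁ (pick-injective n h eq)
    same (inj₁ a) (inj₂ b) eq with () ← ℕₚ.<-irrefl (cong proj₁ eq) (pick-< n h a)
    same (inj₂ a) (inj₁ b) eq with () ← ℕₚ.<-irrefl (cong proj₁ (sym eq)) (pick-< n h b)
    same (inj₂ a) (inj₂ b) eq = cong inj₂ (,-injectiveʳ {h} eq)

  pick-surjective : ∀ n h {i} → i < n → (x : Fin (h i)) → ∃[ y ] pick n h y ≡ (i , x)
  pick-surjective (suc n) h {i} i<1+n x with i ℕₚ.≟ n
  ... | yes refl = sum< n h ↑ʳ x , cong [ pick n h , n ,_ ]′ (splitAt-↑ʳ (sum< n h) (h n) x)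
  ... | no i≢n with pick-surjective n h (ℕₚ.≤∧≢⇒< (ℕₚ.<⇒≤pred i<1+n) i≢n) x
  ...   | y , eq = y ↑ˡ h n , trans (cong [ pick n h , n ,_ ]′ (splitAt-↑ˡ (sum< n h) y (h n))) eq

  sum<-shift : ∀ m n h → sum< (m + n) h ≡ sum< m h + sum< n (λ i → h (m + i))
  sum<-shift m zero    h = trans (cong (λ k → sum< k h) (ℕₚ.+-identityʳ m)) (sym (ℕₚ.+-identityʳ _))
  sum<-shift m (suc n) h = trans (cong (λ k → sum< k h) (ℕₚ.+-suc m n))
    (trans (cong (_+ h (m + n)) (sum<-shift m n h)) (ℕₚ.+-assoc (sum< m h) _ _))

  sum<-cong : ∀ n {h h′} → (∀ {i} → i < n → h i ≡ h′ i) → sum< n h ≡ sum< n h′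
  sum<-cong zero    eq = refl
  sum<-cong (suc n) eq = cong₂ _+_ (sum<-cong n (λ i<n → eq (ℕₚ.m<n⇒m<1+n i<n))) (eq (ℕₚ.n<1+n n))

  *-distribˡ-sum< : ∀ k n h → k * sum< n h ≡ sum< n (λ i → k * h i)
  *-distribˡ-sum< k zero    h = ℕₚ.*-zeroʳ k
  *-distribˡ-sum< k (suc n) h = trans (ℕₚ.*-distribˡ-+ k _ _) (cong (_+ k * h n) (*-distribˡ-sum< k n h))

  module _ (q : ℕ) where

    height : ℕ → ℕ → ℕ
    height n i = q ^ (i ⊓ (n ∸ i))

    diagonal triangle : ℕ → ℕ
    diagonal n = sum< (suc n) (height n)
    triangle n = sum< n diagonal

    -- The two ends of the longer diagonal contribute 1 each. On the inner entries both i and j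
    -- exceed those of the shorter diagonal by 1, which multiplies q^min(i,j) by q.
    diagonal-step : ∀ n → diagonal (2 + n) ≡ 2 + q * diagonal n
    diagonal-step n = begin
      sum< (1 + suc n) (height (2 + n)) + height (2 + n) (2 + n)
        ≡⟨ cong₂ _+_ (sum<-shift 1 (suc n) (height (2 + n))) last ⟩
      1 + sum< (suc n) (λ i → height (2 + n) (suc i)) + 1
        ≡⟨ ℕₚ.+-comm _ 1 ⟩
      2 + sum< (suc n) (λ i → height (2 + n) (suc i))
        ≡⟨ cong (λ k → 2 + k) (sum<-cong (suc n) inner) ⟩
      2 + sum< (suc n) (λ i → q * height n i)
        ≡⟨ cong (λ k → 2 + k) (*-distribˡ-sum< q (suc n) (height n)) ⟨
      2 + q * diagonal n ∎
      where
      open ≡-Reasoning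
      inner : ∀ {i} → i < suc n → height (2 + n) (suc i) ≡ q * height n i
      inner {i} (s≤s i≤n) = cong (λ j → q ^ (suc i ⊓ j)) (ℕₚ.+-∸-assoc 1 i≤n)
      last : height (2 + n) (2 + n) ≡ 1
      last = cong (q ^_) (trans (cong (λ j → (2 + n) ⊓ j) (ℕₚ.n∸n≡0 n)) (ℕₚ.⊓-zeroʳ (2 + n)))

    count : ℕ → ℕ → ℕ → ℕ
    count g d e = sum< (suc d) (λ t → diagonal (g + t)) + (triangle (g + d) + triangle (g + d + e))

    module _ (g d e : ℕ) where
      private
        split : Fin (count g d e) → Fin (sum< (suc d) (λ t → diagonal (g + t))) ⊎ (Fin (triangle (g + d)) ⊎ Fin (triangle (g + d + e)))
        split x = [ inj₁ , (λ y → inj₂ (splitAt (triangle (g + d)) y)) ]′ (splitAt (sum< (suc d) (λ t → diagonal (g + t))) x)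

        split-injective : ∀ {x y} → split x ≡ split y → x ≡ y
        split-injective {x} {y} eq = splitAt-injective S (same (splitAt S x) (splitAt S y) eq)
          where
          S : ℕ
          S = sum< (suc d) (λ t → diagonal (g + t))
          inj₁-injective : ∀ {A B : Set} {a a′ : A} → _≡_ {A = A ⊎ B} (inj₁ a) (inj₁ a′) → a ≡ a′
          inj₁-injective refl = refl
          inj₂-injective : ∀ {A B : Set} {b b′ : B} → _≡_ {A = A ⊎ B} (inj₂ b) (inj₂ b′) → b ≡ b′
          inj₂-injective refl = refl
          same : ∀ (a b : Fin S ⊎ Fin (triangle (g + d) + triangle (g + d + e))) →
            [ inj₁ , (λ y → inj₂ (splitAt (triangle (g + d)) y)) ]′ a ≡ [ inj₁ , (λ y → inj₂ (splitAt (triangle (g + d)) y)) ]′ b → a ≡ b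
          same (inj₁ a) (inj₁ b) eq = cong inj₁ (inj₁-injective eq)
          same (inj₂ a) (inj₂ b) eq = cong inj₂ (splitAt-injective (triangle (g + d)) (inj₂-injective eq))

        split-surjective : ∀ y → ∃[ x ] split x ≡ y
        split-surjective (inj₁ y) = y ↑ˡ _ , cong [ inj₁ , (λ y → inj₂ (splitAt (triangle (g + d)) y)) ]′ (splitAt-↑ˡ _ y _)
        split-surjective (inj₂ y) = S ↑ʳ z ,
          trans (cong [ inj₁ , (λ y → inj₂ (splitAt (triangle (g + d)) y)) ]′ (splitAt-↑ʳ S _ z)) (cong inj₂ (split-join y))
          where
          S : ℕ
          S = sum< (suc d) (λ t → diagonal (g + t))
          z : Fin (triangle (g + d) + triangle (g + d + e))
          z = join _ _ y
          split-join : ∀ y → splitAt (triangle (g + d)) (join (triangle (g + d)) (triangle (g + d + e)) y) ≡ y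
          split-join (inj₁ y) = splitAt-↑ˡ _ y _
          split-join (inj₂ y) = splitAt-↑ʳ (triangle (g + d)) _ y

        point : Part → (n : ℕ) → (Σ ℕ λ i → Fin (height n i)) → Code q
        point part n (i , x) = code part n i x

        decode-lower : Fin (sum< (suc d) (λ t → diagonal (g + t))) → Code q
        decode-lower x = let t , y = pick (suc d) _ x in point lower (g + t) (pick (suc (g + t)) (height (g + t)) y)

        decode-triangle : Part → ∀ m → Fin (triangle m) → Code q
        decode-triangle part m x = let n , y = pick m diagonal x in point part n (pick (suc n) (height n) y)

        decode-split : Fin (sum< (suc d) (λ t → diagonal (g + t))) ⊎ (Fin (triangle (g + d)) ⊎ Fin (triangle (g + d + e))) → Code q
        decode-split (inj₁ x)        = decode-lower x
        decode-split (inj₂ (inj₁ x)) = decode-triangle upper (g + d) x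
        decode-split (inj₂ (inj₂ x)) = decode-triangle crossed (g + d + e) x

        point-injective : ∀ {part part′ n n′} a b → point part n a ≡ point part′ n′ b →
          part ≡ part′ × _≡_ {A = Σ ℕ λ n → Σ ℕ λ i → Fin (height n i)} (n , a) (n′ , b)
        point-injective a b refl = refl , refl

        fibres : ∀ {n n′} {y : Fin (diagonal n)} {y′ : Fin (diagonal n′)} →
          _≡_ {A = Σ ℕ λ n → Σ ℕ λ i → Fin (height n i)} (n , pick (suc n) (height n) y) (n′ , pick (suc n′) (height n′) y′) →
          _≡_ {A = Σ ℕ λ n → Fin (diagonal n)} (n , y) (n′ , y′)
        fibres {n} {n′} {y} {y′} eq = from-base (cong proj₁ eq) eq
          where
          ,-injective : ∀ {n} {a b : Σ ℕ λ i → Fin (height n i)} →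
            _≡_ {A = Σ ℕ λ n → Σ ℕ λ i → Fin (height n i)} (n , a) (n , b) → a ≡ b
          ,-injective refl = refl
          from-base : ∀ {n n′} {y : Fin (diagonal n)} {y′ : Fin (diagonal n′)} → n ≡ n′ →
            _≡_ {A = Σ ℕ λ n → Σ ℕ λ i → Fin (height n i)} (n , pick (suc n) (height n) y) (n′ , pick (suc n′) (height n′) y′) →
            _≡_ {A = Σ ℕ λ n → Fin (diagonal n)} (n , y) (n′ , y′)
          from-base {n} refl eq = cong (n ,_) (pick-injective (suc n) (height n) (,-injective eq))

        lower-injective : ∀ x x′ → decode-lower x ≡ decode-lower x′ → x ≡ x′
        lower-injective x x′ eq = pick-injective (suc d) (λ t → diagonal (g + t))
          (unshift _ _ (fibres (proj₂ (point-injective (pick (suc (g + proj₁ px)) _ (proj₂ px)) (pick (suc (g + proj₁ px′)) _ (proj₂ px′)) eq))))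
          where
          px px′ : Σ ℕ λ t → Fin (diagonal (g + t))
          px  = pick (suc d) (λ t → diagonal (g + t)) x
          px′ = pick (suc d) (λ t → diagonal (g + t)) x′
          unshift : ∀ (a b : Σ ℕ λ t → Fin (diagonal (g + t))) →
            _≡_ {A = Σ ℕ λ n → Fin (diagonal n)} (g + proj₁ a , proj₂ a) (g + proj₁ b , proj₂ b) → a ≡ b
          unshift (t , y) (t′ , y′) eq with ℕₚ.+-cancelˡ-≡ g t t′ (cong proj₁ eq)
          ... | refl = cong (t ,_) (,-injectiveʳ {diagonal} eq)

        triangle-injective : ∀ part m x x′ → decode-triangle part m x ≡ decode-triangle part m x′ → x ≡ x′
        triangle-injective part m x x′ eq = pick-injective m diagonal (fibres (proj₂
          (point-injective (pick (suc (proj₁ (pick m diagonal x))) _ (proj₂ (pick m diagonal x)))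
                           (pick (suc (proj₁ (pick m diagonal x′))) _ (proj₂ (pick m diagonal x′))) eq)))

        decode-split-injective : ∀ a b → decode-split a ≡ decode-split b → a ≡ b
        decode-split-injective (inj₁ _) (inj₂ (inj₁ _)) eq with () ← cong Code.part eq
        decode-split-injective (inj₁ _) (inj₂ (inj₂ _)) eq with () ← cong Code.part eq
        decode-split-injective (inj₂ (inj₁ _)) (inj₁ _) eq with () ← cong Code.part eq
        decode-split-injective (inj₂ (inj₂ _)) (inj₁ _) eq with () ← cong Code.part eq
        decode-split-injective (inj₂ (inj₁ _)) (inj₂ (inj₂ _)) eq with () ← cong Code.part eq
        decode-split-injective (inj₂ (inj₂ _)) (inj₂ (inj₁ _)) eq with () ← cong Code.part eq
        decode-split-injective (inj₁ x) (inj₁ y) eq = cong inj₁ (lower-injective x y eq)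
        decode-split-injective (inj₂ (inj₁ x)) (inj₂ (inj₁ y)) eq = cong (λ z → inj₂ (inj₁ z)) (triangle-injective upper (g + d) x y eq)
        decode-split-injective (inj₂ (inj₂ x)) (inj₂ (inj₂ y)) eq = cong (λ z → inj₂ (inj₂ z)) (triangle-injective crossed (g + d + e) x y eq)

      abstract
        decode : Fin (count g d e) → Code q
        decode x = decode-split (split x)

        decode-injective : ∀ {x y} → decode x ≡ decode y → x ≡ y
        decode-injective {x} {y} eq = split-injective (decode-split-injective (split x) (split y) eq)

        decode-valid : ∀ x → Valid g d e (decode x)
        decode-valid x with split x
        ... | inj₁ y = ℕₚ.<⇒≤pred (pick-< _ _ (proj₂ (pick (suc d) (λ t → diagonal (g + t)) y)))
          , ℕₚ.m≤m+n g _ , ℕₚ.+-monoʳ-≤ g (ℕₚ.<⇒≤pred (pick-< (suc d) _ y))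
        ... | inj₂ (inj₁ y) = ℕₚ.<⇒≤pred (pick-< _ _ (proj₂ (pick (g + d) diagonal y))) , pick-< (g + d) _ y
        ... | inj₂ (inj₂ y) = ℕₚ.<⇒≤pred (pick-< _ _ (proj₂ (pick (g + d + e) diagonal y))) , pick-< (g + d + e) _ y

      private
        offset : ∀ {m n} → m ≤ n → ∃[ t ] m + t ≡ n
        offset {m} {n} m≤n = n ∸ m , ℕₚ.m+[n∸m]≡n m≤n

        decode-split-surjective : ∀ c → Valid g d e c → ∃[ y ] decode-split y ≡ c
        decode-split-surjective (code lower n i x) (i≤n , g≤n , n≤g+d)
          with offset g≤n
        ... | t , refl with pick-surjective (suc (g + t)) (height (g + t)) (s≤s i≤n) x
        ...   | y , eq with pick-surjective (suc d) (λ t → diagonal (g + t)) {t} (s≤s (ℕₚ.+-cancelˡ-≤ g t d n≤g+d)) y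
        ...     | z , eq′ = inj₁ z , trans (cong (λ ty → point lower (g + proj₁ ty) (pick (suc (g + proj₁ ty)) (height (g + proj₁ ty)) (proj₂ ty))) eq′) (cong (point lower (g + t)) eq)
        decode-split-surjective (code upper n i x) (i≤n , n<) with pick-surjective (suc n) (height n) (s≤s i≤n) x
        ... | y , eq with pick-surjective (g + d) diagonal n< y
        ...   | z , eq′ = inj₂ (inj₁ z) , trans (cong (λ ny → point upper (proj₁ ny) (pick (suc (proj₁ ny)) (height (proj₁ ny)) (proj₂ ny))) eq′) (cong (point upper n) eq)
        decode-split-surjective (code crossed n i x) (i≤n , n<) with pick-surjective (suc n) (height n) (s≤s i≤n) x
        ... | y , eq with pick-surjective (g + d + e) diagonal n< y
        ...   | z , eq′ = inj₂ (inj₂ z) , trans (cong (λ ny → point crossed (proj₁ ny) (pick (suc (proj₁ ny)) (height (proj₁ ny)) (proj₂ ny))) eq′) (cong (point crossed n) eq)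

      abstract
        decode-surjective : ∀ c → Valid g d e c → ∃[ x ] decode x ≡ c
        decode-surjective c v with decode-split-surjective c v
        ... | y , eq with split-surjective y
        ...   | x , eq′ = x , trans (cong decode-split eq′) eq

-- Closed forms of the sums and the eight cases.

module Formula where

  open import Data.Empty using (⊥-elim)
  open import Data.Integer.Base as ℤ using (ℤ; +_; 0ℤ; 1ℤ; _+_; _-_; _*_)
  open import Data.Nat.Base as ℕ using (ℕ; zero; suc; _∸_; NonZero)
  import Data.Nat.Properties as ℕₚ
  open import Data.Nat.Divisibility using (_∣_; _∤_; divides; _∣?_; ∣m+n∣m⇒∣n; m∣m*n)
  open import Data.Nat.DivMod using (_/_; m*n/n≡m; /-congˡ)
  open import Relation.Binary.PropositionalEquality as ≡ using (_≡_; _≢_; refl; sym; trans; cong; subst)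
  open import Relation.Nullary.Decidable using (from-no)
  open Counting
  open Solver ℤₚ.+-*-commutativeRing using (ring!)

  num : ∀ {n} → ℕ → Poly n
  num zero    = 𝟘
  num (suc k) = 𝟙 ⊕ num k

  multiple : ∀ {n} → ℕ → Poly n → Poly n
  multiple zero    p = 𝟘
  multiple (suc k) p = p ⊕ multiple k p

  infixr 7 _⊠_

  -- Repeated addition ending in 0 unfolds exactly as multiplication of naturals by a literal does,
  -- so equations between naturals can be passed to `lia` after applying `+_`, with no conversion of
  -- products.
  _⊠_ : ∀ {n} → ℕ → Expr n → Expr n
  zero  ⊠ e = # 0
  suc k ⊠ e = e ⊞ k ⊠ e

  -- (q - 1)², and (q - 1)² times the triangles of even and odd size in terms of x = qᵖ.
  sq : ∀ {n} → Poly n → Poly n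
  sq q = (q ⊖ 𝟙) ⊗ (q ⊖ 𝟙)

  evenᶜ oddᶜ : ∀ {n} → Poly n → Poly n → Poly n → Poly n
  evenᶜ q x p = (num 3 ⊗ q ⊕ 𝟙) ⊗ (x ⊖ 𝟙) ⊖ num 4 ⊗ p ⊗ (q ⊖ 𝟙)
  oddᶜ  q x p = (num 3 ⊗ q ⊕ 𝟙) ⊗ (x ⊖ 𝟙) ⊖ num 4 ⊗ p ⊗ (q ⊖ 𝟙) ⊕ (q ⊖ 𝟙) ⊗ (q ⊗ x ⊕ x ⊖ num 2)

  even-odd : ∀ n → (∃[ p ] n ≡ p ℕ.+ p) ⊎ (∃[ p ] n ≡ suc (p ℕ.+ p))
  even-odd zero    = inj₁ (0 , refl)
  even-odd (suc n) with even-odd n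
  ... | inj₁ (p , refl) = inj₂ (p , refl)
  ... | inj₂ (p , refl) = inj₁ (suc p , cong suc (sym (ℕₚ.+-suc p p)))

  2∣p+p : ∀ p → 2 ∣ p ℕ.+ p
  2∣p+p p = subst (2 ∣_) (cong (p ℕ.+_) (ℕₚ.+-identityʳ p)) (m∣m*n p)

  even-summand : ∀ {n m} k → n ≡ m ℕ.+ (k ℕ.+ k) → 2 ∣ n → ∃[ p ] m ≡ p ℕ.+ p
  even-summand {n} {m} k refl 2∣n with ∣m+n∣m⇒∣n (subst (2 ∣_) (ℕₚ.+-comm m (k ℕ.+ k)) 2∣n) (2∣p+p k)
  ... | divides p refl = p , trans (ℕₚ.*-comm p 2) (cong (p ℕ.+_) (ℕₚ.+-identityʳ p))

  odd-summand : ∀ {n m} k → n ≡ m ℕ.+ (k ℕ.+ k) → 2 ∤ n → ∃[ p ] m ≡ suc (p ℕ.+ p)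
  odd-summand {n} {m} k refl 2∤n with even-odd m
  ... | inj₂ r          = r
  ... | inj₁ (p , refl) = contradiction (subst (2 ∣_)
    (ℤₚ.+-injective (lia 2 (λ p k → ⊩ p ⊞ k ⊞ (p ⊞ k) ≛ p ⊞ p ⊞ (k ⊞ k)) (+ p) (+ k))) (2∣p+p (p ℕ.+ k))) 2∤n

  pred-even : ∀ {m} p → suc m ≡ p ℕ.+ p → ∃[ r ] m ≡ suc (r ℕ.+ r)
  pred-even (suc p) eq = p , trans (ℕₚ.suc-injective eq) (ℕₚ.+-suc p p)

  pred-odd : ∀ {m} p → suc m ≡ suc (p ℕ.+ p) → ∃[ r ] m ≡ r ℕ.+ r
  pred-odd p eq = p , ℕₚ.suc-injective eq

  quotient : ∀ k .{{_ : NonZero k}} {n m} → n ≡ k ℕ.* m → n / k ≡ m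
  quotient k {m = m} refl = trans (/-congˡ {o = k} (ℕₚ.*-comm k m)) (m*n/n≡m m k)

  quotient-∸ : ∀ c k .{{_ : NonZero k}} {n m} → n ≡ c ℕ.+ k ℕ.* m → (n ∸ c) / k ≡ m
  quotient-∸ c k {m = m} refl = quotient k (ℕₚ.m+n∸m≡n c (k ℕ.* m))

  difference : ∀ {s t m k} → t ≡ k → s ≡ m ℕ.+ k → s ∸ t ≡ m
  difference {m = m} {k} refl refl = ℕₚ.m+n∸n≡m m k

  -- Modulo 3 the equation reads f ≡ 2e, so the residue of f decides e.
  e≡0 : ∀ g d {e f} → e ℕ.≤ 1 → f ≡ 3 ℕ.* g ℕ.+ 6 ℕ.* d ℕ.+ 2 ℕ.* e → 3 ∣ f → e ≡ 0
  e≡0 g d ℕ.z≤n _ _ = refl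
  e≡0 g d {f = f} (ℕ.s≤s ℕ.z≤n) hf 3∣f = ⊥-elim (from-no (3 ∣? 2) (∣m+n∣m⇒∣n (subst (3 ∣_)
    (ℤₚ.+-injective (lia 3 (λ f g d → f ≛ 3 ⊠ g ⊞ 6 ⊠ d ⊞ # 2 ⇒ ⊩ f ≛ 3 ⊠ (g ⊞ (d ⊞ d)) ⊞ # 2) (+ f) (+ g) (+ d) (cong +_ hf))) 3∣f)
    (m∣m*n (g ℕ.+ (d ℕ.+ d)))))

  e≡1 : ∀ g d {e f} → e ℕ.≤ 1 → f ≡ 3 ℕ.* g ℕ.+ 6 ℕ.* d ℕ.+ 2 ℕ.* e → 3 ∣ f ℕ.+ 1 → e ≡ 1
  e≡1 g d (ℕ.s≤s ℕ.z≤n) _ _ = refl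
  e≡1 g d {f = f} ℕ.z≤n hf 3∣f = ⊥-elim (from-no (3 ∣? 1) (∣m+n∣m⇒∣n (subst (3 ∣_)
    (ℤₚ.+-injective (lia 3 (λ f g d → f ≛ 3 ⊠ g ⊞ 6 ⊠ d ⊞ # 0 ⇒ ⊩ f ⊞ # 1 ≛ 3 ⊠ (g ⊞ (d ⊞ d)) ⊞ # 1) (+ f) (+ g) (+ d) (cong +_ hf))) 3∣f)
    (m∣m*n (g ℕ.+ (d ℕ.+ d)))))

  -- The parity of f/3 is thus the parity of g.
  third₀ : ∀ g d {f} → f ≡ 3 ℕ.* g ℕ.+ 6 ℕ.* d ℕ.+ 0 → f / 3 ≡ g ℕ.+ (d ℕ.+ d)
  third₀ g d {f} hf = quotient 3 (ℤₚ.+-injective (lia 3 (λ f g d → f ≛ 3 ⊠ g ⊞ 6 ⊠ d ⊞ # 0 ⇒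
    ⊩ f ≛ 3 ⊠ (g ⊞ (d ⊞ d))) (+ f) (+ g) (+ d) (cong +_ hf)))

  third₁ : ∀ g d {f} → f ≡ 3 ℕ.* g ℕ.+ 6 ℕ.* d ℕ.+ 2 → (f ℕ.+ 1) / 3 ≡ suc g ℕ.+ (d ℕ.+ d)
  third₁ g d {f} hf = quotient 3 (ℤₚ.+-injective (lia 3 (λ f g d → f ≛ 3 ⊠ g ⊞ 6 ⊠ d ⊞ # 2 ⇒
    ⊩ f ⊞ # 1 ≛ 3 ⊠ (# 1 ⊞ g ⊞ (d ⊞ d))) (+ f) (+ g) (+ d) (cong +_ hf)))

  -- Exhibits the parity of s as that of d.
  split₀ : ∀ g d {s} → s ≡ 2 ℕ.* g ℕ.+ 3 ℕ.* d ℕ.+ 0 → s ≡ d ℕ.+ (g ℕ.+ d ℕ.+ (g ℕ.+ d))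
  split₀ g d {s} hs = ℤₚ.+-injective (lia 3 (λ s g d → s ≛ 2 ⊠ g ⊞ 3 ⊠ d ⊞ # 0 ⇒
    ⊩ s ≛ d ⊞ (g ⊞ d ⊞ (g ⊞ d))) (+ s) (+ g) (+ d) (cong +_ hs))

  split₁ : ∀ g d {s} → s ≡ 2 ℕ.* g ℕ.+ 3 ℕ.* d ℕ.+ 1 → s ≡ suc d ℕ.+ (g ℕ.+ d ℕ.+ (g ℕ.+ d))
  split₁ g d {s} hs = ℤₚ.+-injective (lia 3 (λ s g d → s ≛ 2 ⊠ g ⊞ 3 ⊠ d ⊞ # 1 ⇒
    ⊩ s ≛ # 1 ⊞ d ⊞ (g ⊞ d ⊞ (g ⊞ d))) (+ s) (+ g) (+ d) (cong +_ hs))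

  -- Every exponent in the numerators is the exponent φ of the denominator plus one of 0, α, or half
  -- of the even one among g + d and g + d - 1, plus a small constant. Factoring the powers turns
  -- the formula into a polynomial identity for the ring solver.
  power : ∀ {q k} φ m c → k ≡ φ ℕ.+ (m ℕ.+ c) → (+ q) ℤ.^ k ≡ (+ q) ℤ.^ φ * ((+ q) ℤ.^ m * (+ q) ℤ.^ c)
  power {q} φ m c refl = trans (ℤₚ.^-distribˡ-+-* (+ q) φ (m ℕ.+ c)) (cong ((+ q) ℤ.^ φ *_) (ℤₚ.^-distribˡ-+-* (+ q) m c))

  power⁺ : ∀ {q k} φ m c → k ≡ φ ℕ.+ (m ℕ.+ c) → ∀ i →
    (+ q) ℤ.^ (k ℕ.+ i) ≡ (+ q) ℤ.^ φ * ((+ q) ℤ.^ m * (+ q) ℤ.^ (c ℕ.+ i))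
  power⁺ φ m c refl i = power φ m (c ℕ.+ i) (trans (ℕₚ.+-assoc φ (m ℕ.+ c) i) (cong (φ ℕ.+_) (ℕₚ.+-assoc m c i)))

  denominator≢0 : ∀ {q} → 2 ℕ.≤ q → ∀ k → (+ q) ℤ.^ k * ((+ q - + 1) * (+ q - + 1)) ≢ 0ℤ
  denominator≢0 {suc (suc q)} (ℕ.s≤s (ℕ.s≤s ℕ.z≤n)) k eq with ℤₚ.i*j≡0⇒i≡0∨j≡0 ((+ suc (suc q)) ℤ.^ k) eq
  ... | inj₁ qᵏ≡0 with () ← ℤₚ.i^n≡0⇒i≡0 (+ suc (suc q)) k qᵏ≡0

  module _ (q : ℕ) where

    -- The band of diagonals g to g + d is a difference of two triangles, so only triangle sums need
    -- a closed form.
    count-triangles : ∀ g d e → + count q g d e ≡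
      + triangle q (g ℕ.+ suc d) + (+ triangle q (g ℕ.+ d) + + triangle q (g ℕ.+ d ℕ.+ e)) - + triangle q g
    count-triangles g d e = ring! 5 (λ t₁ t₀ t₂ t₃ s → (⊝ 𝟙) · t₁ ≗ t₀ ⊕ s ⇒ ⊢ s ⊕ (t₂ ⊕ t₃) ≗ t₁ ⊕ (t₂ ⊕ t₃) ⊖ t₀)
      (+ triangle q (g ℕ.+ suc d) ∷ + triangle q g ∷ + triangle q (g ℕ.+ d) ∷ + triangle q (g ℕ.+ d ℕ.+ e) ∷
       + sum< (suc d) (λ t → diagonal q (g ℕ.+ t)) ∷ []) (cong +_ (sum<-shift g (suc d) (diagonal q)))

    private
      D T x : ℕ → ℤ
      D n = + diagonal q n
      T n = + triangle q n
      x p = (+ q) ℤ.^ p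

    D-step : ∀ n → D (2 ℕ.+ n) ≡ + 2 + + q * D n
    D-step n = trans (cong +_ (diagonal-step q n)) (cong (λ z → + 2 + z) (ℤₚ.pos-* q (diagonal q n)))

    -- Solves the recursion of step 2 from the diagonal sum 1 at n = 0; the odd diagonals start from
    -- 2.
    D-even : ∀ p → (+ q - 1ℤ) * D (p ℕ.+ p) ≡ + q * x p + x p - + 2
    D-even zero    = ring! 1 (λ q → ⊢ (q ⊖ 𝟙) ⊗ 𝟙 ≗ q ⊗ 𝟙 ⊕ 𝟙 ⊖ num 2) (+ q ∷ [])
    D-even (suc p) rewrite ℕₚ.+-suc p p = ring! 4 (λ q x D D′ → (q ⊖ 𝟙) · D′ ≗ num 2 ⊕ q ⊗ D ⇒ q · (q ⊖ 𝟙) ⊗ D ≗ q ⊗ x ⊕ x ⊖ num 2 ⇒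
      ⊢ (q ⊖ 𝟙) ⊗ D′ ≗ q ⊗ (q ⊗ x) ⊕ q ⊗ x ⊖ num 2) (+ q ∷ x p ∷ D (p ℕ.+ p) ∷ D (2 ℕ.+ (p ℕ.+ p)) ∷ []) (D-step (p ℕ.+ p)) (D-even p)

    D-odd : ∀ p → (+ q - 1ℤ) * D (suc (p ℕ.+ p)) ≡ + 2 * (+ q * x p) - + 2
    D-odd zero    = ring! 1 (λ q → ⊢ (q ⊖ 𝟙) ⊗ num 2 ≗ num 2 ⊗ (q ⊗ 𝟙) ⊖ num 2) (+ q ∷ [])
    D-odd (suc p) rewrite ℕₚ.+-suc p p = ring! 4 (λ q x D D′ → (q ⊖ 𝟙) · D′ ≗ num 2 ⊕ q ⊗ D ⇒ q · (q ⊖ 𝟙) ⊗ D ≗ num 2 ⊗ (q ⊗ x) ⊖ num 2 ⇒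
      ⊢ (q ⊖ 𝟙) ⊗ D′ ≗ num 2 ⊗ (q ⊗ (q ⊗ x)) ⊖ num 2) (+ q ∷ x p ∷ D (suc (p ℕ.+ p)) ∷ D (2 ℕ.+ suc (p ℕ.+ p)) ∷ []) (D-step (suc (p ℕ.+ p))) (D-odd p)

    -- Two further diagonals add (q - 1)((3q + 1)qᵖ - 4) after scaling by (q - 1)². The first term
    -- is geometric; the constant -4 accumulates to the term linear in p.
    T-even : ∀ p → (+ q - 1ℤ) * (+ q - 1ℤ) * T (p ℕ.+ p) ≡ (+ 3 * + q + 1ℤ) * (x p - 1ℤ) - + 4 * + p * (+ q - 1ℤ)
    T-even zero    = ring! 1 (λ q → ⊢ sq q ⊗ 𝟘 ≗ evenᶜ q 𝟙 𝟘) (+ q ∷ [])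
    T-even (suc p) rewrite ℕₚ.+-suc p p = ring! 6 (λ q x p T D D′ →
      𝟙 · sq q ⊗ T ≗ evenᶜ q x p ⇒ (q ⊖ 𝟙) · (q ⊖ 𝟙) ⊗ D ≗ q ⊗ x ⊕ x ⊖ num 2 ⇒ (q ⊖ 𝟙) · (q ⊖ 𝟙) ⊗ D′ ≗ num 2 ⊗ (q ⊗ x) ⊖ num 2 ⇒
      ⊢ sq q ⊗ (T ⊕ D ⊕ D′) ≗ evenᶜ q (q ⊗ x) (𝟙 ⊕ p))
      (+ q ∷ x p ∷ + p ∷ T (p ℕ.+ p) ∷ D (p ℕ.+ p) ∷ D (suc (p ℕ.+ p)) ∷ []) (T-even p) (D-even p) (D-odd p)

    triangle-even : ∀ {n} p → n ≡ p ℕ.+ p →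
      (+ q - 1ℤ) * (+ q - 1ℤ) * T n ≡ (+ 3 * + q + 1ℤ) * (x p - 1ℤ) - + 4 * + p * (+ q - 1ℤ)
    triangle-even p refl = T-even p

    triangle-odd : ∀ {n} p → n ≡ suc (p ℕ.+ p) → (+ q - 1ℤ) * (+ q - 1ℤ) * T n ≡
      (+ 3 * + q + 1ℤ) * (x p - 1ℤ) - + 4 * + p * (+ q - 1ℤ) + (+ q - 1ℤ) * (+ q * x p + x p - + 2)
    triangle-odd p refl = ring! 5 (λ q x p T D → 𝟙 · sq q ⊗ T ≗ evenᶜ q x p ⇒ (q ⊖ 𝟙) · (q ⊖ 𝟙) ⊗ D ≗ q ⊗ x ⊕ x ⊖ num 2 ⇒
      ⊢ sq q ⊗ (T ⊕ D) ≗ oddᶜ q x p) (+ q ∷ x p ∷ + p ∷ T (p ℕ.+ p) ∷ D (p ℕ.+ p) ∷ []) (T-even p) (D-even p)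

  open ClassNumberFormula

  -- The residue of f fixes e, and the two parity conditions fix the parities of g = 2α or 2α + 1
  -- and d = 2δ or 2δ + 1. The parts of the four triangle sums free of powers with variable exponent
  -- collect to 2s(1 - q) - 8q, which is the origin of the linear term and of the constant 8.
  formula : ∀ q g d e → 2 ℕ.≤ q → e ℕ.≤ 1 → ∀ {s f} → s ≡ 2 ℕ.* g ℕ.+ 3 ℕ.* d ℕ.+ e →
    f ≡ 3 ℕ.* g ℕ.+ 6 ℕ.* d ℕ.+ 2 ℕ.* e → ClassNumberFormula q s f (count q g d e)
  f₀-s-even-f/3-even (formula q g d e 2≤q e≤1 {s} {f} hs hf) 3∣f 2∣s 2∣t with e≡0 g d e≤1 hf 3∣f
  ... | refl with even-summand {m = d} (g ℕ.+ d) (split₀ g d hs) 2∣s | even-summand {m = g} d (third₀ g d hf) 2∣t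
  ... | δ , refl | α , refl =
        -- F is the power of q in the denominator, X = q^(α+δ) and x = q^α. The h's are the triangle
        -- sums; h₀ enters with the opposite sign since it is subtracted. The coefficient of each
        -- power q₁, q₂, ... is the negative of its coefficient in the numerator. The other cases
        -- follow the same scheme.
        denominator≢0 2≤q (f / 6) , ring! 18 (λ N q F X x h₁ h₀ h₂ h₃ α δ s q₁ q₂ q₃ q₄ q₅ q₆ →
          (F ⊗ sq q) · N ≗ h₁ ⊕ (h₂ ⊕ h₃) ⊖ h₀ ⇒
          F · sq q ⊗ h₁ ≗ oddᶜ q X (α ⊕ δ) ⇒ (⊝ F) · sq q ⊗ h₀ ≗ evenᶜ q x α ⇒
          F · sq q ⊗ h₂ ≗ evenᶜ q X (α ⊕ δ) ⇒ F · sq q ⊗ h₃ ≗ evenᶜ q X (α ⊕ δ) ⇒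
          (⊝ (num 2 ⊗ F ⊗ (𝟙 ⊖ q))) · s ≗ multiple 4 α ⊕ multiple 6 δ ⊕ num 0 ⇒
          (⊝ 𝟙) · q₁ ≗ F ⊗ (X ⊗ (q ⊗ (q ⊗ 𝟙))) ⇒
          (⊝ num 9) · q₂ ≗ F ⊗ (X ⊗ (q ⊗ 𝟙)) ⇒
          (⊝ num 2) · q₃ ≗ F ⊗ (X ⊗ 𝟙) ⇒
          num 8 · q₄ ≗ F ⊗ (𝟙 ⊗ (q ⊗ 𝟙)) ⇒
          num 3 · q₅ ≗ F ⊗ (x ⊗ (q ⊗ 𝟙)) ⇒
          𝟙 · q₆ ≗ F ⊗ (x ⊗ 𝟙) ⇒
          ⊢ N ⊗ (F ⊗ sq q) ≗ q₁ ⊕ num 9 ⊗ q₂ ⊕ num 2 ⊗ q₃ ⊕ num 2 ⊗ s ⊗ F ⊗ (𝟙 ⊖ q) ⊖ num 8 ⊗ q₄ ⊖ num 3 ⊗ q₅ ⊖ q₆)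
          (_ ∷ + q ∷ Q (f / 6) ∷ Q (α ℕ.+ δ) ∷ Q α ∷ _ ∷ _ ∷ _ ∷ _ ∷ + α ∷ + δ ∷ + s ∷ Q (s / 2 ℕ.+ 2) ∷ Q (s / 2 ℕ.+ 1) ∷ Q (s / 2) ∷ Q (f / 6 ℕ.+ 1) ∷ Q (s ∸ f / 3 ℕ.+ 1) ∷ Q (s ∸ f / 3) ∷ [])
          (count-triangles q (α ℕ.+ α) (δ ℕ.+ δ) 0)
          (triangle-odd q (α ℕ.+ δ) (ℤₚ.+-injective (lia 2 (λ α δ → ⊩ α ⊞ α ⊞ (# 1 ⊞ (δ ⊞ δ)) ≛ # 1 ⊞ (α ⊞ δ ⊞ (α ⊞ δ))) (+ α) (+ δ))))
          (triangle-even q α refl)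
          (triangle-even q (α ℕ.+ δ) (ℤₚ.+-injective (lia 2 (λ α δ → ⊩ α ⊞ α ⊞ (δ ⊞ δ) ≛ α ⊞ δ ⊞ (α ⊞ δ)) (+ α) (+ δ))))
          (triangle-even q (α ℕ.+ δ) (ℤₚ.+-injective (lia 2 (λ α δ → ⊩ α ⊞ α ⊞ (δ ⊞ δ) ⊞ # 0 ≛ α ⊞ δ ⊞ (α ⊞ δ)) (+ α) (+ δ))))
          s≡ (power⁺ (f / 6) (α ℕ.+ δ) 0 b₀ 2) (power⁺ (f / 6) (α ℕ.+ δ) 0 b₀ 1) (power (f / 6) (α ℕ.+ δ) 0 b₀) (power (f / 6) 0 1 refl) (power⁺ (f / 6) (α) 0 b₁ 1) (power (f / 6) (α) 0 b₁)
    where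
    Q : ℕ → ℤ
    Q k = (+ q) ℤ.^ k
    s≡ : + s ≡ + (4 ℕ.* α ℕ.+ 6 ℕ.* δ ℕ.+ 0)
    s≡ = lia 3 (λ s α δ → s ≛ 2 ⊠ (α ⊞ α) ⊞ 3 ⊠ (δ ⊞ δ) ⊞ # 0 ⇒ ⊩ s ≛ 4 ⊠ α ⊞ 6 ⊠ δ ⊞ # 0)
      (+ s) (+ α) (+ δ) (cong +_ hs)
    f≡ : + f ≡ + (6 ℕ.* α ℕ.+ 12 ℕ.* δ ℕ.+ 0)
    f≡ = lia 3 (λ f α δ → f ≛ 3 ⊠ (α ⊞ α) ⊞ 6 ⊠ (δ ⊞ δ) ⊞ # 0 ⇒ ⊩ f ≛ 6 ⊠ α ⊞ 12 ⊠ δ ⊞ # 0)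
      (+ f) (+ α) (+ δ) (cong +_ hf)
    den≡ : f / 6 ≡ α ℕ.+ 2 ℕ.* δ
    den≡ = quotient 6 (ℤₚ.+-injective (lia 3 (λ f α δ → f ≛ 6 ⊠ α ⊞ 12 ⊠ δ ⊞ # 0 ⇒ ⊩ f ≛ 6 ⊠ (α ⊞ 2 ⊠ δ)) (+ f) (+ α) (+ δ) f≡))
    b₀ : s / 2 ≡ f / 6 ℕ.+ (α ℕ.+ δ ℕ.+ 0)
    b₀ = quotient 2 (ℤₚ.+-injective (lia 4 (λ s φ α δ → s ≛ 4 ⊠ α ⊞ 6 ⊠ δ ⊞ # 0 ⇒ φ ≛ α ⊞ 2 ⊠ δ ⇒
      ⊩ s ≛ 2 ⊠ (φ ⊞ (α ⊞ δ ⊞ # 0))) (+ s) (+ (f / 6)) (+ α) (+ δ) s≡ (cong +_ den≡)))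
    b₁ : s ∸ f / 3 ≡ f / 6 ℕ.+ (α ℕ.+ 0)
    b₁ = difference {k = 2 ℕ.* α ℕ.+ 4 ℕ.* δ}
      (quotient 3 (ℤₚ.+-injective (lia 3 (λ f α δ → f ≛ 6 ⊠ α ⊞ 12 ⊠ δ ⊞ # 0 ⇒ ⊩ f ≛ 3 ⊠ (2 ⊠ α ⊞ 4 ⊠ δ)) (+ f) (+ α) (+ δ) f≡)))
      (ℤₚ.+-injective (lia 4 (λ s φ α δ → s ≛ 4 ⊠ α ⊞ 6 ⊠ δ ⊞ # 0 ⇒ φ ≛ α ⊞ 2 ⊠ δ ⇒ ⊩ s ≛ φ ⊞ (α ⊞ # 0) ⊞ (2 ⊠ α ⊞ 4 ⊠ δ))
        (+ s) (+ (f / 6)) (+ α) (+ δ) s≡ (cong +_ den≡)))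
  f₀-s-even-f/3-odd (formula q g d e 2≤q e≤1 {s} {f} hs hf) 3∣f 2∣s 2∣t with e≡0 g d e≤1 hf 3∣f
  ... | refl with even-summand {m = d} (g ℕ.+ d) (split₀ g d hs) 2∣s | odd-summand {m = g} d (third₀ g d hf) 2∣t
  ... | δ , refl | α , refl =
        -- Now g + d is odd with half α + δ and g + d + 1 is even with half α + δ + 1, so the even
        -- closed form is evaluated at qX.
        denominator≢0 2≤q ((f ∸ 3) / 6) , ring! 17 (λ N q F X x h₁ h₀ h₂ h₃ α δ s q₁ q₂ q₃ q₄ q₅ →
          (F ⊗ sq q) · N ≗ h₁ ⊕ (h₂ ⊕ h₃) ⊖ h₀ ⇒
          F · sq q ⊗ h₁ ≗ evenᶜ q (q ⊗ X) (𝟙 ⊕ (α ⊕ δ)) ⇒ (⊝ F) · sq q ⊗ h₀ ≗ oddᶜ q x α ⇒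
          F · sq q ⊗ h₂ ≗ oddᶜ q X (α ⊕ δ) ⇒ F · sq q ⊗ h₃ ≗ oddᶜ q X (α ⊕ δ) ⇒
          (⊝ (num 2 ⊗ F ⊗ (𝟙 ⊖ q))) · s ≗ multiple 4 α ⊕ multiple 6 δ ⊕ num 2 ⇒
          (⊝ num 5) · q₁ ≗ F ⊗ (X ⊗ (q ⊗ (q ⊗ 𝟙))) ⇒
          (⊝ num 7) · q₂ ≗ F ⊗ (X ⊗ (q ⊗ 𝟙)) ⇒
          num 8 · q₃ ≗ F ⊗ (𝟙 ⊗ (q ⊗ 𝟙)) ⇒
          𝟙 · q₄ ≗ F ⊗ (x ⊗ (q ⊗ (q ⊗ 𝟙))) ⇒
          num 3 · q₅ ≗ F ⊗ (x ⊗ (q ⊗ 𝟙)) ⇒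
          ⊢ N ⊗ (F ⊗ sq q) ≗ num 5 ⊗ q₁ ⊕ num 7 ⊗ q₂ ⊕ num 2 ⊗ s ⊗ F ⊗ (𝟙 ⊖ q) ⊖ num 8 ⊗ q₃ ⊖ q₄ ⊖ num 3 ⊗ q₅)
          (_ ∷ + q ∷ Q ((f ∸ 3) / 6) ∷ Q (α ℕ.+ δ) ∷ Q α ∷ _ ∷ _ ∷ _ ∷ _ ∷ + α ∷ + δ ∷ + s ∷ Q (s / 2 ℕ.+ 1) ∷ Q (s / 2) ∷ Q ((f ℕ.+ 3) / 6) ∷ Q (s ∸ f / 3 ℕ.+ 1) ∷ Q (s ∸ f / 3) ∷ [])
          (count-triangles q (suc (α ℕ.+ α)) (δ ℕ.+ δ) 0)
          (triangle-even q (suc (α ℕ.+ δ)) (ℤₚ.+-injective (lia 2 (λ α δ → ⊩ # 1 ⊞ (α ⊞ α) ⊞ (# 1 ⊞ (δ ⊞ δ)) ≛ # 1 ⊞ (α ⊞ δ) ⊞ (# 1 ⊞ (α ⊞ δ))) (+ α) (+ δ))))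
          (triangle-odd q α refl)
          (triangle-odd q (α ℕ.+ δ) (ℤₚ.+-injective (lia 2 (λ α δ → ⊩ # 1 ⊞ (α ⊞ α) ⊞ (δ ⊞ δ) ≛ # 1 ⊞ (α ⊞ δ ⊞ (α ⊞ δ))) (+ α) (+ δ))))
          (triangle-odd q (α ℕ.+ δ) (ℤₚ.+-injective (lia 2 (λ α δ → ⊩ # 1 ⊞ (α ⊞ α) ⊞ (δ ⊞ δ) ⊞ # 0 ≛ # 1 ⊞ (α ⊞ δ ⊞ (α ⊞ δ))) (+ α) (+ δ))))
          s≡ (power⁺ ((f ∸ 3) / 6) (α ℕ.+ δ) 1 b₀ 1) (power ((f ∸ 3) / 6) (α ℕ.+ δ) 1 b₀) (power ((f ∸ 3) / 6) (0) 1 b₁) (power⁺ ((f ∸ 3) / 6) (α) 1 b₂ 1) (power ((f ∸ 3) / 6) (α) 1 b₂)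
    where
    Q : ℕ → ℤ
    Q k = (+ q) ℤ.^ k
    s≡ : + s ≡ + (4 ℕ.* α ℕ.+ 6 ℕ.* δ ℕ.+ 2)
    s≡ = lia 3 (λ s α δ → s ≛ 2 ⊠ (# 1 ⊞ (α ⊞ α)) ⊞ 3 ⊠ (δ ⊞ δ) ⊞ # 0 ⇒ ⊩ s ≛ 4 ⊠ α ⊞ 6 ⊠ δ ⊞ # 2)
      (+ s) (+ α) (+ δ) (cong +_ hs)
    f≡ : + f ≡ + (6 ℕ.* α ℕ.+ 12 ℕ.* δ ℕ.+ 3)
    f≡ = lia 3 (λ f α δ → f ≛ 3 ⊠ (# 1 ⊞ (α ⊞ α)) ⊞ 6 ⊠ (δ ⊞ δ) ⊞ # 0 ⇒ ⊩ f ≛ 6 ⊠ α ⊞ 12 ⊠ δ ⊞ # 3)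
      (+ f) (+ α) (+ δ) (cong +_ hf)
    den≡ : (f ∸ 3) / 6 ≡ α ℕ.+ 2 ℕ.* δ
    den≡ = quotient-∸ 3 6 (ℤₚ.+-injective (lia 3 (λ f α δ → f ≛ 6 ⊠ α ⊞ 12 ⊠ δ ⊞ # 3 ⇒ ⊩ f ≛ # 3 ⊞ 6 ⊠ (α ⊞ 2 ⊠ δ)) (+ f) (+ α) (+ δ) f≡))
    b₀ : s / 2 ≡ (f ∸ 3) / 6 ℕ.+ (α ℕ.+ δ ℕ.+ 1)
    b₀ = quotient 2 (ℤₚ.+-injective (lia 4 (λ s φ α δ → s ≛ 4 ⊠ α ⊞ 6 ⊠ δ ⊞ # 2 ⇒ φ ≛ α ⊞ 2 ⊠ δ ⇒
      ⊩ s ≛ 2 ⊠ (φ ⊞ (α ⊞ δ ⊞ # 1))) (+ s) (+ ((f ∸ 3) / 6)) (+ α) (+ δ) s≡ (cong +_ den≡)))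
    b₁ : (f ℕ.+ 3) / 6 ≡ (f ∸ 3) / 6 ℕ.+ (0 ℕ.+ 1)
    b₁ = quotient 6 (ℤₚ.+-injective (lia 4 (λ f φ α δ → f ≛ 6 ⊠ α ⊞ 12 ⊠ δ ⊞ # 3 ⇒ φ ≛ α ⊞ 2 ⊠ δ ⇒
      ⊩ f ⊞ # 3 ≛ 6 ⊠ (φ ⊞ (# 0 ⊞ # 1))) (+ f) (+ ((f ∸ 3) / 6)) (+ α) (+ δ) f≡ (cong +_ den≡)))
    b₂ : s ∸ f / 3 ≡ (f ∸ 3) / 6 ℕ.+ (α ℕ.+ 1)
    b₂ = difference {k = 1 ℕ.+ (2 ℕ.* α ℕ.+ 4 ℕ.* δ)}
      (quotient 3 (ℤₚ.+-injective (lia 3 (λ f α δ → f ≛ 6 ⊠ α ⊞ 12 ⊠ δ ⊞ # 3 ⇒ ⊩ f ≛ 3 ⊠ (# 1 ⊞ (2 ⊠ α ⊞ 4 ⊠ δ))) (+ f) (+ α) (+ δ) f≡)))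
      (ℤₚ.+-injective (lia 4 (λ s φ α δ → s ≛ 4 ⊠ α ⊞ 6 ⊠ δ ⊞ # 2 ⇒ φ ≛ α ⊞ 2 ⊠ δ ⇒ ⊩ s ≛ φ ⊞ (α ⊞ # 1) ⊞ (# 1 ⊞ (2 ⊠ α ⊞ 4 ⊠ δ)))
        (+ s) (+ ((f ∸ 3) / 6)) (+ α) (+ δ) s≡ (cong +_ den≡)))
  f₀-s-odd-f/3-even (formula q g d e 2≤q e≤1 {s} {f} hs hf) 3∣f 2∣s 2∣t with e≡0 g d e≤1 hf 3∣f
  ... | refl with odd-summand {m = d} (g ℕ.+ d) (split₀ g d hs) 2∣s | even-summand {m = g} d (third₀ g d hf) 2∣t
  ... | δ , refl | α , refl =
        denominator≢0 2≤q (f / 6) , ring! 17 (λ N q F X x h₁ h₀ h₂ h₃ α δ s q₁ q₂ q₃ q₄ q₅ →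
          (F ⊗ sq q) · N ≗ h₁ ⊕ (h₂ ⊕ h₃) ⊖ h₀ ⇒
          F · sq q ⊗ h₁ ≗ evenᶜ q (q ⊗ X) (𝟙 ⊕ (α ⊕ δ)) ⇒ (⊝ F) · sq q ⊗ h₀ ≗ evenᶜ q x α ⇒
          F · sq q ⊗ h₂ ≗ oddᶜ q X (α ⊕ δ) ⇒ F · sq q ⊗ h₃ ≗ oddᶜ q X (α ⊕ δ) ⇒
          (⊝ (num 2 ⊗ F ⊗ (𝟙 ⊖ q))) · s ≗ multiple 4 α ⊕ multiple 6 δ ⊕ num 3 ⇒
          (⊝ num 5) · q₁ ≗ F ⊗ (X ⊗ (q ⊗ (q ⊗ 𝟙))) ⇒
          (⊝ num 7) · q₂ ≗ F ⊗ (X ⊗ (q ⊗ 𝟙)) ⇒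
          num 8 · q₃ ≗ F ⊗ (𝟙 ⊗ (q ⊗ 𝟙)) ⇒
          num 3 · q₄ ≗ F ⊗ (x ⊗ (q ⊗ 𝟙)) ⇒
          𝟙 · q₅ ≗ F ⊗ (x ⊗ 𝟙) ⇒
          ⊢ N ⊗ (F ⊗ sq q) ≗ num 5 ⊗ q₁ ⊕ num 7 ⊗ q₂ ⊕ num 2 ⊗ s ⊗ F ⊗ (𝟙 ⊖ q) ⊖ num 8 ⊗ q₃ ⊖ num 3 ⊗ q₄ ⊖ q₅)
          (_ ∷ + q ∷ Q (f / 6) ∷ Q (α ℕ.+ δ) ∷ Q α ∷ _ ∷ _ ∷ _ ∷ _ ∷ + α ∷ + δ ∷ + s ∷ Q ((s ℕ.+ 3) / 2) ∷ Q ((s ℕ.+ 1) / 2) ∷ Q (f / 6 ℕ.+ 1) ∷ Q (s ∸ f / 3 ℕ.+ 1) ∷ Q (s ∸ f / 3) ∷ [])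
          (count-triangles q (α ℕ.+ α) (suc (δ ℕ.+ δ)) 0)
          (triangle-even q (suc (α ℕ.+ δ)) (ℤₚ.+-injective (lia 2 (λ α δ → ⊩ α ⊞ α ⊞ (# 1 ⊞ (# 1 ⊞ (δ ⊞ δ))) ≛ # 1 ⊞ (α ⊞ δ) ⊞ (# 1 ⊞ (α ⊞ δ))) (+ α) (+ δ))))
          (triangle-even q α refl)
          (triangle-odd q (α ℕ.+ δ) (ℤₚ.+-injective (lia 2 (λ α δ → ⊩ α ⊞ α ⊞ (# 1 ⊞ (δ ⊞ δ)) ≛ # 1 ⊞ (α ⊞ δ ⊞ (α ⊞ δ))) (+ α) (+ δ))))
          (triangle-odd q (α ℕ.+ δ) (ℤₚ.+-injective (lia 2 (λ α δ → ⊩ α ⊞ α ⊞ (# 1 ⊞ (δ ⊞ δ)) ⊞ # 0 ≛ # 1 ⊞ (α ⊞ δ ⊞ (α ⊞ δ))) (+ α) (+ δ))))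
          s≡ (power (f / 6) (α ℕ.+ δ) 2 b₀) (power (f / 6) (α ℕ.+ δ) 1 b₁) (power (f / 6) 0 1 refl) (power⁺ (f / 6) (α) 0 b₂ 1) (power (f / 6) (α) 0 b₂)
    where
    Q : ℕ → ℤ
    Q k = (+ q) ℤ.^ k
    s≡ : + s ≡ + (4 ℕ.* α ℕ.+ 6 ℕ.* δ ℕ.+ 3)
    s≡ = lia 3 (λ s α δ → s ≛ 2 ⊠ (α ⊞ α) ⊞ 3 ⊠ (# 1 ⊞ (δ ⊞ δ)) ⊞ # 0 ⇒ ⊩ s ≛ 4 ⊠ α ⊞ 6 ⊠ δ ⊞ # 3)
      (+ s) (+ α) (+ δ) (cong +_ hs)
    f≡ : + f ≡ + (6 ℕ.* α ℕ.+ 12 ℕ.* δ ℕ.+ 6)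
    f≡ = lia 3 (λ f α δ → f ≛ 3 ⊠ (α ⊞ α) ⊞ 6 ⊠ (# 1 ⊞ (δ ⊞ δ)) ⊞ # 0 ⇒ ⊩ f ≛ 6 ⊠ α ⊞ 12 ⊠ δ ⊞ # 6)
      (+ f) (+ α) (+ δ) (cong +_ hf)
    den≡ : f / 6 ≡ 1 ℕ.+ (α ℕ.+ 2 ℕ.* δ)
    den≡ = quotient 6 (ℤₚ.+-injective (lia 3 (λ f α δ → f ≛ 6 ⊠ α ⊞ 12 ⊠ δ ⊞ # 6 ⇒ ⊩ f ≛ 6 ⊠ (# 1 ⊞ (α ⊞ 2 ⊠ δ))) (+ f) (+ α) (+ δ) f≡))
    b₀ : (s ℕ.+ 3) / 2 ≡ f / 6 ℕ.+ (α ℕ.+ δ ℕ.+ 2)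
    b₀ = quotient 2 (ℤₚ.+-injective (lia 4 (λ s φ α δ → s ≛ 4 ⊠ α ⊞ 6 ⊠ δ ⊞ # 3 ⇒ φ ≛ # 1 ⊞ (α ⊞ 2 ⊠ δ) ⇒
      ⊩ s ⊞ # 3 ≛ 2 ⊠ (φ ⊞ (α ⊞ δ ⊞ # 2))) (+ s) (+ (f / 6)) (+ α) (+ δ) s≡ (cong +_ den≡)))
    b₁ : (s ℕ.+ 1) / 2 ≡ f / 6 ℕ.+ (α ℕ.+ δ ℕ.+ 1)
    b₁ = quotient 2 (ℤₚ.+-injective (lia 4 (λ s φ α δ → s ≛ 4 ⊠ α ⊞ 6 ⊠ δ ⊞ # 3 ⇒ φ ≛ # 1 ⊞ (α ⊞ 2 ⊠ δ) ⇒
      ⊩ s ⊞ # 1 ≛ 2 ⊠ (φ ⊞ (α ⊞ δ ⊞ # 1))) (+ s) (+ (f / 6)) (+ α) (+ δ) s≡ (cong +_ den≡)))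
    b₂ : s ∸ f / 3 ≡ f / 6 ℕ.+ (α ℕ.+ 0)
    b₂ = difference {k = 2 ℕ.+ (2 ℕ.* α ℕ.+ 4 ℕ.* δ)}
      (quotient 3 (ℤₚ.+-injective (lia 3 (λ f α δ → f ≛ 6 ⊠ α ⊞ 12 ⊠ δ ⊞ # 6 ⇒ ⊩ f ≛ 3 ⊠ (# 2 ⊞ (2 ⊠ α ⊞ 4 ⊠ δ))) (+ f) (+ α) (+ δ) f≡)))
      (ℤₚ.+-injective (lia 4 (λ s φ α δ → s ≛ 4 ⊠ α ⊞ 6 ⊠ δ ⊞ # 3 ⇒ φ ≛ # 1 ⊞ (α ⊞ 2 ⊠ δ) ⇒ ⊩ s ≛ φ ⊞ (α ⊞ # 0) ⊞ (# 2 ⊞ (2 ⊠ α ⊞ 4 ⊠ δ)))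
        (+ s) (+ (f / 6)) (+ α) (+ δ) s≡ (cong +_ den≡)))
  f₀-s-odd-f/3-odd (formula q g d e 2≤q e≤1 {s} {f} hs hf) 3∣f 2∣s 2∣t with e≡0 g d e≤1 hf 3∣f
  ... | refl with odd-summand {m = d} (g ℕ.+ d) (split₀ g d hs) 2∣s | odd-summand {m = g} d (third₀ g d hf) 2∣t
  ... | δ , refl | α , refl =
        -- With g and d both odd, g + d is even with half α + δ + 1, and X stands for q^(α+δ+1).
        denominator≢0 2≤q ((f ∸ 3) / 6) , ring! 18 (λ N q F X x h₁ h₀ h₂ h₃ α δ s q₁ q₂ q₃ q₄ q₅ q₆ →
          (F ⊗ sq q) · N ≗ h₁ ⊕ (h₂ ⊕ h₃) ⊖ h₀ ⇒
          F · sq q ⊗ h₁ ≗ oddᶜ q X (𝟙 ⊕ (α ⊕ δ)) ⇒ (⊝ F) · sq q ⊗ h₀ ≗ oddᶜ q x α ⇒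
          F · sq q ⊗ h₂ ≗ evenᶜ q X (𝟙 ⊕ (α ⊕ δ)) ⇒ F · sq q ⊗ h₃ ≗ evenᶜ q X (𝟙 ⊕ (α ⊕ δ)) ⇒
          (⊝ (num 2 ⊗ F ⊗ (𝟙 ⊖ q))) · s ≗ multiple 4 α ⊕ multiple 6 δ ⊕ num 5 ⇒
          (⊝ 𝟙) · q₁ ≗ F ⊗ (X ⊗ (q ⊗ (q ⊗ 𝟙))) ⇒
          (⊝ num 9) · q₂ ≗ F ⊗ (X ⊗ (q ⊗ 𝟙)) ⇒
          (⊝ num 2) · q₃ ≗ F ⊗ (X ⊗ 𝟙) ⇒
          num 8 · q₄ ≗ F ⊗ (𝟙 ⊗ (q ⊗ 𝟙)) ⇒
          𝟙 · q₅ ≗ F ⊗ (x ⊗ (q ⊗ (q ⊗ 𝟙))) ⇒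
          num 3 · q₆ ≗ F ⊗ (x ⊗ (q ⊗ 𝟙)) ⇒
          ⊢ N ⊗ (F ⊗ sq q) ≗ q₁ ⊕ num 9 ⊗ q₂ ⊕ num 2 ⊗ q₃ ⊕ num 2 ⊗ s ⊗ F ⊗ (𝟙 ⊖ q) ⊖ num 8 ⊗ q₄ ⊖ q₅ ⊖ num 3 ⊗ q₆)
          (_ ∷ + q ∷ Q ((f ∸ 3) / 6) ∷ Q (suc (α ℕ.+ δ)) ∷ Q α ∷ _ ∷ _ ∷ _ ∷ _ ∷ + α ∷ + δ ∷ + s ∷ Q ((s ℕ.+ 3) / 2) ∷ Q ((s ℕ.+ 1) / 2) ∷ Q ((s ∸ 1) / 2) ∷ Q ((f ℕ.+ 3) / 6) ∷ Q (s ∸ f / 3 ℕ.+ 1) ∷ Q (s ∸ f / 3) ∷ [])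
          (count-triangles q (suc (α ℕ.+ α)) (suc (δ ℕ.+ δ)) 0)
          (triangle-odd q (suc (α ℕ.+ δ)) (ℤₚ.+-injective (lia 2 (λ α δ → ⊩ # 1 ⊞ (α ⊞ α) ⊞ (# 1 ⊞ (# 1 ⊞ (δ ⊞ δ))) ≛ # 1 ⊞ (# 1 ⊞ (α ⊞ δ) ⊞ (# 1 ⊞ (α ⊞ δ)))) (+ α) (+ δ))))
          (triangle-odd q α refl)
          (triangle-even q (suc (α ℕ.+ δ)) (ℤₚ.+-injective (lia 2 (λ α δ → ⊩ # 1 ⊞ (α ⊞ α) ⊞ (# 1 ⊞ (δ ⊞ δ)) ≛ # 1 ⊞ (α ⊞ δ) ⊞ (# 1 ⊞ (α ⊞ δ))) (+ α) (+ δ))))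
          (triangle-even q (suc (α ℕ.+ δ)) (ℤₚ.+-injective (lia 2 (λ α δ → ⊩ # 1 ⊞ (α ⊞ α) ⊞ (# 1 ⊞ (δ ⊞ δ)) ⊞ # 0 ≛ # 1 ⊞ (α ⊞ δ) ⊞ (# 1 ⊞ (α ⊞ δ))) (+ α) (+ δ))))
          s≡ (power ((f ∸ 3) / 6) (suc (α ℕ.+ δ)) 2 b₀) (power ((f ∸ 3) / 6) (suc (α ℕ.+ δ)) 1 b₁) (power ((f ∸ 3) / 6) (suc (α ℕ.+ δ)) 0 b₂) (power ((f ∸ 3) / 6) (0) 1 b₃) (power⁺ ((f ∸ 3) / 6) (α) 1 b₄ 1) (power ((f ∸ 3) / 6) (α) 1 b₄)
    where
    Q : ℕ → ℤ
    Q k = (+ q) ℤ.^ k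
    s≡ : + s ≡ + (4 ℕ.* α ℕ.+ 6 ℕ.* δ ℕ.+ 5)
    s≡ = lia 3 (λ s α δ → s ≛ 2 ⊠ (# 1 ⊞ (α ⊞ α)) ⊞ 3 ⊠ (# 1 ⊞ (δ ⊞ δ)) ⊞ # 0 ⇒ ⊩ s ≛ 4 ⊠ α ⊞ 6 ⊠ δ ⊞ # 5)
      (+ s) (+ α) (+ δ) (cong +_ hs)
    f≡ : + f ≡ + (6 ℕ.* α ℕ.+ 12 ℕ.* δ ℕ.+ 9)
    f≡ = lia 3 (λ f α δ → f ≛ 3 ⊠ (# 1 ⊞ (α ⊞ α)) ⊞ 6 ⊠ (# 1 ⊞ (δ ⊞ δ)) ⊞ # 0 ⇒ ⊩ f ≛ 6 ⊠ α ⊞ 12 ⊠ δ ⊞ # 9)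
      (+ f) (+ α) (+ δ) (cong +_ hf)
    den≡ : (f ∸ 3) / 6 ≡ 1 ℕ.+ (α ℕ.+ 2 ℕ.* δ)
    den≡ = quotient-∸ 3 6 (ℤₚ.+-injective (lia 3 (λ f α δ → f ≛ 6 ⊠ α ⊞ 12 ⊠ δ ⊞ # 9 ⇒ ⊩ f ≛ # 3 ⊞ 6 ⊠ (# 1 ⊞ (α ⊞ 2 ⊠ δ))) (+ f) (+ α) (+ δ) f≡))
    b₀ : (s ℕ.+ 3) / 2 ≡ (f ∸ 3) / 6 ℕ.+ (suc (α ℕ.+ δ) ℕ.+ 2)
    b₀ = quotient 2 (ℤₚ.+-injective (lia 4 (λ s φ α δ → s ≛ 4 ⊠ α ⊞ 6 ⊠ δ ⊞ # 5 ⇒ φ ≛ # 1 ⊞ (α ⊞ 2 ⊠ δ) ⇒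
      ⊩ s ⊞ # 3 ≛ 2 ⊠ (φ ⊞ (# 1 ⊞ (α ⊞ δ) ⊞ # 2))) (+ s) (+ ((f ∸ 3) / 6)) (+ α) (+ δ) s≡ (cong +_ den≡)))
    b₁ : (s ℕ.+ 1) / 2 ≡ (f ∸ 3) / 6 ℕ.+ (suc (α ℕ.+ δ) ℕ.+ 1)
    b₁ = quotient 2 (ℤₚ.+-injective (lia 4 (λ s φ α δ → s ≛ 4 ⊠ α ⊞ 6 ⊠ δ ⊞ # 5 ⇒ φ ≛ # 1 ⊞ (α ⊞ 2 ⊠ δ) ⇒
      ⊩ s ⊞ # 1 ≛ 2 ⊠ (φ ⊞ (# 1 ⊞ (α ⊞ δ) ⊞ # 1))) (+ s) (+ ((f ∸ 3) / 6)) (+ α) (+ δ) s≡ (cong +_ den≡)))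
    b₂ : (s ∸ 1) / 2 ≡ (f ∸ 3) / 6 ℕ.+ (suc (α ℕ.+ δ) ℕ.+ 0)
    b₂ = quotient-∸ 1 2 (ℤₚ.+-injective (lia 4 (λ s φ α δ → s ≛ 4 ⊠ α ⊞ 6 ⊠ δ ⊞ # 5 ⇒ φ ≛ # 1 ⊞ (α ⊞ 2 ⊠ δ) ⇒
      ⊩ s ≛ # 1 ⊞ 2 ⊠ (φ ⊞ (# 1 ⊞ (α ⊞ δ) ⊞ # 0))) (+ s) (+ ((f ∸ 3) / 6)) (+ α) (+ δ) s≡ (cong +_ den≡)))
    b₃ : (f ℕ.+ 3) / 6 ≡ (f ∸ 3) / 6 ℕ.+ (0 ℕ.+ 1)
    b₃ = quotient 6 (ℤₚ.+-injective (lia 4 (λ f φ α δ → f ≛ 6 ⊠ α ⊞ 12 ⊠ δ ⊞ # 9 ⇒ φ ≛ # 1 ⊞ (α ⊞ 2 ⊠ δ) ⇒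
      ⊩ f ⊞ # 3 ≛ 6 ⊠ (φ ⊞ (# 0 ⊞ # 1))) (+ f) (+ ((f ∸ 3) / 6)) (+ α) (+ δ) f≡ (cong +_ den≡)))
    b₄ : s ∸ f / 3 ≡ (f ∸ 3) / 6 ℕ.+ (α ℕ.+ 1)
    b₄ = difference {k = 3 ℕ.+ (2 ℕ.* α ℕ.+ 4 ℕ.* δ)}
      (quotient 3 (ℤₚ.+-injective (lia 3 (λ f α δ → f ≛ 6 ⊠ α ⊞ 12 ⊠ δ ⊞ # 9 ⇒ ⊩ f ≛ 3 ⊠ (# 3 ⊞ (2 ⊠ α ⊞ 4 ⊠ δ))) (+ f) (+ α) (+ δ) f≡)))
      (ℤₚ.+-injective (lia 4 (λ s φ α δ → s ≛ 4 ⊠ α ⊞ 6 ⊠ δ ⊞ # 5 ⇒ φ ≛ # 1 ⊞ (α ⊞ 2 ⊠ δ) ⇒ ⊩ s ≛ φ ⊞ (α ⊞ # 1) ⊞ (# 3 ⊞ (2 ⊠ α ⊞ 4 ⊠ δ)))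
        (+ s) (+ ((f ∸ 3) / 6)) (+ α) (+ δ) s≡ (cong +_ den≡)))
  -- For e = 1 both parities flip: (f + 1)/3 = 1 + g + 2d and s = 1 + d + 2(g + d), so even values
  -- mean odd g and odd d.
  f₂-s-even-[f+1]/3-even (formula q g d e 2≤q e≤1 {s} {f} hs hf) 3∣f 2∣s 2∣t with e≡1 g d e≤1 hf 3∣f
  ... | refl with even-summand {m = suc d} (g ℕ.+ d) (split₁ g d hs) 2∣s | even-summand {m = suc g} d (third₁ g d hf) 2∣t
  ... | δ′ , d≡ | α′ , g≡ with pred-even δ′ d≡ | pred-even α′ g≡
  ... | δ , refl | α , refl =
        denominator≢0 2≤q ((f ℕ.+ 1) / 6) , ring! 18 (λ N q F X x h₁ h₀ h₂ h₃ α δ s q₁ q₂ q₃ q₄ q₅ q₆ →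
          (F ⊗ sq q) · N ≗ h₁ ⊕ (h₂ ⊕ h₃) ⊖ h₀ ⇒
          F · sq q ⊗ h₁ ≗ oddᶜ q X (𝟙 ⊕ (α ⊕ δ)) ⇒ (⊝ F) · sq q ⊗ h₀ ≗ oddᶜ q x α ⇒
          F · sq q ⊗ h₂ ≗ evenᶜ q X (𝟙 ⊕ (α ⊕ δ)) ⇒ F · sq q ⊗ h₃ ≗ oddᶜ q X (𝟙 ⊕ (α ⊕ δ)) ⇒
          (⊝ (num 2 ⊗ F ⊗ (𝟙 ⊖ q))) · s ≗ multiple 4 α ⊕ multiple 6 δ ⊕ num 6 ⇒
          (⊝ num 2) · q₁ ≗ F ⊗ (X ⊗ (q ⊗ (q ⊗ 𝟙))) ⇒
          (⊝ num 9) · q₂ ≗ F ⊗ (X ⊗ (q ⊗ 𝟙)) ⇒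
          (⊝ 𝟙) · q₃ ≗ F ⊗ (X ⊗ 𝟙) ⇒
          num 8 · q₄ ≗ F ⊗ (𝟙 ⊗ (q ⊗ 𝟙)) ⇒
          𝟙 · q₅ ≗ F ⊗ (x ⊗ (q ⊗ (q ⊗ 𝟙))) ⇒
          num 3 · q₆ ≗ F ⊗ (x ⊗ (q ⊗ 𝟙)) ⇒
          ⊢ N ⊗ (F ⊗ sq q) ≗ num 2 ⊗ q₁ ⊕ num 9 ⊗ q₂ ⊕ q₃ ⊕ num 2 ⊗ s ⊗ F ⊗ (𝟙 ⊖ q) ⊖ num 8 ⊗ q₄ ⊖ q₅ ⊖ num 3 ⊗ q₆)
          (_ ∷ + q ∷ Q ((f ℕ.+ 1) / 6) ∷ Q (suc (α ℕ.+ δ)) ∷ Q α ∷ _ ∷ _ ∷ _ ∷ _ ∷ + α ∷ + δ ∷ + s ∷ Q (s / 2 ℕ.+ 2) ∷ Q (s / 2 ℕ.+ 1) ∷ Q (s / 2) ∷ Q ((f ℕ.+ 1) / 6 ℕ.+ 1) ∷ Q (s ∸ (f ℕ.+ 1) / 3 ℕ.+ 2) ∷ Q (s ∸ (f ℕ.+ 1) / 3 ℕ.+ 1) ∷ [])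
          (count-triangles q (suc (α ℕ.+ α)) (suc (δ ℕ.+ δ)) 1)
          (triangle-odd q (suc (α ℕ.+ δ)) (ℤₚ.+-injective (lia 2 (λ α δ → ⊩ # 1 ⊞ (α ⊞ α) ⊞ (# 1 ⊞ (# 1 ⊞ (δ ⊞ δ))) ≛ # 1 ⊞ (# 1 ⊞ (α ⊞ δ) ⊞ (# 1 ⊞ (α ⊞ δ)))) (+ α) (+ δ))))
          (triangle-odd q α refl)
          (triangle-even q (suc (α ℕ.+ δ)) (ℤₚ.+-injective (lia 2 (λ α δ → ⊩ # 1 ⊞ (α ⊞ α) ⊞ (# 1 ⊞ (δ ⊞ δ)) ≛ # 1 ⊞ (α ⊞ δ) ⊞ (# 1 ⊞ (α ⊞ δ))) (+ α) (+ δ))))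
          (triangle-odd q (suc (α ℕ.+ δ)) (ℤₚ.+-injective (lia 2 (λ α δ → ⊩ # 1 ⊞ (α ⊞ α) ⊞ (# 1 ⊞ (δ ⊞ δ)) ⊞ # 1 ≛ # 1 ⊞ (# 1 ⊞ (α ⊞ δ) ⊞ (# 1 ⊞ (α ⊞ δ)))) (+ α) (+ δ))))
          s≡ (power⁺ ((f ℕ.+ 1) / 6) (suc (α ℕ.+ δ)) 0 b₀ 2) (power⁺ ((f ℕ.+ 1) / 6) (suc (α ℕ.+ δ)) 0 b₀ 1) (power ((f ℕ.+ 1) / 6) (suc (α ℕ.+ δ)) 0 b₀) (power ((f ℕ.+ 1) / 6) 0 1 refl) (power⁺ ((f ℕ.+ 1) / 6) (α) 0 b₁ 2) (power⁺ ((f ℕ.+ 1) / 6) (α) 0 b₁ 1)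
    where
    Q : ℕ → ℤ
    Q k = (+ q) ℤ.^ k
    s≡ : + s ≡ + (4 ℕ.* α ℕ.+ 6 ℕ.* δ ℕ.+ 6)
    s≡ = lia 3 (λ s α δ → s ≛ 2 ⊠ (# 1 ⊞ (α ⊞ α)) ⊞ 3 ⊠ (# 1 ⊞ (δ ⊞ δ)) ⊞ # 1 ⇒ ⊩ s ≛ 4 ⊠ α ⊞ 6 ⊠ δ ⊞ # 6)
      (+ s) (+ α) (+ δ) (cong +_ hs)
    f≡ : + f ≡ + (6 ℕ.* α ℕ.+ 12 ℕ.* δ ℕ.+ 11)
    f≡ = lia 3 (λ f α δ → f ≛ 3 ⊠ (# 1 ⊞ (α ⊞ α)) ⊞ 6 ⊠ (# 1 ⊞ (δ ⊞ δ)) ⊞ # 2 ⇒ ⊩ f ≛ 6 ⊠ α ⊞ 12 ⊠ δ ⊞ # 11)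
      (+ f) (+ α) (+ δ) (cong +_ hf)
    den≡ : (f ℕ.+ 1) / 6 ≡ 2 ℕ.+ (α ℕ.+ 2 ℕ.* δ)
    den≡ = quotient 6 (ℤₚ.+-injective (lia 3 (λ f α δ → f ≛ 6 ⊠ α ⊞ 12 ⊠ δ ⊞ # 11 ⇒ ⊩ f ⊞ # 1 ≛ 6 ⊠ (# 2 ⊞ (α ⊞ 2 ⊠ δ))) (+ f) (+ α) (+ δ) f≡))
    b₀ : s / 2 ≡ (f ℕ.+ 1) / 6 ℕ.+ (suc (α ℕ.+ δ) ℕ.+ 0)
    b₀ = quotient 2 (ℤₚ.+-injective (lia 4 (λ s φ α δ → s ≛ 4 ⊠ α ⊞ 6 ⊠ δ ⊞ # 6 ⇒ φ ≛ # 2 ⊞ (α ⊞ 2 ⊠ δ) ⇒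
      ⊩ s ≛ 2 ⊠ (φ ⊞ (# 1 ⊞ (α ⊞ δ) ⊞ # 0))) (+ s) (+ ((f ℕ.+ 1) / 6)) (+ α) (+ δ) s≡ (cong +_ den≡)))
    b₁ : s ∸ (f ℕ.+ 1) / 3 ≡ (f ℕ.+ 1) / 6 ℕ.+ (α ℕ.+ 0)
    b₁ = difference {k = 4 ℕ.+ (2 ℕ.* α ℕ.+ 4 ℕ.* δ)}
      (quotient 3 (ℤₚ.+-injective (lia 3 (λ f α δ → f ≛ 6 ⊠ α ⊞ 12 ⊠ δ ⊞ # 11 ⇒ ⊩ f ⊞ # 1 ≛ 3 ⊠ (# 4 ⊞ (2 ⊠ α ⊞ 4 ⊠ δ))) (+ f) (+ α) (+ δ) f≡)))
      (ℤₚ.+-injective (lia 4 (λ s φ α δ → s ≛ 4 ⊠ α ⊞ 6 ⊠ δ ⊞ # 6 ⇒ φ ≛ # 2 ⊞ (α ⊞ 2 ⊠ δ) ⇒ ⊩ s ≛ φ ⊞ (α ⊞ # 0) ⊞ (# 4 ⊞ (2 ⊠ α ⊞ 4 ⊠ δ)))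
        (+ s) (+ ((f ℕ.+ 1) / 6)) (+ α) (+ δ) s≡ (cong +_ den≡)))
  f₂-s-even-[f+1]/3-odd (formula q g d e 2≤q e≤1 {s} {f} hs hf) 3∣f 2∣s 2∣t with e≡1 g d e≤1 hf 3∣f
  ... | refl with even-summand {m = suc d} (g ℕ.+ d) (split₁ g d hs) 2∣s | odd-summand {m = suc g} d (third₁ g d hf) 2∣t
  ... | δ′ , d≡ | α′ , g≡ with pred-even δ′ d≡ | pred-odd α′ g≡
  ... | δ , refl | α , refl =
        denominator≢0 2≤q ((f ∸ 2) / 6) , ring! 17 (λ N q F X x h₁ h₀ h₂ h₃ α δ s q₁ q₂ q₃ q₄ q₅ →
          (F ⊗ sq q) · N ≗ h₁ ⊕ (h₂ ⊕ h₃) ⊖ h₀ ⇒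
          F · sq q ⊗ h₁ ≗ evenᶜ q (q ⊗ X) (𝟙 ⊕ (α ⊕ δ)) ⇒ (⊝ F) · sq q ⊗ h₀ ≗ evenᶜ q x α ⇒
          F · sq q ⊗ h₂ ≗ oddᶜ q X (α ⊕ δ) ⇒ F · sq q ⊗ h₃ ≗ evenᶜ q (q ⊗ X) (𝟙 ⊕ (α ⊕ δ)) ⇒
          (⊝ (num 2 ⊗ F ⊗ (𝟙 ⊖ q))) · s ≗ multiple 4 α ⊕ multiple 6 δ ⊕ num 4 ⇒
          (⊝ num 7) · q₁ ≗ F ⊗ (X ⊗ (q ⊗ (q ⊗ 𝟙))) ⇒
          (⊝ num 5) · q₂ ≗ F ⊗ (X ⊗ (q ⊗ 𝟙)) ⇒
          num 8 · q₃ ≗ F ⊗ (𝟙 ⊗ (q ⊗ 𝟙)) ⇒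
          num 3 · q₄ ≗ F ⊗ (x ⊗ (q ⊗ 𝟙)) ⇒
          𝟙 · q₅ ≗ F ⊗ (x ⊗ 𝟙) ⇒
          ⊢ N ⊗ (F ⊗ sq q) ≗ num 7 ⊗ q₁ ⊕ num 5 ⊗ q₂ ⊕ num 2 ⊗ s ⊗ F ⊗ (𝟙 ⊖ q) ⊖ num 8 ⊗ q₃ ⊖ num 3 ⊗ q₄ ⊖ q₅)
          (_ ∷ + q ∷ Q ((f ∸ 2) / 6) ∷ Q (α ℕ.+ δ) ∷ Q α ∷ _ ∷ _ ∷ _ ∷ _ ∷ + α ∷ + δ ∷ + s ∷ Q (s / 2 ℕ.+ 1) ∷ Q (s / 2) ∷ Q ((f ℕ.+ 4) / 6) ∷ Q (s ∸ (f ℕ.+ 1) / 3 ℕ.+ 1) ∷ Q (s ∸ (f ℕ.+ 1) / 3) ∷ [])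
          (count-triangles q (α ℕ.+ α) (suc (δ ℕ.+ δ)) 1)
          (triangle-even q (suc (α ℕ.+ δ)) (ℤₚ.+-injective (lia 2 (λ α δ → ⊩ α ⊞ α ⊞ (# 1 ⊞ (# 1 ⊞ (δ ⊞ δ))) ≛ # 1 ⊞ (α ⊞ δ) ⊞ (# 1 ⊞ (α ⊞ δ))) (+ α) (+ δ))))
          (triangle-even q α refl)
          (triangle-odd q (α ℕ.+ δ) (ℤₚ.+-injective (lia 2 (λ α δ → ⊩ α ⊞ α ⊞ (# 1 ⊞ (δ ⊞ δ)) ≛ # 1 ⊞ (α ⊞ δ ⊞ (α ⊞ δ))) (+ α) (+ δ))))
          (triangle-even q (suc (α ℕ.+ δ)) (ℤₚ.+-injective (lia 2 (λ α δ → ⊩ α ⊞ α ⊞ (# 1 ⊞ (δ ⊞ δ)) ⊞ # 1 ≛ # 1 ⊞ (α ⊞ δ) ⊞ (# 1 ⊞ (α ⊞ δ))) (+ α) (+ δ))))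
          s≡ (power⁺ ((f ∸ 2) / 6) (α ℕ.+ δ) 1 b₀ 1) (power ((f ∸ 2) / 6) (α ℕ.+ δ) 1 b₀) (power ((f ∸ 2) / 6) (0) 1 b₁) (power⁺ ((f ∸ 2) / 6) (α) 0 b₂ 1) (power ((f ∸ 2) / 6) (α) 0 b₂)
    where
    Q : ℕ → ℤ
    Q k = (+ q) ℤ.^ k
    s≡ : + s ≡ + (4 ℕ.* α ℕ.+ 6 ℕ.* δ ℕ.+ 4)
    s≡ = lia 3 (λ s α δ → s ≛ 2 ⊠ (α ⊞ α) ⊞ 3 ⊠ (# 1 ⊞ (δ ⊞ δ)) ⊞ # 1 ⇒ ⊩ s ≛ 4 ⊠ α ⊞ 6 ⊠ δ ⊞ # 4)
      (+ s) (+ α) (+ δ) (cong +_ hs)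
    f≡ : + f ≡ + (6 ℕ.* α ℕ.+ 12 ℕ.* δ ℕ.+ 8)
    f≡ = lia 3 (λ f α δ → f ≛ 3 ⊠ (α ⊞ α) ⊞ 6 ⊠ (# 1 ⊞ (δ ⊞ δ)) ⊞ # 2 ⇒ ⊩ f ≛ 6 ⊠ α ⊞ 12 ⊠ δ ⊞ # 8)
      (+ f) (+ α) (+ δ) (cong +_ hf)
    den≡ : (f ∸ 2) / 6 ≡ 1 ℕ.+ (α ℕ.+ 2 ℕ.* δ)
    den≡ = quotient-∸ 2 6 (ℤₚ.+-injective (lia 3 (λ f α δ → f ≛ 6 ⊠ α ⊞ 12 ⊠ δ ⊞ # 8 ⇒ ⊩ f ≛ # 2 ⊞ 6 ⊠ (# 1 ⊞ (α ⊞ 2 ⊠ δ))) (+ f) (+ α) (+ δ) f≡))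
    b₀ : s / 2 ≡ (f ∸ 2) / 6 ℕ.+ (α ℕ.+ δ ℕ.+ 1)
    b₀ = quotient 2 (ℤₚ.+-injective (lia 4 (λ s φ α δ → s ≛ 4 ⊠ α ⊞ 6 ⊠ δ ⊞ # 4 ⇒ φ ≛ # 1 ⊞ (α ⊞ 2 ⊠ δ) ⇒
      ⊩ s ≛ 2 ⊠ (φ ⊞ (α ⊞ δ ⊞ # 1))) (+ s) (+ ((f ∸ 2) / 6)) (+ α) (+ δ) s≡ (cong +_ den≡)))
    b₁ : (f ℕ.+ 4) / 6 ≡ (f ∸ 2) / 6 ℕ.+ (0 ℕ.+ 1)
    b₁ = quotient 6 (ℤₚ.+-injective (lia 4 (λ f φ α δ → f ≛ 6 ⊠ α ⊞ 12 ⊠ δ ⊞ # 8 ⇒ φ ≛ # 1 ⊞ (α ⊞ 2 ⊠ δ) ⇒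
      ⊩ f ⊞ # 4 ≛ 6 ⊠ (φ ⊞ (# 0 ⊞ # 1))) (+ f) (+ ((f ∸ 2) / 6)) (+ α) (+ δ) f≡ (cong +_ den≡)))
    b₂ : s ∸ (f ℕ.+ 1) / 3 ≡ (f ∸ 2) / 6 ℕ.+ (α ℕ.+ 0)
    b₂ = difference {k = 3 ℕ.+ (2 ℕ.* α ℕ.+ 4 ℕ.* δ)}
      (quotient 3 (ℤₚ.+-injective (lia 3 (λ f α δ → f ≛ 6 ⊠ α ⊞ 12 ⊠ δ ⊞ # 8 ⇒ ⊩ f ⊞ # 1 ≛ 3 ⊠ (# 3 ⊞ (2 ⊠ α ⊞ 4 ⊠ δ))) (+ f) (+ α) (+ δ) f≡)))
      (ℤₚ.+-injective (lia 4 (λ s φ α δ → s ≛ 4 ⊠ α ⊞ 6 ⊠ δ ⊞ # 4 ⇒ φ ≛ # 1 ⊞ (α ⊞ 2 ⊠ δ) ⇒ ⊩ s ≛ φ ⊞ (α ⊞ # 0) ⊞ (# 3 ⊞ (2 ⊠ α ⊞ 4 ⊠ δ)))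
        (+ s) (+ ((f ∸ 2) / 6)) (+ α) (+ δ) s≡ (cong +_ den≡)))
  f₂-s-odd-[f+1]/3-even (formula q g d e 2≤q e≤1 {s} {f} hs hf) 3∣f 2∣s 2∣t with e≡1 g d e≤1 hf 3∣f
  ... | refl with odd-summand {m = suc d} (g ℕ.+ d) (split₁ g d hs) 2∣s | even-summand {m = suc g} d (third₁ g d hf) 2∣t
  ... | δ′ , d≡ | α′ , g≡ with pred-odd δ′ d≡ | pred-even α′ g≡
  ... | δ , refl | α , refl =
        denominator≢0 2≤q ((f ℕ.+ 1) / 6) , ring! 17 (λ N q F X x h₁ h₀ h₂ h₃ α δ s q₁ q₂ q₃ q₄ q₅ →
          (F ⊗ sq q) · N ≗ h₁ ⊕ (h₂ ⊕ h₃) ⊖ h₀ ⇒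
          F · sq q ⊗ h₁ ≗ evenᶜ q (q ⊗ X) (𝟙 ⊕ (α ⊕ δ)) ⇒ (⊝ F) · sq q ⊗ h₀ ≗ oddᶜ q x α ⇒
          F · sq q ⊗ h₂ ≗ oddᶜ q X (α ⊕ δ) ⇒ F · sq q ⊗ h₃ ≗ evenᶜ q (q ⊗ X) (𝟙 ⊕ (α ⊕ δ)) ⇒
          (⊝ (num 2 ⊗ F ⊗ (𝟙 ⊖ q))) · s ≗ multiple 4 α ⊕ multiple 6 δ ⊕ num 3 ⇒
          (⊝ num 7) · q₁ ≗ F ⊗ (X ⊗ (q ⊗ (q ⊗ 𝟙))) ⇒
          (⊝ num 5) · q₂ ≗ F ⊗ (X ⊗ (q ⊗ 𝟙)) ⇒
          num 8 · q₃ ≗ F ⊗ (𝟙 ⊗ (q ⊗ 𝟙)) ⇒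
          𝟙 · q₄ ≗ F ⊗ (x ⊗ (q ⊗ (q ⊗ 𝟙))) ⇒
          num 3 · q₅ ≗ F ⊗ (x ⊗ (q ⊗ 𝟙)) ⇒
          ⊢ N ⊗ (F ⊗ sq q) ≗ num 7 ⊗ q₁ ⊕ num 5 ⊗ q₂ ⊕ num 2 ⊗ s ⊗ F ⊗ (𝟙 ⊖ q) ⊖ num 8 ⊗ q₃ ⊖ q₄ ⊖ num 3 ⊗ q₅)
          (_ ∷ + q ∷ Q ((f ℕ.+ 1) / 6) ∷ Q (α ℕ.+ δ) ∷ Q α ∷ _ ∷ _ ∷ _ ∷ _ ∷ + α ∷ + δ ∷ + s ∷ Q ((s ℕ.+ 3) / 2) ∷ Q ((s ℕ.+ 1) / 2) ∷ Q ((f ℕ.+ 1) / 6 ℕ.+ 1) ∷ Q (s ∸ (f ℕ.+ 1) / 3 ℕ.+ 2) ∷ Q (s ∸ (f ℕ.+ 1) / 3 ℕ.+ 1) ∷ [])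
          (count-triangles q (suc (α ℕ.+ α)) (δ ℕ.+ δ) 1)
          (triangle-even q (suc (α ℕ.+ δ)) (ℤₚ.+-injective (lia 2 (λ α δ → ⊩ # 1 ⊞ (α ⊞ α) ⊞ (# 1 ⊞ (δ ⊞ δ)) ≛ # 1 ⊞ (α ⊞ δ) ⊞ (# 1 ⊞ (α ⊞ δ))) (+ α) (+ δ))))
          (triangle-odd q α refl)
          (triangle-odd q (α ℕ.+ δ) (ℤₚ.+-injective (lia 2 (λ α δ → ⊩ # 1 ⊞ (α ⊞ α) ⊞ (δ ⊞ δ) ≛ # 1 ⊞ (α ⊞ δ ⊞ (α ⊞ δ))) (+ α) (+ δ))))
          (triangle-even q (suc (α ℕ.+ δ)) (ℤₚ.+-injective (lia 2 (λ α δ → ⊩ # 1 ⊞ (α ⊞ α) ⊞ (δ ⊞ δ) ⊞ # 1 ≛ # 1 ⊞ (α ⊞ δ) ⊞ (# 1 ⊞ (α ⊞ δ))) (+ α) (+ δ))))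
          s≡ (power ((f ℕ.+ 1) / 6) (α ℕ.+ δ) 2 b₀) (power ((f ℕ.+ 1) / 6) (α ℕ.+ δ) 1 b₁) (power ((f ℕ.+ 1) / 6) 0 1 refl) (power⁺ ((f ℕ.+ 1) / 6) (α) 0 b₂ 2) (power⁺ ((f ℕ.+ 1) / 6) (α) 0 b₂ 1)
    where
    Q : ℕ → ℤ
    Q k = (+ q) ℤ.^ k
    s≡ : + s ≡ + (4 ℕ.* α ℕ.+ 6 ℕ.* δ ℕ.+ 3)
    s≡ = lia 3 (λ s α δ → s ≛ 2 ⊠ (# 1 ⊞ (α ⊞ α)) ⊞ 3 ⊠ (δ ⊞ δ) ⊞ # 1 ⇒ ⊩ s ≛ 4 ⊠ α ⊞ 6 ⊠ δ ⊞ # 3)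
      (+ s) (+ α) (+ δ) (cong +_ hs)
    f≡ : + f ≡ + (6 ℕ.* α ℕ.+ 12 ℕ.* δ ℕ.+ 5)
    f≡ = lia 3 (λ f α δ → f ≛ 3 ⊠ (# 1 ⊞ (α ⊞ α)) ⊞ 6 ⊠ (δ ⊞ δ) ⊞ # 2 ⇒ ⊩ f ≛ 6 ⊠ α ⊞ 12 ⊠ δ ⊞ # 5)
      (+ f) (+ α) (+ δ) (cong +_ hf)
    den≡ : (f ℕ.+ 1) / 6 ≡ 1 ℕ.+ (α ℕ.+ 2 ℕ.* δ)
    den≡ = quotient 6 (ℤₚ.+-injective (lia 3 (λ f α δ → f ≛ 6 ⊠ α ⊞ 12 ⊠ δ ⊞ # 5 ⇒ ⊩ f ⊞ # 1 ≛ 6 ⊠ (# 1 ⊞ (α ⊞ 2 ⊠ δ))) (+ f) (+ α) (+ δ) f≡))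
    b₀ : (s ℕ.+ 3) / 2 ≡ (f ℕ.+ 1) / 6 ℕ.+ (α ℕ.+ δ ℕ.+ 2)
    b₀ = quotient 2 (ℤₚ.+-injective (lia 4 (λ s φ α δ → s ≛ 4 ⊠ α ⊞ 6 ⊠ δ ⊞ # 3 ⇒ φ ≛ # 1 ⊞ (α ⊞ 2 ⊠ δ) ⇒
      ⊩ s ⊞ # 3 ≛ 2 ⊠ (φ ⊞ (α ⊞ δ ⊞ # 2))) (+ s) (+ ((f ℕ.+ 1) / 6)) (+ α) (+ δ) s≡ (cong +_ den≡)))
    b₁ : (s ℕ.+ 1) / 2 ≡ (f ℕ.+ 1) / 6 ℕ.+ (α ℕ.+ δ ℕ.+ 1)
    b₁ = quotient 2 (ℤₚ.+-injective (lia 4 (λ s φ α δ → s ≛ 4 ⊠ α ⊞ 6 ⊠ δ ⊞ # 3 ⇒ φ ≛ # 1 ⊞ (α ⊞ 2 ⊠ δ) ⇒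
      ⊩ s ⊞ # 1 ≛ 2 ⊠ (φ ⊞ (α ⊞ δ ⊞ # 1))) (+ s) (+ ((f ℕ.+ 1) / 6)) (+ α) (+ δ) s≡ (cong +_ den≡)))
    b₂ : s ∸ (f ℕ.+ 1) / 3 ≡ (f ℕ.+ 1) / 6 ℕ.+ (α ℕ.+ 0)
    b₂ = difference {k = 2 ℕ.+ (2 ℕ.* α ℕ.+ 4 ℕ.* δ)}
      (quotient 3 (ℤₚ.+-injective (lia 3 (λ f α δ → f ≛ 6 ⊠ α ⊞ 12 ⊠ δ ⊞ # 5 ⇒ ⊩ f ⊞ # 1 ≛ 3 ⊠ (# 2 ⊞ (2 ⊠ α ⊞ 4 ⊠ δ))) (+ f) (+ α) (+ δ) f≡)))
      (ℤₚ.+-injective (lia 4 (λ s φ α δ → s ≛ 4 ⊠ α ⊞ 6 ⊠ δ ⊞ # 3 ⇒ φ ≛ # 1 ⊞ (α ⊞ 2 ⊠ δ) ⇒ ⊩ s ≛ φ ⊞ (α ⊞ # 0) ⊞ (# 2 ⊞ (2 ⊠ α ⊞ 4 ⊠ δ)))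
        (+ s) (+ ((f ℕ.+ 1) / 6)) (+ α) (+ δ) s≡ (cong +_ den≡)))
  f₂-s-odd-[f+1]/3-odd (formula q g d e 2≤q e≤1 {s} {f} hs hf) 3∣f 2∣s 2∣t with e≡1 g d e≤1 hf 3∣f
  ... | refl with odd-summand {m = suc d} (g ℕ.+ d) (split₁ g d hs) 2∣s | odd-summand {m = suc g} d (third₁ g d hf) 2∣t
  ... | δ′ , d≡ | α′ , g≡ with pred-odd δ′ d≡ | pred-odd α′ g≡
  ... | δ , refl | α , refl =
        denominator≢0 2≤q ((f ∸ 2) / 6) , ring! 18 (λ N q F X x h₁ h₀ h₂ h₃ α δ s q₁ q₂ q₃ q₄ q₅ q₆ →
          (F ⊗ sq q) · N ≗ h₁ ⊕ (h₂ ⊕ h₃) ⊖ h₀ ⇒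
          F · sq q ⊗ h₁ ≗ oddᶜ q X (α ⊕ δ) ⇒ (⊝ F) · sq q ⊗ h₀ ≗ evenᶜ q x α ⇒
          F · sq q ⊗ h₂ ≗ evenᶜ q X (α ⊕ δ) ⇒ F · sq q ⊗ h₃ ≗ oddᶜ q X (α ⊕ δ) ⇒
          (⊝ (num 2 ⊗ F ⊗ (𝟙 ⊖ q))) · s ≗ multiple 4 α ⊕ multiple 6 δ ⊕ num 1 ⇒
          (⊝ num 2) · q₁ ≗ F ⊗ (X ⊗ (q ⊗ (q ⊗ 𝟙))) ⇒
          (⊝ num 9) · q₂ ≗ F ⊗ (X ⊗ (q ⊗ 𝟙)) ⇒
          (⊝ 𝟙) · q₃ ≗ F ⊗ (X ⊗ 𝟙) ⇒
          num 8 · q₄ ≗ F ⊗ (𝟙 ⊗ (q ⊗ 𝟙)) ⇒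
          num 3 · q₅ ≗ F ⊗ (x ⊗ (q ⊗ 𝟙)) ⇒
          𝟙 · q₆ ≗ F ⊗ (x ⊗ 𝟙) ⇒
          ⊢ N ⊗ (F ⊗ sq q) ≗ num 2 ⊗ q₁ ⊕ num 9 ⊗ q₂ ⊕ q₃ ⊕ num 2 ⊗ s ⊗ F ⊗ (𝟙 ⊖ q) ⊖ num 8 ⊗ q₄ ⊖ num 3 ⊗ q₅ ⊖ q₆)
          (_ ∷ + q ∷ Q ((f ∸ 2) / 6) ∷ Q (α ℕ.+ δ) ∷ Q α ∷ _ ∷ _ ∷ _ ∷ _ ∷ + α ∷ + δ ∷ + s ∷ Q ((s ℕ.+ 3) / 2) ∷ Q ((s ℕ.+ 1) / 2) ∷ Q ((s ∸ 1) / 2) ∷ Q ((f ℕ.+ 4) / 6) ∷ Q (s ∸ (f ℕ.+ 1) / 3 ℕ.+ 1) ∷ Q (s ∸ (f ℕ.+ 1) / 3) ∷ [])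
          (count-triangles q (α ℕ.+ α) (δ ℕ.+ δ) 1)
          (triangle-odd q (α ℕ.+ δ) (ℤₚ.+-injective (lia 2 (λ α δ → ⊩ α ⊞ α ⊞ (# 1 ⊞ (δ ⊞ δ)) ≛ # 1 ⊞ (α ⊞ δ ⊞ (α ⊞ δ))) (+ α) (+ δ))))
          (triangle-even q α refl)
          (triangle-even q (α ℕ.+ δ) (ℤₚ.+-injective (lia 2 (λ α δ → ⊩ α ⊞ α ⊞ (δ ⊞ δ) ≛ α ⊞ δ ⊞ (α ⊞ δ)) (+ α) (+ δ))))
          (triangle-odd q (α ℕ.+ δ) (ℤₚ.+-injective (lia 2 (λ α δ → ⊩ α ⊞ α ⊞ (δ ⊞ δ) ⊞ # 1 ≛ # 1 ⊞ (α ⊞ δ ⊞ (α ⊞ δ))) (+ α) (+ δ))))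
          s≡ (power ((f ∸ 2) / 6) (α ℕ.+ δ) 2 b₀) (power ((f ∸ 2) / 6) (α ℕ.+ δ) 1 b₁) (power ((f ∸ 2) / 6) (α ℕ.+ δ) 0 b₂) (power ((f ∸ 2) / 6) (0) 1 b₃) (power⁺ ((f ∸ 2) / 6) (α) 0 b₄ 1) (power ((f ∸ 2) / 6) (α) 0 b₄)
    where
    Q : ℕ → ℤ
    Q k = (+ q) ℤ.^ k
    s≡ : + s ≡ + (4 ℕ.* α ℕ.+ 6 ℕ.* δ ℕ.+ 1)
    s≡ = lia 3 (λ s α δ → s ≛ 2 ⊠ (α ⊞ α) ⊞ 3 ⊠ (δ ⊞ δ) ⊞ # 1 ⇒ ⊩ s ≛ 4 ⊠ α ⊞ 6 ⊠ δ ⊞ # 1)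
      (+ s) (+ α) (+ δ) (cong +_ hs)
    f≡ : + f ≡ + (6 ℕ.* α ℕ.+ 12 ℕ.* δ ℕ.+ 2)
    f≡ = lia 3 (λ f α δ → f ≛ 3 ⊠ (α ⊞ α) ⊞ 6 ⊠ (δ ⊞ δ) ⊞ # 2 ⇒ ⊩ f ≛ 6 ⊠ α ⊞ 12 ⊠ δ ⊞ # 2)
      (+ f) (+ α) (+ δ) (cong +_ hf)
    den≡ : (f ∸ 2) / 6 ≡ α ℕ.+ 2 ℕ.* δ
    den≡ = quotient-∸ 2 6 (ℤₚ.+-injective (lia 3 (λ f α δ → f ≛ 6 ⊠ α ⊞ 12 ⊠ δ ⊞ # 2 ⇒ ⊩ f ≛ # 2 ⊞ 6 ⊠ (α ⊞ 2 ⊠ δ)) (+ f) (+ α) (+ δ) f≡))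
    b₀ : (s ℕ.+ 3) / 2 ≡ (f ∸ 2) / 6 ℕ.+ (α ℕ.+ δ ℕ.+ 2)
    b₀ = quotient 2 (ℤₚ.+-injective (lia 4 (λ s φ α δ → s ≛ 4 ⊠ α ⊞ 6 ⊠ δ ⊞ # 1 ⇒ φ ≛ α ⊞ 2 ⊠ δ ⇒
      ⊩ s ⊞ # 3 ≛ 2 ⊠ (φ ⊞ (α ⊞ δ ⊞ # 2))) (+ s) (+ ((f ∸ 2) / 6)) (+ α) (+ δ) s≡ (cong +_ den≡)))
    b₁ : (s ℕ.+ 1) / 2 ≡ (f ∸ 2) / 6 ℕ.+ (α ℕ.+ δ ℕ.+ 1)
    b₁ = quotient 2 (ℤₚ.+-injective (lia 4 (λ s φ α δ → s ≛ 4 ⊠ α ⊞ 6 ⊠ δ ⊞ # 1 ⇒ φ ≛ α ⊞ 2 ⊠ δ ⇒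
      ⊩ s ⊞ # 1 ≛ 2 ⊠ (φ ⊞ (α ⊞ δ ⊞ # 1))) (+ s) (+ ((f ∸ 2) / 6)) (+ α) (+ δ) s≡ (cong +_ den≡)))
    b₂ : (s ∸ 1) / 2 ≡ (f ∸ 2) / 6 ℕ.+ (α ℕ.+ δ ℕ.+ 0)
    b₂ = quotient-∸ 1 2 (ℤₚ.+-injective (lia 4 (λ s φ α δ → s ≛ 4 ⊠ α ⊞ 6 ⊠ δ ⊞ # 1 ⇒ φ ≛ α ⊞ 2 ⊠ δ ⇒
      ⊩ s ≛ # 1 ⊞ 2 ⊠ (φ ⊞ (α ⊞ δ ⊞ # 0))) (+ s) (+ ((f ∸ 2) / 6)) (+ α) (+ δ) s≡ (cong +_ den≡)))
    b₃ : (f ℕ.+ 4) / 6 ≡ (f ∸ 2) / 6 ℕ.+ (0 ℕ.+ 1)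
    b₃ = quotient 6 (ℤₚ.+-injective (lia 4 (λ f φ α δ → f ≛ 6 ⊠ α ⊞ 12 ⊠ δ ⊞ # 2 ⇒ φ ≛ α ⊞ 2 ⊠ δ ⇒
      ⊩ f ⊞ # 4 ≛ 6 ⊠ (φ ⊞ (# 0 ⊞ # 1))) (+ f) (+ ((f ∸ 2) / 6)) (+ α) (+ δ) f≡ (cong +_ den≡)))
    b₄ : s ∸ (f ℕ.+ 1) / 3 ≡ (f ∸ 2) / 6 ℕ.+ (α ℕ.+ 0)
    b₄ = difference {k = 1 ℕ.+ (2 ℕ.* α ℕ.+ 4 ℕ.* δ)}
      (quotient 3 (ℤₚ.+-injective (lia 3 (λ f α δ → f ≛ 6 ⊠ α ⊞ 12 ⊠ δ ⊞ # 2 ⇒ ⊩ f ⊞ # 1 ≛ 3 ⊠ (# 1 ⊞ (2 ⊠ α ⊞ 4 ⊠ δ))) (+ f) (+ α) (+ δ) f≡)))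
      (ℤₚ.+-injective (lia 4 (λ s φ α δ → s ≛ 4 ⊠ α ⊞ 6 ⊠ δ ⊞ # 1 ⇒ φ ≛ α ⊞ 2 ⊠ δ ⇒ ⊩ s ≛ φ ⊞ (α ⊞ # 0) ⊞ (# 1 ⊞ (2 ⊠ α ⊞ 4 ⊠ δ)))
        (+ s) (+ ((f ∸ 2) / 6)) (+ α) (+ δ) s≡ (cong +_ den≡)))

-- The class number as a function of q, s and f.

module ClassNumber where

  open import Data.Fin.Base using (Fin; zero; suc)
  open import Data.Nat.Base as ℕ using (ℕ; zero; suc; _∸_)
  import Data.Nat.Properties as ℕₚ
  open import Data.Nat.Divisibility using (n∣m*n)
  open import Data.Nat.DivMod using (_/_; _%_; m*n/n≡m; m<n⇒m/n≡0; m<n⇒m%n≡m; +-distrib-/-∣ʳ; [m+kn]%n≡m%n)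
  open import Relation.Binary.Bundles using (Setoid)
  open Extension
  open Lattice
  open Orders
  open Length
  open Conductor
  open Digits
  open Ideals
  open Cells
  open Counting
  open Formula using (formula; _⊠_)

  distinct⇒2≤ : ∀ {n} {i j : Fin n} → i ≢ j → 2 ℕ.≤ n
  distinct⇒2≤ {suc zero} {zero} {zero} i≢j with () ← i≢j ≡.refl
  distinct⇒2≤ {suc (suc n)}            _   = ℕ.s≤s (ℕ.s≤s ℕ.z≤n)

  -- Inverts s = 2g + 3d + e and f = 3g + 6d + 2e: one finds g = 2s - f and 3d + e = 2f - 3s, from
  -- which d and e are quotient and remainder modulo 3. Written this way the number visibly depends
  -- on q, s and f only.
  classNumber : ℕ → ℕ → ℕ → ℕ
  classNumber q s f = count q (2 ℕ.* s ∸ f) ((2 ℕ.* f ∸ 3 ℕ.* s) / 3) ((2 ℕ.* f ∸ 3 ℕ.* s) % 3)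

  classNumber-count : ∀ q g d e {s f} → e ℕ.≤ 1 → s ≡ 2 ℕ.* g ℕ.+ 3 ℕ.* d ℕ.+ e →
    f ≡ 3 ℕ.* g ℕ.+ 6 ℕ.* d ℕ.+ 2 ℕ.* e → classNumber q s f ≡ count q g d e
  classNumber-count q g d e {s} {f} e≤1 hs hf = ≡.trans
    (≡.cong₂ (λ g t → count q g (t / 3) (t % 3)) 2s∸f 2f∸3s) (≡.cong₂ (count q g) quotient≡ remainder≡)
    where
    e<3 : e ℕ.< 3
    e<3 = ℕ.s≤s (ℕₚ.≤-trans e≤1 (ℕ.s≤s ℕ.z≤n))
    2s∸f : 2 ℕ.* s ∸ f ≡ g
    2s∸f = ≡.trans (≡.cong (_∸ f) (ℤₚ.+-injective (lia 5 (λ s f g d e → s ≛ 2 ⊠ g ⊞ 3 ⊠ d ⊞ e ⇒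
      f ≛ 3 ⊠ g ⊞ 6 ⊠ d ⊞ 2 ⊠ e ⇒ ⊩ 2 ⊠ s ≛ f ⊞ g) (+ s) (+ f) (+ g) (+ d) (+ e) (≡.cong +_ hs) (≡.cong +_ hf))))
      (ℕₚ.m+n∸m≡n f g)
    2f∸3s : 2 ℕ.* f ∸ 3 ℕ.* s ≡ e ℕ.+ d ℕ.* 3
    2f∸3s = ≡.trans (≡.cong (_∸ 3 ℕ.* s) (ℤₚ.+-injective (lia 5 (λ s f g d e → s ≛ 2 ⊠ g ⊞ 3 ⊠ d ⊞ e ⇒
      f ≛ 3 ⊠ g ⊞ 6 ⊠ d ⊞ 2 ⊠ e ⇒ ⊩ 2 ⊠ f ≛ 3 ⊠ s ⊞ (e ⊞ 3 ⊠ d)) (+ s) (+ f) (+ g) (+ d) (+ e) (≡.cong +_ hs) (≡.cong +_ hf))))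
      (≡.trans (ℕₚ.m+n∸m≡n (3 ℕ.* s) (e ℕ.+ 3 ℕ.* d)) (≡.cong (e ℕ.+_) (ℕₚ.*-comm 3 d)))
    quotient≡ : (e ℕ.+ d ℕ.* 3) / 3 ≡ d
    quotient≡ = ≡.trans (+-distrib-/-∣ʳ e (n∣m*n d)) (≡.cong₂ ℕ._+_ (m<n⇒m/n≡0 e<3) (m*n/n≡m d 3))
    remainder≡ : (e ℕ.+ d ℕ.* 3) % 3 ≡ e
    remainder≡ = ≡.trans ([m+kn]%n≡m%n e d 3) (m<n⇒m%n≡m e<3)

  module _ {c ℓ} (F E : LocalField c ℓ) (E/F : TotallyRamifiedExtension F E 3) (𝓡 : Order E/F) where
    open Ramified F E E/F
    open OrderStructure F E E/F 𝓡
    open DigitExpansions F E E/F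
    open LatticeIdeals F E E/F 𝓡
    open Classification F E E/F 𝓡

    private
      q : ℕ
      q = LocalField.q F

      Cl : Setoid _ _
      Cl = Cl̄ E/F 𝓡

    -- The digits of 0 and 1 differ, as 1 has valuation 0 < 3. This keeps the denominators, powers
    -- of q times (q - 1)², nonzero.
    2≤q : 2 ℕ.≤ q
    2≤q with digit-surjective 𝔬-0 | digit-surjective 𝔬-1
    ... | i , p | j , p′ = distinct⇒2≤ {i = i} {j} λ { ≡.refl → 3≰0 (P-Val (P-resp
      (ring! 1 (λ x → ⊢ (𝟙 ⊖ x) ⊖ (𝟘 ⊖ x) ≗ 𝟙) (digit i ∷ [])) (P-- p′ p)) Val-1) }
      where
      3≰0 : ¬ + 3 ℤ.≤ 0ℤ
      3≰0 (ℤ.+≤+ ())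

    module _ (g d e : ℕ) (ρ₀≡ : ρ₀ ≡ 1ℤ ℤ.+ + e) (a₀≡ : a₀ ≡ + g ℤ.+ + d)
             (b₀≡ : b₀ ≡ 1ℤ ℤ.+ + e ℤ.+ + g ℤ.+ + 2 ℤ.* + d) where

      private
        ideal : (x : Code q) → Valid g d e x → FractionalIdeal E/F 𝓡
        ideal = code-ideal g d e ρ₀≡ a₀≡ b₀≡

      Cl̄-cardinality : HasCardinality Cl (count q g d e)
      Cl̄-cardinality = record
        { to        = to
        ; cong      = λ { {x} ≡.refl → Setoid.refl Cl {to x} }
        ; bijective = (λ {x} {y} sim → decode-injective q g d e
            (code-ideal-injective g d e ρ₀≡ a₀≡ b₀≡ (decode q g d e x) (decode q g d e y) (decode-valid q g d e x) (decode-valid q g d e y) sim))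
          , λ 𝓘 → surjective 𝓘 (code-ideal-surjective g d e ρ₀≡ a₀≡ b₀≡ 𝓘)
        }
        where
        to : Fin (count q g d e) → FractionalIdeal E/F 𝓡
        to x = ideal (decode q g d e x) (decode-valid q g d e x)
        -- A code found by surjectivity carries its own validity proof, whereas `to` uses the one
        -- attached to the index; the two must be reconciled.
        transport : ∀ 𝓘 {x y} → x ≡ y → (v : Valid g d e y) (w : Valid g d e x) → ideal y v ≋ 𝓘 → ideal x w ≋ 𝓘
        transport 𝓘 {x} ≡.refl v w = ≡.subst (λ v → ideal x v ≋ 𝓘) (Valid-irrelevant g d e x v w)
        surjective : ∀ 𝓘 → (Σ (Code q) λ x → Σ (Valid g d e x) λ v → ideal x v ≋ 𝓘) →
          ∃[ x ] (∀ {z} → z ≡ x → to z ≋ 𝓘)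
        surjective 𝓘 (y , v , sim) =
          let x , decode-x≡y = decode-surjective q g d e y v
          in x , λ { ≡.refl → transport 𝓘 decode-x≡y v (decode-valid q g d e x) sim }

    class-count : ∀ {s f} → HasLength (𝒪E/R E/F 𝓡) s → IsConductorExponent E/F 𝓡 f →
      HasCardinality Cl (classNumber q s f) × ClassNumberFormula q s f (classNumber q s f)
    class-count {s} {f} length conductor = from-parameters
      -- The three parameters are natural numbers because B₀ ≤ 2A₀, A₀ < B₀ and ρ₀ ≥ 1,
      -- respectively.
      (toℕ {+ 2 ℤ.* a₀ ℤ.+ ρ₀ ℤ.- b₀} (ℤₚ.i≤j⇒0≤j-i b₀≤2a₀+ρ₀))
      (toℕ {b₀ ℤ.- a₀ ℤ.- ρ₀} (lia 3 (λ ρ a b → ρ ⊞ + 3 ⊛ a ⊞ # 1 ≼ neg ρ ⊞ + 3 ⊛ b ⇒ ρ ≼ # 2 ⇒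
        ⊩ # 0 ≼ b ⊟ a ⊟ ρ) ρ₀ a₀ b₀ θ.A<B θ.ρ≤2))
      (toℕ {ρ₀ ℤ.- 1ℤ} (ℤₚ.i≤j⇒0≤j-i θ.1≤ρ))
      where
      length≡ : a₀ ℤ.+ b₀ ≡ 1ℤ ℤ.+ + s
      length≡ = OrderLength.a₀+b₀≡1+s F E E/F 𝓡 length
      conductor≡ : + f ≡ high ρ₀ b₀ ℤ.- + 2
      conductor≡ = OrderConductor.f≡B-2 F E E/F 𝓡 conductor
      from-parameters : (∃[ g ] + 2 ℤ.* a₀ ℤ.+ ρ₀ ℤ.- b₀ ≡ + g) → (∃[ d ] b₀ ℤ.- a₀ ℤ.- ρ₀ ≡ + d) → (∃[ e ] ρ₀ ℤ.- 1ℤ ≡ + e) →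
        HasCardinality Cl (classNumber q s f) × ClassNumberFormula q s f (classNumber q s f)
      from-parameters (g , g≡) (d , d≡) (e , e≡) =
        ≡.subst (λ N → HasCardinality Cl N × ClassNumberFormula q s f N) (≡.sym (classNumber-count q g d e e≤1 s≡ f≡))
          ( Cl̄-cardinality g d e
              (lia 2 (λ ρ e → ρ ⊟ # 1 ≛ e ⇒ ⊩ ρ ≛ # 1 ⊞ e) ρ₀ (+ e) e≡)
              (lia 5 (λ ρ a b g d → + 2 ⊛ a ⊞ ρ ⊟ b ≛ g ⇒ b ⊟ a ⊟ ρ ≛ d ⇒ ⊩ a ≛ g ⊞ d) ρ₀ a₀ b₀ (+ g) (+ d) g≡ d≡)
              (lia 6 (λ ρ a b g d e → + 2 ⊛ a ⊞ ρ ⊟ b ≛ g ⇒ b ⊟ a ⊟ ρ ≛ d ⇒ ρ ⊟ # 1 ≛ e ⇒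
                ⊩ b ≛ # 1 ⊞ e ⊞ g ⊞ + 2 ⊛ d) ρ₀ a₀ b₀ (+ g) (+ d) (+ e) g≡ d≡ e≡)
          , formula q g d e 2≤q e≤1 s≡ f≡ )
        where
        e≤1 : e ℕ.≤ 1
        e≤1 = ℤₚ.drop‿+≤+ (lia 2 (λ ρ e → ρ ⊟ # 1 ≛ e ⇒ ρ ≼ # 2 ⇒ ⊩ e ≼ # 1) ρ₀ (+ e) e≡ θ.ρ≤2)
        s≡ : s ≡ 2 ℕ.* g ℕ.+ 3 ℕ.* d ℕ.+ e
        s≡ = ℤₚ.+-injective (lia 7 (λ ρ a b g d e s → + 2 ⊛ a ⊞ ρ ⊟ b ≛ g ⇒ b ⊟ a ⊟ ρ ≛ d ⇒ ρ ⊟ # 1 ≛ e ⇒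
          a ⊞ b ≛ # 1 ⊞ s ⇒ ⊩ s ≛ 2 ⊠ g ⊞ 3 ⊠ d ⊞ e) ρ₀ a₀ b₀ (+ g) (+ d) (+ e) (+ s) g≡ d≡ e≡ length≡)
        f≡ : f ≡ 3 ℕ.* g ℕ.+ 6 ℕ.* d ℕ.+ 2 ℕ.* e
        f≡ = ℤₚ.+-injective (lia 7 (λ ρ a b g d e f → + 2 ⊛ a ⊞ ρ ⊟ b ≛ g ⇒ b ⊟ a ⊟ ρ ≛ d ⇒ ρ ⊟ # 1 ≛ e ⇒
          f ≛ neg ρ ⊞ + 3 ⊛ b ⊟ # 2 ⇒ ⊩ f ≛ 3 ⊠ g ⊞ 6 ⊠ d ⊞ 2 ⊠ e) ρ₀ a₀ b₀ (+ g) (+ d) (+ e) (+ f) g≡ d≡ e≡ conductor≡)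

theorem4p12 :
  ∀ {c ℓ} → Σ (ℕ → ℕ → ℕ → ℕ) λ N →
    ∀ (F E : LocalField c ℓ) (E/F : TotallyRamifiedExtension F E 3)
      (R : Order E/F) (s f : ℕ) →
    let q = LocalField.q F in
    HasLength (𝒪E/R E/F R) s →
    IsConductorExponent E/F R f →
    HasCardinality (Cl̄ E/F R) (N q s f) × ClassNumberFormula q s f (N q s f)
theorem4p12 = ClassNumber.classNumber , λ F E E/F R s f length conductor → ClassNumber.class-count F E E/F R length conductor
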